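{- Let $K_n$ be the complete graph on $n$ vertices and let $\mathcal{I}(K_n)$ denote the smallest possible magic sum of an edge-magic injection of $K_n$. Then $$\mathcal{I}(K_n)\le\left(\frac{288}{121}+o(1)\right)n^2 \qquad (n\to\infty).$$
   Context: For a finite simple graph $G$ (with $V(G)\cap E(G)=\emptyset$), an edge-magic injection is an injective map $l:V(G)\cup E(G)\to\mathbb{Z}_{>0}$ such that for some constant $s$ (the magic sum) we have $l(a)+l(b)+l(ab)=s$ for every edge $ab\in E(G)$. -}

module Defs where

open import Data.Nat using (ℕ; _+_; _<_)
open import Data.Fin as F using (Fin)
open import Data.Product using (Σ; _×_)
open import Relation.Binary.PropositionalEquality using (_≡_)
open import Function.Definitions using (Injective)

-- The elements V(K_n) ∪ E(K_n) of the complete graph K_n, with vertex set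
-- Fin n; an edge {i,j} is represented once, as (i , j) with i < j.
data Elem (n : ℕ) : Set where
  vert : Fin n → Elem n
  edge : (i j : Fin n) → i F.< j → Elem n

IsEdgeMagicInjection : (n : ℕ) → (Elem n → ℕ) → ℕ → Set
IsEdgeMagicInjection n l s =
  Injective _≡_ _≡_ l ×
  (∀ x → 0 < l x) ×
  (∀ i j (p : i F.< j) → l (vert i) + l (vert j) + l (edge i j p) ≡ s)

IsMagicSum : ℕ → ℕ → Set
IsMagicSum n s = Σ (Elem n → ℕ) λ l → IsEdgeMagicInjection n l s

-- For a prime p with primitive root g, Ruzsa's residues aᵢ modulo M = p (p − 1), with aᵢ ≡ i (mod p − 1) and
-- aᵢ ≡ − gⁱ (mod p), form a Sidon set.  By a second moment estimate some translate of it is evenly distributed among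
-- short windows, so that the number of its triples x < y < z with x + y + z = s is, for a suitable s slightly above
-- 2 M, at most (1/12 + o(1)) p.  Deleting the largest element of each such triple, and the few solutions of
-- 2 x + y = s, leaves (11/12 + o(1)) p vertex labels; the complements s − x − y then differ from each other by the
-- Sidon property and from the vertex labels by the choice of s, and s = (2 + o(1)) p² = (288/121 + o(1)) n².
--
-- This needs primes with ratios tending to 1, which come from Erdős's deduction from Selberg's formula
-- ψ(x) log x + Σ Λ(n) ψ(x/n) = 2 x log x + O(x).  If (X, X + u] contains no primes, the windows
-- (X/n, (X + u)/n] must have twice the expected density of primes for almost all n, in the sense of Λ(n)/n.
-- But every long stretch contains a z near which the density is intermediate, which by Selberg's upper bound
-- contradicts this for the n near X/z.
--
-- All estimates are over ℚ: the logarithm is replaced by the completely additive function whose value at a prime p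
-- is Σ 1/j over P < j ≤ P p for a large fixed P, and Λ is defined from these values.

module Submission where

open import Data.Empty using (⊥; ⊥-elim)
open import Data.Nat as ℕ using (ℕ; zero; suc; z≤n; s≤s)
import Data.Nat.Properties as ℕ
open import Data.Product using (_×_; _,_; proj₁; proj₂; ∃)
open import Data.Sum using (_⊎_; inj₁; inj₂)
open import Relation.Binary.PropositionalEquality
open import Relation.Nullary using (¬_; Dec; yes; no)

-- The deduction from Selberg's formula rests on the symmetry of n and X / n. At a point z of
-- intermediate density, compare the n near v = X / z with the n near z. If primes are frequent near
-- v, they are themselves n whose windows lie near z and are not full; if they are rare near v, the
-- windows of the n near z contain v and are not full. Either way a share of X of order 1/k² is
-- lost, for windows of relative length 1/k, and about log X separate scales lose it, while
-- Selberg's formula leaves only a multiple of δ X log X to lose. Hence k is fixed first, then δ of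
-- order 1/k², then the threshold y₀ in terms of δ, and X last.
--
-- The sum s has to exceed 2 M because x + y may come close to 2 M and edge labels are positive.
-- Just above 2 M the plane x + y + z = s meets about K²/2 of the K³ cells formed by K blocks, and
-- each triple occurs in six orders: 1/12 = 1/2 · 1/6. No single s is controlled; an average over s
-- in a range of length about M / w is taken, long against the blocks and short against M.

-- The rationals as an abstract ordered field

module OrderedField where
  open import Data.Integer as ℤ using (ℤ; +_; -[1+_])
  import Data.Integer.Properties as ℤ
  open import Data.Rational as ℚ using (ℚ)
  import Data.Rational.Properties as ℚ
  import Data.Rational.Unnormalised as ℚᵘ
  import Data.Rational.Unnormalised.Properties as ℚᵘ

  infixl 6 _⊕_ _⊖_
  infixl 7 _⊗_
  infix 4 _≼_

  private
    castℚ : ℤ → ℚ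
    castℚ i = i ℚ./ 1

    toℚᵘ-cast : ∀ i → ℚ.toℚᵘ (castℚ i) ℚᵘ.≃ ℚᵘ.mkℚᵘ i 0
    toℚᵘ-cast i = ℚ.toℚᵘ-fromℚᵘ (ℚᵘ.mkℚᵘ i 0)

    cast-+ : ∀ i j → castℚ (i ℤ.+ j) ≡ castℚ i ℚ.+ castℚ j
    cast-+ i j = ℚ.toℚᵘ-injective (begin
      ℚ.toℚᵘ (castℚ (i ℤ.+ j))                ≈⟨ toℚᵘ-cast (i ℤ.+ j) ⟩
      ℚᵘ.mkℚᵘ (i ℤ.+ j) 0                     ≈⟨ ℚᵘ.*≡* (cong (ℤ._* + 1) (cong₂ ℤ._+_ (sym (ℤ.*-identityʳ i)) (sym (ℤ.*-identityʳ j)))) ⟩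
      ℚᵘ.mkℚᵘ i 0 ℚᵘ.+ ℚᵘ.mkℚᵘ j 0            ≈⟨ ℚᵘ.+-cong (toℚᵘ-cast i) (toℚᵘ-cast j) ⟨
      ℚ.toℚᵘ (castℚ i) ℚᵘ.+ ℚ.toℚᵘ (castℚ j)  ≈⟨ ℚ.toℚᵘ-homo-+ (castℚ i) (castℚ j) ⟨
      ℚ.toℚᵘ (castℚ i ℚ.+ castℚ j) ∎)
      where open ℚᵘ.≃-Reasoning

    cast-* : ∀ i j → castℚ (i ℤ.* j) ≡ castℚ i ℚ.* castℚ j
    cast-* i j = ℚ.toℚᵘ-injective (begin
      ℚ.toℚᵘ (castℚ (i ℤ.* j))                ≈⟨ toℚᵘ-cast (i ℤ.* j) ⟩
      ℚᵘ.mkℚᵘ i 0 ℚᵘ.* ℚᵘ.mkℚᵘ j 0            ≈⟨ ℚᵘ.*-cong (toℚᵘ-cast i) (toℚᵘ-cast j) ⟨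
      ℚ.toℚᵘ (castℚ i) ℚᵘ.* ℚ.toℚᵘ (castℚ j)  ≈⟨ ℚ.toℚᵘ-homo-* (castℚ i) (castℚ j) ⟨
      ℚ.toℚᵘ (castℚ i ℚ.* castℚ j) ∎)
      where open ℚᵘ.≃-Reasoning

    cast-mono : ∀ {i j} → i ℤ.≤ j → castℚ i ℚ.≤ castℚ j
    cast-mono {i} {j} h = ℚ.toℚᵘ-cancel-≤
      (ℚᵘ.≤-respˡ-≃ (ℚᵘ.≃-sym (toℚᵘ-cast i)) (ℚᵘ.≤-respʳ-≃ (ℚᵘ.≃-sym (toℚᵘ-cast j))
        (ℚᵘ.*≤* (ℤ.*-monoʳ-≤-nonNeg (+ 1) h))))

    cast-cancel : ∀ {i j} → castℚ i ℚ.≤ castℚ j → i ℤ.≤ j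
    cast-cancel {i} {j} h = ℤ.*-cancelʳ-≤-pos i j (+ 1)
      (ℚᵘ.drop-*≤* (ℚᵘ.≤-respˡ-≃ (toℚᵘ-cast i) (ℚᵘ.≤-respʳ-≃ (toℚᵘ-cast j) (ℚ.toℚᵘ-mono-≤ h))))

    -- The value at 0 is a convention; it keeps `recℚ-nonneg` free of side conditions.
    recℚ : ℕ → ℚ
    recℚ zero    = ℚ.0ℚ
    recℚ (suc n) = + 1 ℚ./ suc n

    recℚ-inv : ∀ n → castℚ (+ suc n) ℚ.* recℚ (suc n) ≡ castℚ (+ 1)
    recℚ-inv n = ℚ.toℚᵘ-injective (begin
      ℚ.toℚᵘ (castℚ (+ suc n) ℚ.* recℚ (suc n))              ≈⟨ ℚ.toℚᵘ-homo-* (castℚ (+ suc n)) (recℚ (suc n)) ⟩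
      ℚ.toℚᵘ (castℚ (+ suc n)) ℚᵘ.* ℚ.toℚᵘ (recℚ (suc n))    ≈⟨ ℚᵘ.*-cong (toℚᵘ-cast (+ suc n)) (ℚ.toℚᵘ-fromℚᵘ (ℚᵘ.mkℚᵘ (+ 1) n)) ⟩
      ℚᵘ.mkℚᵘ (+ suc n) 0 ℚᵘ.* ℚᵘ.mkℚᵘ (+ 1) n
          ≈⟨ ℚᵘ.*≡* (trans (ℤ.*-identityʳ (+ suc n ℤ.* + 1))
          (trans (ℤ.*-identityʳ (+ suc n)) (trans (cong (λ z → + suc z) (sym (ℕ.+-identityʳ n))) (sym (ℤ.*-identityˡ _))))) ⟩
      ℚᵘ.mkℚᵘ (+ 1) 0                                        ≈⟨ toℚᵘ-cast (+ 1) ⟨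
      ℚ.toℚᵘ (castℚ (+ 1)) ∎)
      where open ℚᵘ.≃-Reasoning

    recℚ-nonneg : ∀ n → ℚ.0ℚ ℚ.≤ recℚ n
    recℚ-nonneg zero    = ℚ.≤-refl
    recℚ-nonneg (suc n) = ℚ.nonNegative⁻¹ _ {{ℚ.normalize-nonNeg 1 (suc n)}}

    neg-def : ∀ a b → a ℚ.- b ≡ a ℚ.+ (castℚ -[1+ 0 ] ℚ.* b)
    neg-def a b = cong (a ℚ.+_) (trans (cong ℚ.-_ (sym (ℚ.*-identityˡ b))) (ℚ.neg-distribˡ-* ℚ.1ℚ b))

    *-nonneg : ∀ {a b} → ℚ.0ℚ ℚ.≤ a → ℚ.0ℚ ℚ.≤ b → ℚ.0ℚ ℚ.≤ a ℚ.* b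
    *-nonneg {a} {b} ha hb = subst (ℚ._≤ a ℚ.* b) (ℚ.*-zeroˡ b) (ℚ.*-monoʳ-≤-nonNeg b {{ℚ.nonNegative hb}} ha)

    *-distribʳ : ∀ a b c → (a ℚ.+ b) ℚ.* c ≡ (a ℚ.* c) ℚ.+ (b ℚ.* c)
    *-distribʳ a b c = ℚ.*-distribʳ-+ c a b

  -- Opacity stops the type checker from evaluating rational arithmetic, so that terms keep the
  -- shape in which `lin` states them.
  opaque
    R : Set
    R = ℚ

  opaque
    unfolding R

    _⊕_ _⊗_ _⊖_ : R → R → R
    _⊕_ = ℚ._+_
    _⊗_ = ℚ._*_
    _⊖_ = ℚ._-_

    _≼_ : R → R → Set
    _≼_ = ℚ._≤_

    ιℤ : ℤ → R
    ιℤ = castℚ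

    rec : ℕ → R
    rec = recℚ

  ι : ℕ → R
  ι n = ιℤ (+ n)

  opaque
    unfolding _⊕_

    ιℤ-+ : ∀ i j → ιℤ (i ℤ.+ j) ≡ ιℤ i ⊕ ιℤ j
    ιℤ-+ = cast-+
    ιℤ-* : ∀ i j → ιℤ (i ℤ.* j) ≡ ιℤ i ⊗ ιℤ j
    ιℤ-* = cast-*
    ιℤ-mono : ∀ {i j} → i ℤ.≤ j → ιℤ i ≼ ιℤ j
    ιℤ-mono = cast-mono
    ιℤ-cancel : ∀ {i j} → ιℤ i ≼ ιℤ j → i ℤ.≤ j
    ιℤ-cancel = cast-cancel

    ⊕-assoc : ∀ a b c → (a ⊕ b) ⊕ c ≡ a ⊕ (b ⊕ c)
    ⊕-assoc = ℚ.+-assoc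
    ⊕-comm : ∀ a b → a ⊕ b ≡ b ⊕ a
    ⊕-comm = ℚ.+-comm
    ⊕-identityʳ : ∀ a → a ⊕ ι 0 ≡ a
    ⊕-identityʳ = ℚ.+-identityʳ
    ⊖-def : ∀ a b → a ⊖ b ≡ a ⊕ (ιℤ -[1+ 0 ] ⊗ b)
    ⊖-def = neg-def
    ⊗-assoc : ∀ a b c → (a ⊗ b) ⊗ c ≡ a ⊗ (b ⊗ c)
    ⊗-assoc = ℚ.*-assoc
    ⊗-comm : ∀ a b → a ⊗ b ≡ b ⊗ a
    ⊗-comm = ℚ.*-comm
    ⊗-identityˡ : ∀ a → ι 1 ⊗ a ≡ a
    ⊗-identityˡ = ℚ.*-identityˡ
    ⊗-zeroˡ : ∀ a → ι 0 ⊗ a ≡ ι 0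
    ⊗-zeroˡ = ℚ.*-zeroˡ
    ⊗-distribʳ : ∀ a b c → (a ⊕ b) ⊗ c ≡ (a ⊗ c) ⊕ (b ⊗ c)
    ⊗-distribʳ = *-distribʳ

    ≼-refl : ∀ {a} → a ≼ a
    ≼-refl = ℚ.≤-refl
    ≼-trans : ∀ {a b c} → a ≼ b → b ≼ c → a ≼ c
    ≼-trans = ℚ.≤-trans
    ≼-antisym : ∀ {a b} → a ≼ b → b ≼ a → a ≡ b
    ≼-antisym = ℚ.≤-antisym
    ≼-total : ∀ a b → a ≼ b ⊎ b ≼ a
    ≼-total = ℚ.≤-total
    _≼?_ : ∀ a b → Dec (a ≼ b)
    _≼?_ = ℚ._≤?_
    ⊕-mono : ∀ {a b c d} → a ≼ b → c ≼ d → a ⊕ c ≼ b ⊕ d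
    ⊕-mono = ℚ.+-mono-≤
    0≼⊗ : ∀ {a b} → ι 0 ≼ a → ι 0 ≼ b → ι 0 ≼ a ⊗ b
    0≼⊗ = *-nonneg

    rec-inv : ∀ n → ι (suc n) ⊗ rec (suc n) ≡ ι 1
    rec-inv = recℚ-inv
    rec-nonneg : ∀ n → ι 0 ≼ rec n
    rec-nonneg = recℚ-nonneg

-- Linear arithmetic by reflection, with certificates

module LinearArithmetic where
  open OrderedField
  import Data.Nat.DivMod as ℕ
  open import Data.Integer as ℤ using (ℤ; +_; -[1+_])
  import Data.Integer.Properties as ℤ
  open import Data.Bool using (Bool; true; false; if_then_else_; T; _∧_)
  open import Data.List using (List; []; _∷_; map; _++_; length; concatMap; filterᵇ)
  open import Data.Maybe using (Maybe; just; nothing)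
  open import Data.Unit using (tt)

  infixl 6 _:+_ _:-_
  infixl 7 _:*_
  infix 4 _:≤_ _:≡_
  infixr 3 _⇒_

  data Expr : Set where
    var : ℕ → Expr
    :ι : ℕ → Expr
    _:+_ _:-_ _:*_ : Expr → Expr → Expr

  data Stmt : Set where
    _:≤_ _:≡_ : Expr → Expr → Stmt
    _⇒_ : Stmt → Stmt → Stmt

  Env : Set
  Env = List R

  nth : Env → ℕ → R
  nth []      _       = ι 0
  nth (x ∷ ρ) zero    = x
  nth (x ∷ ρ) (suc i) = nth ρ i

  ⟦_⟧ : Expr → Env → R
  ⟦ var i ⟧ ρ  = nth ρ i
  ⟦ :ι n ⟧ ρ   = ι n
  ⟦ a :+ b ⟧ ρ = ⟦ a ⟧ ρ ⊕ ⟦ b ⟧ ρ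
  ⟦ a :- b ⟧ ρ = ⟦ a ⟧ ρ ⊖ ⟦ b ⟧ ρ
  ⟦ a :* b ⟧ ρ = ⟦ a ⟧ ρ ⊗ ⟦ b ⟧ ρ

  ⟦_⟧ₛ : Stmt → Env → Set
  ⟦ a :≤ b ⟧ₛ ρ = ⟦ a ⟧ ρ ≼ ⟦ b ⟧ ρ
  ⟦ a :≡ b ⟧ₛ ρ = ⟦ a ⟧ ρ ≡ ⟦ b ⟧ ρ
  ⟦ s ⇒ t ⟧ₛ ρ  = ⟦ s ⟧ₛ ρ → ⟦ t ⟧ₛ ρ

  -- Normal forms have sorted monomials and no zero coefficients.

  Mono Term : Set
  Mono = List ℕ
  Term = ℤ × Mono

  Poly : Set
  Poly = List Term

  data Cmp : Set where
    LT EQ GT : Cmp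

  cmpℕ : ℕ → ℕ → Cmp
  cmpℕ i j = if i ℕ.≡ᵇ j then EQ else (if i ℕ.<ᵇ j then LT else GT)

  cmpM : Mono → Mono → Cmp
  cmpM []      []      = EQ
  cmpM []      (_ ∷ _) = LT
  cmpM (_ ∷ _) []      = GT
  cmpM (i ∷ m) (j ∷ n) with cmpℕ i j
  ... | LT = LT
  ... | GT = GT
  ... | EQ = cmpM m n

  isZero : ℤ → Bool
  isZero (+ 0) = true
  isZero _     = false

  insM : ℕ → Mono → Mono
  insM i []      = i ∷ []
  insM i (j ∷ m) with cmpℕ i j
  ... | GT = j ∷ insM i m
  ... | _  = i ∷ j ∷ m

  mulM : Mono → Mono → Mono
  mulM []      n = n
  mulM (i ∷ m) n = insM i (mulM m n)

  cons : ℤ → Mono → Poly → Poly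
  cons c m p = if isZero c then p else (c , m) ∷ p

  ins : ℤ → Mono → Poly → Poly
  ins c m [] = cons c m []
  ins c m ((d , n) ∷ p) with cmpM m n
  ... | LT = cons c m ((d , n) ∷ p)
  ... | EQ = cons (c ℤ.+ d) n p
  ... | GT = (d , n) ∷ ins c m p

  addP : Poly → Poly → Poly
  addP []            q = q
  addP ((c , m) ∷ p) q = ins c m (addP p q)

  addMul : ℤ → Mono → Poly → Poly → Poly
  addMul c m []            r = r
  addMul c m ((d , n) ∷ q) r = ins (c ℤ.* d) (mulM m n) (addMul c m q r)

  mulP : Poly → Poly → Poly
  mulP []            q = []
  mulP ((c , m) ∷ p) q = addMul c m q (mulP p q)

  scaleP : ℤ → Poly → Poly
  scaleP c p = addMul c [] p []

  norm : Expr → Poly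
  norm (var i)  = (+ 1 , i ∷ []) ∷ []
  norm (:ι n)   = cons (+ n) [] []
  norm (a :+ b) = addP (norm a) (norm b)
  norm (a :- b) = addP (norm a) (scaleP -[1+ 0 ] (norm b))
  norm (a :* b) = mulP (norm a) (norm b)

  module _ (ρ : Env) where
    evM : Mono → R
    evM []      = ι 1
    evM (i ∷ m) = nth ρ i ⊗ evM m

    evP : Poly → R
    evP []            = ι 0
    evP ((c , m) ∷ p) = (ιℤ c ⊗ evM m) ⊕ evP p

    open ≡-Reasoning

    cmpℕ-eq : ∀ i j → cmpℕ i j ≡ EQ → i ≡ j
    cmpℕ-eq i j h with i ℕ.≡ᵇ j in e
    ... | true = ℕ.≡ᵇ⇒≡ i j (subst T (sym e) tt)
    ... | false with i ℕ.<ᵇ j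
    cmpℕ-eq i j () | false | true
    cmpℕ-eq i j () | false | false

    cmpM-eq : ∀ m n → cmpM m n ≡ EQ → m ≡ n
    cmpM-eq []      []      h = refl
    cmpM-eq (i ∷ m) (j ∷ n) h with cmpℕ i j in e
    cmpM-eq (i ∷ m) (j ∷ n) () | LT
    cmpM-eq (i ∷ m) (j ∷ n) () | GT
    ... | EQ = cong₂ _∷_ (cmpℕ-eq i j e) (cmpM-eq m n h)

    private
      swap : ∀ a b c → a ⊕ (b ⊕ c) ≡ b ⊕ (a ⊕ c)
      swap a b c = trans (sym (⊕-assoc a b c)) (trans (cong (_⊕ c) (⊕-comm a b)) (⊕-assoc b a c))
      swap* : ∀ a b c → a ⊗ (b ⊗ c) ≡ b ⊗ (a ⊗ c)
      swap* a b c = trans (sym (⊗-assoc a b c)) (trans (cong (_⊗ c) (⊗-comm a b)) (⊗-assoc b a c))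
      ⊕-identityˡ : ∀ a → ι 0 ⊕ a ≡ a
      ⊕-identityˡ a = trans (⊕-comm _ _) (⊕-identityʳ a)
      ⊗-distribˡ : ∀ a b c → a ⊗ (b ⊕ c) ≡ (a ⊗ b) ⊕ (a ⊗ c)
      ⊗-distribˡ a b c = trans (⊗-comm a _) (trans (⊗-distribʳ b c a) (cong₂ _⊕_ (⊗-comm b a) (⊗-comm c a)))

    evInsM : ∀ i m → evM (insM i m) ≡ nth ρ i ⊗ evM m
    evInsM i [] = refl
    evInsM i (j ∷ m) with cmpℕ i j
    ... | LT = refl
    ... | EQ = refl
    ... | GT = trans (cong (nth ρ j ⊗_) (evInsM i m)) (swap* _ _ _)

    evMulM : ∀ m n → evM (mulM m n) ≡ evM m ⊗ evM n
    evMulM []      n = sym (⊗-identityˡ _)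
    evMulM (i ∷ m) n = trans (evInsM i (mulM m n)) (trans (cong (nth ρ i ⊗_) (evMulM m n)) (sym (⊗-assoc _ _ _)))

    evCons : ∀ c m p → evP (cons c m p) ≡ (ιℤ c ⊗ evM m) ⊕ evP p
    evCons (+ 0)      m p = sym (trans (cong (_⊕ evP p) (⊗-zeroˡ (evM m))) (⊕-identityˡ _))
    evCons (+ suc n)  m p = refl
    evCons -[1+ n ]   m p = refl

    evIns : ∀ c m p → evP (ins c m p) ≡ (ιℤ c ⊗ evM m) ⊕ evP p
    evIns c m [] = evCons c m []
    evIns c m ((d , n) ∷ p) with cmpM m n in e
    ... | LT = evCons c m _
    ... | GT = trans (cong ((ιℤ d ⊗ evM n) ⊕_) (evIns c m p)) (swap _ _ _)
    ... | EQ = begin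
      evP (cons (c ℤ.+ d) n p)                       ≡⟨ evCons _ n p ⟩
      (ιℤ (c ℤ.+ d) ⊗ evM n) ⊕ evP p                 ≡⟨ cong (λ z → (z ⊗ evM n) ⊕ evP p) (ιℤ-+ c d) ⟩
      ((ιℤ c ⊕ ιℤ d) ⊗ evM n) ⊕ evP p                ≡⟨ cong (_⊕ evP p) (⊗-distribʳ _ _ _) ⟩
      ((ιℤ c ⊗ evM n) ⊕ (ιℤ d ⊗ evM n)) ⊕ evP p      ≡⟨ ⊕-assoc _ _ _ ⟩
      (ιℤ c ⊗ evM n) ⊕ ((ιℤ d ⊗ evM n) ⊕ evP p)      ≡⟨ cong (λ z → (ιℤ c ⊗ evM z) ⊕ ((ιℤ d ⊗ evM n) ⊕ evP p)) (cmpM-eq m n e) ⟨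
      (ιℤ c ⊗ evM m) ⊕ ((ιℤ d ⊗ evM n) ⊕ evP p)      ∎

    evAdd : ∀ p q → evP (addP p q) ≡ evP p ⊕ evP q
    evAdd []            q = sym (⊕-identityˡ _)
    evAdd ((c , m) ∷ p) q = trans (evIns c m (addP p q)) (trans (cong (_ ⊕_) (evAdd p q)) (sym (⊕-assoc _ _ _)))

    evAddMul : ∀ c m q r → evP (addMul c m q r) ≡ ((ιℤ c ⊗ evM m) ⊗ evP q) ⊕ evP r
    evAddMul c m [] r = sym (trans (cong (_⊕ evP r) (trans (⊗-comm _ _) (⊗-zeroˡ _))) (⊕-identityˡ _))
    evAddMul c m ((d , n) ∷ q) r = begin
      evP (ins (c ℤ.* d) (mulM m n) (addMul c m q r))                               ≡⟨ evIns (c ℤ.* d) (mulM m n) (addMul c m q r) ⟩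
      (ιℤ (c ℤ.* d) ⊗ evM (mulM m n)) ⊕ evP (addMul c m q r)
          ≡⟨ cong₂ _⊕_ (cong₂ _⊗_ (ιℤ-* c d) (evMulM m n)) (evAddMul c m q r) ⟩
      ((ιℤ c ⊗ ιℤ d) ⊗ (evM m ⊗ evM n)) ⊕ (((ιℤ c ⊗ evM m) ⊗ evP q) ⊕ evP r)         ≡⟨ ⊕-assoc _ _ _ ⟨
      (((ιℤ c ⊗ ιℤ d) ⊗ (evM m ⊗ evM n)) ⊕ ((ιℤ c ⊗ evM m) ⊗ evP q))
          ⊕ evP r         ≡⟨ cong (λ z → (z ⊕ ((ιℤ c ⊗ evM m) ⊗ evP q)) ⊕ evP r)
          (trans (⊗-assoc _ _ _) (trans (cong (ιℤ c ⊗_) (swap* _ _ _)) (sym (⊗-assoc _ _ _)))) ⟩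
      (((ιℤ c ⊗ evM m) ⊗ (ιℤ d ⊗ evM n)) ⊕ ((ιℤ c ⊗ evM m) ⊗ evP q)) ⊕ evP r         ≡⟨ cong (_⊕ evP r) (⊗-distribˡ _ _ _) ⟨
      ((ιℤ c ⊗ evM m) ⊗ ((ιℤ d ⊗ evM n) ⊕ evP q)) ⊕ evP r                            ∎

    evMul : ∀ p q → evP (mulP p q) ≡ evP p ⊗ evP q
    evMul []            q = sym (⊗-zeroˡ _)
    evMul ((c , m) ∷ p) q = trans (evAddMul c m q (mulP p q)) (trans (cong (_ ⊕_) (evMul p q)) (sym (⊗-distribʳ _ _ _)))

    evScale : ∀ c p → evP (scaleP c p) ≡ ιℤ c ⊗ evP p
    evScale c p = trans (evAddMul c [] p []) (trans (⊕-identityʳ _) (cong (_⊗ evP p) (trans (⊗-comm _ _) (⊗-identityˡ _))))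

    evNorm : ∀ e → evP (norm e) ≡ ⟦ e ⟧ ρ
    evNorm (var i)  = trans (⊕-identityʳ _) (trans (⊗-identityˡ _) (trans (⊗-comm _ _) (⊗-identityˡ _)))
    evNorm (:ι n)   = trans (evCons (+ n) [] []) (trans (⊕-identityʳ _) (trans (⊗-comm _ _) (⊗-identityˡ _)))
    evNorm (a :+ b) = trans (evAdd (norm a) (norm b)) (cong₂ _⊕_ (evNorm a) (evNorm b))
    evNorm (a :* b) = trans (evMul (norm a) (norm b)) (cong₂ _⊗_ (evNorm a) (evNorm b))
    evNorm (a :- b) = trans (evAdd (norm a) _) (trans (cong₂ _⊕_ (evNorm a) (trans (evScale _ (norm b)) (cong (_ ⊗_) (evNorm b)))) (sym (⊖-def _ _)))

    evDiff : ∀ a b → evP (norm (b :- a)) ≡ ⟦ b ⟧ ρ ⊕ (ιℤ -[1+ 0 ] ⊗ ⟦ a ⟧ ρ)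
    evDiff a b = trans (evNorm (b :- a)) (⊖-def _ _)

    private
      negPlus : ∀ x → x ⊕ (ιℤ -[1+ 0 ] ⊗ x) ≡ ι 0
      negPlus x = trans (cong (_⊕ (ιℤ -[1+ 0 ] ⊗ x)) (sym (⊗-identityˡ x)))
          (trans (sym (⊗-distribʳ _ _ _)) (trans (cong (_⊗ x) (sym (ιℤ-+ (+ 1) -[1+ 0 ]))) (⊗-zeroˡ x)))

    toDiff : ∀ a b → ⟦ a ⟧ ρ ≼ ⟦ b ⟧ ρ → ι 0 ≼ evP (norm (b :- a))
    toDiff a b h = subst₂ _≼_ (negPlus _) (sym (evDiff a b)) (⊕-mono h ≼-refl)

    fromDiff : ∀ a b → ι 0 ≼ evP (norm (b :- a)) → ⟦ a ⟧ ρ ≼ ⟦ b ⟧ ρ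
    fromDiff a b h = subst₂ _≼_ (⊕-identityˡ _)
      (trans (cong (_⊕ ⟦ a ⟧ ρ) (evDiff a b)) (trans (⊕-assoc _ _ _) (trans (cong (⟦ b ⟧ ρ ⊕_) (trans (⊕-comm _ _) (negPlus _))) (⊕-identityʳ _))))
      (⊕-mono h (≼-refl {⟦ a ⟧ ρ}))

    data Nonneg : List Poly → Set where
      []  : Nonneg []
      _∷_ : ∀ {p ps} → ι 0 ≼ evP p → Nonneg ps → Nonneg (p ∷ ps)


  comb : List ℕ → List Poly → Poly
  comb (zero ∷ ms)  (p ∷ ps) = comb ms ps
  comb (suc m ∷ ms) (p ∷ ps) = addP (scaleP (+ suc m) p) (comb ms ps)
  comb _            _        = []

  nonposConst : Poly → Bool
  nonposConst []                      = true
  nonposConst ((-[1+ _ ] , []) ∷ [])  = true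
  nonposConst _                       = false

  -- With c = (K − 1 , ms): K · goal exceeds the combination ms of the hypotheses by a nonnegative constant.
  check : ℕ × List ℕ → List Poly → Poly → Bool
  check (k , ms) ps g = nonposConst (addP (scaleP -[1+ k ] g) (comb ms ps))

  module _ (ρ : Env) where
    private
      0≼ι : ∀ n → ι 0 ≼ ι n
      0≼ι n = ιℤ-mono (ℤ.+≤+ ℕ.z≤n)

    combNonneg : ∀ ms {ps} → Nonneg ρ ps → ι 0 ≼ evP ρ (comb ms ps)
    combNonneg []           _        = ≼-refl
    combNonneg (zero ∷ ms)  []       = ≼-refl
    combNonneg (suc m ∷ ms) []       = ≼-refl
    combNonneg (zero ∷ ms)  (h ∷ hs) = combNonneg ms hs
    combNonneg (suc m ∷ ms) (_∷_ {p} {ps} h hs) = subst₂ _≼_ (⊕-identityʳ _) (sym (evAdd ρ (scaleP (+ suc m) p) (comb ms ps)))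
      (⊕-mono (subst (ι 0 ≼_) (sym (evScale ρ (+ suc m) p)) (0≼⊗ (0≼ι (suc m)) h)) (combNonneg ms hs))

    nonposEv : ∀ p → T (nonposConst p) → evP ρ p ≼ ι 0
    nonposEv [] _ = ≼-refl
    nonposEv ((-[1+ n ] , []) ∷ []) _ = subst (_≼ ι 0) (sym (trans (⊕-identityʳ _) (trans (⊗-comm _ _) (⊗-identityˡ _)))) (ιℤ-mono ℤ.-≤+)

    -- An accepted certificate says - K g + c ≼ 0 with c the nonnegative combination of hypotheses
    -- and K = suc k. So K g is nonnegative, and multiplication by `rec (suc k)` removes K.
    checkSound : ∀ c ps g → T (check c ps g) → Nonneg ρ ps → ι 0 ≼ evP ρ g
    checkSound (k , ms) ps g t hs = subst (ι 0 ≼_) cancel (0≼⊗ (rec-nonneg (suc k)) Kg)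
      where
      open ≡-Reasoning
      eqn : evP ρ (addP (scaleP -[1+ k ] g) (comb ms ps)) ≡ (ιℤ -[1+ k ] ⊗ evP ρ g) ⊕ evP ρ (comb ms ps)
      eqn = trans (evAdd ρ (scaleP -[1+ k ] g) (comb ms ps)) (cong (_⊕ _) (evScale ρ -[1+ k ] g))
      le : (ιℤ -[1+ k ] ⊗ evP ρ g) ⊕ ι 0 ≼ ι 0
      le = ≼-trans (⊕-mono ≼-refl (combNonneg ms hs)) (subst (_≼ ι 0) eqn (nonposEv _ t))
      zeroSum : (ι (suc k) ⊗ evP ρ g) ⊕ ((ιℤ -[1+ k ] ⊗ evP ρ g) ⊕ ι 0) ≡ ι 0
      zeroSum = begin
        (ι (suc k) ⊗ evP ρ g) ⊕ ((ιℤ -[1+ k ] ⊗ evP ρ g) ⊕ ι 0)  ≡⟨ cong ((ι (suc k) ⊗ evP ρ g) ⊕_) (⊕-identityʳ (ιℤ -[1+ k ] ⊗ evP ρ g)) ⟩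
        (ι (suc k) ⊗ evP ρ g) ⊕ (ιℤ -[1+ k ] ⊗ evP ρ g)          ≡⟨ ⊗-distribʳ _ _ _ ⟨
        (ι (suc k) ⊕ ιℤ -[1+ k ]) ⊗ evP ρ g
            ≡⟨ cong (_⊗ evP ρ g) (trans (sym (ιℤ-+ (+ suc k) -[1+ k ])) (cong ιℤ (ℤ.+-inverseʳ (+ suc k)))) ⟩
        ι 0 ⊗ evP ρ g                                            ≡⟨ ⊗-zeroˡ _ ⟩
        ι 0 ∎
      Kg : ι 0 ≼ ι (suc k) ⊗ evP ρ g
      Kg = subst₂ _≼_ zeroSum (⊕-identityʳ _) (⊕-mono (≼-refl {ι (suc k) ⊗ evP ρ g}) le)
      cancel : rec (suc k) ⊗ (ι (suc k) ⊗ evP ρ g) ≡ evP ρ g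
      cancel = trans (sym (⊗-assoc _ _ _)) (trans (cong (_⊗ evP ρ g) (trans (⊗-comm _ _) (rec-inv k))) (⊗-identityˡ _))

  -- Fourier–Motzkin elimination; it only proposes multipliers, which `check` verifies.

  Row : Set
  Row = Poly × List ℕ

  addV : List ℕ → List ℕ → List ℕ
  addV (a ∷ u) (b ∷ v) = (a ℕ.+ b) ∷ addV u v
  addV []      v       = v
  addV u       []      = u

  scaleV : ℕ → List ℕ → List ℕ
  scaleV k = map (k ℕ.*_)

  gcdF : ℕ → ℕ → ℕ → ℕ
  gcdF zero    a b       = 1
  gcdF (suc f) a zero    = a
  gcdF (suc f) a (suc b) = gcdF f (suc b) (a ℕ.% suc b)

  divF : ℕ → ℕ → ℕ
  divF a zero    = a
  divF a (suc b) = a ℕ./ suc b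

  eqM : Mono → Mono → Bool
  eqM m n with cmpM m n
  ... | EQ = true
  ... | _  = false

  coef : Mono → Poly → ℤ
  coef m [] = + 0
  coef m ((c , n) ∷ p) = if eqM m n then c else coef m p

  isPos isNeg : ℤ → Bool
  isPos (+ suc _)  = true
  isPos _          = false
  isNeg -[1+ _ ]   = true
  isNeg _          = false

  -- The multipliers cancel the monomial `m`; dividing them by their gcd keeps the integers small.
  combine : Mono → Row → Row → Row
  combine m (p , u) (q , v) = addP (scaleP (+ b′) p) (scaleP (+ a′) q) , addV (scaleV b′ u) (scaleV a′ v)
    where
    a = ℤ.∣ coef m p ∣
    b = ℤ.∣ coef m q ∣
    g = gcdF 200 a b
    a′ = divF a g
    b′ = divF b g

  trivial : Row → Bool
  trivial ([] , zero ∷ _)              = true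
  trivial ((+ _ , []) ∷ [] , zero ∷ _) = true
  trivial ((+ suc _ , []) ∷ [] , _)    = true
  trivial _                            = false

  support : List ℕ → ℕ
  support []           = 0
  support (zero ∷ u)   = support u
  support (suc _ ∷ u)  = suc (support u)

  eliminate : ℕ → Mono → List Row → List Row
  eliminate k m rows = filterᵇ keep (concatMap (λ r → map (combine m r) negs) poss) ++ zeros
    where
    poss  = filterᵇ (λ r → isPos (coef m (proj₁ r))) rows
    negs  = filterᵇ (λ r → isNeg (coef m (proj₁ r))) rows
    zeros = filterᵇ (λ r → isZero (coef m (proj₁ r))) rows
    keep : Row → Bool
    -- Chernikov's rule: after k + 1 eliminations, a row that combines more than k + 2 of the
    -- original rows is redundant.
    keep r = if trivial r then false else (support (proj₂ r) ℕ.≤ᵇ suc (suc k))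

  monosOf : Poly → List Mono
  monosOf [] = []
  monosOf ((_ , []) ∷ p)    = monosOf p
  monosOf ((_ , i ∷ m) ∷ p) = (i ∷ m) ∷ monosOf p

  memM : Mono → List Mono → Bool
  memM m []       = false
  memM m (n ∷ ns) = if eqM m n then true else memM m ns

  dedup : List Mono → List Mono → List Mono
  dedup []       acc = acc
  dedup (m ∷ ms) acc = if memM m acc then dedup ms acc else dedup ms (m ∷ acc)

  cost : List Row → Mono → ℕ
  cost rows m = length (filterᵇ (λ r → isPos (coef m (proj₁ r))) rows) ℕ.* length (filterᵇ (λ r → isNeg (coef m (proj₁ r))) rows)

  pick : List Row → Mono → ℕ → List Mono → Mono
  pick rows m c []       = m
  pick rows m c (n ∷ ns) with cost rows n
  ... | d = if d ℕ.<ᵇ c then pick rows n d ns else pick rows m c ns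

  findCert : List Row → Maybe (List ℕ)
  findCert [] = nothing
  findCert (([] , suc k ∷ u) ∷ rows)                = just (suc k ∷ u)
  findCert (((-[1+ _ ] , []) ∷ [] , suc k ∷ u) ∷ rows) = just (suc k ∷ u)
  -- contradictory hypotheses, for the goal 1 ≤ 0
  findCert (((-[1+ c ] , []) ∷ [] , zero ∷ u) ∷ rows) = just (suc c ∷ u)
  findCert (_ ∷ rows)                               = findCert rows

  search : ℕ → ℕ → List Row → Maybe (List ℕ)
  search zero    k rows = findCert rows
  search (suc f) k rows with dedup (concatMap (λ r → monosOf (proj₁ r)) rows) []
  ... | []     = findCert rows
  ... | m ∷ ms with pick rows m (cost rows m) ms
  ...   | n = search f (suc k) (eliminate k n rows)

  unitV : ℕ → List ℕ
  unitV zero    = 1 ∷ []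
  unitV (suc i) = 0 ∷ unitV i

  rowsFrom : ℕ → List Poly → List Row
  rowsFrom i []       = []
  rowsFrom i (p ∷ ps) = (p , unitV i) ∷ rowsFrom (suc i) ps

  -- Row 0 is the negated goal; a refutation that uses it suc k times is read as a certificate with
  -- K = suc k. The default uses no hypothesis, and `check` then fails unless the goal is a
  -- nonnegative constant.
  certificate : List Poly → Poly → ℕ × List ℕ
  certificate ps g with search 60 0 (filterᵇ (λ r → if trivial r then false else true) (rowsFrom 0 (scaleP -[1+ 0 ] g ∷ ps)))
  ... | just (suc k ∷ ms) = k , ms
  ... | _                 = 0 , []

  prove : List Poly → Poly → Bool
  prove ps g = check (certificate ps g) ps g

  decide : List Poly → Stmt → Bool
  decide ps (a :≤ b)        = prove ps (norm (b :- a))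
  decide ps (a :≡ b)        = prove ps (norm (b :- a)) ∧ prove ps (norm (a :- b))
  decide ps ((a :≤ b) ⇒ s)  = decide (norm (b :- a) ∷ ps) s
  decide ps ((a :≡ b) ⇒ s)  = decide (norm (b :- a) ∷ norm (a :- b) ∷ ps) s
  decide ps ((_ ⇒ _) ⇒ s)   = decide ps s

  module _ (ρ : Env) where
    private
      ≡⇒≼ : ∀ {a b : R} → a ≡ b → a ≼ b
      ≡⇒≼ refl = ≼-refl
      ∧ˡ : ∀ a {b} → T (a ∧ b) → T a
      ∧ˡ true _ = tt
      ∧ʳ : ∀ a {b} → T (a ∧ b) → T b
      ∧ʳ true t = t

    decideSound : ∀ ps s → T (decide ps s) → Nonneg ρ ps → ⟦ s ⟧ₛ ρ
    decideSound ps (a :≤ b) t hs = fromDiff ρ a b (checkSound ρ (certificate ps (norm (b :- a))) ps (norm (b :- a)) t hs)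
    decideSound ps (a :≡ b) t hs = ≼-antisym
      (fromDiff ρ a b (checkSound ρ (certificate ps (norm (b :- a))) ps (norm (b :- a)) (∧ˡ (prove ps (norm (b :- a))) t) hs))
      (fromDiff ρ b a (checkSound ρ (certificate ps (norm (a :- b))) ps (norm (a :- b)) (∧ʳ (prove ps (norm (b :- a))) t) hs))
    decideSound ps ((a :≤ b) ⇒ s) t hs h = decideSound _ s t (toDiff ρ a b h ∷ hs)
    decideSound ps ((a :≡ b) ⇒ s) t hs h = decideSound _ s t (toDiff ρ a b (≡⇒≼ h) ∷ toDiff ρ b a (≡⇒≼ (sym h)) ∷ hs)
    decideSound ps ((_ ⇒ _) ⇒ s) t hs _ = decideSound ps s t hs

  Fun : ℕ → Set
  Fun zero    = Stmt
  Fun (suc n) = Expr → Fun n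

  close : ∀ n → ℕ → Fun n → Stmt
  close zero    i s = s
  close (suc n) i f = close n (suc i) (f (var i))

  ∀ᴿ : ℕ → (Env → Set) → Set
  ∀ᴿ zero    P = P []
  ∀ᴿ (suc n) P = (x : R) → ∀ᴿ n (λ ρ → P (x ∷ ρ))

  curryᴿ : ∀ n {P : Env → Set} → (∀ ρ → P ρ) → ∀ᴿ n P
  curryᴿ zero    h   = h []
  curryᴿ (suc n) h x = curryᴿ n (λ ρ → h (x ∷ ρ))

  -- The monomials of the statement are treated as independent unknowns, so products of hypotheses have to be supplied as further hypotheses.
  lin : ∀ n (f : Fun n) → {T (decide [] (close n 0 f))} → ∀ᴿ n ⟦ close n 0 f ⟧ₛ
  lin n f {t} = curryᴿ n (λ ρ → decideSound ρ [] (close n 0 f) t [])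

-- Finite sums, indicators and integer division

module FiniteSums where
  open OrderedField
  open LinearArithmetic
  import Data.Nat.DivMod as ℕ
  open import Data.Nat.Divisibility using (_∣?_; divides)
  import Data.Integer as ℤ
  import Data.Integer.Properties as ℤ
  open import Relation.Nullary.Decidable using (_×-dec_)

  ι-+ : ∀ m n → ι (m ℕ.+ n) ≡ ι m ⊕ ι n
  ι-+ m n = ιℤ-+ (ℤ.+ m) (ℤ.+ n)

  ι-* : ∀ m n → ι (m ℕ.* n) ≡ ι m ⊗ ι n
  ι-* m n = trans (cong ιℤ (ℤ.pos-* m n)) (ιℤ-* (ℤ.+ m) (ℤ.+ n))

  ι-suc : ∀ n → ι (suc n) ≡ ι n ⊕ ι 1
  ι-suc n = trans (ι-+ 1 n) (⊕-comm _ _)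

  ι-mono : ∀ {m n} → m ℕ.≤ n → ι m ≼ ι n
  ι-mono h = ιℤ-mono (ℤ.+≤+ h)

  ι-cancel : ∀ {m n} → ι m ≼ ι n → m ℕ.≤ n
  ι-cancel h = ℤ.drop‿+≤+ (ιℤ-cancel h)

  0≼ι : ∀ n → ι 0 ≼ ι n
  0≼ι n = ι-mono z≤n

  1⋠0 : ¬ (ι 1 ≼ ι 0)
  1⋠0 h with ι-cancel h
  ... | ()

  ≼-reflexive : ∀ {a b} → a ≡ b → a ≼ b
  ≼-reflexive refl = ≼-refl

  ⊗-monoˡ : ∀ {a b} c → ι 0 ≼ c → a ≼ b → c ⊗ a ≼ c ⊗ b
  ⊗-monoˡ {a} {b} c hc h = lin 3 (λ a b c → (:ι 0 :≤ c :* (b :- a)) ⇒ (c :* a :≤ c :* b)) a b c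
    (0≼⊗ hc (lin 2 (λ a b → (a :≤ b) ⇒ (:ι 0 :≤ b :- a)) a b h))

  ⊗-monoʳ : ∀ {a b} c → ι 0 ≼ c → a ≼ b → a ⊗ c ≼ b ⊗ c
  ⊗-monoʳ {a} {b} c hc h = subst₂ _≼_ (⊗-comm c a) (⊗-comm c b) (⊗-monoˡ c hc h)

  ⊗-mono : ∀ {a b c d} → ι 0 ≼ a → ι 0 ≼ d → a ≼ b → c ≼ d → a ⊗ c ≼ b ⊗ d
  ⊗-mono {a} {b} {c} {d} ha hd h k = ≼-trans (⊗-monoˡ a ha k) (⊗-monoʳ d hd h)

  ⊗-cancelˡ : ∀ {a b} n → 1 ℕ.≤ n → ι n ⊗ a ≼ ι n ⊗ b → a ≼ b
  ⊗-cancelˡ {a} {b} (suc n) _ h = lin 4 (λ a b n r → (n :* r :≡ :ι 1) ⇒ (:ι 0 :≤ r :* (n :* b :- n :* a)) ⇒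
      (r :* (n :* b) :≡ (n :* r) :* b) ⇒ ((n :* r) :* b :≡ :ι 1 :* b) ⇒ ((n :* r) :* a :≡ :ι 1 :* a) ⇒ (a :≤ b)) a b (ι (suc n)) (rec (suc n))
    (rec-inv n) (0≼⊗ (rec-nonneg (suc n)) (lin 2 (λ x y → (x :≤ y) ⇒ (:ι 0 :≤ y :- x)) _ _ h))
    (lin 3 (λ b n r → r :* (n :* b) :≡ (n :* r) :* b) b (ι (suc n)) (rec (suc n)))
    (cong (_⊗ b) (rec-inv n)) (cong (_⊗ a) (rec-inv n))

  rec-inv′ : ∀ n → 1 ℕ.≤ n → ι n ⊗ rec n ≡ ι 1
  rec-inv′ (suc n) _ = rec-inv n

  ⊕-congˡ : ∀ {a b c} → b ≡ c → a ⊕ b ≡ a ⊕ c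
  ⊕-congˡ refl = refl

  ⊕-congʳ : ∀ {a b c} → a ≡ b → a ⊕ c ≡ b ⊕ c
  ⊕-congʳ refl = refl

  ⊗-congˡ : ∀ {a b c} → b ≡ c → a ⊗ b ≡ a ⊗ c
  ⊗-congˡ refl = refl

  ⊗-congʳ : ∀ {a b c} → a ≡ b → a ⊗ c ≡ b ⊗ c
  ⊗-congʳ refl = refl

  0⊗ : ∀ {a b} → a ≡ ι 0 → a ⊗ b ≡ ι 0
  0⊗ refl = ⊗-zeroˡ _

  1⊗ : ∀ {a b} → a ≡ ι 1 → a ⊗ b ≡ b
  1⊗ refl = ⊗-identityˡ _

  0⊕ : ∀ {a b} → a ≡ ι 0 → a ⊕ b ≡ b
  0⊕ refl = trans (⊕-comm _ _) (⊕-identityʳ _)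

  ⊕0 : ∀ {a b} → b ≡ ι 0 → a ⊕ b ≡ a
  ⊕0 refl = ⊕-identityʳ _

  χ : ∀ {P : Set} → Dec P → R
  χ (yes _) = ι 1
  χ (no _)  = ι 0

  χ-yes : ∀ {P : Set} (d : Dec P) → P → χ d ≡ ι 1
  χ-yes (yes _) _ = refl
  χ-yes (no ¬p) p = ⊥-elim (¬p p)

  χ-no : ∀ {P : Set} (d : Dec P) → ¬ P → χ d ≡ ι 0
  χ-no (yes p) ¬p = ⊥-elim (¬p p)
  χ-no (no _)  _  = refl

  0≼χ : ∀ {P : Set} (d : Dec P) → ι 0 ≼ χ d
  0≼χ (yes _) = 0≼ι 1
  0≼χ (no _)  = ≼-refl

  χ≼1 : ∀ {P : Set} (d : Dec P) → χ d ≼ ι 1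
  χ≼1 (yes _) = ≼-refl
  χ≼1 (no _)  = 0≼ι 1

  χ-mono : ∀ {P Q : Set} (d : Dec P) (e : Dec Q) → (P → Q) → χ d ≼ χ e
  χ-mono (yes p) e h = ≼-reflexive (sym (χ-yes e (h p)))
  χ-mono (no _)  e h = 0≼χ e

  χ-⇔ : ∀ {P Q : Set} (d : Dec P) (e : Dec Q) → (P → Q) → (Q → P) → χ d ≡ χ e
  χ-⇔ d e h k = ≼-antisym (χ-mono d e h) (χ-mono e d k)

  χ-× : ∀ {P Q : Set} (d : Dec P) (e : Dec Q) → χ (d ×-dec e) ≡ χ d ⊗ χ e
  χ-× (yes p) (yes q) = sym (⊗-identityˡ _)
  χ-× (yes p) (no q)  = sym (⊗-identityˡ _)
  χ-× (no p)  e       = sym (⊗-zeroˡ _)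

  ∑ : ℕ → (ℕ → R) → R
  ∑ zero    f = ι 0
  ∑ (suc n) f = ∑ n f ⊕ f (suc n)

  ∑-cong : ∀ n {f g} → (∀ i → 1 ℕ.≤ i → i ℕ.≤ n → f i ≡ g i) → ∑ n f ≡ ∑ n g
  ∑-cong zero    h = refl
  ∑-cong (suc n) h = cong₂ _⊕_ (∑-cong n (λ i l u → h i l (ℕ.m≤n⇒m≤1+n u))) (h (suc n) (s≤s z≤n) ℕ.≤-refl)

  ∑-cong′ : ∀ n {f g} → (∀ i → f i ≡ g i) → ∑ n f ≡ ∑ n g
  ∑-cong′ n h = ∑-cong n (λ i _ _ → h i)

  ∑-mono : ∀ n {f g} → (∀ i → 1 ℕ.≤ i → i ℕ.≤ n → f i ≼ g i) → ∑ n f ≼ ∑ n g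
  ∑-mono zero    h = ≼-refl
  ∑-mono (suc n) h = ⊕-mono (∑-mono n (λ i l u → h i l (ℕ.m≤n⇒m≤1+n u))) (h (suc n) (s≤s z≤n) ℕ.≤-refl)

  ∑-zero : ∀ n → ∑ n (λ _ → ι 0) ≡ ι 0
  ∑-zero zero    = refl
  ∑-zero (suc n) = trans (⊕-identityʳ _) (∑-zero n)

  ∑-nonneg : ∀ n {f} → (∀ i → 1 ℕ.≤ i → i ℕ.≤ n → ι 0 ≼ f i) → ι 0 ≼ ∑ n f
  ∑-nonneg n h = subst (_≼ ∑ n _) (∑-zero n) (∑-mono n h)

  ∑-⊕ : ∀ n f g → ∑ n (λ i → f i ⊕ g i) ≡ ∑ n f ⊕ ∑ n g
  ∑-⊕ zero    f g = sym (⊕-identityʳ _)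
  ∑-⊕ (suc n) f g = trans (⊕-congʳ (∑-⊕ n f g)) (lin 4 (λ a b c d → (a :+ b) :+ (c :+ d) :≡ (a :+ c) :+ (b :+ d)) _ _ _ _)

  ∑-⊖ : ∀ n f g → ∑ n (λ i → f i ⊖ g i) ≡ ∑ n f ⊖ ∑ n g
  ∑-⊖ zero    f g = lin 0 (:ι 0 :≡ :ι 0 :- :ι 0)
  ∑-⊖ (suc n) f g = trans (⊕-congʳ (∑-⊖ n f g)) (lin 4 (λ a b c d → (a :- b) :+ (c :- d) :≡ (a :+ c) :- (b :+ d)) _ _ _ _)

  ∑-⊗ˡ : ∀ n c f → ∑ n (λ i → c ⊗ f i) ≡ c ⊗ ∑ n f
  ∑-⊗ˡ zero    c f = sym (trans (⊗-comm _ _) (⊗-zeroˡ _))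
  ∑-⊗ˡ (suc n) c f = trans (⊕-congʳ (∑-⊗ˡ n c f)) (lin 3 (λ a b c → c :* a :+ c :* b :≡ c :* (a :+ b)) _ _ _)

  ∑-⊗ʳ : ∀ n c f → ∑ n (λ i → f i ⊗ c) ≡ ∑ n f ⊗ c
  ∑-⊗ʳ n c f = trans (∑-cong′ n (λ i → ⊗-comm (f i) c)) (trans (∑-⊗ˡ n c f) (⊗-comm _ _))

  ∑-const : ∀ n c → ∑ n (λ _ → c) ≡ ι n ⊗ c
  ∑-const zero    c = sym (⊗-zeroˡ c)
  ∑-const (suc n) c = trans (cong (_⊕ c) (∑-const n c)) (sym (trans (cong (_⊗ c) (ι-suc n)) (trans (⊗-distribʳ _ _ _) (⊕-congˡ (⊗-identityˡ c)))))

  ∑-swap : ∀ m n (f : ℕ → ℕ → R) → ∑ m (λ i → ∑ n (f i)) ≡ ∑ n (λ j → ∑ m (λ i → f i j))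
  ∑-swap zero    n f = sym (∑-zero n)
  ∑-swap (suc m) n f = trans (⊕-congʳ (∑-swap m n f)) (sym (∑-⊕ n _ _))

  ∑-product : ∀ m n f g → ∑ m f ⊗ ∑ n g ≡ ∑ m (λ i → ∑ n (λ j → f i ⊗ g j))
  ∑-product m n f g = trans (sym (∑-⊗ʳ m (∑ n g) f)) (∑-cong′ m (λ i → sym (∑-⊗ˡ n (f i) g)))

  private
    ∑-extend′ : ∀ k n {f} → (∀ i → n ℕ.< i → f i ≡ ι 0) → ∑ (k ℕ.+ n) f ≡ ∑ n f
    ∑-extend′ zero    n h = refl
    ∑-extend′ (suc k) n h = trans (cong₂ _⊕_ (∑-extend′ k n h) (h _ (s≤s (ℕ.m≤n+m n k)))) (⊕-identityʳ _)

  ∑-extend : ∀ {n m f} → n ℕ.≤ m → (∀ i → n ℕ.< i → f i ≡ ι 0) → ∑ m f ≡ ∑ n f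
  ∑-extend {n} {m} {f} le h = subst (λ z → ∑ z f ≡ ∑ n f) (ℕ.m∸n+n≡m le) (∑-extend′ (m ℕ.∸ n) n h)

  ∑-grow≤ : ∀ {a b f} → a ℕ.≤ b → (∀ i → a ℕ.< i → i ℕ.≤ b → ι 0 ≼ f i) → ∑ a f ≼ ∑ b f
  ∑-grow≤ {a} {b} {f} h nn = subst (λ z → ∑ a f ≼ ∑ z f) (ℕ.m∸n+n≡m h) (go (b ℕ.∸ a) (ℕ.≤-reflexive (ℕ.m∸n+n≡m h)))
    where
    go : ∀ i → i ℕ.+ a ℕ.≤ b → ∑ a f ≼ ∑ (i ℕ.+ a) f
    go zero    _ = ≼-refl
    go (suc i) u = lin 3 (λ g h t → (g :≤ h) ⇒ (:ι 0 :≤ t) ⇒ (g :≤ h :+ t)) _ _ _ (go i (ℕ.<⇒≤ u)) (nn _ (s≤s (ℕ.m≤n+m a i)) u)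

  ∑-grow : ∀ {n m f} → n ℕ.≤ m → (∀ i → n ℕ.< i → ι 0 ≼ f i) → ∑ n f ≼ ∑ m f
  ∑-grow le h = ∑-grow≤ le (λ i lt _ → h i lt)

  ∑-term : ∀ n {f} → (∀ i → 1 ℕ.≤ i → i ℕ.≤ n → ι 0 ≼ f i) → ∀ a → 1 ℕ.≤ a → a ℕ.≤ n → f a ≼ ∑ n f
  ∑-term zero    h (suc a) _ ()
  ∑-term (suc n) {f} h a l u with a ℕ.≟ suc n
  ... | yes refl = lin 2 (λ s t → (:ι 0 :≤ s) ⇒ (t :≤ s :+ t)) _ _ (∑-nonneg n (λ i l u → h i l (ℕ.m≤n⇒m≤1+n u)))
  ... | no a≢    = lin 3 (λ x s t → (x :≤ s) ⇒ (:ι 0 :≤ t) ⇒ (x :≤ s :+ t)) _ _ _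
                     (∑-term n (λ i l u → h i l (ℕ.m≤n⇒m≤1+n u)) a l (ℕ.≤-pred (ℕ.≤∧≢⇒< u a≢))) (h (suc n) (s≤s z≤n) ℕ.≤-refl)

  ∑-single : ∀ n a f → 1 ℕ.≤ a → a ℕ.≤ n → (∀ i → 1 ℕ.≤ i → i ℕ.≤ n → i ≢ a → f i ≡ ι 0) → ∑ n f ≡ f a
  ∑-single zero    (suc a) f l () h
  ∑-single (suc n) a f l u h with a ℕ.≟ suc n
  ... | yes refl = 0⊕ (trans (∑-cong n (λ i l u → h i l (ℕ.m≤n⇒m≤1+n u) (λ e → ℕ.<⇒≢ (s≤s u) e))) (∑-zero n))
  ... | no a≢    = trans (⊕0 (h (suc n) (s≤s z≤n) ℕ.≤-refl (λ e → a≢ (sym e))))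
                     (∑-single n a f l (ℕ.≤-pred (ℕ.≤∧≢⇒< u a≢)) (λ i l u → h i l (ℕ.m≤n⇒m≤1+n u)))

  ∑-δ : ∀ x a (G : ℕ → R) → 1 ℕ.≤ a → (∀ i → x ℕ.< i → G i ≡ ι 0) → ∑ x (λ n → χ (a ℕ.≟ n) ⊗ G n) ≡ G a
  ∑-δ x a G l h with a ℕ.≤? x
  ... | yes a≤x = trans (∑-single x a (λ n → χ (a ℕ.≟ n) ⊗ G n) l a≤x (λ i _ _ i≢a → 0⊗ (χ-no (a ℕ.≟ i) (λ e → i≢a (sym e)))))
                    (1⊗ (χ-yes (a ℕ.≟ a) refl))
  ... | no a≰x  = trans (∑-cong x (λ i _ u → 0⊗ (χ-no (a ℕ.≟ i) (λ { refl → a≰x u }))))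
                    (trans (∑-zero x) (sym (h a (ℕ.≰⇒> a≰x))))

  ∑-χ∣ : ∀ x k n → 1 ℕ.≤ k → 1 ℕ.≤ n → n ℕ.≤ x → ∑ x (λ m → χ (k ℕ.* m ℕ.≟ n)) ≡ χ (k ∣? n)
  ∑-χ∣ x (suc k) n _ 1≤n n≤x with suc k ∣? n
  ... | yes (divides m eq) = trans (∑-single x m (λ m → χ (suc k ℕ.* m ℕ.≟ n)) 1≤m (ℕ.≤-trans (ℕ.m≤m*n m (suc k)) (subst (ℕ._≤ x) eq n≤x))
            (λ i _ _ i≢m → χ-no (suc k ℕ.* i ℕ.≟ n) (λ e → i≢m (ℕ.*-cancelˡ-≡ i m (suc k) (trans e (trans eq (ℕ.*-comm m (suc k))))))))
            (χ-yes (suc k ℕ.* m ℕ.≟ n) (trans (ℕ.*-comm (suc k) m) (sym eq)))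
    where
    1≤m : 1 ℕ.≤ m
    1≤m = ℕ.n≢0⇒n>0 (λ { refl → ℕ.<⇒≢ 1≤n (sym eq) })
  ... | no ∤ = trans (∑-cong′ x (λ i → χ-no (suc k ℕ.* i ℕ.≟ n) (λ e → ∤ (divides i (trans (sym e) (ℕ.*-comm (suc k) i)))))) (∑-zero x)

  -- Because G vanishes beyond x, both sums may run up to x and no quotient x ÷ k enters.
  ∑-multiples : ∀ x k (G : ℕ → R) → 1 ℕ.≤ k → (∀ i → x ℕ.< i → G i ≡ ι 0) →
    ∑ x (λ n → χ (k ∣? n) ⊗ G n) ≡ ∑ x (λ m → G (k ℕ.* m))
  ∑-multiples x k G 1≤k h = begin
    ∑ x (λ n → χ (k ∣? n) ⊗ G n)                              ≡⟨ ∑-cong x (λ n l u → cong (_⊗ G n) (sym (∑-χ∣ x k n 1≤k l u))) ⟩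
    ∑ x (λ n → ∑ x (λ m → χ (k ℕ.* m ℕ.≟ n)) ⊗ G n)           ≡⟨ ∑-cong′ x (λ n → sym (∑-⊗ʳ x (G n) (λ m → χ (k ℕ.* m ℕ.≟ n)))) ⟩
    ∑ x (λ n → ∑ x (λ m → χ (k ℕ.* m ℕ.≟ n) ⊗ G n))           ≡⟨ ∑-swap x x _ ⟩
    ∑ x (λ m → ∑ x (λ n → χ (k ℕ.* m ℕ.≟ n) ⊗ G n))           ≡⟨ ∑-cong x (λ m l _ → ∑-δ x (k ℕ.* m) G (ℕ.*-mono-≤ 1≤k l) h) ⟩
    ∑ x (λ m → G (k ℕ.* m))                                   ∎
    where open ≡-Reasoning

  -- Division with the convention n ÷ 0 = 0
  infixl 7 _÷_
  _÷_ : ℕ → ℕ → ℕ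
  n ÷ zero  = 0
  n ÷ suc d = n ℕ./ suc d

  ÷-upper : ∀ n d → 1 ℕ.≤ d → d ℕ.* (n ÷ d) ℕ.≤ n
  ÷-upper n (suc d) _ = subst (ℕ._≤ n) (ℕ.*-comm (n ℕ./ suc d) (suc d)) (ℕ.m/n*n≤m n (suc d))

  ÷-lower : ∀ n d → 1 ℕ.≤ d → n ℕ.< d ℕ.* suc (n ÷ d)
  ÷-lower n (suc d) _ = subst (ℕ._< suc d ℕ.* suc (n ℕ./ suc d)) (sym (ℕ.m≡m%n+[m/n]*n n (suc d)))
    (subst ((n ℕ.% suc d) ℕ.+ (n ℕ./ suc d) ℕ.* suc d ℕ.<_) (sym (trans (ℕ.*-suc (suc d) _) (cong (suc d ℕ.+_) (ℕ.*-comm (suc d) (n ℕ./ suc d)))))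
      (ℕ.+-monoˡ-< _ (ℕ.m%n<n n (suc d))))

  ≤÷⇒*≤ : ∀ {m n d} → 1 ℕ.≤ d → m ℕ.≤ n ÷ d → d ℕ.* m ℕ.≤ n
  ≤÷⇒*≤ {m} {n} {d} l h = ℕ.≤-trans (ℕ.*-monoʳ-≤ d h) (÷-upper n d l)

  *≤⇒≤÷ : ∀ {m n d} → 1 ℕ.≤ d → d ℕ.* m ℕ.≤ n → m ℕ.≤ n ÷ d
  *≤⇒≤÷ {m} {n} {d} l h = ℕ.≤-pred (ℕ.*-cancelˡ-< d m (suc (n ÷ d)) (ℕ.≤-<-trans h (÷-lower n d l)))

  ÷-≤ : ∀ n d → n ÷ d ℕ.≤ n
  ÷-≤ n zero    = z≤n
  ÷-≤ n (suc d) = ℕ.m/n≤m n (suc d)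

  ÷-zero : ∀ x n → x ℕ.< n → x ÷ n ≡ 0
  ÷-zero x (suc n) lt = ℕ.m<n⇒m/n≡0 lt

  ÷-monoˡ : ∀ {m n} d → m ℕ.≤ n → m ÷ d ℕ.≤ n ÷ d
  ÷-monoˡ zero    h = z≤n
  ÷-monoˡ (suc d) h = ℕ./-monoˡ-≤ (suc d) h

  ÷-monoʳ : ∀ n {d e} → 1 ℕ.≤ d → d ℕ.≤ e → n ÷ e ℕ.≤ n ÷ d
  ÷-monoʳ n {d} {e} l h = *≤⇒≤÷ {n ÷ e} {n} {d} l (ℕ.≤-trans (ℕ.*-monoˡ-≤ (n ÷ e) h) (÷-upper n e (ℕ.≤-trans l h)))

  ∑-cut : ∀ x d f → 1 ℕ.≤ d → ∑ x (λ m → χ (d ℕ.* m ℕ.≤? x) ⊗ f m) ≡ ∑ (x ÷ d) f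
  ∑-cut x d f l = trans (∑-extend (÷-≤ x d) (λ i lt → 0⊗ (χ-no (d ℕ.* i ℕ.≤? x) (λ le → ℕ.<⇒≱ lt (*≤⇒≤÷ l le)))))
    (∑-cong (x ÷ d) (λ i _ u → 1⊗ (χ-yes (d ℕ.* i ℕ.≤? x) (≤÷⇒*≤ l u))))

-- Möbius inversion as a sieve by the primes

module LegendreSieve where
  open OrderedField
  open LinearArithmetic
  open FiniteSums
  open import Data.Nat using (_!)
  open import Data.Nat.Primality using (Prime; prime?; euclidsLemma; prime⇒nonTrivial; prime⇒irreducible; ¬prime[0]; ¬prime[1])
  open import Data.Nat.Primality.Factorisation using (factorise)
  open import Data.Nat.Divisibility
  open import Data.List using (_∷_)
  open import Data.List.Relation.Unary.All using (_∷_)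
  open import Relation.Nullary.Decidable using (_×-dec_; ¬?)

  prime≥2 : ∀ {p} → Prime p → 2 ℕ.≤ p
  prime≥2 {p} pp = ℕ.nonTrivial⇒n>1 p {{prime⇒nonTrivial pp}}

  prime≥1 : ∀ {p} → Prime p → 1 ℕ.≤ p
  prime≥1 pp = ℕ.≤-trans (s≤s z≤n) (prime≥2 pp)

  prime∣prime : ∀ {p q} → Prime p → Prime q → p ∣ q → p ≡ q
  prime∣prime pp pq d with prime⇒irreducible pq d
  ... | inj₁ refl = ⊥-elim (¬prime[1] pp)
  ... | inj₂ e    = e

  primeFactor : ∀ n → 2 ℕ.≤ n → ∃ λ p → Prime p × p ∣ n
  primeFactor (suc zero) (s≤s ())
  primeFactor (suc (suc n)) _ with factorise (suc (suc n))
  ... | record { factors = p ∷ ps ; isFactorisation = e ; factorsPrime = pp ∷ _ } = p , pp , subst (p ∣_) (sym e) (m∣m*n _)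

  prime∤! : ∀ {p} n → Prime p → p ∣ n ! → p ℕ.≤ n
  prime∤! zero pp d = ⊥-elim (¬prime[1] (subst Prime (∣1⇒≡1 d) pp))
  prime∤! (suc n) pp d with euclidsLemma (suc n) (n !) pp d
  ... | inj₁ h = ∣⇒≤ h
  ... | inj₂ h = ℕ.m≤n⇒m≤1+n (prime∤! n pp h)

  NoFactor≤ : ℕ → ℕ → Set
  NoFactor≤ k n = ∀ {p} → p ℕ.< suc k → ¬ (Prime p × p ∣ n)

  abstract
    noFactor≤? : ∀ k n → Dec (NoFactor≤ k n)
    noFactor≤? k n = ℕ.allUpTo? (λ p → ¬? (prime? p ×-dec p ∣? n)) (suc k)

  -- Legendre's sieve takes the place of convolution with the Möbius function.
  sieve : ℕ → (ℕ → R) → ℕ → R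
  sieve zero    G d = G d
  sieve (suc k) G d = sieve k G d ⊖ χ (prime? (suc k)) ⊗ sieve k G (suc k ℕ.* d)

  module _ (x : ℕ) where
    Supported : (ℕ → R) → Set
    Supported F = ∀ i → x ℕ.< i → F i ≡ ι 0

    dil : ∀ {F} → Supported F → ∀ d → 1 ℕ.≤ d → ∀ i → x ℕ.< i → F (d ℕ.* i) ≡ ι 0
    dil h (suc d) _ i lt = h _ (ℕ.<-≤-trans lt (ℕ.m≤m+n i (d ℕ.* i)))

    rough : ℕ → (ℕ → R) → ℕ → R
    rough k F d = ∑ x (λ n → χ (noFactor≤? k n) ⊗ F (d ℕ.* n))

    private
      noFactor-suc : ∀ k n → ¬ Prime (suc k) → χ (noFactor≤? k n) ≡ χ (noFactor≤? (suc k) n)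
      noFactor-suc k n ¬pr = χ-⇔ (noFactor≤? k n) (noFactor≤? (suc k) n) (λ h {p} → up h {p}) (λ h {p} lt → h (ℕ.m<n⇒m<1+n lt))
        where
        up : NoFactor≤ k n → NoFactor≤ (suc k) n
        up h {p} lt (pp , d) with p ℕ.≟ suc k
        ... | yes refl = ¬pr pp
        ... | no p≢    = h (ℕ.≤∧≢⇒< (ℕ.≤-pred lt) p≢) (pp , d)

      noFactor-prime : ∀ k n → Prime (suc k) → χ (noFactor≤? k n) ⊖ χ (suc k ∣? n) ⊗ χ (noFactor≤? k n) ≡ χ (noFactor≤? (suc k) n)
      noFactor-prime k n pr with suc k ∣? n
      ... | yes d = trans (lin 1 (λ a → a :- :ι 1 :* a :≡ :ι 0) _) (sym (χ-no (noFactor≤? (suc k) n) (λ h → h ℕ.≤-refl (pr , d))))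
      ... | no ∤  = trans (lin 1 (λ a → a :- :ι 0 :* a :≡ a) _)
          (χ-⇔ (noFactor≤? k n) (noFactor≤? (suc k) n) (λ h {p} → up h {p}) (λ h {p} lt → h (ℕ.m<n⇒m<1+n lt)))
        where
        up : NoFactor≤ k n → NoFactor≤ (suc k) n
        up h {p} lt (pp , d) with p ℕ.≟ suc k
        ... | yes refl = ∤ d
        ... | no p≢    = h (ℕ.≤∧≢⇒< (ℕ.≤-pred lt) p≢) (pp , d)

      noFactor-mul : ∀ k m → Prime (suc k) → χ (noFactor≤? k (suc k ℕ.* m)) ≡ χ (noFactor≤? k m)
      noFactor-mul k m pr = χ-⇔ (noFactor≤? k _) (noFactor≤? k m) (λ h {p} lt (pp , d) → h lt (pp , ∣n⇒∣m*n (suc k) d)) (λ h {p} → back h {p})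
        where
        back : NoFactor≤ k m → NoFactor≤ k (suc k ℕ.* m)
        back h {p} lt (pp , d) with euclidsLemma (suc k) m pp d
        ... | inj₁ e = ℕ.<⇒≢ lt (prime∣prime pp pr e)
        ... | inj₂ e = h lt (pp , e)

    -- For a prime q = k + 1 the multiples n = q m drop out. They form the same sum at q d, since q
    -- m has a prime factor at most k exactly when m has one.
    rough-step : ∀ k F → Supported F → ∀ d → 1 ℕ.≤ d →
      rough (suc k) F d ≡ rough k F d ⊖ χ (prime? (suc k)) ⊗ rough k F (suc k ℕ.* d)
    rough-step k F sF d 1≤d with prime? (suc k)
    ... | no ¬pr = sym (trans (lin 2 (λ a b → a :- :ι 0 :* b :≡ a) _ _) (∑-cong′ x (λ n → ⊗-congʳ (noFactor-suc k n ¬pr))))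
    ... | yes pr = sym (begin
      rough k F d ⊖ ι 1 ⊗ rough k F (q ℕ.* d)
        ≡⟨ lin 2 (λ a b → a :- :ι 1 :* b :≡ a :- b) _ _ ⟩
      rough k F d ⊖ rough k F (q ℕ.* d)
        ≡⟨ cong (rough k F d ⊖_) (sym (trans (∑-multiples x q (λ n → χ (noFactor≤? k n) ⊗ F (d ℕ.* n)) (s≤s z≤n)
              (λ i lt → trans (⊗-congˡ (dil sF d 1≤d i lt)) (trans (⊗-comm _ _) (⊗-zeroˡ _))))
            (∑-cong′ x (λ m → cong₂ _⊗_ (noFactor-mul k m pr) (cong F (assoc m)))))) ⟩
      rough k F d ⊖ ∑ x (λ n → χ (q ∣? n) ⊗ (χ (noFactor≤? k n) ⊗ F (d ℕ.* n)))
        ≡⟨ sym (∑-⊖ x (λ n → χ (noFactor≤? k n) ⊗ F (d ℕ.* n)) (λ n → χ (q ∣? n) ⊗ (χ (noFactor≤? k n) ⊗ F (d ℕ.* n)))) ⟩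
      ∑ x (λ n → χ (noFactor≤? k n) ⊗ F (d ℕ.* n) ⊖ χ (q ∣? n) ⊗ (χ (noFactor≤? k n) ⊗ F (d ℕ.* n)))
        ≡⟨ ∑-cong′ x (λ n → trans (lin 3 (λ a b c → a :* b :- c :* (a :* b) :≡ (a :- c :* a) :* b) _ _ _) (⊗-congʳ (noFactor-prime k n pr))) ⟩
      rough (suc k) F d ∎)
      where
      open ≡-Reasoning
      q = suc k
      assoc : ∀ m → d ℕ.* (q ℕ.* m) ≡ q ℕ.* d ℕ.* m
      assoc m = trans (sym (ℕ.*-assoc d q m)) (cong (ℕ._* m) (ℕ.*-comm d q))

    S : (ℕ → R) → ℕ → R
    S F d = ∑ x (λ n → F (d ℕ.* n))

    sieve-rough : ∀ k F → Supported F → ∀ d → 1 ℕ.≤ d → sieve k (S F) d ≡ rough k F d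
    sieve-rough zero    F sF d _ = ∑-cong′ x (λ n → sym (1⊗ (χ-yes (noFactor≤? 0 n) (λ { {zero} _ (pp , _) → ¬prime[0] pp ; {suc p} (s≤s ()) _ }))))
    sieve-rough (suc k) F sF d l = trans (cong₂ (λ a b → a ⊖ χ (prime? (suc k)) ⊗ b) (sieve-rough k F sF d l)
        (sieve-rough k F sF (suc k ℕ.* d) (ℕ.*-mono-≤ (s≤s {0} {k} z≤n) l)))
      (sym (rough-step k F sF d l))

    -- At level x every n from 2 to x has a prime factor that excludes it, so n = 1 alone survives.
    -- This is Möbius inversion of `S`.
    sieve-S : ∀ F → 1 ℕ.≤ x → Supported F → ∀ d → 1 ℕ.≤ d → sieve x (S F) d ≡ F d
    sieve-S F 1≤x sF d l = trans (sieve-rough x F sF d l)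
      (trans (∑-single x 1 (λ n → χ (noFactor≤? x n) ⊗ F (d ℕ.* n)) ℕ.≤-refl 1≤x other)
        (trans (1⊗ (χ-yes (noFactor≤? x 1) (λ { _ (pp , e) → ¬prime[1] (subst Prime (∣1⇒≡1 e) pp) }))) (cong F (ℕ.*-identityʳ d))))
      where
      other : ∀ i → 1 ℕ.≤ i → i ℕ.≤ x → i ≢ 1 → χ (noFactor≤? x i) ⊗ F (d ℕ.* i) ≡ ι 0
      other i@(suc _) 1≤i i≤x i≢1 with primeFactor i (ℕ.≤∧≢⇒< 1≤i (λ e → i≢1 (sym e)))
      ... | p , pp , e = 0⊗ (χ-no (noFactor≤? x i) (λ h → h (s≤s (ℕ.≤-trans (∣⇒≤ e) i≤x)) (pp , e)))

    sieve-cong : ∀ k {F G} → (∀ d → 1 ℕ.≤ d → F d ≡ G d) → ∀ d → 1 ℕ.≤ d → sieve k F d ≡ sieve k G d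
    sieve-cong zero    h d l = h d l
    sieve-cong (suc k) h d l = cong₂ (λ a b → a ⊖ χ (prime? (suc k)) ⊗ b) (sieve-cong k h d l)
        (sieve-cong k h (suc k ℕ.* d) (ℕ.*-mono-≤ (s≤s {0} {k} z≤n) l))

    -- Only divisors of k ! occur when sieving by the primes up to k, each at most once.
    private
      bound : ℕ → (ℕ → R) → ℕ → R
      bound k E d = ∑ x (λ n → χ (n ∣? k !) ⊗ E (d ℕ.* n))

      -- A prime q = k + 1 does not divide k !, so the divisors n of k ! and the products q n are
      -- different divisors of q (k !).
      bound-step : ∀ k E → (∀ i → ι 0 ≼ E i) → Supported E → ∀ d → 1 ℕ.≤ d →
        bound k E d ⊕ χ (prime? (suc k)) ⊗ bound k E (suc k ℕ.* d) ≼ bound (suc k) E d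
      bound-step k E nE sE d 1≤d with prime? (suc k)
      ... | no _ = ≼-trans (≼-reflexive (lin 2 (λ a b → a :+ :ι 0 :* b :≡ a) _ _))
                     (∑-mono x (λ n _ _ → ⊗-monoʳ _ (nE _) (χ-mono (n ∣? k !) (n ∣? suc k !) (∣n⇒∣m*n (suc k)))))
      ... | yes pr = ≼-trans (≼-reflexive (begin
          bound k E d ⊕ ι 1 ⊗ bound k E (q ℕ.* d)
            ≡⟨ ⊕-congˡ (trans (⊗-identityˡ _) (trans
                (∑-cong′ x (λ m → cong₂ _⊗_ (χ-⇔ (m ∣? k !) (q ℕ.* m ∣? q ℕ.* k !) (*-monoʳ-∣ q) (*-cancelˡ-∣ q)) (cong E (assoc m))))
                 (sym (∑-multiples x q (λ n → χ (n ∣? q ℕ.* k !) ⊗ E (d ℕ.* n)) (s≤s z≤n)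
                   (λ i lt → trans (⊗-congˡ (dil sE d 1≤d i lt)) (trans (⊗-comm _ _) (⊗-zeroˡ _))))))) ⟩
          bound k E d ⊕ ∑ x (λ n → χ (q ∣? n) ⊗ (χ (n ∣? q ℕ.* k !) ⊗ E (d ℕ.* n)))
            ≡⟨ sym (∑-⊕ x (λ n → χ (n ∣? k !) ⊗ E (d ℕ.* n)) (λ n → χ (q ∣? n) ⊗ (χ (n ∣? q ℕ.* k !) ⊗ E (d ℕ.* n)))) ⟩
          ∑ x (λ n → χ (n ∣? k !) ⊗ E (d ℕ.* n) ⊕ χ (q ∣? n) ⊗ (χ (n ∣? q ℕ.* k !) ⊗ E (d ℕ.* n))) ∎))
          (∑-mono x (λ n _ _ → ≼-trans (≼-reflexive (lin 4 (λ a b c e → a :* e :+ b :* (c :* e) :≡ (a :+ b :* c) :* e) _ _ _ _))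
              (⊗-monoʳ _ (nE _) (pointwise n))))
        where
        open ≡-Reasoning
        q = suc k
        assoc : ∀ m → q ℕ.* d ℕ.* m ≡ d ℕ.* (q ℕ.* m)
        assoc m = trans (cong (ℕ._* m) (ℕ.*-comm q d)) (ℕ.*-assoc d q m)
        pointwise : ∀ n → χ (n ∣? k !) ⊕ χ (q ∣? n) ⊗ χ (n ∣? q ℕ.* k !) ≼ χ (n ∣? q ℕ.* k !)
        pointwise n with n ∣? k !
        ... | no _  = ≼-trans (≼-reflexive (0⊕ refl)) (≼-trans (⊗-monoʳ _ (0≼χ (n ∣? q ℕ.* k !)) (χ≼1 (q ∣? n))) (≼-reflexive (⊗-identityˡ _)))
        ... | yes d = ≼-reflexive (trans (⊕0 (0⊗ (χ-no (q ∣? n) (λ e → ℕ.<⇒≱ ℕ.≤-refl (prime∤! k pr (∣-trans e d))))))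
            (sym (χ-yes (n ∣? q ℕ.* k !) (∣n⇒∣m*n q d))))

      bound-sieve : ∀ k {G E} → (∀ i → ι 0 ≼ E i) → Supported E → (∀ d → 1 ℕ.≤ d → ι 0 ⊖ E d ≼ G d × G d ≼ E d) →
        ∀ d → 1 ℕ.≤ d → ι 0 ⊖ bound k E d ≼ sieve k G d × sieve k G d ≼ bound k E d
      bound-sieve zero {G} {E} nE sE h d l with 1 ℕ.≤? x
      ... | no 1≰x rewrite ℕ.n<1⇒n≡0 (ℕ.≰⇒> 1≰x) = lin 2 (λ g e → (:ι 0 :- e :≤ g) ⇒ (e :≡ :ι 0) ⇒ (:ι 0 :- :ι 0 :≤ g)) (G d) (E d)
          (proj₁ (h d l)) (sE d l) ,
                     subst (G d ≼_) (sE d l) (proj₂ (h d l))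
      ... | yes 1≤x = subst (λ b → ι 0 ⊖ b ≼ G d × G d ≼ b) (sym (trans (∑-single x 1 (λ n → χ (n ∣? 1) ⊗ E (d ℕ.* n)) ℕ.≤-refl 1≤x
                         (λ i _ _ i≢1 → 0⊗ (χ-no (i ∣? 1) (λ e → i≢1 (∣1⇒≡1 e)))))
                             (trans (1⊗ (χ-yes (1 ∣? 1) (1∣ 1))) (cong E (ℕ.*-identityʳ d))))) (h d l)
      bound-sieve (suc k) {G} {E} nE sE h d l =
        lin 6 (λ a a′ b b′ c t → (:ι 0 :- a′ :≤ a) ⇒ (t :* b :≤ t :* b′) ⇒ (a′ :+ t :* b′ :≤ c) ⇒ (:ι 0 :- c :≤ a :- t :* b)) _ _ _ _ _ t
          (proj₁ IH₁) (⊗-monoˡ t (0≼χ (prime? (suc k))) (proj₂ IH₂)) st ,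
        lin 6 (λ a a′ b b′ c t → (a :≤ a′) ⇒ (t :* (:ι 0 :- b′) :≤ t :* b) ⇒ (a′ :+ t :* b′ :≤ c) ⇒ (a :- t :* b :≤ c)) _ _ _ _ _ t
          (proj₂ IH₁) (⊗-monoˡ t (0≼χ (prime? (suc k))) (proj₁ IH₂)) st
        where
        t = χ (prime? (suc k))
        IH₁ = bound-sieve k nE sE h d l
        IH₂ = bound-sieve k nE sE h (suc k ℕ.* d) (ℕ.*-mono-≤ (s≤s {0} {k} z≤n) l)
        st = bound-step k E nE sE d l

    sieve-bound : ∀ {G E} → (∀ i → ι 0 ≼ E i) → Supported E → (∀ d → 1 ℕ.≤ d → ι 0 ⊖ E d ≼ G d × G d ≼ E d) →
      ι 0 ⊖ ∑ x E ≼ sieve x G 1 × sieve x G 1 ≼ ∑ x E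
    sieve-bound {G} {E} nE sE h = ≼-trans (lin 2 (λ a b → (a :≤ b) ⇒ (:ι 0 :- b :≤ :ι 0 :- a)) _ _ le) (proj₁ b) , ≼-trans (proj₂ b) le
      where
      b = bound-sieve x nE sE h 1 ℕ.≤-refl
      le : bound x E 1 ≼ ∑ x E
      le = ∑-mono x (λ n _ _ → subst (λ m → χ (n ∣? x !) ⊗ E m ≼ E n) (sym (ℕ.*-identityˡ n))
          (≼-trans (⊗-monoʳ _ (nE n) (χ≼1 (n ∣? x !))) (≼-reflexive (⊗-identityˡ _))))

-- Approximate logarithms and the von Mangoldt function

module Logarithms where
  open OrderedField
  open LinearArithmetic
  open FiniteSums
  open LegendreSieve
  open import Data.Nat using (_^_)
  open import Data.Nat.Induction using (<-rec)
  open import Data.Nat.Primality using (Prime; prime?; euclidsLemma; ¬prime[0]; ¬prime[1])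
  open import Data.Nat.Divisibility
  open import Relation.Nullary.Decidable using (_×-dec_)

  ≼-sub : ∀ {a b} → a ≼ b → ι 0 ≼ b ⊖ a
  ≼-sub {a} {b} = lin 2 (λ a b → (a :≤ b) ⇒ (:ι 0 :≤ b :- a)) a b

  rec-anti : ∀ {m n} → 1 ℕ.≤ m → m ℕ.≤ n → rec n ≼ rec m
  rec-anti {m} {n} l h = lin 4 (λ m n u v → (m :* u :≡ :ι 1) ⇒ (n :* v :≡ :ι 1) ⇒ (:ι 0 :≤ (u :* v) :* (n :- m)) ⇒
      (v :* (m :* u) :≡ v :* :ι 1) ⇒ (u :* (n :* v) :≡ u :* :ι 1) ⇒ (v :≤ u)) (ι m) (ι n) (rec m) (rec n)
    (rec-inv′ m l) (rec-inv′ n (ℕ.≤-trans l h)) (0≼⊗ (0≼⊗ (rec-nonneg m) (rec-nonneg n)) (≼-sub (ι-mono h)))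
    (⊗-congˡ (rec-inv′ m l)) (⊗-congˡ (rec-inv′ n (ℕ.≤-trans l h)))

  rec-* : ∀ m n → 1 ℕ.≤ m → 1 ℕ.≤ n → rec (m ℕ.* n) ≡ rec m ⊗ rec n
  rec-* m n lm ln = begin
    rec (m ℕ.* n)                                        ≡⟨ lin 1 (λ a → a :≡ a :* (:ι 1 :* :ι 1)) _ ⟩
    rec (m ℕ.* n) ⊗ (ι 1 ⊗ ι 1)                          ≡⟨ ⊗-congˡ (cong₂ _⊗_ (sym (rec-inv′ m lm)) (sym (rec-inv′ n ln))) ⟩
    rec (m ℕ.* n) ⊗ ((ι m ⊗ rec m) ⊗ (ι n ⊗ rec n))
        ≡⟨ lin 5 (λ a m u n v → a :* ((m :* u) :* (n :* v)) :≡ ((m :* n) :* a) :* (u :* v)) _ _ _ _ _ ⟩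
    ((ι m ⊗ ι n) ⊗ rec (m ℕ.* n)) ⊗ (rec m ⊗ rec n)      ≡⟨ 1⊗ (trans (⊗-congʳ (sym (ι-* m n))) (rec-inv′ (m ℕ.* n) (ℕ.*-mono-≤ lm ln))) ⟩
    rec m ⊗ rec n ∎
    where open ≡-Reasoning

  rec1 : rec 1 ≡ ι 1
  rec1 = trans (sym (⊗-identityˡ _)) (rec-inv 0)

  rec≼1 : ∀ n → 1 ℕ.≤ n → rec n ≼ ι 1
  rec≼1 n l = subst (rec n ≼_) rec1 (rec-anti ℕ.≤-refl l)

  H : ℕ → R
  H y = ∑ y rec

  H-upper : ∀ m k → 1 ℕ.≤ m → H (k ℕ.+ m) ⊖ H m ≼ ι k ⊗ rec m
  H-upper m zero    l = lin 2 (λ a b → a :- a :≤ :ι 0 :* b) _ _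
  H-upper m (suc k) l = lin 5 (λ h a r s k → (a :- h :≤ k :* r) ⇒ (s :≤ r) ⇒ (a :+ s :- h :≤ k :* r :+ r)) _ _ _ _ (ι k)
      (H-upper m k l) (rec-anti l (ℕ.m≤n⇒m≤1+n (ℕ.m≤n+m m k)))
    ⟨≼⟩ ≼-reflexive (trans (lin 2 (λ k r → k :* r :+ r :≡ (k :+ :ι 1) :* r) (ι k) (rec m)) (⊗-congʳ (sym (ι-suc k))))
    where _⟨≼⟩_ = ≼-trans

  H-lower : ∀ m k → ι k ⊗ rec (k ℕ.+ m) ≼ H (k ℕ.+ m) ⊖ H m
  H-lower m zero    = lin 2 (λ a b → :ι 0 :* b :≤ a :- a) _ _
  H-lower m (suc zero) = lin 2 (λ h s → :ι 1 :* s :≤ h :+ s :- h) _ _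
  H-lower m (suc (suc k)) = ≼-trans (≼-reflexive (trans (⊗-congʳ (ι-suc (suc k))) (lin 2 (λ k s → (k :+ :ι 1) :* s :≡ k :* s :+ s) _ _)))
    (lin 5 (λ h a r s k → (k :* r :≤ a :- h) ⇒ (k :* s :≤ k :* r) ⇒ (k :* s :+ s :≤ a :+ s :- h)) _ _ _ _ (ι (suc k))
      (H-lower m (suc k)) (⊗-monoˡ _ (0≼ι (suc k)) (rec-anti {suc k ℕ.+ m} (s≤s z≤n) (ℕ.n≤1+n _))))

  -- The number ℓ P n = Σ_{P < j ≤ P n} 1/j tends to log n as P → ∞.
  ℓ : ℕ → ℕ → R
  ℓ P n = H (P ℕ.* n) ⊖ H P

  module _ (P : ℕ) (1≤P : 1 ℕ.≤ P) where
    private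
      scale : ∀ a c → 1 ℕ.≤ a → 1 ℕ.≤ c → ι a ⊗ rec (a ℕ.* c) ≡ rec c
      scale a c la lc = trans (⊗-congˡ (rec-* a c la lc)) (trans (sym (⊗-assoc _ _ _)) (1⊗ (rec-inv′ a la)))

    ℓ-suc-upper : ∀ n → 1 ℕ.≤ n → ℓ P (suc n) ⊖ ℓ P n ≼ rec n
    ℓ-suc-upper n l rewrite ℕ.*-suc P n = ≼-trans
        (lin 4 (λ a b h r → (a :- b :≤ r) ⇒ ((a :- h) :- (b :- h) :≤ r)) _ _ _ _ (H-upper (P ℕ.* n) P (ℕ.*-mono-≤ 1≤P l)))
       (≼-reflexive (scale P n 1≤P l))

    ℓ-suc-lower : ∀ n → 1 ℕ.≤ n → rec (suc n) ≼ ℓ P (suc n) ⊖ ℓ P n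
    ℓ-suc-lower n l = ≼-trans (≼-reflexive (sym (scale P (suc n) 1≤P (s≤s z≤n))))
      (≼-trans (subst (λ z → ι P ⊗ rec z ≼ H z ⊖ H (P ℕ.* n)) (sym (ℕ.*-suc P n)) (H-lower (P ℕ.* n) P))
          (lin 3 (λ a b h → a :- b :≤ (a :- h) :- (b :- h)) _ _ _))

    private
      -- Raising c by one adds a terms to H (a c), together between 1/(c + 1) and 1/c, and the term
      -- 1/(c + 1) to H c. The errors 1/c - 1/(c + 1) telescope.
      additive : ∀ a k → 1 ℕ.≤ a → let c = k ℕ.+ P in
        ι 0 ≼ H (a ℕ.* c) ⊖ H (a ℕ.* P) ⊖ (H c ⊖ H P) × H (a ℕ.* c) ⊖ H (a ℕ.* P) ⊖ (H c ⊖ H P) ≼ rec P ⊖ rec c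
      additive a zero    l = lin 2 (λ a b → :ι 0 :≤ a :- a :- (b :- b)) _ _ , lin 3 (λ a b c → a :- a :- (b :- b) :≤ c :- c) _ _ _
      additive a (suc k) l rewrite ℕ.*-suc a (k ℕ.+ P) =
        lin 6 (λ A A′ A₀ C C₀ t → (:ι 0 :≤ A :- A₀ :- (C :- C₀)) ⇒ (t :≤ A′ :- A) ⇒ (:ι 0 :≤ A′ :- A₀ :- (C :+ t :- C₀))) _ (H
            (a ℕ.+ a ℕ.* c)) _ _ _ _
           (proj₁ IH) lo ,
        lin 8 (λ A A′ A₀ C C₀ s t P → (A :- A₀ :- (C :- C₀) :≤ P :- s) ⇒ (A′ :- A :≤ s) ⇒ (A′ :- A₀ :- (C :+ t :- C₀) :≤ P :- t)) _ (H
            (a ℕ.+ a ℕ.* c)) _ _ _ _ _ _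
           (proj₂ IH) hi
        where
        c = k ℕ.+ P
        1≤c : 1 ℕ.≤ c
        1≤c = ℕ.≤-trans 1≤P (ℕ.m≤n+m P k)
        IH = additive a k l
        lo : rec (suc c) ≼ H (a ℕ.+ a ℕ.* c) ⊖ H (a ℕ.* c)
        lo = ≼-trans (≼-reflexive (sym (trans (⊗-congˡ (cong rec (sym (ℕ.*-suc a c)))) (scale a (suc c) l (s≤s z≤n))))) (H-lower (a ℕ.* c) a)
        hi : H (a ℕ.+ a ℕ.* c) ⊖ H (a ℕ.* c) ≼ rec c
        hi = ≼-trans (H-upper (a ℕ.* c) a (ℕ.*-mono-≤ l 1≤c)) (≼-reflexive (scale a c l 1≤c))

    -- This is `additive` at c = P b. Additivity of `ℓ P` is thus only approximate, which is why the
    -- logarithm in use is rebuilt from its values at the primes.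
    ℓ-* : ∀ a b → 1 ℕ.≤ a → 1 ℕ.≤ b → ℓ P a ⊕ ℓ P b ≼ ℓ P (a ℕ.* b) × ℓ P (a ℕ.* b) ≼ ℓ P a ⊕ ℓ P b ⊕ rec P
    ℓ-* a b la lb =
      lin 4 (λ x y z h → (:ι 0 :≤ x :- y :- (z :- h)) ⇒ ((y :- h) :+ (z :- h) :≤ x :- h)) _ _ _ _ (proj₁ add) ,
      lin 6 (λ x y z h r s → (x :- y :- (z :- h) :≤ r :- s) ⇒ (:ι 0 :≤ s) ⇒ (x :- h :≤ (y :- h) :+ (z :- h) :+ r)) _ _ _ _ _ _ (proj₂ add)
          (rec-nonneg (P ℕ.* b))
      where
      e : (P ℕ.* b ℕ.∸ P) ℕ.+ P ≡ P ℕ.* b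
      e = ℕ.m∸n+n≡m (subst (ℕ._≤ P ℕ.* b) (ℕ.*-identityʳ P) (ℕ.*-monoʳ-≤ P lb))
      e′ : a ℕ.* (P ℕ.* b) ≡ P ℕ.* (a ℕ.* b)
      e′ = trans (sym (ℕ.*-assoc a P b)) (trans (cong (ℕ._* b) (ℕ.*-comm a P)) (ℕ.*-assoc P a b))
      add : ι 0 ≼ H (P ℕ.* (a ℕ.* b)) ⊖ H (P ℕ.* a) ⊖ (H (P ℕ.* b) ⊖ H P) × H (P ℕ.* (a ℕ.* b)) ⊖ H (P ℕ.* a) ⊖ (H (P ℕ.* b) ⊖ H P)
          ≼ rec P ⊖ rec (P ℕ.* b)
      add = subst₂ (λ u v → ι 0 ≼ H u ⊖ H v ⊖ (H (P ℕ.* b) ⊖ H P) × H u ⊖ H v ⊖ (H (P ℕ.* b) ⊖ H P) ≼ rec P ⊖ rec (P ℕ.* b)) e′ (ℕ.*-comm a P)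
        (subst (λ c → ι 0 ≼ H (a ℕ.* c) ⊖ H (a ℕ.* P) ⊖ (H c ⊖ H P) × H (a ℕ.* c) ⊖ H (a ℕ.* P) ⊖ (H c ⊖ H P) ≼ rec P ⊖ rec c) e
            (additive a (P ℕ.* b ℕ.∸ P) la))

    ℓ1 : ℓ P 1 ≡ ι 0
    ℓ1 = trans (cong (λ z → H z ⊖ H P) (ℕ.*-identityʳ P)) (lin 1 (λ a → a :- a :≡ :ι 0) _)

    0≼ℓ : ∀ n → 1 ℕ.≤ n → ι 0 ≼ ℓ P n
    0≼ℓ n l = ≼-sub (∑-grow (subst (ℕ._≤ P ℕ.* n) (ℕ.*-identityʳ P) (ℕ.*-monoʳ-≤ P l)) (λ i _ → rec-nonneg i))

  -- von Mangoldt's function and the logarithm when log p is replaced by w p.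
  module Mangoldt (w : ℕ → R) (w≥0 : ∀ n → 1 ℕ.≤ n → ι 0 ≼ w n) where
    abstract
      Λ : ℕ → R
      Λ m = ∑ m (λ p → ∑ m (λ j → (χ (prime? p) ⊗ w p) ⊗ χ (p ^ j ℕ.≟ m)))

      logʷ : ℕ → R
      logʷ k = ∑ k (λ m → χ (m ∣? k) ⊗ Λ m)

      logʷ-def : ∀ k → logʷ k ≡ ∑ k (λ m → χ (m ∣? k) ⊗ Λ m)
      logʷ-def k = refl

      0≼pw : ∀ p → ι 0 ≼ χ (prime? p) ⊗ w p
      0≼pw zero    = ≼-reflexive (sym (0⊗ (χ-no (prime? 0) ¬prime[0])))
      0≼pw (suc p) = 0≼⊗ (0≼χ (prime? (suc p))) (w≥0 (suc p) (s≤s z≤n))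

      0≼Λ : ∀ m → ι 0 ≼ Λ m
      0≼Λ m = ∑-nonneg m (λ p _ _ → ∑-nonneg m (λ j _ _ → 0≼⊗ (0≼pw p) (0≼χ (p ^ j ℕ.≟ m))))

      private
        j<p^j : ∀ p j → 2 ℕ.≤ p → j ℕ.< p ^ j
        j<p^j p zero    h = s≤s z≤n
        j<p^j p (suc j) h = ℕ.≤-trans (ℕ.+-mono-≤ (ℕ.≤-trans (s≤s z≤n) (j<p^j p j h)) (j<p^j p j h))
          (ℕ.≤-trans (ℕ.≤-reflexive (cong (p ^ j ℕ.+_) (sym (ℕ.+-identityʳ (p ^ j))))) (ℕ.*-monoˡ-≤ (p ^ j) h))

        p≤p^j : ∀ p j → 1 ℕ.≤ p → 1 ℕ.≤ j → p ℕ.≤ p ^ j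
        p≤p^j (suc p) (suc j) _ _ = ℕ.≤-trans (ℕ.≤-reflexive (sym (ℕ.*-identityʳ (suc p))))
            (ℕ.*-monoʳ-≤ (suc p) (ℕ.>-nonZero⁻¹ (suc p ^ j) {{ℕ.m^n≢0 (suc p) j}}))

        noPower : ∀ p j m → (Prime p → 1 ℕ.≤ p → p ^ j ≡ m → ⊥) → (χ (prime? p) ⊗ w p) ⊗ χ (p ^ j ℕ.≟ m) ≡ ι 0
        noPower p j m h with prime? p
        ... | no _   = 0⊗ (0⊗ refl)
        ... | yes pr = trans (⊗-congˡ (χ-no (p ^ j ℕ.≟ m) (h pr (prime≥1 pr)))) (trans (⊗-comm _ _) (⊗-zeroˡ _))

      -- As p ^ j exceeds j and is at least p, a power equal to m has p and j at most m, so both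
      -- ranges may be enlarged.
      Λ-extend : ∀ N m → m ℕ.≤ N → Λ m ≡ ∑ N (λ p → ∑ N (λ j → (χ (prime? p) ⊗ w p) ⊗ χ (p ^ j ℕ.≟ m)))
      Λ-extend N m le = sym (trans (∑-cong N (λ p _ _ → ∑-extend le
          (λ j lt → noPower p j m (λ pr _ e → ℕ.<⇒≱ lt (ℕ.<⇒≤ (subst (j ℕ.<_) e (j<p^j p j (prime≥2 pr))))))))
        (∑-extend le (λ p lt → trans (∑-cong m (λ j l _ → noPower p j m (λ _ 1≤p e → ℕ.<⇒≱ lt (subst (p ℕ.≤_) e (p≤p^j p j 1≤p l))))) (∑-zero m))))

      ∑Λ : ∀ N (G : ℕ → R) → (∀ i → N ℕ.< i → G i ≡ ι 0) →
        ∑ N (λ m → Λ m ⊗ G m) ≡ ∑ N (λ p → (χ (prime? p) ⊗ w p) ⊗ ∑ N (λ j → G (p ^ j)))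
      ∑Λ N G sG = begin
        ∑ N (λ m → Λ m ⊗ G m)
          ≡⟨ ∑-cong N (λ m _ u → trans (⊗-congʳ (Λ-extend N m u)) (trans (sym (∑-⊗ʳ N (G m) (λ p → ∑ N (λ j → c p ⊗ χ (p ^ j ℕ.≟ m)))))
               (∑-cong′ N (λ p → sym (∑-⊗ʳ N (G m) (λ j → c p ⊗ χ (p ^ j ℕ.≟ m))))))) ⟩
        ∑ N (λ m → ∑ N (λ p → ∑ N (λ j → (c p ⊗ χ (p ^ j ℕ.≟ m)) ⊗ G m)))
          ≡⟨ ∑-swap N N (λ m p → ∑ N (λ j → (c p ⊗ χ (p ^ j ℕ.≟ m)) ⊗ G m)) ⟩
        ∑ N (λ p → ∑ N (λ m → ∑ N (λ j → (c p ⊗ χ (p ^ j ℕ.≟ m)) ⊗ G m)))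
          ≡⟨ ∑-cong N (λ p l _ → trans (∑-swap N N (λ m j → (c p ⊗ χ (p ^ j ℕ.≟ m)) ⊗ G m))
              (trans (∑-cong′ N (inner p l)) (∑-⊗ˡ N (c p) (λ j → G (p ^ j))))) ⟩
        ∑ N (λ p → c p ⊗ ∑ N (λ j → G (p ^ j))) ∎
        where
        open ≡-Reasoning
        c : ℕ → R
        c p = χ (prime? p) ⊗ w p
        inner : ∀ p → 1 ℕ.≤ p → ∀ j → ∑ N (λ m → (c p ⊗ χ (p ^ j ℕ.≟ m)) ⊗ G m) ≡ c p ⊗ G (p ^ j)
        inner p@(suc _) l j = trans (∑-cong′ N (λ m → ⊗-assoc (c p) (χ (p ^ j ℕ.≟ m)) (G m))) (trans (∑-⊗ˡ N (c p) (λ m → χ (p ^ j ℕ.≟ m) ⊗ G m))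
          (⊗-congˡ (∑-δ N (p ^ j) G (ℕ.>-nonZero⁻¹ (p ^ j) {{ℕ.m^n≢0 p j}}) sG)))

      logʷ-extend : ∀ N k → 1 ℕ.≤ k → k ℕ.≤ N → logʷ k ≡ ∑ N (λ m → χ (m ∣? k) ⊗ Λ m)
      logʷ-extend N k@(suc _) l le = sym (∑-extend le (λ i lt → 0⊗ (χ-no (i ∣? k) (λ d → ℕ.<⇒≱ lt (∣⇒≤ d)))))

      private
        logʷ-powers : ∀ N k → 1 ℕ.≤ k → k ℕ.≤ N → logʷ k ≡ ∑ N (λ p → (χ (prime? p) ⊗ w p) ⊗ ∑ N (λ j → χ (p ^ j ∣? k)))
        logʷ-powers N k@(suc _) l le = trans (logʷ-extend N k l le) (trans (∑-cong′ N (λ m → ⊗-comm (χ (m ∣? k)) (Λ m)))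
          (∑Λ N (λ m → χ (m ∣? k)) (λ i lt → χ-no (i ∣? k) (λ d → ℕ.<⇒≱ lt (ℕ.≤-trans (∣⇒≤ d) le)))))

        other-power : ∀ p q → Prime p → Prime q → p ≢ q → ∀ j k → q ^ j ∣ p ℕ.* k → q ^ j ∣ k
        other-power p q pp pq p≢q zero    k d = 1∣ k
        other-power p q pp pq p≢q (suc j) k d with euclidsLemma p k pq (∣-trans (m∣m*n (q ^ j)) d)
        ... | inj₁ e = ⊥-elim (p≢q (sym (prime∣prime pq pp e)))
        ... | inj₂ (divides k′ refl) = subst (q ^ suc j ∣_) (ℕ.*-comm q k′) (*-monoʳ-∣ q (other-power p q pp pq p≢q j k′
                 (*-cancelˡ-∣ q {{ℕ.>-nonZero (prime≥1 pq)}} (subst (q ^ suc j ∣_) (trans (sym (ℕ.*-assoc p k′ q)) (ℕ.*-comm (p ℕ.* k′) q)) d))))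

        telescope : ∀ n (f : ℕ → R) → ∑ n (λ j → f (ℕ.pred j) ⊖ f j) ≡ f 0 ⊖ f n
        telescope zero    f = lin 1 (λ a → :ι 0 :≡ a :- a) _
        telescope (suc n) f = trans (⊕-congʳ (telescope n f)) (lin 3 (λ a b c → a :- b :+ (b :- c) :≡ a :- c) _ _ _)

        ⊖≡ : ∀ {a b} → a ≡ b → a ⊖ b ≡ ι 0
        ⊖≡ {a} refl = lin 1 (λ a → a :- a :≡ :ι 0) a

      -- Here `logʷ k` weighs every prime by the number of its powers dividing k. Passing to p k
      -- shifts the powers of p by one and leaves the other primes alone, so the difference
      -- telescopes to w p.
      logʷ-prime* : ∀ p k → Prime p → 1 ℕ.≤ k → logʷ (p ℕ.* k) ≡ w p ⊕ logʷ k
      logʷ-prime* p k pp l = lin 3 (λ a b c → (a :- b :≡ c) ⇒ (a :≡ c :+ b)) _ _ _ (begin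
        logʷ (p ℕ.* k) ⊖ logʷ k
          ≡⟨ cong₂ _⊖_ (logʷ-powers N N 1≤N ℕ.≤-refl) (logʷ-powers N k l k≤N) ⟩
        ∑ N (λ q → c q ⊗ ∑ N (λ j → χ (q ^ j ∣? p ℕ.* k))) ⊖ ∑ N (λ q → c q ⊗ ∑ N (λ j → χ (q ^ j ∣? k)))
          ≡⟨ sym (∑-⊖ N (λ q → c q ⊗ ∑ N (λ j → χ (q ^ j ∣? p ℕ.* k))) (λ q → c q ⊗ ∑ N (λ j → χ (q ^ j ∣? k)))) ⟩
        ∑ N (λ q → c q ⊗ ∑ N (λ j → χ (q ^ j ∣? p ℕ.* k)) ⊖ c q ⊗ ∑ N (λ j → χ (q ^ j ∣? k)))
          ≡⟨ ∑-single N p (λ q → c q ⊗ ∑ N (λ j → χ (q ^ j ∣? p ℕ.* k)) ⊖ c q ⊗ ∑ N (λ j → χ (q ^ j ∣? k))) (prime≥1 pp)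
               (subst (ℕ._≤ N) (ℕ.*-identityʳ p) (ℕ.*-monoʳ-≤ p l)) others ⟩
        c p ⊗ ∑ N (λ j → χ (p ^ j ∣? p ℕ.* k)) ⊖ c p ⊗ ∑ N (λ j → χ (p ^ j ∣? k))
          ≡⟨ lin 3 (λ c a b → c :* a :- c :* b :≡ c :* (a :- b)) _ _ _ ⟩
        c p ⊗ (∑ N (λ j → χ (p ^ j ∣? p ℕ.* k)) ⊖ ∑ N (λ j → χ (p ^ j ∣? k)))
          ≡⟨ cong₂ _⊗_ (1⊗ (χ-yes (prime? p) pp)) (trans (sym (∑-⊖ N (λ j → χ (p ^ j ∣? p ℕ.* k)) (λ j → χ (p ^ j ∣? k))))
              (trans (∑-cong N shift) (telescope N (λ j → χ (p ^ j ∣? k))))) ⟩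
        w p ⊗ (χ (1 ∣? k) ⊖ χ (p ^ N ∣? k))
          ≡⟨ cong₂ (λ a b → w p ⊗ (a ⊖ b)) (χ-yes (1 ∣? k) (1∣ k))
              (χ-no (p ^ N ∣? k) (λ d → ℕ.<⇒≱ (j<p^j p N (prime≥2 pp)) (ℕ.≤-trans (∣⇒≤ {{ℕ.>-nonZero l}} d) k≤N))) ⟩
        w p ⊗ (ι 1 ⊖ ι 0)
          ≡⟨ lin 1 (λ a → a :* (:ι 1 :- :ι 0) :≡ a) _ ⟩
        w p ∎)
        where
        open ≡-Reasoning
        N : ℕ
        N = p ℕ.* k
        c : ℕ → R
        c q = χ (prime? q) ⊗ w q
        1≤N : 1 ℕ.≤ N
        1≤N = ℕ.*-mono-≤ (prime≥1 pp) l
        k≤N : k ℕ.≤ N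
        k≤N = subst (ℕ._≤ N) (ℕ.*-identityˡ k) (ℕ.*-monoˡ-≤ k (prime≥1 pp))
        others : ∀ q → 1 ℕ.≤ q → q ℕ.≤ N → q ≢ p → c q ⊗ ∑ N (λ j → χ (q ^ j ∣? p ℕ.* k)) ⊖ c q ⊗ ∑ N (λ j → χ (q ^ j ∣? k)) ≡ ι 0
        others q _ _ q≢p with prime? q
        ... | no _   = lin 3 (λ w a b → (:ι 0 :* w) :* a :- (:ι 0 :* w) :* b :≡ :ι 0) _ _ _
        ... | yes pq = ⊖≡ (⊗-congˡ (∑-cong′ N (λ j → χ-⇔ (q ^ j ∣? p ℕ.* k) (q ^ j ∣? k) (other-power p q pp pq (λ e → q≢p (sym e)) j k)
            (∣n⇒∣m*n p))))
        shift : ∀ j → 1 ℕ.≤ j → j ℕ.≤ N → χ (p ^ j ∣? p ℕ.* k) ⊖ χ (p ^ j ∣? k) ≡ χ (p ^ ℕ.pred j ∣? k) ⊖ χ (p ^ j ∣? k)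
        shift (suc j) _ _ = cong (_⊖ χ (p ^ suc j ∣? k))
            (χ-⇔ (p ^ suc j ∣? p ℕ.* k) (p ^ j ∣? k) (*-cancelˡ-∣ p {{ℕ.>-nonZero (prime≥1 pp)}}) (*-monoʳ-∣ p))

      logʷ1 : logʷ 1 ≡ ι 0
      logʷ1 = trans (0⊕ refl) (trans (1⊗ (χ-yes (1 ∣? 1) (1∣ 1))) (trans (0⊕ refl) (trans (0⊕ refl) (0⊗ (0⊗ (χ-no (prime? 1) ¬prime[1]))))))

      splitPrime : ∀ n → 2 ℕ.≤ n → ∃ λ p → ∃ λ m → Prime p × 1 ℕ.≤ m × m ℕ.< n × n ≡ p ℕ.* m
      splitPrime n h with primeFactor n h
      ... | p , pp , divides zero refl = ⊥-elim (ℕ.<⇒≱ h z≤n)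
      ... | p , pp , divides (suc m) e = p , suc m , pp , s≤s z≤n , subst (suc m ℕ.<_) (sym e) (ℕ.m<m*n (suc m) p (prime≥2 pp)) , trans e
          (ℕ.*-comm (suc m) p)

      logʷ-* : ∀ a b → 1 ℕ.≤ a → 1 ℕ.≤ b → logʷ (a ℕ.* b) ≡ logʷ a ⊕ logʷ b
      logʷ-* = <-rec (λ a → ∀ b → 1 ℕ.≤ a → 1 ℕ.≤ b → logʷ (a ℕ.* b) ≡ logʷ a ⊕ logʷ b) step
        where
        step : ∀ a → (∀ {a′} → a′ ℕ.< a → ∀ b → 1 ℕ.≤ a′ → 1 ℕ.≤ b → logʷ (a′ ℕ.* b) ≡ logʷ a′ ⊕ logʷ b) → ∀ b → 1 ℕ.≤ a → 1 ℕ.≤ b → logʷ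
            (a ℕ.* b) ≡ logʷ a ⊕ logʷ b
        step (suc zero) IH b _ lb = trans (cong logʷ (ℕ.*-identityˡ b)) (sym (0⊕ logʷ1))
        step a@(suc (suc _)) IH b _ lb with splitPrime a (s≤s (s≤s z≤n))
        ... | p , m , pp , lm , m<a , e = begin
          logʷ (a ℕ.* b)              ≡⟨ cong logʷ (trans (cong (ℕ._* b) e) (ℕ.*-assoc p m b)) ⟩
          logʷ (p ℕ.* (m ℕ.* b))      ≡⟨ logʷ-prime* p (m ℕ.* b) pp (ℕ.*-mono-≤ lm lb) ⟩
          w p ⊕ logʷ (m ℕ.* b)        ≡⟨ ⊕-congˡ (IH m<a b lm lb) ⟩
          w p ⊕ (logʷ m ⊕ logʷ b)       ≡⟨ sym (⊕-assoc _ _ _) ⟩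
          (w p ⊕ logʷ m) ⊕ logʷ b       ≡⟨ ⊕-congʳ (sym (trans (cong logʷ e) (logʷ-prime* p m pp lm))) ⟩
          logʷ a ⊕ logʷ b ∎
          where open ≡-Reasoning

      -- Without primes in (X, Y] only powers with exponent at least 2 contribute. Their primes are
      -- at most √Y, hence at most s, and each prime contributes at most its weight.
      ψ-gap : ∀ X Y s → Y ℕ.< 2 ℕ.* X → X ℕ.≤ Y → (∀ p → Prime p → X ℕ.< p → ¬ (p ℕ.≤ Y)) → Y ℕ.< suc s ℕ.* suc s →
        (c : R) → (∀ p → 1 ℕ.≤ p → p ℕ.≤ Y → w p ≼ c) → ι 0 ≼ c → ∑ Y Λ ⊖ ∑ X Λ ≼ ι s ⊗ c
      ψ-gap X Y s Y<2X X≤Y no-prime Y<s² c w≤c c≥0 = ≼-trans (≼-reflexive as-sum)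
          (≼-trans (≼-reflexive (∑Λ Y G (λ i lt → χ-no (G? i) (λ { (_ , le) → ℕ.<⇒≱ lt le }))))
          (≼-trans (∑-mono Y (λ p l u → bound p l u)) cut-s))
        where
        G? : ∀ m → Dec (X ℕ.< m × m ℕ.≤ Y)
        G? m = (X ℕ.<? m) ×-dec (m ℕ.≤? Y)
        G : ℕ → R
        G m = χ (G? m)
        as-sum : ∑ Y Λ ⊖ ∑ X Λ ≡ ∑ Y (λ m → Λ m ⊗ G m)
        as-sum = begin
          ∑ Y Λ ⊖ ∑ X Λ
            ≡⟨ cong (∑ Y Λ ⊖_) (sym (trans (∑-extend X≤Y (λ i lt → 0⊗ (χ-no (i ℕ.≤? X) (ℕ.<⇒≱ lt))))
                (∑-cong X (λ i _ u → 1⊗ (χ-yes (i ℕ.≤? X) u))))) ⟩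
          ∑ Y Λ ⊖ ∑ Y (λ m → χ (m ℕ.≤? X) ⊗ Λ m)
            ≡⟨ sym (∑-⊖ Y Λ (λ m → χ (m ℕ.≤? X) ⊗ Λ m)) ⟩
          ∑ Y (λ m → Λ m ⊖ χ (m ℕ.≤? X) ⊗ Λ m)
            ≡⟨ ∑-cong Y (λ m _ u → split m u) ⟩
          ∑ Y (λ m → Λ m ⊗ G m) ∎
          where
          open ≡-Reasoning
          split : ∀ m → m ℕ.≤ Y → Λ m ⊖ χ (m ℕ.≤? X) ⊗ Λ m ≡ Λ m ⊗ G m
          split m u with m ℕ.≤? X
          ... | yes le = trans (lin 1 (λ a → a :- :ι 1 :* a :≡ a :* :ι 0) (Λ m)) (⊗-congˡ (sym (χ-no (G? m) (λ { (lt , _) → ℕ.<⇒≱ lt le }))))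
          ... | no ≰   = trans (lin 1 (λ a → a :- :ι 0 :* a :≡ a :* :ι 1) (Λ m)) (⊗-congˡ (sym (χ-yes (G? m) (ℕ.≰⇒> ≰ , u))))
        -- Since Y < 2 X, at most one power of p lies in (X, Y].
        count : ∀ p → 2 ℕ.≤ p → ∀ n → ∑ n (λ j → G (p ^ j)) ≼ ι 1 × (∑ n (λ j → G (p ^ j)) ≡ ι 0 ⊎ X ℕ.< p ^ n)
        count p h zero    = 0≼ι 1 , inj₁ refl
        count p h (suc n) with count p h n
        ... | _ , inj₁ z with X ℕ.<? p ^ suc n
        ...   | yes lt = subst (_≼ ι 1) (sym (0⊕ z)) (χ≼1 (yes lt ×-dec (p ^ suc n ℕ.≤? Y))) , inj₂ lt
        ...   | no ≮   = subst (_≼ ι 1) (sym (0⊕ z)) (χ≼1 (no ≮ ×-dec (p ^ suc n ℕ.≤? Y))) , inj₁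
            (trans (0⊕ z) (χ-no (no ≮ ×-dec (p ^ suc n ℕ.≤? Y)) (λ { (lt , _) → ≮ lt })))
        count p h (suc n) | le , inj₂ X<p^n = subst (_≼ ι 1)
            (sym (⊕0 (χ-no (G? (p ^ suc n)) (λ { (_ , u) → ℕ.<⇒≱ Y<2X (ℕ.≤-trans (ℕ.*-mono-≤ h (ℕ.<⇒≤ X<p^n)) u) })))) le
           , inj₂ (ℕ.<-≤-trans X<p^n (subst (ℕ._≤ p ^ suc n) (ℕ.*-identityˡ (p ^ n)) (ℕ.*-monoˡ-≤ (p ^ n) (ℕ.≤-trans (s≤s z≤n) h))))
        large : ∀ p → Prime p → ¬ (p ℕ.* p ℕ.≤ Y) → ∀ j → 1 ℕ.≤ j → G (p ^ j) ≡ ι 0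
        large p pp ≰ (suc zero)    _ = χ-no (G? (p ^ 1))
            (λ { (lt , le) → no-prime p pp (subst (X ℕ.<_) (ℕ.*-identityʳ p) lt) (subst (ℕ._≤ Y) (ℕ.*-identityʳ p) le) })
        large p pp ≰ (suc (suc j)) _ = χ-no (G? (p ^ suc (suc j)))
            (λ { (_ , le) → ≰ (ℕ.≤-trans (ℕ.≤-trans (ℕ.*-monoʳ-≤ p (p≤p^j p (suc j) (prime≥1 pp) (s≤s z≤n))) ℕ.≤-refl) le) })
        bound : ∀ p → 1 ℕ.≤ p → p ℕ.≤ Y → (χ (prime? p) ⊗ w p) ⊗ ∑ Y (λ j → G (p ^ j)) ≼ χ (p ℕ.* p ℕ.≤? Y) ⊗ c
        bound p l u with prime? p
        ... | no _ = ≼-trans (≼-reflexive (0⊗ (0⊗ refl))) (0≼⊗ (0≼χ (p ℕ.* p ℕ.≤? Y)) c≥0)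
        ... | yes pp with p ℕ.* p ℕ.≤? Y
        ...   | no ≰ = ≼-reflexive (trans (⊗-congˡ (trans (∑-cong Y (λ j l _ → large p pp ≰ j l)) (∑-zero Y)))
            (lin 2 (λ a c → a :* :ι 0 :≡ :ι 0 :* c) _ c))
        ...   | yes _ = ≼-trans (⊗-mono (subst (ι 0 ≼_) (sym (⊗-identityˡ _)) (w≥0 p l)) (0≼ι 1)
            (subst (_≼ c) (sym (⊗-identityˡ _)) (w≤c p l u)) (proj₁ (count p (prime≥2 pp) Y))) (≼-reflexive (⊗-comm _ _))
        cut-s : ∑ Y (λ p → χ (p ℕ.* p ℕ.≤? Y) ⊗ c) ≼ ι s ⊗ c
        cut-s with s ℕ.≤? Y
        ... | yes s≤Y = ≼-trans (≼-reflexive (∑-extend s≤Y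
            (λ i lt → 0⊗ (χ-no (i ℕ.* i ℕ.≤? Y) (λ le → ℕ.<⇒≱ Y<s² (ℕ.≤-trans (ℕ.*-mono-≤ lt lt) le))))))
                          (≼-trans (∑-mono s (λ p _ _ → ≼-trans (⊗-monoʳ c c≥0 (χ≼1 (p ℕ.* p ℕ.≤? Y))) (≼-reflexive (⊗-identityˡ c))))
                              (≼-reflexive (∑-const s c)))
        ... | no s≰Y  = ≼-trans (∑-mono Y (λ p _ _ → ≼-trans (⊗-monoʳ c c≥0 (χ≼1 (p ℕ.* p ℕ.≤? Y))) (≼-reflexive (⊗-identityˡ c))))
                          (≼-trans (≼-reflexive (∑-const Y c)) (⊗-monoʳ c c≥0 (ι-mono (ℕ.<⇒≤ (ℕ.≰⇒> s≰Y)))))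

-- A completely additive logarithm

module AdditiveLogarithm where
  open OrderedField
  open LinearArithmetic
  open FiniteSums
  open LegendreSieve
  open Logarithms
  open import Data.Nat.Induction using (<-rec)
  open import Data.Nat.Primality using (Prime)
  open import Data.Nat.Divisibility

  rec-step : ∀ n → 1 ℕ.≤ n → rec n ⊖ rec (suc n) ≡ rec n ⊗ rec (suc n)
  rec-step n l = lin 3 (λ n r s → (n :* r :≡ :ι 1) ⇒ (s :* (n :* r) :≡ s :* :ι 1) ⇒ (r :* ((n :+ :ι 1) :* s) :≡ r :* :ι 1) ⇒
      (r :- s :≡ r :* s)) (ι n) (rec n) (rec (suc n))
    (rec-inv′ n l) (⊗-congˡ (rec-inv′ n l)) (⊗-congˡ (trans (⊗-congʳ (sym (ι-suc n))) (rec-inv n)))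

  -- A completely additive function within O(1/n²) of the increments of log for n ≤ Z.
  record Logarithm (Z : ℕ) : Set where
    field
      lg Λ      : ℕ → R
      lg-*      : ∀ a b → 1 ℕ.≤ a → 1 ℕ.≤ b → lg (a ℕ.* b) ≡ lg a ⊕ lg b
      lg-upper  : ∀ n → 1 ℕ.≤ n → n ℕ.≤ Z → lg (suc n) ⊖ lg n ≼ rec n ⊕ rec n ⊗ rec n
      lg-lower  : ∀ n → 1 ℕ.≤ n → n ℕ.≤ Z → rec n ⊖ ι 2 ⊗ (rec n ⊗ rec n) ≼ lg (suc n) ⊖ lg n
      lg-step   : ∀ n → 1 ℕ.≤ n → n ℕ.≤ Z → lg n ≼ lg (suc n)
      4lg2≽1    : 1 ℕ.≤ Z → ι 1 ≼ ι 4 ⊗ lg 2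
      0≼Λ       : ∀ n → ι 0 ≼ Λ n
      lg-∑Λ     : ∀ N k → 1 ℕ.≤ k → k ℕ.≤ N → lg k ≡ ∑ N (λ m → χ (m ∣? k) ⊗ Λ m)
      ψ-gap     : ∀ X Y s → Y ℕ.≤ Z → Y ℕ.< 2 ℕ.* X → X ℕ.≤ Y → (∀ p → Prime p → X ℕ.< p → ¬ (p ℕ.≤ Y)) → Y ℕ.< suc s ℕ.* suc s →
                  ∑ Y Λ ⊖ ∑ X Λ ≼ ι s ⊗ (lg Y ⊕ ι 1)

  module _ (Z : ℕ) where
    private
      abstract
        -- The error of `near-ℓ` grows like n ε. With ε = (Z + 1)⁻³ it stays below (n + 1)⁻² for n ≤
        -- Z, the accuracy that `Logarithm` asks for.
        Z³ : ℕ
        Z³ = suc Z ℕ.* (suc Z ℕ.* suc Z)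
        1≤Z³ : 1 ℕ.≤ Z³
        1≤Z³ = s≤s z≤n
        rec-Z³ : rec Z³ ≡ rec (suc Z) ⊗ rec (suc Z ℕ.* suc Z)
        rec-Z³ = rec-* (suc Z) (suc Z ℕ.* suc Z) (s≤s z≤n) (s≤s z≤n)
      module M = Mangoldt (ℓ Z³) (0≼ℓ Z³ 1≤Z³)
      lg : ℕ → R
      lg = M.logʷ
      ε : R
      ε = rec Z³

      -- Both functions agree at primes. Splitting n = p m loses at most ε by `ℓ-*`, and m + 1 ≤ n
      -- pays for this loss.
      near-ℓ : ∀ n → 1 ℕ.≤ n → lg n ≼ ℓ Z³ n × ℓ Z³ n ≼ lg n ⊕ ι n ⊗ ε
      near-ℓ = <-rec (λ n → 1 ℕ.≤ n → lg n ≼ ℓ Z³ n × ℓ Z³ n ≼ lg n ⊕ ι n ⊗ ε) step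
        where
        step : ∀ n → (∀ {m} → m ℕ.< n → 1 ℕ.≤ m → lg m ≼ ℓ Z³ m × ℓ Z³ m ≼ lg m ⊕ ι m ⊗ ε) → 1 ℕ.≤ n → lg n ≼ ℓ Z³ n × ℓ Z³ n ≼ lg n ⊕ ι n ⊗ ε
        step (suc zero) IH _ = ≼-reflexive (trans M.logʷ1 (sym (ℓ1 Z³ 1≤Z³))) ,
          lin 3 (λ a b e → (a :≡ :ι 0) ⇒ (b :≡ :ι 0) ⇒ (:ι 0 :≤ e) ⇒ (a :≤ b :+ :ι 1 :* e)) _ _ _ (ℓ1 Z³ 1≤Z³) M.logʷ1 (rec-nonneg Z³)
        step n@(suc (suc _)) IH _ with M.splitPrime n (s≤s (s≤s z≤n))
        ... | p , m , pp , lm , m<n , e =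
            lin 5 (λ ln w lm xm xn → (ln :≡ w :+ lm) ⇒ (lm :≤ xm) ⇒ (w :+ xm :≤ xn) ⇒ (ln :≤ xn)) _ _ _ _ _ lgn (proj₁ (IH m<n lm)) (proj₁ ad) ,
            lin 8 (λ ln w lm xm xn m n e → (ln :≡ w :+ lm) ⇒ (xm :≤ lm :+ m :* e) ⇒ (xn :≤ w :+ xm :+ e) ⇒ ((m :+ :ι 1) :* e :≤ n :* e) ⇒
                (xn :≤ ln :+ n :* e)) _ _ _ _ _ (ι m) (ι n) ε
              lgn (proj₂ (IH m<n lm)) (proj₂ ad) (⊗-monoʳ ε (rec-nonneg Z³) (≼-trans (≼-reflexive (sym (ι-suc m))) (ι-mono m<n)))
          where
          lgn : lg n ≡ ℓ Z³ p ⊕ lg m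
          lgn = trans (cong lg e) (M.logʷ-prime* p m pp lm)
          ad : ℓ Z³ p ⊕ ℓ Z³ m ≼ ℓ Z³ n × ℓ Z³ n ≼ ℓ Z³ p ⊕ ℓ Z³ m ⊕ ε
          ad = subst (λ z → ℓ Z³ p ⊕ ℓ Z³ m ≼ ℓ Z³ z × ℓ Z³ z ≼ ℓ Z³ p ⊕ ℓ Z³ m ⊕ ε) (sym e) (ℓ-* Z³ 1≤Z³ p m (prime≥1 pp) lm)

      small : ∀ n → n ℕ.≤ Z → ι (suc n) ⊗ ε ≼ rec (suc n) ⊗ rec (suc n)
      small n le = ≼-trans (⊗-monoʳ ε (rec-nonneg Z³) (ι-mono (s≤s le)))
        (≼-trans (≼-reflexive (trans (⊗-congˡ rec-Z³)
            (trans (sym (⊗-assoc _ _ _)) (trans (1⊗ (rec-inv Z)) (rec-* (suc Z) (suc Z) (s≤s z≤n) (s≤s z≤n))))))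
          (⊗-mono (rec-nonneg (suc Z)) (rec-nonneg (suc n)) (rec-anti (s≤s z≤n) (s≤s le)) (rec-anti (s≤s z≤n) (s≤s le))))

      upper : ∀ n → 1 ℕ.≤ n → n ℕ.≤ Z → lg (suc n) ⊖ lg n ≼ rec n ⊕ rec n ⊗ rec n
      upper n l le = lin 8 (λ a b x y r t s u → (a :≤ x) ⇒ (y :≤ b :+ t) ⇒ (x :- y :≤ r) ⇒ (t :≤ s) ⇒ (s :≤ u) ⇒ (u :≤ r :* r) ⇒
          (a :- b :≤ r :+ r :* r)) _ _ _ _ _ (ι n ⊗ ε) _ _
        (proj₁ (near-ℓ (suc n) (s≤s z≤n))) (proj₂ (near-ℓ n l)) (ℓ-suc-upper Z³ 1≤Z³ n l)
        (⊗-monoʳ ε (rec-nonneg Z³) (ι-mono (ℕ.n≤1+n n))) (small n le)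
            (⊗-mono (rec-nonneg (suc n)) (rec-nonneg n) (rec-anti l (ℕ.n≤1+n n)) (rec-anti l (ℕ.n≤1+n n)))

      lower₁ : ∀ n → 1 ℕ.≤ n → n ℕ.≤ Z → rec (suc n) ⊖ rec (suc n) ⊗ rec (suc n) ≼ lg (suc n) ⊖ lg n
      lower₁ n l le = lin 7 (λ a b x y r t u → (b :≤ y) ⇒ (x :≤ a :+ t) ⇒ (r :≤ x :- y) ⇒ (t :≤ u) ⇒ (r :- u :≤ a :- b)) _ _ _ _ _ (ι (suc n) ⊗ ε) _
        (proj₁ (near-ℓ n l)) (proj₂ (near-ℓ (suc n) (s≤s z≤n))) (ℓ-suc-lower Z³ 1≤Z³ n l) (small n le)

    logarithm : Logarithm Z
    logarithm = record
      { lg = lg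
      ; Λ = M.Λ
      ; lg-* = M.logʷ-*
      ; lg-upper = upper
      ; lg-lower = λ n l le → ≼-trans (lin 2 (λ r s → (r :- s :≡ r :* s) ⇒ (r :* s :≤ r :* r) ⇒ (s :* s :≤ r :* r) ⇒
          (r :- :ι 2 :* (r :* r) :≤ s :- s :* s)) _ _
           (rec-step n l) (⊗-monoˡ _ (rec-nonneg n) (rec-anti l (ℕ.n≤1+n n)))
           (⊗-mono (rec-nonneg (suc n)) (rec-nonneg n) (rec-anti l (ℕ.n≤1+n n)) (rec-anti l (ℕ.n≤1+n n)))) (lower₁ n l le)
      ; lg-step = λ n l le → lin 3 (λ s a b → (:ι 0 :≤ s :* (:ι 1 :- s)) ⇒ (s :- s :* s :≤ a :- b) ⇒ (b :≤ a)) _ _ _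
           (0≼⊗ (rec-nonneg (suc n)) (≼-sub (rec≼1 (suc n) (s≤s z≤n)))) (lower₁ n l le)
      ; 4lg2≽1 = λ le → lin 3 (λ s a b → (s :- s :* s :≤ a :- b) ⇒ (b :≡ :ι 0) ⇒ (:ι 2 :* s :≡ :ι 1) ⇒ ((:ι 2 :* s) :* s :≡ :ι 1 :* s) ⇒
          (:ι 1 :≤ :ι 4 :* a)) _ _ _
           (lower₁ 1 ℕ.≤-refl le) M.logʷ1 (rec-inv 1) (⊗-congʳ (rec-inv 1))
      ; 0≼Λ = M.0≼Λ
      ; lg-∑Λ = M.logʷ-extend
      ; ψ-gap = λ X Y s Y≤Z Y<2X X≤Y np Y<s² → M.ψ-gap X Y s Y<2X X≤Y np Y<s² (lg Y ⊕ ι 1)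
          (λ p lp p≤Y → ≼-trans (mono-ℓ lp p≤Y) (c-bound Y (ℕ.≤-trans lp p≤Y) Y≤Z)) (nonneg Y X≤Y Y<2X)
      }
      where
      mono-ℓ : ∀ {p Y} → 1 ℕ.≤ p → p ℕ.≤ Y → ℓ Z³ p ≼ ℓ Z³ Y
      mono-ℓ {p} {Y} l le = lin 3 (λ a b h → (a :≤ b) ⇒ (a :- h :≤ b :- h)) _ _ _ (∑-grow (ℕ.*-monoʳ-≤ Z³ le) (λ i _ → rec-nonneg i))
      c-bound : ∀ Y → 1 ℕ.≤ Y → Y ℕ.≤ Z → ℓ Z³ Y ≼ lg Y ⊕ ι 1
      c-bound Y l le = lin 5 (λ x b t s r → (x :≤ b :+ t) ⇒ (t :≤ s) ⇒ (s :≤ r :* r) ⇒ (r :* r :≤ :ι 1 :* :ι 1) ⇒ (x :≤ b :+ :ι 1)) _ _ (ι Y ⊗ ε) _ _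
        (proj₂ (near-ℓ Y l)) (⊗-monoʳ ε (rec-nonneg Z³) (ι-mono (ℕ.n≤1+n Y))) (small Y le)
        (⊗-mono (rec-nonneg (suc Y)) (0≼ι 1) (rec≼1 (suc Y) (s≤s z≤n)) (rec≼1 (suc Y) (s≤s z≤n)))
      nonneg : ∀ Y {X} → X ℕ.≤ Y → Y ℕ.< 2 ℕ.* X → ι 0 ≼ lg Y ⊕ ι 1
      nonneg Y {X} _ _ = lin 1 (λ a → (:ι 0 :≤ a) ⇒ (:ι 0 :≤ a :+ :ι 1)) _
         (subst (ι 0 ≼_) (sym (M.logʷ-def Y)) (∑-nonneg Y (λ m _ _ → 0≼⊗ (0≼χ (m ∣? Y)) (M.0≼Λ m))))

-- Summatory functions: Stirling, Euler's constant, Chebyshev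

module SummatoryFunctions where
  open OrderedField
  open LinearArithmetic
  open FiniteSums
  open Logarithms
  open AdditiveLogarithm
  import Data.Nat.DivMod as ℕ
  open import Data.Nat.Induction using (<-rec)
  open import Data.Nat.Divisibility

  ÷-*  : ∀ x d n → 1 ℕ.≤ d → 1 ℕ.≤ n → x ÷ (d ℕ.* n) ≡ (x ÷ d) ÷ n
  ÷-* x (suc d) (suc n) _ _ = sym (ℕ.m/n/o≡m/[n*o] x (suc d) (suc n))

  ÷-ι-upper : ∀ x d → 1 ℕ.≤ d → ι (x ÷ d) ≼ ι x ⊗ rec d
  ÷-ι-upper x d l = lin 4 (λ q x d r → (d :* r :≡ :ι 1) ⇒ ((d :* q) :* r :≤ x :* r) ⇒ (q :* (d :* r) :≡ q :* :ι 1) ⇒ (q :≤ x :* r))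
      (ι (x ÷ d)) (ι x) (ι d) (rec d)
    (rec-inv′ d l) (⊗-monoʳ _ (rec-nonneg d) (≼-trans (≼-reflexive (sym (ι-* d (x ÷ d)))) (ι-mono (÷-upper x d l)))) (⊗-congˡ (rec-inv′ d l))

  ÷-ι-lower : ∀ x d → 1 ℕ.≤ d → ι x ⊗ rec d ≼ ι (x ÷ d) ⊕ ι 1
  ÷-ι-lower x d l = lin 4 (λ q x d r → (x :* r :≤ (d :* (q :+ :ι 1)) :* r) ⇒ (q :* (d :* r) :≡ q :* :ι 1) ⇒ (d :* r :≡ :ι 1) ⇒
      (x :* r :≤ q :+ :ι 1)) (ι (x ÷ d)) (ι x) (ι d) (rec d)
    (⊗-monoʳ _ (rec-nonneg d) (≼-trans (ι-mono (ℕ.<⇒≤ (÷-lower x d l))) (≼-reflexive (trans (ι-* d _) (⊗-congˡ (ι-suc (x ÷ d)))))))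
        (⊗-congˡ (rec-inv′ d l)) (rec-inv′ d l)

  -- Both sides sum f d ⊗ g n over the pairs with d n ≤ x.
  ∑-hyperbola : ∀ x (f g : ℕ → R) → ∑ x (λ d → f d ⊗ ∑ (x ÷ d) g) ≡ ∑ x (λ n → g n ⊗ ∑ (x ÷ n) f)
  ∑-hyperbola x f g = begin
    ∑ x (λ d → f d ⊗ ∑ (x ÷ d) g)
        ≡⟨ ∑-cong x (λ d l _ → trans (⊗-congˡ (sym (∑-cut x d g l))) (sym (∑-⊗ˡ x (f d) (λ n → χ (d ℕ.* n ℕ.≤? x) ⊗ g n)))) ⟩
    ∑ x (λ d → ∑ x (λ n → f d ⊗ (χ (d ℕ.* n ℕ.≤? x) ⊗ g n)))   ≡⟨ ∑-swap x x (λ d n → f d ⊗ (χ (d ℕ.* n ℕ.≤? x) ⊗ g n)) ⟩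
    ∑ x (λ n → ∑ x (λ d → f d ⊗ (χ (d ℕ.* n ℕ.≤? x) ⊗ g n)))
        ≡⟨ ∑-cong x (λ n l _ → trans (∑-cong′ x (λ d → trans (lin 3 (λ a b c → a :* (b :* c) :≡ c :* (b :* a)) (f d) (χ (d ℕ.* n ℕ.≤? x)) (g n))
                                                                      (⊗-congˡ (⊗-congʳ (χ-⇔ (d ℕ.* n ℕ.≤? x) (n ℕ.* d ℕ.≤? x)
                                                                          (subst (ℕ._≤ x) (ℕ.*-comm d n)) (subst (ℕ._≤ x) (ℕ.*-comm n d)))))))
                                                                    (trans (∑-⊗ˡ x (g n) (λ d → χ (n ℕ.* d ℕ.≤? x) ⊗ f d))
                                                                        (⊗-congˡ (∑-cut x n f l)))) ⟩
    ∑ x (λ n → g n ⊗ ∑ (x ÷ n) f)                              ∎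
    where open ≡-Reasoning

  ∑-one : ∀ n → ∑ n (λ _ → ι 1) ≡ ι n
  ∑-one n = trans (∑-const n (ι 1)) (trans (⊗-comm _ _) (⊗-identityˡ _))

  ∑-floor : ∀ x (g : ℕ → R) → ∑ x (λ d → ∑ (x ÷ d) g) ≡ ∑ x (λ n → g n ⊗ ι (x ÷ n))
  ∑-floor x g = trans (∑-cong′ x (λ d → sym (⊗-identityˡ _))) (trans (∑-hyperbola x (λ _ → ι 1) g) (∑-cong′ x (λ n → ⊗-congˡ (∑-one (x ÷ n)))))

  ∑-floor-≼ : ∀ x (g : ℕ → R) → (∀ n → ι 0 ≼ g n) → ∑ x (λ d → ∑ (x ÷ d) g) ≼ ι x ⊗ ∑ x (λ n → g n ⊗ rec n)
  ∑-floor-≼ x g g≥0 = ≼-trans (≼-reflexive (∑-floor x g))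
    (≼-trans (∑-mono x (λ n l _ → ≼-trans (⊗-monoˡ (g n) (g≥0 n) (÷-ι-upper x n l))
        (≼-reflexive (lin 3 (λ g x r → g :* (x :* r) :≡ x :* (g :* r)) (g n) (ι x) (rec n)))))
      (≼-reflexive (∑-⊗ˡ x (ι x) (λ n → g n ⊗ rec n))))

  0≼H : ∀ y → ι 0 ≼ H y
  0≼H y = ∑-nonneg y (λ i _ _ → rec-nonneg i)

  1≼H : ∀ y → 1 ℕ.≤ y → ι 1 ≼ H y
  1≼H y l = subst (_≼ H y) rec1 (∑-term y (λ i _ _ → rec-nonneg i) 1 ℕ.≤-refl l)

  H≼ι : ∀ y → H y ≼ ι y
  H≼ι y = ≼-trans (∑-mono y (λ i l _ → rec≼1 i l)) (≼-reflexive (∑-one y))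

  rec≼2rec : ∀ n → 1 ℕ.≤ n → rec n ≼ ι 2 ⊗ rec (suc n)
  rec≼2rec n l = lin 2 (λ r s → (r :- s :≡ r :* s) ⇒ (:ι 0 :≤ (:ι 1 :- r) :* s) ⇒ (r :≤ :ι 2 :* s)) (rec n) (rec (suc n)) (rec-step n l)
      (0≼⊗ (≼-sub (rec≼1 n l)) (rec-nonneg (suc n)))

  -- Summation of H(n)² - H(n - 1)² = 2 H(n)/n - 1/n².
  H² : ∀ y → H y ⊗ H y ≼ ι 2 ⊗ ∑ y (λ n → rec n ⊗ H n)
  H² zero    = lin 0 (:ι 0 :* :ι 0 :≤ :ι 2 :* :ι 0)
  H² (suc y) = lin 3 (λ h s r → (h :* h :≤ :ι 2 :* s) ⇒ (:ι 0 :≤ r :* r) ⇒ ((h :+ r) :* (h :+ r) :≤ :ι 2 :* (s :+ r :* (h :+ r)))) (H y)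
      (∑ y (λ n → rec n ⊗ H n)) (rec (suc y))
    (H² y) (0≼⊗ (rec-nonneg (suc y)) (rec-nonneg (suc y)))

  -- Discrete form of the antiderivative - (log t + 1)/t of log t / t²; keeping the negative term
  -- makes the induction close.
  ∑H/n² : ∀ y → 1 ℕ.≤ y → ∑ y (λ n → (rec n ⊗ H n) ⊗ rec n) ≼ ι 3 ⊖ (H y ⊕ ι 1) ⊗ rec y
  ∑H/n² (suc zero) _ rewrite rec1 = lin 0 (:ι 0 :+ (:ι 1 :* (:ι 0 :+ :ι 1)) :* :ι 1 :≤ :ι 3 :- ((:ι 0 :+ :ι 1) :+ :ι 1) :* :ι 1)
  ∑H/n² (suc y@(suc _)) _ = lin 4 (λ v h r s → (v :≤ :ι 3 :- (h :+ :ι 1) :* r) ⇒ (r :- s :≡ r :* s) ⇒ ((r :- s) :* h :≡ (r :* s) :* h) ⇒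
      (:ι 0 :≤ (h :* s) :* (r :- s)) ⇒
        (s :* (r :- s) :≡ s :* (r :* s)) ⇒ (:ι 0 :≤ (s :* s) :* (r :- s)) ⇒ (v :+ (s :* (h :+ s)) :* s :≤ :ι 3 :- ((h :+ s) :+ :ι 1) :* s))
            (∑ y (λ n → (rec n ⊗ H n) ⊗ rec n)) (H y) (rec y) s
      (∑H/n² y (s≤s z≤n)) step (⊗-congʳ step) (0≼⊗ (0≼⊗ (0≼H y) (rec-nonneg (suc y))) r≥s) (⊗-congˡ step)
          (0≼⊗ (0≼⊗ (rec-nonneg (suc y)) (rec-nonneg (suc y))) r≥s)
    where
    s : R
    s = rec (suc y)
    step = rec-step y (s≤s z≤n)
    r≥s = ≼-sub (rec-anti {y} {suc y} (s≤s z≤n) (ℕ.n≤1+n y))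

  -- By `H²` and an exchange of summation the left side is at most 2 x ∑ H(n)/n², a bounded multiple
  -- of x. A bound without a logarithm here is what gives Selberg's formula an error of O(x).
  ∑H² : ∀ x → ∑ x (λ d → H (x ÷ d) ⊗ H (x ÷ d)) ≼ ι 6 ⊗ ι x
  ∑H² zero    = lin 0 (:ι 0 :≤ :ι 6 :* :ι 0)
  ∑H² x@(suc _) = ≼-trans (∑-mono x (λ d _ _ → H² (x ÷ d)))
    (≼-trans (≼-reflexive (∑-⊗ˡ x (ι 2) (λ d → ∑ (x ÷ d) (λ n → rec n ⊗ H n))))
    (≼-trans (⊗-monoˡ (ι 2) (0≼ι 2) (∑-floor-≼ x (λ n → rec n ⊗ H n) (λ n → 0≼⊗ (rec-nonneg n) (0≼H n))))
      (lin 4 (λ x v h r → (x :* v :≤ x :* (:ι 3 :- (h :+ :ι 1) :* r)) ⇒ (:ι 0 :≤ x :* ((h :+ :ι 1) :* r)) ⇒ (:ι 2 :* (x :* v) :≤ :ι 6 :* x))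
          (ι x) _ (H x) (rec x)
        (⊗-monoˡ (ι x) (0≼ι x) (∑H/n² x (s≤s z≤n)))
            (0≼⊗ (0≼ι x) (0≼⊗ (lin 1 (λ h → (:ι 0 :≤ h) ⇒ (:ι 0 :≤ h :+ :ι 1)) (H x) (0≼H x)) (rec-nonneg x))))))

  module Estimates (Z : ℕ) (LG : Logarithm Z) where
    open Logarithm LG

    ψ : ℕ → R
    ψ y = ∑ y Λ

    lg1 : lg 1 ≡ ι 0
    lg1 = lin 1 (λ a → (a :≡ a :+ a) ⇒ (a :≡ :ι 0)) (lg 1) (lg-* 1 1 ℕ.≤-refl ℕ.≤-refl)

    lg-mono : ∀ {m n} → 1 ℕ.≤ m → m ℕ.≤ n → n ℕ.≤ suc Z → lg m ≼ lg n
    lg-mono {m} {n} l h u = subst (λ z → lg m ≼ lg z) (ℕ.m∸n+n≡m h) (go (n ℕ.∸ m) (subst (ℕ._≤ suc Z) (sym (ℕ.m∸n+n≡m h)) u))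
      where
      go : ∀ k → k ℕ.+ m ℕ.≤ suc Z → lg m ≼ lg (k ℕ.+ m)
      go zero    _ = ≼-refl
      go (suc k) u = ≼-trans (go k (ℕ.<⇒≤ u)) (lg-step (k ℕ.+ m) (ℕ.≤-trans l (ℕ.m≤n+m m k)) (ℕ.≤-pred u))

    0≼lg : ∀ n → 1 ℕ.≤ n → n ℕ.≤ suc Z → ι 0 ≼ lg n
    0≼lg n l u = subst (_≼ lg n) lg1 (lg-mono ℕ.≤-refl l u)

    lg-suc≼2H : ∀ y → y ℕ.≤ Z → lg (suc y) ≼ ι 2 ⊗ H y
    lg-suc≼2H zero    _ = ≼-trans (≼-reflexive lg1) (lin 0 (:ι 0 :≤ :ι 2 :* :ι 0))
    lg-suc≼2H (suc y) u = lin 4 (λ a b h r → (b :≤ :ι 2 :* h) ⇒ (a :- b :≤ r :+ r :* r) ⇒ (:ι 0 :≤ r :* (:ι 1 :- r)) ⇒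
        (a :≤ :ι 2 :* (h :+ r))) (lg (suc (suc y))) (lg (suc y)) (H y) (rec (suc y))
      (lg-suc≼2H y (ℕ.<⇒≤ u)) (lg-upper (suc y) (s≤s z≤n) u) (0≼⊗ (rec-nonneg (suc y)) (≼-sub (rec≼1 (suc y) (s≤s z≤n))))

    lg≼2H : ∀ y → 1 ℕ.≤ y → y ℕ.≤ Z → lg y ≼ ι 2 ⊗ H y
    lg≼2H y l u = ≼-trans (lg-step y l u) (lg-suc≼2H y u)

    lg≼2ι : ∀ y → 1 ℕ.≤ y → y ℕ.≤ Z → lg y ≼ ι 2 ⊗ ι y
    lg≼2ι y l u = ≼-trans (lg≼2H y l u) (⊗-monoˡ (ι 2) (0≼ι 2) (H≼ι y))

    lg2≼2 : 1 ℕ.≤ Z → lg 2 ≼ ι 2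
    lg2≼2 u = ≼-trans (lg-suc≼2H 1 u) (≼-trans (⊗-monoˡ (ι 2) (0≼ι 2) (H≼ι 1)) (lin 0 (:ι 2 :* :ι 1 :≤ :ι 2)))

    -- The logarithm of y !; `T-bounds` is Stirling's formula for it.
    T : ℕ → R
    T y = ∑ y lg

    T-bounds : ∀ y → 1 ℕ.≤ y → y ℕ.≤ Z →
      ι y ⊗ lg y ⊖ ι y ⊕ ι 1 ⊖ (H y ⊖ rec y) ≼ T y × T y ≼ ι y ⊗ lg y ⊖ ι y ⊕ ι 1 ⊕ ι 2 ⊗ (H y ⊖ rec y)
    T-bounds (suc zero) _ _ =
      lin 2 (λ a r → (a :≡ :ι 0) ⇒ (:ι 1 :* a :- :ι 1 :+ :ι 1 :- ((:ι 0 :+ r) :- r) :≤ :ι 0 :+ a)) (lg 1) (rec 1) lg1 ,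
      lin 2 (λ a r → (a :≡ :ι 0) ⇒ (:ι 0 :+ a :≤ :ι 1 :* a :- :ι 1 :+ :ι 1 :+ :ι 2 :* ((:ι 0 :+ r) :- r))) (lg 1) (rec 1) lg1
    T-bounds (suc y@(suc _)) _ u =
      lin 8 (λ t n n′ a b h r s → (n′ :≡ n :+ :ι 1) ⇒ (n′ :* b :≡ (n :+ :ι 1) :* b) ⇒ (n :* a :- n :+ :ι 1 :- (h :- r) :≤ t) ⇒
          (n :* (b :- a) :≤ :ι 1 :+ r) ⇒
          (n′ :* b :- n′ :+ :ι 1 :- (h :+ s :- s) :≤ t :+ b)) (T y) (ι y) (ι (suc y)) (lg y) (lg (suc y)) (H y) (rec y) (rec (suc y))
        (ι-suc y) (⊗-congʳ (ι-suc y)) (proj₁ (T-bounds y (s≤s z≤n) (ℕ.<⇒≤ u))) up ,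
      lin 8 (λ t n n′ a b h r s → (n′ :≡ n :+ :ι 1) ⇒ (n′ :* b :≡ (n :+ :ι 1) :* b) ⇒ (t :≤ n :* a :- n :+ :ι 1 :+ :ι 2 :* (h :- r)) ⇒
          (:ι 1 :- :ι 2 :* r :≤ n :* (b :- a)) ⇒
          (t :+ b :≤ n′ :* b :- n′ :+ :ι 1 :+ :ι 2 :* (h :+ s :- s))) (T y) (ι y) (ι (suc y)) (lg y) (lg (suc y)) (H y) (rec y) (rec (suc y))
        (ι-suc y) (⊗-congʳ (ι-suc y)) (proj₂ (T-bounds y (s≤s z≤n) (ℕ.<⇒≤ u))) down
      where
      inv = rec-inv′ y (s≤s z≤n)
      up : ι y ⊗ (lg (suc y) ⊖ lg y) ≼ ι 1 ⊕ rec y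
      up = lin 3 (λ n r d → (n :* d :≤ n :* (r :+ r :* r)) ⇒ (n :* r :≡ :ι 1) ⇒ ((n :* r) :* r :≡ :ι 1 :* r) ⇒ (n :* d :≤ :ι 1 :+ r)) (ι y) (rec y) _
        (⊗-monoˡ (ι y) (0≼ι y) (lg-upper y (s≤s z≤n) (ℕ.<⇒≤ u))) inv (⊗-congʳ inv)
      down : ι 1 ⊖ ι 2 ⊗ rec y ≼ ι y ⊗ (lg (suc y) ⊖ lg y)
      down = lin 3 (λ n r d → (n :* (r :- :ι 2 :* (r :* r)) :≤ n :* d) ⇒ (n :* r :≡ :ι 1) ⇒ ((n :* r) :* r :≡ :ι 1 :* r) ⇒
          (:ι 1 :- :ι 2 :* r :≤ n :* d)) (ι y) (rec y) _
        (⊗-monoˡ (ι y) (0≼ι y) (lg-lower y (s≤s z≤n) (ℕ.<⇒≤ u))) inv (⊗-congʳ inv)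

    T-upper : ∀ y → 1 ℕ.≤ y → y ℕ.≤ Z → T y ≼ ι y ⊗ lg y ⊖ ι y ⊕ ι 1 ⊕ ι 2 ⊗ H y
    T-upper y l u = lin 4 (λ t a h r → (t :≤ a :+ :ι 1 :+ :ι 2 :* (h :- r)) ⇒ (:ι 0 :≤ r) ⇒ (t :≤ a :+ :ι 1 :+ :ι 2 :* h)) _ _ _ _ (proj₂
        (T-bounds y l u)) (rec-nonneg y)

    T-lower : ∀ y → 1 ℕ.≤ y → y ℕ.≤ Z → ι y ⊗ lg y ⊖ ι y ⊖ H y ≼ T y
    T-lower y l u = lin 4 (λ t a h r → (a :+ :ι 1 :- (h :- r) :≤ t) ⇒ (:ι 0 :≤ r) ⇒ (a :- h :≤ t)) _ _ _ _ (proj₁ (T-bounds y l u)) (rec-nonneg y)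

    -- Euler's constant, taken at the largest admissible argument in place of a limit.
    γ : R
    γ = H Z ⊖ lg Z

    -- The increments of H - lg are O(1/n²), and those of 4/n dominate them. So H - lg - 4 rec is
    -- nondecreasing, H - lg + 4 rec is nonincreasing, and both are compared with their values at Z.
    γ-bounds : ∀ y → 1 ℕ.≤ y → y ℕ.≤ Z → H y ⊖ lg y ⊖ ι 4 ⊗ rec y ≼ γ × γ ≼ H y ⊖ lg y ⊕ ι 4 ⊗ rec y
    γ-bounds y l u = drop (subst (λ z → φ y ⊖ ι 4 ⊗ rec y ≼ φ z ⊖ ι 4 ⊗ rec z × φ z ⊕ ι 4 ⊗ rec z ≼ φ y ⊕ ι 4 ⊗ rec y) (ℕ.m∸n+n≡m u)
         (go (Z ℕ.∸ y) (subst (ℕ._≤ Z) (sym (ℕ.m∸n+n≡m u)) ℕ.≤-refl)))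
      where
      φ : ℕ → R
      φ y = H y ⊖ lg y
      drop : φ y ⊖ ι 4 ⊗ rec y ≼ φ Z ⊖ ι 4 ⊗ rec Z × φ Z ⊕ ι 4 ⊗ rec Z ≼ φ y ⊕ ι 4 ⊗ rec y → φ y ⊖ ι 4 ⊗ rec y ≼ γ × γ ≼ φ y ⊕ ι 4 ⊗ rec y
      drop (a , b) = lin 3 (λ a g r → (a :≤ g :- :ι 4 :* r) ⇒ (:ι 0 :≤ r) ⇒ (a :≤ g)) _ _ _ a (rec-nonneg Z) , lin 3
          (λ a g r → (g :+ :ι 4 :* r :≤ a) ⇒ (:ι 0 :≤ r) ⇒ (g :≤ a)) _ _ _ b (rec-nonneg Z)
      go : ∀ k → k ℕ.+ y ℕ.≤ Z → φ y ⊖ ι 4 ⊗ rec y ≼ φ (k ℕ.+ y) ⊖ ι 4 ⊗ rec (k ℕ.+ y) × φ (k ℕ.+ y) ⊕ ι 4 ⊗ rec (k ℕ.+ y) ≼ φ y ⊕ ι 4 ⊗ rec y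
      go zero    u = ≼-refl , ≼-refl
      go (suc k) u =
        lin 6 (λ p h a b r s → (p :≤ h :- a :- :ι 4 :* r) ⇒ (b :- a :≤ r :+ r :* r) ⇒ (r :- s :≡ r :* s) ⇒ (r :* r :≤ r :* (:ι 2 :* s)) ⇒
            (:ι 0 :≤ r :* s) ⇒ (p :≤ h :+ s :- b :- :ι 4 :* s)) _ _ _ _ _ _
          (proj₁ IH) (lg-upper m lm (ℕ.<⇒≤ u)) (rec-step m lm) (⊗-monoˡ (rec m) (rec-nonneg m) (rec≼2rec m lm))
              (0≼⊗ (rec-nonneg m) (rec-nonneg (suc m))) ,
        lin 6 (λ p h a b r s → (h :- a :+ :ι 4 :* r :≤ p) ⇒ (r :- :ι 2 :* (r :* r) :≤ b :- a) ⇒ (r :- s :≡ r :* s) ⇒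
            (r :* r :≤ r :* (:ι 2 :* s)) ⇒ (:ι 0 :≤ r :* s) ⇒ (h :+ s :- b :+ :ι 4 :* s :≤ p)) _ _ _ _ _ _
          (proj₂ IH) (lg-lower m lm (ℕ.<⇒≤ u)) (rec-step m lm) (⊗-monoˡ (rec m) (rec-nonneg m) (rec≼2rec m lm))
              (0≼⊗ (rec-nonneg m) (rec-nonneg (suc m)))
        where
        m = k ℕ.+ y
        lm : 1 ℕ.≤ m
        lm = ℕ.≤-trans l (ℕ.m≤n+m y k)
        IH = go k (ℕ.<⇒≤ u)

    γ-range : 1 ℕ.≤ Z → ι 0 ≼ γ ⊕ ι 3 × γ ≼ ι 5
    γ-range u = lin 3 (λ g h a → (h :- a :- :ι 4 :* h :≤ g) ⇒ (a :≡ :ι 0) ⇒ (h :≡ :ι 1) ⇒ (:ι 0 :≤ g :+ :ι 3)) _ _ _ (subst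
        (λ h → h ⊖ lg 1 ⊖ ι 4 ⊗ rec 1 ≼ γ) (0⊕ refl) (proj₁ b)) lg1 rec1 ,
                lin 3 (λ g h a → (g :≤ h :- a :+ :ι 4 :* h) ⇒ (a :≡ :ι 0) ⇒ (h :≡ :ι 1) ⇒ (g :≤ :ι 5)) _ _ _ (subst
                    (λ h → γ ≼ h ⊖ lg 1 ⊕ ι 4 ⊗ rec 1) (0⊕ refl) (proj₂ b)) lg1 rec1
      where b = γ-bounds 1 ℕ.≤-refl u

    ∑lg-Λ : ∀ N (G : ℕ → R) → (∀ i → N ℕ.< i → G i ≡ ι 0) → ∑ N (λ k → lg k ⊗ G k) ≡ ∑ N (λ m → Λ m ⊗ ∑ N (λ n → G (m ℕ.* n)))
    ∑lg-Λ N G sG = begin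
      ∑ N (λ k → lg k ⊗ G k)
          ≡⟨ ∑-cong N (λ k l u → trans (⊗-congʳ (lg-∑Λ N k l u)) (sym (∑-⊗ʳ N (G k) (λ m → χ (m ∣? k) ⊗ Λ m)))) ⟩
      ∑ N (λ k → ∑ N (λ m → (χ (m ∣? k) ⊗ Λ m) ⊗ G k))    ≡⟨ ∑-swap N N (λ k m → (χ (m ∣? k) ⊗ Λ m) ⊗ G k) ⟩
      ∑ N (λ m → ∑ N (λ k → (χ (m ∣? k) ⊗ Λ m) ⊗ G k))
          ≡⟨ ∑-cong N (λ m l _ → trans (∑-cong′ N (λ k → lin 3 (λ a b c → (a :* b) :* c :≡ b :* (a :* c)) (χ (m ∣? k)) (Λ m) (G k)))
                                                               (trans (∑-⊗ˡ N (Λ m) (λ k → χ (m ∣? k) ⊗ G k)) (⊗-congˡ (∑-multiples N m G l sG)))) ⟩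
      ∑ N (λ m → Λ m ⊗ ∑ N (λ n → G (m ℕ.* n)))           ∎
      where open ≡-Reasoning

    T-floor : ∀ y → T y ≡ ∑ y (λ m → Λ m ⊗ ι (y ÷ m))
    T-floor y = begin
      T y
          ≡⟨ ∑-cong y (λ k _ u → sym (trans (⊗-congˡ (χ-yes (k ℕ.≤? y) u)) (trans (⊗-comm _ _) (⊗-identityˡ _)))) ⟩
      ∑ y (λ k → lg k ⊗ χ (k ℕ.≤? y))                                 ≡⟨ ∑lg-Λ y (λ k → χ (k ℕ.≤? y)) (λ i lt → χ-no (i ℕ.≤? y) (ℕ.<⇒≱ lt)) ⟩
      ∑ y (λ m → Λ m ⊗ ∑ y (λ n → χ (m ℕ.* n ℕ.≤? y)))
          ≡⟨ ∑-cong y (λ m l _ → ⊗-congˡ (trans (∑-cong′ y (λ n → sym (trans (⊗-comm _ _) (⊗-identityˡ _))))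
          (trans (∑-cut y m (λ _ → ι 1) l) (∑-one (y ÷ m))))) ⟩
      ∑ y (λ m → Λ m ⊗ ι (y ÷ m))                                     ∎
      where open ≡-Reasoning

    T-ψ : ∀ y → T y ≡ ∑ y (λ n → ψ (y ÷ n))
    T-ψ y = trans (T-floor y) (sym (∑-floor y Λ))

    0≼ψ : ∀ y → ι 0 ≼ ψ y
    0≼ψ y = ∑-nonneg y (λ i _ _ → 0≼Λ i)

    ψ-mono : ∀ {a b} → a ℕ.≤ b → ψ a ≼ ψ b
    ψ-mono h = ∑-grow h (λ i _ → 0≼Λ i)

    private
      half : ∀ x → ∃ λ m → (2 ℕ.* m ℕ.≤ x) × (x ℕ.≤ suc (2 ℕ.* m))
      half x = x ÷ 2 , ÷-upper x 2 (s≤s z≤n) , ℕ.≤-pred (subst (x ℕ.<_) (ℕ.*-suc 2 (x ÷ 2)) (÷-lower x 2 (s≤s z≤n)))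

    -- Chebyshev's comparison, term by term in `T-floor`: for n ≤ m one has x ÷ n ≥ 2 (m ÷ n), and
    -- for m < n ≤ x one has x ÷ n ≥ 1 and m ÷ n = 0.
    ψ-half : ∀ m x → 2 ℕ.* m ℕ.≤ x → ψ x ⊖ ψ m ≼ T x ⊖ ι 2 ⊗ T m
    ψ-half m x h = ≼-trans (≼-reflexive ψ-form) (≼-trans (∑-mono x term) (≼-reflexive (sym T-form)))
      where
      m≤x : m ℕ.≤ x
      m≤x = ℕ.≤-trans (ℕ.m≤n*m m 2) h
      ψ-form : ψ x ⊖ ψ m ≡ ∑ x (λ n → Λ n ⊖ χ (n ℕ.≤? m) ⊗ Λ n)
      ψ-form = trans (cong (ψ x ⊖_) (sym (trans (∑-extend m≤x (λ i lt → 0⊗ (χ-no (i ℕ.≤? m) (ℕ.<⇒≱ lt))))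
          (∑-cong m (λ i _ u → 1⊗ (χ-yes (i ℕ.≤? m) u))))))
        (sym (∑-⊖ x Λ (λ n → χ (n ℕ.≤? m) ⊗ Λ n)))
      T-form : T x ⊖ ι 2 ⊗ T m ≡ ∑ x (λ n → Λ n ⊗ ι (x ÷ n) ⊖ ι 2 ⊗ (Λ n ⊗ ι (m ÷ n)))
      T-form = trans (cong₂ (λ a b → a ⊖ ι 2 ⊗ b) (T-floor x)
          (trans (T-floor m) (sym (∑-extend m≤x (λ i lt → trans (⊗-congˡ (cong ι (÷-zero m i lt))) (trans (⊗-comm _ _) (⊗-zeroˡ _)))))))
        (trans (cong (∑ x (λ n → Λ n ⊗ ι (x ÷ n)) ⊖_) (sym (∑-⊗ˡ x (ι 2) (λ n → Λ n ⊗ ι (m ÷ n)))))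
            (sym (∑-⊖ x (λ n → Λ n ⊗ ι (x ÷ n)) (λ n → ι 2 ⊗ (Λ n ⊗ ι (m ÷ n))))))
      term : ∀ n → 1 ℕ.≤ n → n ℕ.≤ x → Λ n ⊖ χ (n ℕ.≤? m) ⊗ Λ n ≼ Λ n ⊗ ι (x ÷ n) ⊖ ι 2 ⊗ (Λ n ⊗ ι (m ÷ n))
      term n l u with n ℕ.≤? m
      ... | yes _ = lin 3 (λ a q p → (a :* (:ι 2 :* p) :≤ a :* q) ⇒ (a :- :ι 1 :* a :≤ a :* q :- :ι 2 :* (a :* p))) (Λ n) (ι (x ÷ n)) (ι (m ÷ n))
            (⊗-monoˡ (Λ n) (0≼Λ n) (≼-trans (≼-reflexive (sym (ι-* 2 (m ÷ n))))
                (ι-mono (*≤⇒≤÷ {2 ℕ.* (m ÷ n)} l (ℕ.≤-trans (ℕ.≤-reflexive (swap n (m ÷ n))) (ℕ.≤-trans (ℕ.*-monoʳ-≤ 2 (÷-upper m n l)) h))))))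
        where
        swap : ∀ n p → n ℕ.* (2 ℕ.* p) ≡ 2 ℕ.* (n ℕ.* p)
        swap n p = trans (sym (ℕ.*-assoc n 2 p)) (trans (cong (ℕ._* p) (ℕ.*-comm n 2)) (ℕ.*-assoc 2 n p))
      ... | no ≰ = lin 3 (λ a q p → (p :≡ :ι 0) ⇒ (a :* p :≡ a :* :ι 0) ⇒ (a :* :ι 1 :≤ a :* q) ⇒
          (a :- :ι 0 :* a :≤ a :* q :- :ι 2 :* (a :* p))) (Λ n) (ι (x ÷ n)) (ι (m ÷ n))
            (cong ι (÷-zero m n (ℕ.≰⇒> ≰))) (⊗-congˡ (cong ι (÷-zero m n (ℕ.≰⇒> ≰))))
                (⊗-monoˡ (Λ n) (0≼Λ n) (ι-mono (*≤⇒≤÷ {1} l (subst (ℕ._≤ x) (sym (ℕ.*-identityʳ n)) u))))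

    -- By Stirling's formula the main terms of T x - 2 T m cancel up to O(x) when m is about x/2,
    -- and the recursion through m sums a geometric series.
    chebyshev : ∀ x → x ℕ.≤ Z → ψ x ≼ ι 24 ⊗ ι x
    chebyshev = <-rec (λ x → x ℕ.≤ Z → ψ x ≼ ι 24 ⊗ ι x) step
      where
      step : ∀ x → (∀ {m} → m ℕ.< x → m ℕ.≤ Z → ψ m ≼ ι 24 ⊗ ι m) → x ℕ.≤ Z → ψ x ≼ ι 24 ⊗ ι x
      step zero    _  _ = lin 0 (:ι 0 :≤ :ι 24 :* :ι 0)
      step (suc zero) _ u = lin 2 (λ a b → (b :≡ :ι 0) ⇒ (b :≡ :ι 0 :+ :ι 1 :* a) ⇒ (:ι 0 :+ a :≤ :ι 24 :* :ι 1)) (Λ 1) (lg 1) lg1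
          (trans (lg-∑Λ 1 1 ℕ.≤-refl ℕ.≤-refl) (⊕-congˡ (⊗-congʳ (χ-yes (1 ∣? 1) (1∣ 1)))))
      step x@(suc (suc _)) IH u with half x
      ... | zero , _ , s≤s ()
      ... | m@(suc m′) , lo , hi = lin 11 (λ px pm tx tm x m lx lm l2 hx hm →
            (pm :≤ :ι 24 :* m) ⇒ (px :- pm :≤ tx :- :ι 2 :* tm) ⇒ (tx :≤ x :* lx :- x :+ :ι 1 :+ :ι 2 :* hx) ⇒ (m :* lm :- m :- hm :≤ tm) ⇒
            (:ι 2 :* m :≤ x) ⇒ (hx :≤ x) ⇒ (hm :≤ m) ⇒ (x :* lx :≤ (:ι 2 :* m :+ :ι 1) :* lx) ⇒ (lx :≤ :ι 2 :* x) ⇒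
                (m :* lx :≤ m :* (l2 :+ lm) :+ :ι 2) ⇒ (m :* l2 :≤ m :* :ι 2) ⇒ (:ι 1 :≤ m) ⇒
            (px :≤ :ι 24 :* x)) (ψ x) (ψ m) (T x) (T m) (ι x) (ι m) (lg x) (lg m) (lg 2) (H x) (H m)
          (IH m<x m≤Z) (ψ-half m x lo) (T-upper x (s≤s z≤n) u) (T-lower m (s≤s z≤n) m≤Z)
          (≼-trans (≼-reflexive (sym (ι-* 2 m))) (ι-mono lo)) (H≼ι x) (H≼ι m)
          (⊗-monoʳ _ (0≼lg x (s≤s z≤n) (ℕ.m≤n⇒m≤1+n u)) (≼-trans (ι-mono hi) (≼-reflexive (trans (ι-suc (2 ℕ.* m)) (⊕-congʳ (ι-* 2 m))))))
          (lg≼2ι x (s≤s z≤n) u)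
          mlx
          (⊗-monoˡ (ι m) (0≼ι m) (lg2≼2 1≤Z)) (ι-mono (s≤s z≤n))
        where
        1≤Z : 1 ℕ.≤ Z
        1≤Z = ℕ.≤-trans (s≤s z≤n) u
        m<x : m ℕ.< x
        m<x = ℕ.<-≤-trans (subst (m ℕ.<_) (ℕ.*-comm m 2) (ℕ.m<m*n m 2 (s≤s (s≤s z≤n)))) lo
        m≤Z : m ℕ.≤ Z
        m≤Z = ℕ.≤-trans (ℕ.<⇒≤ m<x) u
        lgx : lg x ≼ lg 2 ⊕ lg (suc m)
        lgx = ≼-trans (ℕ-mono) (≼-reflexive (lg-* 2 (suc m) (s≤s z≤n) (s≤s z≤n)))
          where
          goal : 2 ℕ.* suc m ℕ.≤ suc (suc x)
          goal = subst (ℕ._≤ suc (suc x)) (sym (ℕ.*-suc 2 m)) (s≤s (s≤s lo))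
          -- Monotonicity reaches only to Z + 1. If x = Z and 2 (m + 1) lies beyond, then x = 2 m,
          -- and additivity reduces the claim to the step from m to m + 1.
          ℕ-mono : lg x ≼ lg (2 ℕ.* suc m)
          ℕ-mono with x ℕ.≟ Z
          ... | no x≢Z = lg-mono (s≤s z≤n) x≤ (ℕ.≤-trans (subst (ℕ._≤ suc (suc x)) (sym (ℕ.*-suc 2 m)) (s≤s (s≤s lo))) (s≤s (ℕ.≤∧≢⇒< u x≢Z)))
            where
            x≤ : x ℕ.≤ 2 ℕ.* suc m
            x≤ = ℕ.≤-trans hi (ℕ.≤-trans (ℕ.n≤1+n _) (ℕ.≤-reflexive (sym (ℕ.*-suc 2 m))))
          ... | yes refl with 2 ℕ.* suc m ℕ.≤? suc Z
          ...   | yes le = lg-mono (s≤s z≤n) (ℕ.≤-trans hi (ℕ.≤-trans (ℕ.n≤1+n _) (ℕ.≤-reflexive (sym (ℕ.*-suc 2 m))))) le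
          ...   | no ≰ = ≼-trans (≼-reflexive (cong lg (sym eqx)))
              (≼-trans (≼-reflexive (lg-* 2 m (s≤s z≤n) (s≤s z≤n)))
              (≼-trans (⊕-mono ≼-refl (lg-step m (s≤s z≤n) m≤Z)) (≼-reflexive (sym (lg-* 2 (suc m) (s≤s z≤n) (s≤s z≤n))))))
            where
            eqx : 2 ℕ.* m ≡ x
            eqx = ℕ.≤-antisym lo (ℕ.≤-pred (ℕ.≤-pred (subst (suc (suc x) ℕ.≤_) (ℕ.*-suc 2 m) (ℕ.≰⇒> ≰))))
        mlx : ι m ⊗ lg x ≼ ι m ⊗ (lg 2 ⊕ lg m) ⊕ ι 2
        mlx = lin 6 (λ m lx l2 ls lm r → (m :* lx :≤ m :* (l2 :+ ls)) ⇒ (m :* (ls :- lm) :≤ m :* (r :+ r :* r)) ⇒ (m :* r :≡ :ι 1) ⇒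
            ((m :* r) :* r :≡ :ι 1 :* r) ⇒ (r :≤ :ι 1) ⇒ (m :* lx :≤ m :* (l2 :+ lm) :+ :ι 2)) _ _ _ _ _ (rec m)
          (⊗-monoˡ (ι m) (0≼ι m) lgx) (⊗-monoˡ (ι m) (0≼ι m) (lg-upper m (s≤s z≤n) m≤Z)) (rec-inv′ m (s≤s z≤n))
              (⊗-congʳ (rec-inv′ m (s≤s z≤n))) (rec≼1 m (s≤s z≤n))

-- Selberg's formula, by the identity of Tatuzawa and Iseki

module SelbergFormula where
  open OrderedField
  open LinearArithmetic
  open FiniteSums
  open LegendreSieve
  open Logarithms
  open AdditiveLogarithm
  open SummatoryFunctions

  module Selberg (Z : ℕ) (LG : Logarithm Z) where
    open Logarithm LG
    open Estimates Z LG

    M : ℕ → R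
    M x = ∑ x (λ n → Λ n ⊗ rec n)

    module _ (x : ℕ) (1≤x : 1 ℕ.≤ x) (2x≤Z : 2 ℕ.* x ℕ.≤ Z) where
      private
        x≤Z : x ℕ.≤ Z
        x≤Z = ℕ.≤-trans (ℕ.m≤n*m x 2) 2x≤Z
        1≤Z : 1 ℕ.≤ Z
        1≤Z = ℕ.≤-trans 1≤x x≤Z

      xM-lower : T x ≼ ι x ⊗ M x
      xM-lower = ≼-trans (≼-reflexive (T-floor x)) (≼-trans (∑-mono x (λ n l _ → ≼-trans (⊗-monoˡ (Λ n) (0≼Λ n) (÷-ι-upper x n l))
           (≼-reflexive (lin 3 (λ a x r → a :* (x :* r) :≡ x :* (a :* r)) (Λ n) (ι x) (rec n))))) (≼-reflexive (∑-⊗ˡ x (ι x) (λ n → Λ n ⊗ rec n))))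

      xM-upper : ι x ⊗ M x ≼ T x ⊕ ψ x
      xM-upper = ≼-trans (≼-reflexive (sym (∑-⊗ˡ x (ι x) (λ n → Λ n ⊗ rec n)))) (≼-trans (∑-mono x (λ n l _ → ≼-trans
           (≼-reflexive (lin 3 (λ a x r → x :* (a :* r) :≡ a :* (x :* r)) (Λ n) (ι x) (rec n)))
           (≼-trans (⊗-monoˡ (Λ n) (0≼Λ n) (÷-ι-lower x n l)) (≼-reflexive (lin 2 (λ a q → a :* (q :+ :ι 1) :≡ a :* q :+ a) (Λ n) (ι (x ÷ n)))))))
         (≼-reflexive (trans (∑-⊕ x (λ n → Λ n ⊗ ι (x ÷ n)) Λ) (⊕-congʳ (sym (T-floor x))))))

      private
        -- With y = x ÷ d, the sum over the multiples of d is about y lg y - y - y (lg y + γ) + (γ +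
        -- 1) y. The constant γ + 1 is the one that makes all of this cancel up to O(H y).
        f : ℕ → R
        f d = ψ (x ÷ d) ⊖ ι x ⊗ rec d ⊕ (γ ⊕ ι 1)

        F : ℕ → R
        F d = χ (d ℕ.≤? x) ⊗ f d

        F-supported : Supported x F
        F-supported i lt = 0⊗ (χ-no (i ℕ.≤? x) (ℕ.<⇒≱ lt))

        SF-form : ∀ d → 1 ℕ.≤ d → S x F d ≡ T (x ÷ d) ⊖ (ι x ⊗ rec d) ⊗ H (x ÷ d) ⊕ (γ ⊕ ι 1) ⊗ ι (x ÷ d)
        SF-form d l = begin
          ∑ x (λ n → χ (d ℕ.* n ℕ.≤? x) ⊗ f (d ℕ.* n))
            ≡⟨ ∑-cut x d (λ n → f (d ℕ.* n)) l ⟩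
          ∑ y (λ n → f (d ℕ.* n))
            ≡⟨ ∑-cong y (λ n ln _ → cong₂ (λ a b → ψ a ⊖ b ⊕ (γ ⊕ ι 1)) (÷-* x d n l ln) (trans (⊗-congˡ (rec-* d n l ln)) (sym (⊗-assoc _ _ _)))) ⟩
          ∑ y (λ n → ψ (y ÷ n) ⊖ (ι x ⊗ rec d) ⊗ rec n ⊕ (γ ⊕ ι 1))
            ≡⟨ trans (∑-⊕ y (λ n → ψ (y ÷ n) ⊖ (ι x ⊗ rec d) ⊗ rec n) (λ _ → γ ⊕ ι 1))
                (cong₂ _⊕_ (∑-⊖ y (λ n → ψ (y ÷ n)) (λ n → (ι x ⊗ rec d) ⊗ rec n)) (trans (∑-const y (γ ⊕ ι 1)) (⊗-comm _ _))) ⟩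
          ∑ y (λ n → ψ (y ÷ n)) ⊖ ∑ y (λ n → (ι x ⊗ rec d) ⊗ rec n) ⊕ (γ ⊕ ι 1) ⊗ ι y
            ≡⟨ ⊕-congʳ (cong₂ _⊖_ (sym (T-ψ y)) (∑-⊗ˡ y (ι x ⊗ rec d) rec)) ⟩
          T y ⊖ (ι x ⊗ rec d) ⊗ H y ⊕ (γ ⊕ ι 1) ⊗ ι y ∎
          where
          open ≡-Reasoning
          y : ℕ
          y = x ÷ d

        SF-bound : ∀ d → 1 ℕ.≤ d → d ℕ.≤ x → ι 0 ⊖ ι 7 ⊗ H (x ÷ d) ≼ S x F d × S x F d ≼ ι 7 ⊗ H (x ÷ d)
        SF-bound d l u =
          lin 8 (λ s t q y g h lh r → (s :≡ t :- q :* h :+ (g :+ :ι 1) :* y) ⇒ (y :* lh :- y :- h :≤ t) ⇒ (q :* h :≤ (y :+ :ι 1) :* h) ⇒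
              (y :* (h :- lh :- :ι 4 :* r) :≤ y :* g) ⇒ (y :* r :≡ :ι 1) ⇒ (:ι 1 :≤ h) ⇒ (:ι 0 :- :ι 7 :* h :≤ s)) (S x F d) _ (ι x ⊗ rec d)
                  (ι y) γ (H y) (lg y) (rec y)
            (SF-form d l) (T-lower y ly y≤Z) (⊗-monoʳ (H y) (0≼H y) (÷-ι-lower x d l)) (⊗-monoˡ (ι y) (0≼ι y) (proj₁ (γ-bounds y ly y≤Z)))
                (rec-inv′ y ly) (1≼H y ly) ,
          lin 8 (λ s t q y g h lh r → (s :≡ t :- q :* h :+ (g :+ :ι 1) :* y) ⇒ (t :≤ y :* lh :- y :+ :ι 1 :+ :ι 2 :* h) ⇒ (y :* h :≤ q :* h) ⇒
              (y :* g :≤ y :* (h :- lh :+ :ι 4 :* r)) ⇒ (y :* r :≡ :ι 1) ⇒ (:ι 1 :≤ h) ⇒ (s :≤ :ι 7 :* h)) (S x F d) _ (ι x ⊗ rec d) (ι y) γ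
                  (H y) (lg y) (rec y)
            (SF-form d l) (T-upper y ly y≤Z) (⊗-monoʳ (H y) (0≼H y) (÷-ι-upper x d l)) (⊗-monoˡ (ι y) (0≼ι y) (proj₂ (γ-bounds y ly y≤Z)))
                (rec-inv′ y ly) (1≼H y ly)
          where
          y : ℕ
          y = x ÷ d
          ly : 1 ℕ.≤ y
          ly = *≤⇒≤÷ {1} l (subst (ℕ._≤ x) (sym (ℕ.*-identityʳ d)) u)
          y≤Z : y ℕ.≤ Z
          y≤Z = ℕ.≤-trans (÷-≤ x d) x≤Z

        L : ℕ → R
        L d = lg x ⊖ lg d

        L-bound : ∀ d → 1 ℕ.≤ d → d ℕ.≤ x → ι 0 ≼ L d × L d ≼ ι 2 ⊗ H (x ÷ d)
        L-bound d l u = ≼-sub (lg-mono l u (ℕ.m≤n⇒m≤1+n x≤Z)) , lin 4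
            (λ a b c h → (a :≤ b :+ c) ⇒ (c :≤ :ι 2 :* h) ⇒ (a :- b :≤ :ι 2 :* h)) _ _ (lg (suc y)) _ below (lg-suc≼2H y (ℕ.≤-trans (÷-≤ x d) x≤Z))
          where
          y : ℕ
          y = x ÷ d
          below : lg x ≼ lg d ⊕ lg (suc y)
          below = ≼-trans (lg-mono 1≤x (ℕ.<⇒≤ (÷-lower x d l)) (ℕ.m≤n⇒m≤1+n (ℕ.≤-trans near 2x≤Z))) (≼-reflexive (lg-* d (suc y) l (s≤s z≤n)))
            where
            near : d ℕ.* suc y ℕ.≤ 2 ℕ.* x
            near = ℕ.≤-trans (ℕ.≤-reflexive (ℕ.*-suc d y)) (ℕ.+-mono-≤ u (ℕ.≤-trans (÷-upper x d l) (ℕ.m≤m+n x 0)))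

        W : ℕ → R
        W d = F d ⊗ L d ⊕ ∑ x (λ n → Λ n ⊗ F (d ℕ.* n))

        W-supported : Supported x W
        W-supported i lt = trans (0⊕ (0⊗ (F-supported i lt)))
            (trans (∑-cong x (λ n l _ → trans (⊗-congˡ
            (F-supported (i ℕ.* n) (ℕ.<-≤-trans lt (subst (ℕ._≤ i ℕ.* n) (ℕ.*-identityʳ i) (ℕ.*-monoʳ-≤ i l)))))
             (trans (⊗-comm _ _) (⊗-zeroˡ _)))) (∑-zero x))

        -- Since L (d m) = L d - lg m, the sum produces a term - lg m F(d m). It cancels against the
        -- sum with Λ, because lg m is the sum of Λ over the divisors of m.
        SW : ∀ d → 1 ℕ.≤ d → S x W d ≡ L d ⊗ S x F d
        SW d l = begin
          ∑ x (λ m → F (d ℕ.* m) ⊗ L (d ℕ.* m) ⊕ ∑ x (λ n → Λ n ⊗ F (d ℕ.* m ℕ.* n)))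
            ≡⟨ ∑-⊕ x (λ m → F (d ℕ.* m) ⊗ L (d ℕ.* m)) (λ m → ∑ x (λ n → Λ n ⊗ F (d ℕ.* m ℕ.* n))) ⟩
          ∑ x (λ m → F (d ℕ.* m) ⊗ L (d ℕ.* m)) ⊕ ∑ x (λ m → ∑ x (λ n → Λ n ⊗ F (d ℕ.* m ℕ.* n)))
            ≡⟨ cong₂ _⊕_ (∑-cong x (λ m lm _ → trans (⊗-congˡ (cong (lg x ⊖_) (lg-* d m l lm)))
                (lin 4 (λ a b c e → a :* (b :- (c :+ e)) :≡ (b :- c) :* a :- e :* a) (F (d ℕ.* m)) (lg x) (lg d) (lg m)))) second ⟩
          ∑ x (λ m → L d ⊗ F (d ℕ.* m) ⊖ lg m ⊗ F (d ℕ.* m)) ⊕ ∑ x (λ k → lg k ⊗ F (d ℕ.* k))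
            ≡⟨ ⊕-congʳ (∑-⊖ x (λ m → L d ⊗ F (d ℕ.* m)) (λ m → lg m ⊗ F (d ℕ.* m))) ⟩
          (∑ x (λ m → L d ⊗ F (d ℕ.* m)) ⊖ ∑ x (λ k → lg k ⊗ F (d ℕ.* k))) ⊕ ∑ x (λ k → lg k ⊗ F (d ℕ.* k))
            ≡⟨ lin 2 (λ a b → a :- b :+ b :≡ a) _ _ ⟩
          ∑ x (λ m → L d ⊗ F (d ℕ.* m))
            ≡⟨ ∑-⊗ˡ x (L d) (λ m → F (d ℕ.* m)) ⟩
          L d ⊗ S x F d ∎
          where
          open ≡-Reasoning
          second : ∑ x (λ m → ∑ x (λ n → Λ n ⊗ F (d ℕ.* m ℕ.* n))) ≡ ∑ x (λ k → lg k ⊗ F (d ℕ.* k))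
          second = trans (∑-swap x x (λ m n → Λ n ⊗ F (d ℕ.* m ℕ.* n)))
              (trans (∑-cong′ x (λ n → trans (∑-cong′ x (λ m → ⊗-congˡ (cong F (trans (ℕ.*-assoc d m n) (cong (d ℕ.*_) (ℕ.*-comm m n))))))
              (∑-⊗ˡ x (Λ n) (λ m → F (d ℕ.* (n ℕ.* m)))))) (sym (∑lg-Λ x (λ k → F (d ℕ.* k)) (dil x F-supported d l))))

        -- The product of the bounds 2 H for `L` and 7 H for `S x F`.
        E : ℕ → R
        E d = ι 14 ⊗ (H (x ÷ d) ⊗ H (x ÷ d))

        0≼E : ∀ d → ι 0 ≼ E d
        0≼E d = 0≼⊗ (0≼ι 14) (0≼⊗ (0≼H (x ÷ d)) (0≼H (x ÷ d)))

        E-supported : Supported x E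
        E-supported i lt = trans (cong (λ y → ι 14 ⊗ (H y ⊗ H y)) (÷-zero x i lt)) (lin 0 (:ι 14 :* (:ι 0 :* :ι 0) :≡ :ι 0))

        G-bound : ∀ d → 1 ℕ.≤ d → ι 0 ⊖ E d ≼ L d ⊗ S x F d × L d ⊗ S x F d ≼ E d
        G-bound d l with d ℕ.≤? x
        ... | yes u =
            lin 3 (λ a s h → (:ι 0 :≤ a :* (s :- (:ι 0 :- :ι 7 :* h))) ⇒ (:ι 0 :≤ h :* (:ι 2 :* h :- a)) ⇒
                (:ι 0 :- :ι 14 :* (h :* h) :≤ a :* s)) (L d) (S x F d) (H (x ÷ d))
              (0≼⊗ (proj₁ (L-bound d l u)) (≼-sub (proj₁ (SF-bound d l u)))) (0≼⊗ (0≼H (x ÷ d)) (≼-sub (proj₂ (L-bound d l u)))) ,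
            lin 3 (λ a s h → (:ι 0 :≤ a :* (:ι 7 :* h :- s)) ⇒ (:ι 0 :≤ h :* (:ι 2 :* h :- a)) ⇒ (a :* s :≤ :ι 14 :* (h :* h))) (L d)
                (S x F d) (H (x ÷ d))
              (0≼⊗ (proj₁ (L-bound d l u)) (≼-sub (proj₂ (SF-bound d l u)))) (0≼⊗ (0≼H (x ÷ d)) (≼-sub (proj₂ (L-bound d l u))))
        ... | no ≰  = ≼-trans (lin 1 (λ e → (:ι 0 :≤ e) ⇒ (:ι 0 :- e :≤ :ι 0)) (E d) (0≼E d)) (≼-reflexive (sym zero′)) , ≼-trans
            (≼-reflexive zero′) (0≼E d)
          where
          zero′ : L d ⊗ S x F d ≡ ι 0
          zero′ = trans (⊗-congˡ (trans (∑-cong x (λ n ln _ → F-supported (d ℕ.* n)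
              (ℕ.<-≤-trans (ℕ.≰⇒> ≰) (subst (ℕ._≤ d ℕ.* n) (ℕ.*-identityʳ d) (ℕ.*-monoʳ-≤ d ln))))) (∑-zero x)))
            (trans (⊗-comm _ _) (⊗-zeroˡ _))

        ∑E : ∑ x E ≼ ι 84 ⊗ ι x
        ∑E = lin 2 (λ s x → (s :≤ :ι 6 :* x) ⇒ (:ι 14 :* s :≤ :ι 84 :* x)) _ (ι x) (∑H² x) ∙ ∑-⊗ˡ x (ι 14) (λ d → H (x ÷ d) ⊗ H (x ÷ d))
          where
          _∙_ : ∀ {a b c : R} → b ≼ c → a ≡ b → a ≼ c
          h ∙ refl = h

        -- By `SW` and inversion, W 1 is the sieve applied to L ⊗ S x F, so the sum of the pointwise
        -- bounds `E` controls it.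
        W-bound : ι 0 ⊖ ι 84 ⊗ ι x ≼ W 1 × W 1 ≼ ι 84 ⊗ ι x
        W-bound = subst (λ w → ι 0 ⊖ ι 84 ⊗ ι x ≼ w × w ≼ ι 84 ⊗ ι x)
            (trans (sieve-cong x x (λ d l → sym (SW d l)) 1 ℕ.≤-refl) (sieve-S x W 1≤x W-supported 1 ℕ.≤-refl))
            (lin 3 (λ e w x → (e :≤ :ι 84 :* x) ⇒ (:ι 0 :- e :≤ w) ⇒ (:ι 0 :- :ι 84 :* x :≤ w)) _ _ (ι x) ∑E (proj₁ b) , ≼-trans (proj₂ b) ∑E)
          where
          b = sieve-bound x 0≼E E-supported G-bound

        W-form : W 1 ≡ ψ x ⊗ lg x ⊖ ι x ⊗ lg x ⊕ (γ ⊕ ι 1) ⊗ lg x ⊕ (∑ x (λ n → Λ n ⊗ ψ (x ÷ n)) ⊖ ι x ⊗ M x ⊕ (γ ⊕ ι 1) ⊗ ψ x)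
        W-form = cong₂ _⊕_
          (trans (cong₂ _⊗_ (1⊗ (χ-yes (1 ℕ.≤? x) 1≤x)) (cong (lg x ⊖_) lg1)) (trans (cong (λ y → (ψ y ⊖ ι x ⊗ rec 1 ⊕ (γ ⊕ ι 1)) ⊗ (lg x ⊖ ι 0)) x÷1)
            (trans (cong (λ r → (ψ x ⊖ ι x ⊗ r ⊕ (γ ⊕ ι 1)) ⊗ (lg x ⊖ ι 0)) rec1)
                (lin 4 (λ p x g l → (p :- x :* :ι 1 :+ (g :+ :ι 1)) :* (l :- :ι 0) :≡ p :* l :- x :* l :+ (g :+ :ι 1) :* l) (ψ x) (ι x) γ (lg x)))))
          (trans (∑-cong x (λ n _ u → ⊗-congˡ (trans (cong F (ℕ.*-identityˡ n)) (1⊗ (χ-yes (n ℕ.≤? x) u)))))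
            (trans (∑-cong′ x (λ n → lin 5 (λ a p x r g → a :* (p :- x :* r :+ (g :+ :ι 1)) :≡ a :* p :- x :* (a :* r) :+ (g :+ :ι 1) :* a)
                (Λ n) (ψ (x ÷ n)) (ι x) (rec n) γ))
            (trans (∑-⊕ x (λ n → Λ n ⊗ ψ (x ÷ n) ⊖ ι x ⊗ (Λ n ⊗ rec n)) (λ n → (γ ⊕ ι 1) ⊗ Λ n))
              (cong₂ _⊕_ (trans (∑-⊖ x (λ n → Λ n ⊗ ψ (x ÷ n)) (λ n → ι x ⊗ (Λ n ⊗ rec n)))
                  (cong (∑ x (λ n → Λ n ⊗ ψ (x ÷ n)) ⊖_) (∑-⊗ˡ x (ι x) (λ n → Λ n ⊗ rec n)))) (∑-⊗ˡ x (γ ⊕ ι 1) Λ)))))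
          where
          x÷1 : x ÷ 1 ≡ x
          x÷1 = trans (sym (ℕ.*-identityˡ (x ÷ 1)))
              (ℕ.≤-antisym (÷-upper x 1 ℕ.≤-refl) (ℕ.≤-pred (subst (x ℕ.<_) (ℕ.*-identityˡ (suc (x ÷ 1))) (÷-lower x 1 ℕ.≤-refl))
              ∙ ℕ.*-identityˡ (x ÷ 1)))
            where
            _∙_ : ∀ {a b c : ℕ} → a ℕ.≤ b → c ≡ b → a ℕ.≤ c
            h ∙ refl = h

      Φ : R
      Φ = ψ x ⊗ lg x ⊕ ∑ x (λ n → Λ n ⊗ ψ (x ÷ n))

      private
        lγ-lower = 0≼⊗ (0≼lg x 1≤x (ℕ.m≤n⇒m≤1+n x≤Z)) (proj₁ (γ-range 1≤Z))
        lγ-upper = 0≼⊗ (0≼lg x 1≤x (ℕ.m≤n⇒m≤1+n x≤Z)) (≼-sub (proj₂ (γ-range 1≤Z)))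
        ψγ-lower = 0≼⊗ (0≼ψ x) (proj₁ (γ-range 1≤Z))
        ψγ-upper = 0≼⊗ (0≼ψ x) (≼-sub (proj₂ (γ-range 1≤Z)))

      -- Expanding W 1 gives Φ - x lg x - x M x up to multiples of ψ x and lg x, and x M x = x lg x
      -- + O(x) by Stirling and Chebyshev.
      selberg-upper : Φ ≼ ι 2 ⊗ (ι x ⊗ lg x) ⊕ ι 400 ⊗ ι x
      selberg-upper = lin 9 (λ w p s x l g m t h → (w :≡ p :* l :- x :* l :+ (g :+ :ι 1) :* l :+ (s :- x :* m :+ (g :+ :ι 1) :* p)) ⇒
          (w :≤ :ι 84 :* x) ⇒
            (x :* m :≤ t :+ p) ⇒ (t :≤ x :* l :- x :+ :ι 1 :+ :ι 2 :* h) ⇒ (h :≤ x) ⇒ (:ι 1 :≤ x) ⇒ (p :≤ :ι 24 :* x) ⇒ (l :≤ :ι 2 :* x) ⇒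
            (:ι 0 :≤ l :* (g :+ :ι 3)) ⇒ (:ι 0 :≤ p :* (g :+ :ι 3)) ⇒
            (p :* l :+ s :≤ :ι 2 :* (x :* l) :+ :ι 400 :* x)) (W 1) (ψ x) _ (ι x) (lg x) γ (M x) (T x) (H x)
         W-form (proj₂ W-bound) xM-upper (T-upper x 1≤x x≤Z) (H≼ι x) (ι-mono 1≤x) (chebyshev x x≤Z) (lg≼2ι x 1≤x x≤Z) lγ-lower ψγ-lower

      selberg-lower : ι 2 ⊗ (ι x ⊗ lg x) ≼ Φ ⊕ ι 400 ⊗ ι x
      selberg-lower = lin 9 (λ w p s x l g m t h → (w :≡ p :* l :- x :* l :+ (g :+ :ι 1) :* l :+ (s :- x :* m :+ (g :+ :ι 1) :* p)) ⇒
          (:ι 0 :- :ι 84 :* x :≤ w) ⇒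
            (t :≤ x :* m) ⇒ (x :* l :- x :- h :≤ t) ⇒ (h :≤ x) ⇒ (:ι 1 :≤ x) ⇒ (p :≤ :ι 24 :* x) ⇒ (l :≤ :ι 2 :* x) ⇒
            (:ι 0 :≤ l :* (:ι 5 :- g)) ⇒ (:ι 0 :≤ p :* (:ι 5 :- g)) ⇒
            (:ι 2 :* (x :* l) :≤ p :* l :+ s :+ :ι 400 :* x)) (W 1) (ψ x) _ (ι x) (lg x) γ (M x) (T x) (H x)
         W-form (proj₁ W-bound) xM-lower (T-lower x 1≤x x≤Z) (H≼ι x) (ι-mono 1≤x) (chebyshev x x≤Z) (lg≼2ι x 1≤x x≤Z) lγ-upper ψγ-upper

      mertens-upper : M x ≼ lg x ⊕ ι 30
      mertens-upper = ⊗-cancelˡ x 1≤x (lin 6 (λ x m t p l h → (x :* m :≤ t :+ p) ⇒ (t :≤ x :* l :- x :+ :ι 1 :+ :ι 2 :* h) ⇒ (h :≤ x) ⇒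
          (:ι 1 :≤ x) ⇒ (p :≤ :ι 24 :* x) ⇒ (x :* m :≤ x :* (l :+ :ι 30)))
         (ι x) (M x) (T x) (ψ x) (lg x) (H x) xM-upper (T-upper x 1≤x x≤Z) (H≼ι x) (ι-mono 1≤x) (chebyshev x x≤Z))

      mertens-lower : lg x ≼ M x ⊕ ι 30
      mertens-lower = ⊗-cancelˡ x 1≤x (lin 5 (λ x m t l h → (t :≤ x :* m) ⇒ (x :* l :- x :- h :≤ t) ⇒ (h :≤ x) ⇒ (:ι 1 :≤ x) ⇒
          (x :* l :≤ x :* (m :+ :ι 30)))
         (ι x) (M x) (T x) (lg x) (H x) xM-lower (T-lower x 1≤x x≤Z) (H≼ι x) (ι-mono 1≤x))

-- What a gap between primes forces on all windows

module GapDeficit where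
  open OrderedField
  open LinearArithmetic
  open FiniteSums
  open Logarithms
  open AdditiveLogarithm
  open SummatoryFunctions
  open SelbergFormula

  ⊗-cancelʳ≥1 : ∀ {a b l} → ι 1 ≼ l → a ⊗ l ≼ b ⊗ l → a ≼ b
  ⊗-cancelʳ≥1 {a} {b} {l} hl h with ≼-total a b
  ... | inj₁ le = le
  ... | inj₂ ge = lin 3 (λ a b l → (:ι 0 :≤ (a :- b) :* (l :- :ι 1)) ⇒ (a :* l :≤ b :* l) ⇒ (a :≤ b)) a b l (0≼⊗ (≼-sub ge) (≼-sub hl)) h

  module Upper (Z : ℕ) (LG : Logarithm Z) where
    open Logarithm LG
    open Estimates Z LG
    open Selberg Z LG

    ΛΨ : ℕ → R
    ΛΨ x = ∑ x (λ n → Λ n ⊗ ψ (x ÷ n))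

    ΛΨ-extend : ∀ {a b} → a ℕ.≤ b → ΛΨ a ≡ ∑ b (λ n → Λ n ⊗ ψ (a ÷ n))
    ΛΨ-extend {a} h = sym (∑-extend h (λ n lt → trans (⊗-congˡ (cong ψ (÷-zero a n lt))) (trans (⊗-comm _ _) (⊗-zeroˡ _))))

    ΛΨ-mono : ∀ {a b} → a ℕ.≤ b → ΛΨ a ≼ ΛΨ b
    ΛΨ-mono {a} {b} h = ≼-trans (≼-reflexive (ΛΨ-extend h)) (∑-mono b (λ n _ _ → ⊗-monoˡ (Λ n) (0≼Λ n) (ψ-mono (÷-monoˡ n h))))

    lg-double : ∀ a b → 1 ℕ.≤ a → a ℕ.≤ b → b ℕ.≤ 2 ℕ.* a → 2 ℕ.* a ℕ.≤ Z → lg b ≼ lg a ⊕ ι 2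
    lg-double a b l ab b2 u = lin 4 (λ b d a t → (b :≤ d) ⇒ (d :≡ t :+ a) ⇒ (t :≤ :ι 2) ⇒ (b :≤ a :+ :ι 2)) _ _ _ _
      (lg-mono (ℕ.≤-trans l ab) b2 (ℕ.m≤n⇒m≤1+n u)) (lg-* 2 a (s≤s z≤n) l) (lg2≼2 (ℕ.≤-trans l (ℕ.≤-trans (ℕ.m≤n*m a 2) u)))

    -- Subtract Selberg's formula at a from that at b and drop the increase of the nondecreasing sum
    -- of Λ(n) ψ(x/n). The constant is 400 (a + b) + 4 b with b ≤ 2 a.
    ψ-interval : ∀ a b → 1 ℕ.≤ a → a ℕ.≤ b → b ℕ.≤ 2 ℕ.* a → 2 ℕ.* b ℕ.≤ Z →
      (ψ b ⊖ ψ a) ⊗ lg a ≼ ι 2 ⊗ ((ι b ⊖ ι a) ⊗ lg a) ⊕ ι 1208 ⊗ ι a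
    ψ-interval a b l ab b2 u = lin 8 (λ pa pb la lb sa sb a b →
        (pb :* lb :+ sb :≤ :ι 2 :* (b :* lb) :+ :ι 400 :* b) ⇒ (:ι 2 :* (a :* la) :≤ pa :* la :+ sa :+ :ι 400 :* a) ⇒ (sa :≤ sb) ⇒
        (:ι 0 :≤ pb :* (lb :- la)) ⇒ (b :* lb :≤ b :* (la :+ :ι 2)) ⇒ (b :≤ :ι 2 :* a) ⇒
        ((pb :- pa) :* la :≤ :ι 2 :* ((b :- a) :* la) :+ :ι 1208 :* a)) _ _ _ _ _ _ (ι a) (ι b)
      (selberg-upper b 1≤b u) (selberg-lower a l 2a≤Z) (ΛΨ-mono ab)
      (0≼⊗ (0≼ψ b) (≼-sub (lg-mono l ab (ℕ.m≤n⇒m≤1+n (ℕ.≤-trans (ℕ.m≤n*m b 2) u)))))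
      (⊗-monoˡ (ι b) (0≼ι b) (lg-double a b l ab b2 2a≤Z)) (≼-trans (ι-mono b2) (≼-reflexive (ι-* 2 a)))
      where
      1≤b = ℕ.≤-trans l ab
      2a≤Z = ℕ.≤-trans (ℕ.*-monoʳ-≤ 2 ab) u

  -- The interval to be excluded is (X, X + u] with X = k u; above y₀ the error terms are at most δ times the argument.
  record Setup (Z : ℕ) (LG : Logarithm Z) : Set where
    open Logarithm LG
    field
      k u y₀   : ℕ
      δ        : R
      20≤k     : 20 ℕ.≤ k
      1≤u      : 1 ℕ.≤ u
      8ku≤Z    : 8 ℕ.* (k ℕ.* u) ℕ.≤ Z
      100k≤y₀   : 100 ℕ.* k ℕ.≤ y₀
      0≼δ      : ι 0 ≼ δ
      δ-small  : ι 1000 ⊗ (ι k ⊗ δ) ≼ ι 1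
      δ-log    : ι 1208 ≼ δ ⊗ lg y₀
      δ-y₀     : ι 2 ≼ δ ⊗ ι y₀
      y₀≤ku    : y₀ ℕ.≤ k ℕ.* u

  module Erdos₁ (Z : ℕ) (LG : Logarithm Z) (SU : Setup Z LG) where
    open Logarithm LG public
    open Estimates Z LG public
    open Selberg Z LG public
    open Upper Z LG public
    open Setup SU public

    X Y : ℕ
    X = k ℕ.* u
    Y = X ℕ.+ u

    1≤k : 1 ℕ.≤ k
    1≤k = ℕ.≤-trans (s≤s z≤n) 20≤k
    1≤y₀ : 1 ℕ.≤ y₀
    1≤y₀ = ℕ.≤-trans (ℕ.*-mono-≤ {1} {100} (s≤s z≤n) 1≤k) 100k≤y₀
    y₀≤X : y₀ ℕ.≤ X
    y₀≤X = y₀≤ku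
    1≤X : 1 ℕ.≤ X
    1≤X = ℕ.*-mono-≤ 1≤k 1≤u
    X≤Y : X ℕ.≤ Y
    X≤Y = ℕ.m≤m+n X u
    u≤X : u ℕ.≤ X
    u≤X = ℕ.≤-trans (ℕ.≤-reflexive (sym (ℕ.*-identityˡ u))) (ℕ.*-monoˡ-≤ u 1≤k)
    Y≤2X : Y ℕ.≤ 2 ℕ.* X
    Y≤2X = ℕ.+-monoʳ-≤ X (ℕ.≤-trans u≤X (ℕ.m≤m+n X 0))
    2Y≤Z : 2 ℕ.* Y ℕ.≤ Z
    2Y≤Z = ℕ.≤-trans (ℕ.*-monoʳ-≤ 2 Y≤2X) (ℕ.≤-trans (ℕ.≤-reflexive (sym (ℕ.*-assoc 2 2 X)))
        (ℕ.≤-trans (ℕ.*-monoˡ-≤ X {4} {8} (s≤s (s≤s (s≤s (s≤s z≤n))))) 8ku≤Z))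
    X≤Z : X ℕ.≤ Z
    X≤Z = ℕ.≤-trans (ℕ.m≤n*m X 8) 8ku≤Z

    ιX : ι X ≡ ι k ⊗ ι u
    ιX = ι-* k u
    ιY : ι Y ≡ ι X ⊕ ι u
    ιY = ι-+ X u

    δ≼1 : ι 1000 ⊗ δ ≼ ι 1
    δ≼1 = lin 2 (λ k d → (:ι 1000 :* (k :* d) :≤ :ι 1) ⇒ (:ι 0 :≤ (k :- :ι 1) :* d) ⇒ (:ι 1000 :* d :≤ :ι 1)) (ι k) δ δ-small
        (0≼⊗ (≼-sub (ι-mono 1≤k)) 0≼δ)

    -- Division of `ψ-interval` by lg a; the choice of y₀ makes 1208 ≼ δ ⊗ lg a.
    ψ-short : ∀ a b → y₀ ℕ.≤ a → a ℕ.≤ b → b ℕ.≤ 2 ℕ.* a → 2 ℕ.* b ℕ.≤ Z → ψ b ⊖ ψ a ≼ ι 2 ⊗ (ι b ⊖ ι a) ⊕ δ ⊗ ι a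
    ψ-short a b la ab b2 u = ⊗-cancelʳ≥1 1≼lga
        (lin 5 (λ p b a l d → (p :* l :≤ :ι 2 :* ((b :- a) :* l) :+ :ι 1208 :* a) ⇒ (:ι 0 :≤ a :* (d :* l :- :ι 1208)) ⇒
        (p :* l :≤ (:ι 2 :* (b :- a) :+ d :* a) :* l)) (ψ b ⊖ ψ a) (ι b) (ι a) (lg a) δ
      (ψ-interval a b 1≤a ab b2 u) (0≼⊗ (0≼ι a) (≼-sub δlga)))
      where
      1≤a = ℕ.≤-trans 1≤y₀ la
      a≤Z : a ℕ.≤ Z
      a≤Z = ℕ.≤-trans ab (ℕ.≤-trans (ℕ.m≤n*m b 2) u)
      mono : lg y₀ ≼ lg a
      mono = lg-mono 1≤y₀ la (ℕ.m≤n⇒m≤1+n a≤Z)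
      δlga : ι 1208 ≼ δ ⊗ lg a
      δlga = ≼-trans δ-log (⊗-monoˡ δ 0≼δ mono)
      1≼lga : ι 1 ≼ lg a
      1≼lga = lin 2 (λ d l → (:ι 1208 :≤ d :* l) ⇒ (:ι 1000 :* (d :* l) :≤ :ι 1 :* l) ⇒ (:ι 1 :≤ l)) δ (lg a) δlga
         (≼-trans (≼-reflexive (sym (⊗-assoc _ _ _))) (⊗-monoʳ (lg a) (0≼lg a 1≤a (ℕ.m≤n⇒m≤1+n a≤Z)) δ≼1))

    D : ℕ → R
    D n = ψ (Y ÷ n) ⊖ ψ (X ÷ n)

    ÷-diff : ∀ n → 1 ℕ.≤ n → ι (Y ÷ n) ⊖ ι (X ÷ n) ≼ ι u ⊗ rec n ⊕ ι 1
    ÷-diff n l = lin 6 (λ q p y x r u → (q :≤ y :* r) ⇒ (x :* r :≤ p :+ :ι 1) ⇒ (y :* r :≡ (x :+ u) :* r) ⇒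
        (q :- p :≤ u :* r :+ :ι 1)) _ _ (ι Y) (ι X) (rec n) (ι u)
      (÷-ι-upper Y n l) (÷-ι-lower X n l) (⊗-congʳ ιY)

    δ-big : ∀ a → y₀ ℕ.≤ a → ι 2 ≼ δ ⊗ ι a
    δ-big a h = ≼-trans δ-y₀ (⊗-monoˡ δ 0≼δ (ι-mono h))

    100k≤ : ∀ a → y₀ ℕ.≤ a → 100 ℕ.* k ℕ.≤ a
    100k≤ a h = ℕ.≤-trans 100k≤y₀ h

    window-double : ∀ n → 1 ℕ.≤ n → y₀ ℕ.≤ X ÷ n → Y ÷ n ℕ.≤ 2 ℕ.* (X ÷ n)
    window-double n l h = ι-cancel (lin 7 (λ q p x r u k d → (q :- p :≤ u :* r :+ :ι 1) ⇒ (x :* r :≡ (k :* u) :* r) ⇒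
        (:ι 0 :≤ (k :- :ι 20) :* (u :* r)) ⇒ (x :* r :≤ p :+ :ι 1) ⇒ (:ι 100 :≤ p) ⇒ (d :≡ :ι 2 :* p) ⇒ (q :≤ d)) _ (ι (X ÷ n)) (ι X)
        (rec n) (ι u) (ι k) _
      (÷-diff n l) (⊗-congʳ ιX) (0≼⊗ (≼-sub (ι-mono 20≤k)) (0≼⊗ (0≼ι u) (rec-nonneg n))) (÷-ι-lower X n l)
      (ι-mono (ℕ.≤-trans (ℕ.m≤m*n 100 k {{ℕ.>-nonZero 1≤k}}) (100k≤ _ h))) (ι-* 2 (X ÷ n)))

    D-upper : ∀ n → 1 ℕ.≤ n → y₀ ℕ.≤ X ÷ n → D n ≼ (ι 2 ⊗ ι u ⊕ ι 2 ⊗ (δ ⊗ ι X)) ⊗ rec n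
    D-upper n l h = lin 7 (λ D b a u r d x → (D :≤ :ι 2 :* (b :- a) :+ d :* a) ⇒ (b :- a :≤ u :* r :+ :ι 1) ⇒ (:ι 2 :≤ d :* a) ⇒
        (d :* a :≤ d :* (x :* r)) ⇒
         (D :≤ (:ι 2 :* u :+ :ι 2 :* (d :* x)) :* r)) (D n) _ _ (ι u) (rec n) δ (ι X)
      (ψ-short (X ÷ n) (Y ÷ n) h (÷-monoˡ n X≤Y) (window-double n l h) (ℕ.≤-trans (ℕ.*-monoʳ-≤ 2 (÷-≤ Y n)) 2Y≤Z))
      (÷-diff n l) (δ-big _ h) (⊗-monoˡ δ 0≼δ (÷-ι-upper X n l))

    -- The shortfall of window n from twice its expected mass 2 u / n; the allowance with δ makes it
    -- nonnegative up to `N₁`.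
    deficit : ℕ → R
    deficit n = (ι 2 ⊗ ι u ⊕ ι 2 ⊗ (δ ⊗ ι X)) ⊗ rec n ⊖ D n

    -- Up to here the windows begin at y₀ or later, where `ψ-short` applies.
    N₁ : ℕ
    N₁ = X ÷ y₀

    below-N₁ : ∀ n → 1 ℕ.≤ n → n ℕ.≤ N₁ → y₀ ℕ.≤ X ÷ n
    below-N₁ n l h = *≤⇒≤÷ l (subst (ℕ._≤ X) (ℕ.*-comm y₀ n) (≤÷⇒*≤ {n} {X} {y₀} 1≤y₀ h))

    0≼deficit : ∀ n → 1 ℕ.≤ n → n ℕ.≤ N₁ → ι 0 ≼ deficit n
    0≼deficit n l h = ≼-sub (D-upper n l (below-N₁ n l h))

    -- The main term of Selberg's formula grows by about 2 u lg X from X to Y. If ψ hardly grows,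
    -- the windows have to supply this.
    ∑ΛD-lower : ψ Y ⊖ ψ X ≼ δ ⊗ ι X → ι 2 ⊗ (ι u ⊗ lg X) ⊖ δ ⊗ (ι X ⊗ lg X) ⊖ ι 1250 ⊗ ι X ≼ ∑ Y (λ n → Λ n ⊗ D n)
    ∑ΛD-lower gap = lin 11 (λ px py lx ly sx sy x y u d s → (:ι 2 :* (y :* ly) :≤ py :* ly :+ sy :+ :ι 400 :* y) ⇒
        (px :* lx :+ sx :≤ :ι 2 :* (x :* lx) :+ :ι 400 :* x) ⇒
         (s :≡ sy :- sx) ⇒ (y :≡ x :+ u) ⇒ (y :* ly :≡ (x :+ u) :* ly) ⇒ (:ι 0 :≤ (d :* x :- (py :- px)) :* ly) ⇒
             ((d :* x) :* ly :≤ (d :* x) :* (lx :+ :ι 2)) ⇒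
         (px :* ly :≤ px :* (lx :+ :ι 2)) ⇒ (px :≤ :ι 24 :* x) ⇒ (u :≤ x) ⇒ (:ι 0 :≤ x :* (ly :- lx)) ⇒ (:ι 0 :≤ u :* (ly :- lx)) ⇒
             ((:ι 1000 :* d) :* x :≤ :ι 1 :* x) ⇒ (:ι 0 :≤ x) ⇒
         (:ι 2 :* (u :* lx) :- d :* (x :* lx) :- :ι 1250 :* x :≤ s)) (ψ X) (ψ Y) (lg X) (lg Y) (ΛΨ X) (ΛΨ Y) (ι X) (ι Y) (ι u) δ _
       (selberg-lower Y 1≤Y 2Y≤Z) (selberg-upper X 1≤X 2X≤Z) split ιY (⊗-congʳ ιY) (0≼⊗ (≼-sub gap) (0≼lg Y 1≤Y (ℕ.m≤n⇒m≤1+n Y≤Z)))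
       (⊗-monoˡ _ (0≼⊗ 0≼δ (0≼ι X)) lgY) (⊗-monoˡ _ (0≼ψ X) lgY) (chebyshev X X≤Z) (ι-mono u≤X) (0≼⊗ (0≼ι X) lgXY) (0≼⊗ (0≼ι u) lgXY)
       (⊗-monoʳ (ι X) (0≼ι X) δ≼1) (0≼ι X)
      where
      1≤Y = ℕ.≤-trans 1≤X X≤Y
      Y≤Z = ℕ.≤-trans (ℕ.m≤n*m Y 2) 2Y≤Z
      2X≤Z = ℕ.≤-trans (ℕ.*-monoʳ-≤ 2 X≤Y) 2Y≤Z
      lgY : lg Y ≼ lg X ⊕ ι 2
      lgY = lg-double X Y 1≤X X≤Y Y≤2X 2X≤Z
      lgXY : ι 0 ≼ lg Y ⊖ lg X
      lgXY = ≼-sub (lg-mono 1≤X X≤Y (ℕ.m≤n⇒m≤1+n Y≤Z))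
      split : ∑ Y (λ n → Λ n ⊗ D n) ≡ ΛΨ Y ⊖ ΛΨ X
      split = trans (∑-cong′ Y (λ n → lin 3 (λ a b c → a :* (b :- c) :≡ a :* b :- a :* c) (Λ n) (ψ (Y ÷ n)) (ψ (X ÷ n))))
          (trans (∑-⊖ Y (λ n → Λ n ⊗ ψ (Y ÷ n)) (λ n → Λ n ⊗ ψ (X ÷ n))) (cong (ΛΨ Y ⊖_) (sym (ΛΨ-extend X≤Y))))

    N₁≤X : N₁ ℕ.≤ X
    N₁≤X = ÷-≤ X y₀
    N₁≤Y : N₁ ℕ.≤ Y
    N₁≤Y = ℕ.≤-trans N₁≤X X≤Y
    1≤N₁ : 1 ℕ.≤ N₁
    1≤N₁ = *≤⇒≤÷ {1} {X} {y₀} 1≤y₀ (subst (ℕ._≤ X) (sym (ℕ.*-identityʳ y₀)) y₀≤X)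

    private
      lgN₁ : lg Y ≼ lg N₁ ⊕ lg y₀ ⊕ ι 4
      lgN₁ = lin 5 (λ ly lx ls ln l0 → (ly :≤ lx :+ :ι 2) ⇒ (lx :≤ l0 :+ ls) ⇒ (ls :≤ ln :+ :ι 2) ⇒ (ly :≤ ln :+ l0 :+ :ι 4)) _ (lg X)
          (lg (suc N₁)) _ _
        (lg-double X Y 1≤X X≤Y Y≤2X (ℕ.≤-trans (ℕ.*-monoʳ-≤ 2 X≤Y) 2Y≤Z))
        (≼-trans (lg-mono 1≤X (ℕ.<⇒≤ (÷-lower X y₀ 1≤y₀)) (ℕ.m≤n⇒m≤1+n near)) (≼-reflexive (lg-* y₀ (suc N₁) 1≤y₀ (s≤s z≤n))))
        (lg-double N₁ (suc N₁) 1≤N₁ (ℕ.n≤1+n N₁) (ℕ.+-mono-≤ 1≤N₁ (ℕ.≤-reflexive (sym (ℕ.+-identityʳ N₁)))) (ℕ.≤-trans (ℕ.*-monoʳ-≤ 2 N₁≤Y) 2Y≤Z))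
        where
        near : y₀ ℕ.* suc N₁ ℕ.≤ Z
        near = ℕ.≤-trans (ℕ.≤-reflexive (ℕ.*-suc y₀ N₁))
            (ℕ.≤-trans (ℕ.+-mono-≤ y₀≤X (ℕ.≤-trans (÷-upper X y₀ 1≤y₀) (ℕ.≤-reflexive (sym (ℕ.+-identityʳ X)))))
            (ℕ.≤-trans (ℕ.*-monoˡ-≤ X {2} {8} (s≤s (s≤s z≤n))) 8ku≤Z))

    -- Chebyshev's bound gives D n ≼ 24 Y / n, and the Λ(n)/n with N₁ < n ≤ Y add up to lg y₀ + O(1)
    -- by Mertens.
    ∑ΛD-tail : ∑ Y (λ n → Λ n ⊗ D n) ≼ ∑ N₁ (λ n → Λ n ⊗ D n) ⊕ ι 48 ⊗ (ι X ⊗ (lg y₀ ⊕ ι 64))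
    ∑ΛD-tail = lin 9 (λ s t y mY mN lY lN l0 x → (s :- t :≤ :ι 24 :* (y :* (mY :- mN))) ⇒ (y :* mY :≤ y :* (lY :+ :ι 30)) ⇒
        (y :* lN :≤ y :* (mN :+ :ι 30)) ⇒ (y :* lY :≤ y :* (lN :+ l0 :+ :ι 4)) ⇒
         (y :* (l0 :+ :ι 64) :≤ (:ι 2 :* x) :* (l0 :+ :ι 64)) ⇒ (s :≤ t :+ :ι 48 :* (x :* (l0 :+ :ι 64)))) _ _ (ι Y) (M Y) (M N₁) (lg Y)
             (lg N₁) (lg y₀) (ι X)
       main (⊗-monoˡ _ (0≼ι Y) (mertens-upper Y 1≤Y 2Y≤Z)) (⊗-monoˡ _ (0≼ι Y) (mertens-lower N₁ 1≤N₁ (ℕ.≤-trans (ℕ.*-monoʳ-≤ 2 N₁≤Y) 2Y≤Z)))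
           (⊗-monoˡ _ (0≼ι Y) lgN₁)
       (⊗-monoʳ _ (lin 1 (λ l → (:ι 0 :≤ l) ⇒ (:ι 0 :≤ l :+ :ι 64)) _ (0≼lg y₀ 1≤y₀ (ℕ.m≤n⇒m≤1+n (ℕ.≤-trans y₀≤X X≤Z))))
           (≼-trans (ι-mono Y≤2X) (≼-reflexive (ι-* 2 X))))
      where
      1≤Y = ℕ.≤-trans 1≤X X≤Y
      g : ℕ → R
      g n = ι 24 ⊗ ι Y ⊗ (Λ n ⊗ rec n) ⊖ Λ n ⊗ D n
      0≼g : ∀ n → N₁ ℕ.< n → ι 0 ≼ g n
      0≼g n lt = lin 6 (λ D p b y r a → (:ι 0 :≤ a :* (:ι 24 :* b :- p)) ⇒ (:ι 0 :≤ a :* (y :* r :- b)) ⇒ (:ι 0 :≤ a :* (p :- D)) ⇒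
          (:ι 0 :≤ :ι 24 :* y :* (a :* r) :- a :* D)) (D n) (ψ (Y ÷ n)) (ι (Y ÷ n)) (ι Y) (rec n) (Λ n)
        (0≼⊗ (0≼Λ n) (≼-sub (chebyshev (Y ÷ n) (ℕ.≤-trans (÷-≤ Y n) (ℕ.≤-trans (ℕ.m≤n*m Y 2) 2Y≤Z)))))
            (0≼⊗ (0≼Λ n) (≼-sub (÷-ι-upper Y n (ℕ.≤-trans (s≤s z≤n) lt))))
        (0≼⊗ (0≼Λ n) (lin 2 (λ a b → (:ι 0 :≤ b) ⇒ (:ι 0 :≤ a :- (a :- b))) _ _ (0≼ψ (X ÷ n))))
      ∑g : ∀ N → ∑ N g ≡ ι 24 ⊗ ι Y ⊗ M N ⊖ ∑ N (λ n → Λ n ⊗ D n)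
      ∑g N = trans (∑-⊖ N (λ n → ι 24 ⊗ ι Y ⊗ (Λ n ⊗ rec n)) (λ n → Λ n ⊗ D n))
          (cong (_⊖ ∑ N (λ n → Λ n ⊗ D n)) (∑-⊗ˡ N (ι 24 ⊗ ι Y) (λ n → Λ n ⊗ rec n)))
      main : ∑ Y (λ n → Λ n ⊗ D n) ⊖ ∑ N₁ (λ n → Λ n ⊗ D n) ≼ ι 24 ⊗ (ι Y ⊗ (M Y ⊖ M N₁))
      main = lin 5 (λ s t y a b → (:ι 24 :* y :* b :- t :≤ :ι 24 :* y :* a :- s) ⇒ (s :- t :≤ :ι 24 :* (y :* (a :- b)))) _ _ (ι Y) (M Y) (M N₁)
        (subst₂ _≼_ (∑g N₁) (∑g Y) (∑-grow N₁≤Y 0≼g))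

    G : ℕ → R
    G t = ∑ t (λ n → Λ n ⊗ deficit n)

    G-mono : ∀ {a b} → a ℕ.≤ b → b ℕ.≤ N₁ → G a ≼ G b
    G-mono {a} {b} h u = subst (λ z → G a ≼ G z) (ℕ.m∸n+n≡m h) (go (b ℕ.∸ a) (subst (ℕ._≤ N₁) (sym (ℕ.m∸n+n≡m h)) u))
      where
      go : ∀ i → i ℕ.+ a ℕ.≤ N₁ → G a ≼ G (i ℕ.+ a)
      go zero    _ = ≼-refl
      go (suc i) u = lin 3 (λ g h t → (g :≤ h) ⇒ (:ι 0 :≤ t) ⇒ (g :≤ h :+ t)) _ _ _ (go i (ℕ.<⇒≤ u)) (0≼⊗ (0≼Λ _) (0≼deficit _ (s≤s z≤n) u))

    -- The full allowance sums to at most (2 u + 2 δ X)(lg X + O(1)). Against the lower bound for ∑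
    -- Λ D the terms 2 u lg X cancel, and only multiples of δ X lg X remain.
    G-total : ψ Y ⊖ ψ X ≼ δ ⊗ ι X → ι 48 ⊗ lg y₀ ⊕ ι 5000 ≼ δ ⊗ lg X → G N₁ ≼ ι 4 ⊗ (δ ⊗ (ι X ⊗ lg X))
    G-total gap large = lin 9 (λ g m s u d x lX l0 t → (g :≡ (:ι 2 :* u :+ :ι 2 :* (d :* x)) :* m :- s) ⇒
        (:ι 0 :≤ (:ι 2 :* u :+ :ι 2 :* (d :* x)) :* (lX :+ :ι 30 :- m)) ⇒
        (t :≤ s :+ :ι 48 :* (x :* (l0 :+ :ι 64))) ⇒ (:ι 2 :* (u :* lX) :- d :* (x :* lX) :- :ι 1250 :* x :≤ t) ⇒ (u :≤ x) ⇒
            ((:ι 1000 :* d) :* x :≤ :ι 1 :* x) ⇒ (:ι 0 :≤ x) ⇒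
        (x :* (:ι 48 :* l0 :+ :ι 5000) :≤ x :* (d :* lX)) ⇒ (g :≤ :ι 4 :* (d :* (x :* lX)))) (G N₁) (M N₁) _ (ι u) δ (ι X) (lg X) (lg y₀) _
      form (0≼⊗ 0≼c (≼-sub MN)) ∑ΛD-tail (∑ΛD-lower gap) (ι-mono u≤X) (⊗-monoʳ (ι X) (0≼ι X) δ≼1) (0≼ι X) (⊗-monoˡ (ι X) (0≼ι X) large)
      where
      c : R
      c = ι 2 ⊗ ι u ⊕ ι 2 ⊗ (δ ⊗ ι X)
      form : G N₁ ≡ c ⊗ M N₁ ⊖ ∑ N₁ (λ n → Λ n ⊗ D n)
      form = trans (∑-cong′ N₁ (λ n → lin 4 (λ a c r d → a :* (c :* r :- d) :≡ c :* (a :* r) :- a :* d) (Λ n) c (rec n) (D n)))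
        (trans (∑-⊖ N₁ (λ n → c ⊗ (Λ n ⊗ rec n)) (λ n → Λ n ⊗ D n)) (cong (_⊖ ∑ N₁ (λ n → Λ n ⊗ D n)) (∑-⊗ˡ N₁ c (λ n → Λ n ⊗ rec n))))
      0≼c : ι 0 ≼ c
      0≼c = lin 2 (λ u e → (:ι 0 :≤ u) ⇒ (:ι 0 :≤ e) ⇒ (:ι 0 :≤ :ι 2 :* u :+ :ι 2 :* e)) _ _ (0≼ι u) (0≼⊗ 0≼δ (0≼ι X))
      MN : M N₁ ≼ lg X ⊕ ι 30
      MN = ≼-trans (mertens-upper N₁ 1≤N₁ (ℕ.≤-trans (ℕ.*-monoʳ-≤ 2 N₁≤Y) 2Y≤Z)) (⊕-mono (lg-mono 1≤N₁ N₁≤X (ℕ.m≤n⇒m≤1+n X≤Z)) ≼-refl)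

-- Points of intermediate prime density

module MidPoints where
  open OrderedField
  open LinearArithmetic
  open FiniteSums
  open Logarithms
  open AdditiveLogarithm
  open GapDeficit
  open import Data.Sum using (swap)
  open import Relation.Nullary.Decidable using (_×-dec_)

  search≤ : ∀ {P : ℕ → Set} → (∀ n → Dec (P n)) → ∀ N → (∃ λ n → n ℕ.≤ N × P n) ⊎ (∀ n → n ℕ.≤ N → ¬ P n)
  search≤ P? zero with P? 0
  ... | yes p = inj₁ (0 , z≤n , p)
  ... | no ¬p = inj₂ (λ { .0 z≤n → ¬p })
  search≤ {P} P? (suc N) with P? (suc N) | search≤ P? N
  ... | yes p | _ = inj₁ (suc N , ℕ.≤-refl , p)
  ... | no ¬p | inj₁ (n , le , p) = inj₁ (n , ℕ.m≤n⇒m≤1+n le , p)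
  ... | no ¬p | inj₂ none = inj₂ excluded
    where
    excluded : ∀ n → n ℕ.≤ suc N → ¬ P n
    excluded n le p with n ℕ.≟ suc N
    ... | yes refl = ¬p p
    ... | no n≢    = none n (ℕ.≤-pred (ℕ.≤∧≢⇒< le n≢)) p

  module Erdos₂ (Z : ℕ) (LG : Logarithm Z) (SU : Setup Z LG) where
    open Erdos₁ Z LG SU public

    M-upper : ∀ a b → 1 ℕ.≤ a → a ℕ.≤ b → M b ⊖ M a ≼ (ψ b ⊖ ψ a) ⊗ rec a
    M-upper a b l h = lin 5 (λ pa pb ma mb r → (pa :* r :- ma :≤ pb :* r :- mb) ⇒ (mb :- ma :≤ (pb :- pa) :* r)) _ _ _ _ _
        (subst₂ _≼_ (form a) (form b) (∑-grow≤ h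
            (λ i lt _ → lin 3 (λ x r s → (:ι 0 :≤ x :* (r :- s)) ⇒ (:ι 0 :≤ x :* r :- x :* s)) (Λ i) (rec a) (rec i)
            (0≼⊗ (0≼Λ i) (≼-sub (rec-anti l (ℕ.<⇒≤ lt)))))))
      where
      form : ∀ N → ∑ N (λ i → Λ i ⊗ rec a ⊖ Λ i ⊗ rec i) ≡ ψ N ⊗ rec a ⊖ M N
      form N = trans (∑-⊖ N (λ i → Λ i ⊗ rec a) (λ i → Λ i ⊗ rec i)) (cong (_⊖ M N) (∑-⊗ʳ N (rec a) Λ))

    M-lower : ∀ a b → a ℕ.≤ b → (ψ b ⊖ ψ a) ⊗ rec b ≼ M b ⊖ M a
    M-lower a b h = lin 5 (λ pa pb ma mb r → (ma :- pa :* r :≤ mb :- pb :* r) ⇒ ((pb :- pa) :* r :≤ mb :- ma)) _ _ _ _ _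
        (subst₂ _≼_ (form a) (form b) (∑-grow≤ h
            (λ i lt u → lin 3 (λ x r s → (:ι 0 :≤ x :* (s :- r)) ⇒ (:ι 0 :≤ x :* s :- x :* r)) (Λ i) (rec b) (rec i)
            (0≼⊗ (0≼Λ i) (≼-sub (rec-anti (ℕ.≤-trans (s≤s z≤n) lt) u))))))
      where
      form : ∀ N → ∑ N (λ i → Λ i ⊗ rec i ⊖ Λ i ⊗ rec b) ≡ M N ⊖ ψ N ⊗ rec b
      form N = trans (∑-⊖ N (λ i → Λ i ⊗ rec i) (λ i → Λ i ⊗ rec b)) (cong (M N ⊖_) (∑-⊗ʳ N (rec b) Λ))

    lg-run-upper : ∀ z i → 1 ℕ.≤ z → i ℕ.+ z ℕ.≤ Z → lg (i ℕ.+ z) ⊖ lg z ≼ ι i ⊗ (rec z ⊕ rec z ⊗ rec z)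
    lg-run-upper z zero    l u = lin 2 (λ a b → a :- a :≤ :ι 0 :* b) _ _
    lg-run-upper z (suc i) l u = lin 7 (λ a b c n n′ r s → (b :- a :≤ n :* (r :+ r :* r)) ⇒ (c :- b :≤ s :+ s :* s) ⇒ (s :≤ r) ⇒
        (s :* s :≤ r :* r) ⇒ (n′ :* (r :+ r :* r) :≡ (n :+ :ι 1) :* (r :+ r :* r)) ⇒
        (c :- a :≤ n′ :* (r :+ r :* r))) _ (lg (i ℕ.+ z)) _ (ι i) (ι (suc i)) (rec z) (rec (i ℕ.+ z))
      (lg-run-upper z i l (ℕ.<⇒≤ u)) (lg-upper (i ℕ.+ z) (ℕ.≤-trans l (ℕ.m≤n+m z i)) (ℕ.<⇒≤ u)) s≤r
          (⊗-mono (rec-nonneg _) (rec-nonneg z) s≤r s≤r) (⊗-congʳ (ι-suc i))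
      where s≤r = rec-anti l (ℕ.m≤n+m z i)

    lg-run-lower : ∀ z N i → 1 ℕ.≤ z → i ℕ.+ z ℕ.≤ N → N ℕ.≤ Z → ι i ⊗ (rec N ⊖ ι 2 ⊗ (rec z ⊗ rec z)) ≼ lg (i ℕ.+ z) ⊖ lg z
    lg-run-lower z N zero    l u v = lin 2 (λ a b → :ι 0 :* b :≤ a :- a) _ _
    lg-run-lower z N (suc i) l u v = lin 8 (λ a b c n n′ r s t → (n :* (t :- :ι 2 :* (r :* r)) :≤ b :- a) ⇒
        (s :- :ι 2 :* (s :* s) :≤ c :- b) ⇒ (t :≤ s) ⇒ (s :* s :≤ r :* r) ⇒
        (n′ :* (t :- :ι 2 :* (r :* r)) :≡ (n :+ :ι 1) :* (t :- :ι 2 :* (r :* r))) ⇒ (n′ :* (t :- :ι 2 :* (r :* r)) :≤ c :- a)) _ (lg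
            (i ℕ.+ z)) _ (ι i) (ι (suc i)) (rec z) (rec (i ℕ.+ z)) (rec N)
      (lg-run-lower z N i l (ℕ.<⇒≤ u) v) (lg-lower (i ℕ.+ z) lm (ℕ.≤-trans (ℕ.<⇒≤ u) v)) (rec-anti lm (ℕ.<⇒≤ u))
          (⊗-mono (rec-nonneg _) (rec-nonneg z) s≤r s≤r) (⊗-congʳ (ι-suc i))
      where
      s≤r = rec-anti l (ℕ.m≤n+m z i)
      lm = ℕ.≤-trans l (ℕ.m≤n+m z i)

    next : ℕ → ℕ
    next z = z ÷ k ℕ.+ z

    inc : ℕ → R
    inc z = ψ (next z) ⊖ ψ z

    -- Normalised so that density 1, that is an increment of z / k, corresponds to 4 z. `Mid` thus
    -- allows densities from 1/4 to 5/4.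
    q : ℕ → R
    q z = ι 4 ⊗ (ι k ⊗ inc z)

    Low High Mid : ℕ → Set
    Low z  = q z ≼ ι z
    High z = ι 5 ⊗ ι z ≼ q z
    Mid z  = ι z ≼ q z × q z ≼ ι 5 ⊗ ι z

    20next≤21 : ∀ z → 20 ℕ.* next z ℕ.≤ 21 ℕ.* z
    20next≤21 z = ℕ.≤-trans (ℕ.≤-reflexive (ℕ.*-distribˡ-+ 20 (z ÷ k) z))
        (ℕ.+-monoˡ-≤ (20 ℕ.* z) (ℕ.≤-trans (ℕ.*-monoˡ-≤ (z ÷ k) 20≤k) (÷-upper z k 1≤k)))

    next≤2 : ∀ z → next z ℕ.≤ 2 ℕ.* z
    next≤2 z = ℕ.≤-trans (ℕ.+-monoˡ-≤ z (÷-≤ z k)) (ℕ.≤-reflexive (cong (z ℕ.+_) (sym (ℕ.+-identityʳ z))))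

    module _ (z : ℕ) (y₀≤z : y₀ ℕ.≤ z) (8z≤Z : 8 ℕ.* z ℕ.≤ Z) where
      private
        1≤z = ℕ.≤-trans 1≤y₀ y₀≤z
        100≤z : ι 100 ⊗ ι k ≼ ι z
        100≤z = ≼-trans (≼-reflexive (sym (ι-* 100 k))) (ι-mono (100k≤ z y₀≤z))
        20≼k : ι 20 ≼ ι k
        20≼k = ι-mono 20≤k
        r = rec z
        r′ = rec (next z)
        zr = rec-inv′ z 1≤z
        1≤z′ : 1 ℕ.≤ next z
        1≤z′ = ℕ.≤-trans 1≤z (ℕ.m≤n+m z (z ÷ k))
        next≤Z : next z ℕ.≤ Z
        next≤Z = ℕ.≤-trans (next≤2 z) (ℕ.≤-trans (ℕ.*-monoˡ-≤ z {2} {8} (s≤s (s≤s z≤n))) 8z≤Z)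
        ratio : ι 20 ≼ ι 21 ⊗ (ι z ⊗ r′)
        ratio = lin 3 (λ z n r → (n :* r :≡ :ι 1) ⇒ ((:ι 20 :* n) :* r :≤ (:ι 21 :* z) :* r) ⇒ (:ι 20 :≤ :ι 21 :* (z :* r))) (ι z) (ι (next z)) r′
          (rec-inv′ (next z) 1≤z′) (⊗-monoʳ r′ (rec-nonneg (next z)) (subst₂ _≼_ (ι-* 20 (next z)) (ι-* 21 z) (ι-mono (20next≤21 z))))
        100r≤1 : ι 100 ⊗ r ≼ ι 1
        100r≤1 = lin 3 (λ z r k → (z :* r :≡ :ι 1) ⇒ (:ι 0 :≤ (z :- :ι 100 :* k) :* r) ⇒ (:ι 0 :≤ (k :- :ι 20) :* r) ⇒ (:ι 0 :≤ r) ⇒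
            (:ι 100 :* r :≤ :ι 1)) (ι z) r (ι k)
          zr (0≼⊗ (≼-sub 100≤z) (rec-nonneg z)) (0≼⊗ (≼-sub 20≼k) (rec-nonneg z)) (rec-nonneg z)

      -- M gains at least inc z / next z, which is at least 5/4 · 20/21 of 1/k, while lg gains at
      -- most 101/100 of 1/k.
      high-step : High z → ι 9 ⊗ (lg (next z) ⊖ lg z) ≼ ι 8 ⊗ (M (next z) ⊖ M z)
      high-step h = ⊗-cancelˡ k 1≤k (lin 8 (λ k dl dm i z r s p → (dl :≤ p :* (r :+ r :* r)) ⇒ (i :* s :≤ dm) ⇒
          ((:ι 5 :* z) :* s :≤ (:ι 4 :* (k :* i)) :* s) ⇒
          (k :* (dl) :≤ k :* (p :* (r :+ r :* r))) ⇒ (k :* (i :* s) :≤ k :* dm) ⇒ ((k :* p) :* (r :+ r :* r) :≤ z :* (r :+ r :* r)) ⇒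
              (z :* r :≡ :ι 1) ⇒ ((z :* r) :* r :≡ :ι 1 :* r) ⇒
          (:ι 20 :≤ :ι 21 :* (z :* s)) ⇒ (:ι 100 :* r :≤ :ι 1) ⇒ (k :* (:ι 9 :* dl) :≤ k :* (:ι 8 :* dm))) (ι k) (lg (next z) ⊖ lg z)
              (M (next z) ⊖ M z) (inc z) (ι z) r r′ (ι (z ÷ k))
        up lo (⊗-monoʳ r′ (rec-nonneg (next z)) h) (⊗-monoˡ (ι k) (0≼ι k) up) (⊗-monoˡ (ι k) (0≼ι k) lo)
        (⊗-monoʳ _ rr (≼-trans (≼-reflexive (sym (ι-* k (z ÷ k)))) (ι-mono (÷-upper z k 1≤k)))) zr (⊗-congʳ zr) ratio 100r≤1)
        where
        up = lg-run-upper z (z ÷ k) 1≤z next≤Z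
        lo = M-lower z (next z) (ℕ.m≤n+m z (z ÷ k))
        rr : ι 0 ≼ r ⊕ r ⊗ r
        rr = lin 2 (λ r s → (:ι 0 :≤ r) ⇒ (:ι 0 :≤ s) ⇒ (:ι 0 :≤ r :+ s)) _ _ (rec-nonneg z) (0≼⊗ (rec-nonneg z) (rec-nonneg z))

      -- M gains at most inc z / z, hence at most 1/(4 k), while lg gains almost 1/k.
      low-step : Low z → ι 2 ⊗ (M (next z) ⊖ M z) ≼ lg (next z) ⊖ lg z
      low-step h = ⊗-cancelˡ k 1≤k (lin 8 (λ k dl dm i z r s p → (p :* (s :- :ι 2 :* (r :* r)) :≤ dl) ⇒
          (k :* (p :* (s :- :ι 2 :* (r :* r))) :≤ k :* dl) ⇒ (k :* dm :≤ k :* (i :* r)) ⇒ ((:ι 4 :* (k :* i)) :* r :≤ z :* r) ⇒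
          (z :* r :≡ :ι 1) ⇒ ((z :* r) :* r :≡ :ι 1 :* r) ⇒ (:ι 0 :≤ (k :* p :+ k :- z) :* (s :- :ι 2 :* (r :* r))) ⇒
              (:ι 0 :≤ (z :- :ι 100 :* k) :* (s :- :ι 2 :* (r :* r))) ⇒
          (:ι 20 :≤ :ι 21 :* (z :* s)) ⇒ (:ι 100 :* r :≤ :ι 1) ⇒ (k :* (:ι 2 :* dm) :≤ k :* dl)) (ι k) (lg (next z) ⊖ lg z)
              (M (next z) ⊖ M z) (inc z) (ι z) r r′ (ι (z ÷ k))
        lo (⊗-monoˡ (ι k) (0≼ι k) lo) (⊗-monoˡ (ι k) (0≼ι k) up) (⊗-monoʳ r (rec-nonneg z) h) zr (⊗-congʳ zr) (0≼⊗ (≼-sub kp) pos)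
            (0≼⊗ (≼-sub 100≤z) pos) ratio 100r≤1)
        where
        lo = lg-run-lower z (next z) (z ÷ k) 1≤z ℕ.≤-refl next≤Z
        up = M-upper z (next z) 1≤z (ℕ.m≤n+m z (z ÷ k))
        kp : ι z ≼ ι k ⊗ ι (z ÷ k) ⊕ ι k
        kp = ≼-trans (ι-mono (ℕ.<⇒≤ (÷-lower z k 1≤k)))
            (≼-reflexive (trans (ι-* k _) (trans (⊗-congˡ (ι-suc (z ÷ k))) (lin 2 (λ k p → k :* (p :+ :ι 1) :≡ k :* p :+ k) _ _))))
        pos : ι 0 ≼ r′ ⊖ ι 2 ⊗ (r ⊗ r)
        pos = lin 3 (λ z r s → ((:ι 20) :* r :≤ (:ι 21 :* (z :* s)) :* r) ⇒ ((z :* r) :* s :≡ :ι 1 :* s) ⇒ ((:ι 100 :* r) :* r :≤ :ι 1 :* r)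
            ⇒ (:ι 0 :≤ r) ⇒ (:ι 0 :≤ s :- :ι 2 :* (r :* r))) (ι z) r r′
          (⊗-monoʳ r (rec-nonneg z) ratio) (⊗-congʳ zr) (⊗-monoʳ r (rec-nonneg z) 100r≤1) (rec-nonneg z)

      private
        8suc : ∀ w → w ℕ.≤ 4 ℕ.* z → 2 ℕ.* w ℕ.≤ Z
        8suc w h = ℕ.≤-trans (ℕ.*-monoʳ-≤ 2 h) (ℕ.≤-trans (ℕ.≤-reflexive (sym (ℕ.*-assoc 2 4 z))) 8z≤Z)
        kδz : ι 1000 ⊗ (ι k ⊗ (δ ⊗ ι z)) ≼ ι z
        kδz = lin 3 (λ k d z → ((:ι 1000 :* (k :* d)) :* z :≤ :ι 1 :* z) ⇒ (:ι 1000 :* (k :* (d :* z)) :≤ z)) _ _ _ (⊗-monoʳ (ι z) (0≼ι z) δ-small)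
        1≼z : ι 1 ≼ ι z
        1≼z = ι-mono 1≤z

      -- From z to z + 1 the increment drops by at most Λ (suc z), which `ψ-short` bounds by 2 δ z:
      -- too little to cross the gap between the two thresholds.
      high-low : High z → Low (suc z) → ⊥
      high-low h l = 1⋠0 (lin 7 (λ k i j z z′ a d → (:ι 5 :* z :≤ :ι 4 :* (k :* i)) ⇒ (:ι 4 :* (k :* j) :≤ z′) ⇒ (z′ :≡ z :+ :ι 1) ⇒
          (k :* i :≤ k :* (j :+ a)) ⇒ (k :* a :≤ k :* (:ι 2 :* (d :* z))) ⇒ (:ι 1000 :* (k :* (d :* z)) :≤ z) ⇒ (:ι 1 :≤ z) ⇒ (:ι 1 :≤ :ι 0))
           (ι k) (inc z) (inc (suc z)) (ι z) (ι (suc z)) (Λ (suc z)) δ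
           h l (ι-suc z) (⊗-monoˡ (ι k) (0≼ι k) change) (⊗-monoˡ (ι k) (0≼ι k) newΛ) kδz 1≼z)
        where
        change : inc z ≼ inc (suc z) ⊕ Λ (suc z)
        change = lin 4 (λ a b c d → (a :≤ b) ⇒ (a :- c :≤ b :- (c :+ d) :+ d)) (ψ (next z)) (ψ (next (suc z))) (ψ z) (Λ (suc z))
          (ψ-mono (ℕ.+-mono-≤ (÷-monoˡ k (ℕ.n≤1+n z)) (ℕ.n≤1+n z)))
        newΛ : Λ (suc z) ≼ ι 2 ⊗ (δ ⊗ ι z)
        newΛ = lin 5 (λ p l z z′ e → (p :+ l :- p :≤ :ι 2 :* (z′ :- z) :+ e) ⇒ (z′ :≡ z :+ :ι 1) ⇒ (:ι 2 :≤ e) ⇒ (l :≤ :ι 2 :* e))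
            (ψ z) _ (ι z) (ι (suc z)) (δ ⊗ ι z)
          (ψ-short z (suc z) y₀≤z (ℕ.n≤1+n z) (ℕ.+-mono-≤ 1≤z (ℕ.≤-reflexive (sym (ℕ.+-identityʳ z))))
              (8suc (suc z) (ℕ.+-mono-≤ 1≤z (ℕ.m≤m+n z _)))) (ι-suc z) (δ-big z y₀≤z)

      -- The end point `next` advances by at most 2, so the increment grows by at most 6 δ z.
      low-high : Low z → High (suc z) → ⊥
      low-high l h = 1⋠0 (lin 6 (λ k i j z z′ d → (:ι 5 :* z′ :≤ :ι 4 :* (k :* j)) ⇒ (:ι 4 :* (k :* i) :≤ z) ⇒ (z′ :≡ z :+ :ι 1) ⇒
          (k :* j :≤ k :* (i :+ :ι 6 :* (d :* z))) ⇒ (:ι 1000 :* (k :* (d :* z)) :≤ z) ⇒ (:ι 1 :≤ z) ⇒ (:ι 1 :≤ :ι 0))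
           (ι k) (inc z) (inc (suc z)) (ι z) (ι (suc z)) δ
           h l (ι-suc z) (⊗-monoˡ (ι k) (0≼ι k) change) kδz 1≼z)
        where
        w = next z
        step : next (suc z) ℕ.≤ suc (suc w)
        step = ℕ.≤-trans (ℕ.+-monoˡ-≤ (suc z) (ℕ.≤-pred (ℕ.*-cancelˡ-< k (suc z ÷ k) (suc (suc (z ÷ k))) (ℕ.≤-<-trans (÷-upper (suc z) k 1≤k)
            (ℕ.<-≤-trans (s≤s (÷-lower z k 1≤k)) (ℕ.≤-trans (ℕ.+-monoˡ-≤ (k ℕ.* suc (z ÷ k)) 1≤k)
                (ℕ.≤-reflexive (sym (ℕ.*-suc k (suc (z ÷ k)))))))))))
            (ℕ.≤-reflexive (cong suc (ℕ.+-suc (z ÷ k) z)))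
        4≤z : 4 ℕ.≤ z
        4≤z = ℕ.≤-trans (ℕ.≤-trans (ℕ.m≤n+m 4 96) (ℕ.m≤m*n 100 k {{ℕ.>-nonZero 1≤k}})) (100k≤ z y₀≤z)
        w≥ : z ℕ.≤ w
        w≥ = ℕ.m≤n+m z (z ÷ k)
        change : inc (suc z) ≼ inc z ⊕ ι 6 ⊗ (δ ⊗ ι z)
        change = lin 9 (λ a b c e l w w′ d z → (a :≤ e) ⇒ (e :- b :≤ :ι 2 :* (w′ :- w) :+ d :* w) ⇒ (w′ :≡ w :+ :ι 2) ⇒ (:ι 2 :≤ d :* z) ⇒
            (d :* w :≤ d :* (:ι 2 :* z)) ⇒ (:ι 0 :≤ l) ⇒
            (a :- (c :+ l) :≤ b :- c :+ :ι 6 :* (d :* z))) (ψ (next (suc z))) (ψ w) (ψ z) (ψ (suc (suc w))) (Λ (suc z)) (ι w)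
                (ι (suc (suc w))) δ (ι z)
          (ψ-mono step) (ψ-short w (suc (suc w)) (ℕ.≤-trans y₀≤z w≥) (ℕ.m≤n+m w 2)
              (ℕ.+-mono-≤ (ℕ.≤-trans (ℕ.≤-trans (s≤s (s≤s z≤n)) 4≤z) w≥) (ℕ.≤-reflexive (sym (ℕ.+-identityʳ w))))
              (8suc (suc (suc w)) (ℕ.≤-trans (ℕ.+-mono-≤ (ℕ.≤-trans (s≤s (s≤s z≤n)) 4≤z) (next≤2 z))
                  (ℕ.+-monoʳ-≤ z (ℕ.*-monoˡ-≤ z {2} {3} (s≤s (s≤s z≤n)))))))
          (trans (ι-+ 2 w) (⊕-comm _ _)) (δ-big z y₀≤z) (⊗-monoˡ δ 0≼δ (≼-trans (ι-mono (next≤2 z)) (≼-reflexive (ι-* 2 z)))) (0≼Λ (suc z))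

    module _ (a b : ℕ) (y₀≤a : y₀ ℕ.≤ a) (a≤b : a ℕ.≤ b) (16b≤Z : 16 ℕ.* b ℕ.≤ Z) (long : lg a ⊕ ι 481 ≼ lg b) where
      private
        1≤a = ℕ.≤-trans 1≤y₀ y₀≤a
        8≤ : ∀ z → z ℕ.≤ 2 ℕ.* b → 8 ℕ.* z ℕ.≤ Z
        8≤ z h = ℕ.≤-trans (ℕ.*-monoʳ-≤ 8 h) (ℕ.≤-trans (ℕ.≤-reflexive (sym (ℕ.*-assoc 8 2 b))) 16b≤Z)
        b≤2b : b ℕ.≤ 2 ℕ.* b
        b≤2b = ℕ.m≤n*m b 2
        2≤ : ∀ z → z ℕ.≤ 2 ℕ.* b → 2 ℕ.* z ℕ.≤ Z
        2≤ z h = ℕ.≤-trans (ℕ.*-monoˡ-≤ z {2} {8} (s≤s (s≤s z≤n))) (8≤ z h)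

        -- Iterates `next` until b is passed and adds up the inequalities; next z ≤ 2 z keeps the
        -- end below 2 b. The fuel f suffices because each step advances by at least 1.
        chain : ∀ {s t} → ((∀ z → a ℕ.≤ z → z ℕ.< b → ι s ⊗ (lg (next z) ⊖ lg z) ≼ ι t ⊗ (M (next z) ⊖ M z)) →
                ∀ f z → a ℕ.≤ z → z ℕ.≤ 2 ℕ.* b → b ℕ.≤ f ℕ.+ z → ∃ λ w → b ℕ.≤ w × w ℕ.≤ 2 ℕ.* b × ι s ⊗ (lg w ⊖ lg z) ≼ ι t ⊗ (M w ⊖ M z))
        chain {s} {t} st f z az zb fz with b ℕ.≤? z
        ... | yes bz = z , bz , zb , lin 4 (λ s t l m → s :* (l :- l) :≤ t :* (m :- m)) (ι s) (ι t) (lg z) (M z)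
        chain st zero    z az zb fz | no b≰z = ⊥-elim (b≰z fz)
        chain {s} {t} st (suc f) z az zb fz | no b≰z with chain st f (next z) (ℕ.≤-trans az (ℕ.m≤n+m z (z ÷ k)))
            (ℕ.≤-trans (next≤2 z) (ℕ.*-monoʳ-≤ 2 (ℕ.<⇒≤ (ℕ.≰⇒> b≰z))))
               (ℕ.≤-trans fz (ℕ.≤-trans (ℕ.≤-reflexive (sym (ℕ.+-suc f z))) (ℕ.+-monoʳ-≤ f (ℕ.+-monoˡ-≤ z 1≤z÷k))))
          where
          1≤z÷k : 1 ℕ.≤ z ÷ k
          1≤z÷k = *≤⇒≤÷ 1≤k (ℕ.≤-trans (ℕ.*-monoʳ-≤ k {1} {100} (s≤s z≤n)) (ℕ.≤-trans (ℕ.≤-reflexive (ℕ.*-comm k 100)) (100k≤ z (ℕ.≤-trans y₀≤a az))))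
        ... | w , bw , wb , h = w , bw , wb , lin 8
            (λ s t lw lz ln mw mz mn → (s :* (ln :- lz) :≤ t :* (mn :- mz)) ⇒ (s :* (lw :- ln) :≤ t :* (mw :- mn)) ⇒
            (s :* (lw :- lz) :≤ t :* (mw :- mz))) (ι s) (ι t) _ _ _ _ _ _
              (st z az (ℕ.≰⇒> b≰z)) h

        chain≥ : (∀ z → a ℕ.≤ z → z ℕ.< b → ι 2 ⊗ (M (next z) ⊖ M z) ≼ lg (next z) ⊖ lg z) →
                ∀ f z → a ℕ.≤ z → z ℕ.≤ 2 ℕ.* b → b ℕ.≤ f ℕ.+ z → ∃ λ w → b ℕ.≤ w × w ℕ.≤ 2 ℕ.* b × ι 2 ⊗ (M w ⊖ M z) ≼ lg w ⊖ lg z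
        chain≥ st f z az zb fz with b ℕ.≤? z
        ... | yes bz = z , bz , zb , lin 2 (λ l m → :ι 2 :* (m :- m) :≤ (l :- l)) (lg z) (M z)
        chain≥ st zero    z az zb fz | no b≰z = ⊥-elim (b≰z fz)
        chain≥ st (suc f) z az zb fz | no b≰z with chain≥ st f (next z) (ℕ.≤-trans az (ℕ.m≤n+m z (z ÷ k)))
            (ℕ.≤-trans (next≤2 z) (ℕ.*-monoʳ-≤ 2 (ℕ.<⇒≤ (ℕ.≰⇒> b≰z))))
               (ℕ.≤-trans fz (ℕ.≤-trans (ℕ.≤-reflexive (sym (ℕ.+-suc f z))) (ℕ.+-monoʳ-≤ f (ℕ.+-monoˡ-≤ z 1≤z÷k))))
          where
          1≤z÷k : 1 ℕ.≤ z ÷ k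
          1≤z÷k = *≤⇒≤÷ 1≤k (ℕ.≤-trans (ℕ.*-monoʳ-≤ k {1} {100} (s≤s z≤n)) (ℕ.≤-trans (ℕ.≤-reflexive (ℕ.*-comm k 100)) (100k≤ z (ℕ.≤-trans y₀≤a az))))
        ... | w , bw , wb , h = w , bw , wb , lin 6
            (λ lw lz ln mw mz mn → (:ι 2 :* (mn :- mz) :≤ ln :- lz) ⇒ (:ι 2 :* (mw :- mn) :≤ lw :- ln) ⇒ (:ι 2 :* (mw :- mz) :≤ lw :- lz)) _ _ _ _ _ _
              (st z az (ℕ.≰⇒> b≰z)) h

        end-lg : ∀ w → b ℕ.≤ w → w ℕ.≤ 2 ℕ.* b → lg b ≼ lg w
        end-lg w bw wb = lg-mono (ℕ.≤-trans 1≤a a≤b) bw (ℕ.m≤n⇒m≤1+n (ℕ.≤-trans (ℕ.m≤n*m w 2) (2≤ w wb)))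

        all-high : (∀ z → a ℕ.≤ z → z ℕ.≤ b → High z) → ⊥
        all-high hi = conclude (chain {9} {8} (λ z az zb → high-step z (ℕ.≤-trans y₀≤a az) (8≤ z (ℕ.≤-trans (ℕ.<⇒≤ zb) b≤2b))
            (hi z az (ℕ.<⇒≤ zb))) b a ℕ.≤-refl (ℕ.≤-trans a≤b b≤2b) (ℕ.m≤m+n b a))
          where
          conclude : (∃ λ w → b ℕ.≤ w × w ℕ.≤ 2 ℕ.* b × ι 9 ⊗ (lg w ⊖ lg a) ≼ ι 8 ⊗ (M w ⊖ M a)) → ⊥
          conclude (w , bw , wb , h) = 1⋠0 (lin 5 (λ lw la mw ma lb → (:ι 9 :* (lw :- la) :≤ :ι 8 :* (mw :- ma)) ⇒ (mw :≤ lw :+ :ι 30) ⇒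
              (la :≤ ma :+ :ι 30) ⇒ (lb :≤ lw) ⇒ (la :+ :ι 481 :≤ lb) ⇒ (:ι 1 :≤ :ι 0)) (lg w) (lg a) (M w) (M a) (lg b)
             h (mertens-upper w (ℕ.≤-trans (ℕ.≤-trans 1≤a a≤b) bw) (2≤ w wb)) (mertens-lower a 1≤a (2≤ a (ℕ.≤-trans a≤b b≤2b))) (end-lg w bw wb) long)

        all-low : (∀ z → a ℕ.≤ z → z ℕ.≤ b → Low z) → ⊥
        all-low lo = conclude (chain≥ (λ z az zb → low-step z (ℕ.≤-trans y₀≤a az) (8≤ z (ℕ.≤-trans (ℕ.<⇒≤ zb) b≤2b)) (lo z az (ℕ.<⇒≤ zb)))
            b a ℕ.≤-refl (ℕ.≤-trans a≤b b≤2b) (ℕ.m≤m+n b a))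
          where
          conclude : (∃ λ w → b ℕ.≤ w × w ℕ.≤ 2 ℕ.* b × ι 2 ⊗ (M w ⊖ M a) ≼ lg w ⊖ lg a) → ⊥
          conclude (w , bw , wb , h) = 1⋠0 (lin 5 (λ lw la mw ma lb → (:ι 2 :* (mw :- ma) :≤ (lw :- la)) ⇒ (lw :≤ mw :+ :ι 30) ⇒
              (ma :≤ la :+ :ι 30) ⇒ (lb :≤ lw) ⇒ (la :+ :ι 481 :≤ lb) ⇒ (:ι 1 :≤ :ι 0)) (lg w) (lg a) (M w) (M a) (lg b)
             h (mertens-lower w (ℕ.≤-trans (ℕ.≤-trans 1≤a a≤b) bw) (2≤ w wb)) (mertens-upper a 1≤a (2≤ a (ℕ.≤-trans a≤b b≤2b))) (end-lg w bw wb) long)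

        module None (none : ∀ z → a ℕ.≤ z → z ℕ.≤ b → ¬ Mid z) where
          side : ∀ z → a ℕ.≤ z → z ℕ.≤ b → Low z ⊎ High z
          side z az zb with ≼-total (q z) (ι z)
          ... | inj₁ lo = inj₁ lo
          ... | inj₂ ge with ≼-total (q z) (ι 5 ⊗ ι z)
          ...   | inj₁ le = ⊥-elim (none z az zb (ge , le))
          ...   | inj₂ hi = inj₂ hi

          propagate : (P Q : ℕ → Set) → (∀ z → a ℕ.≤ z → suc z ℕ.≤ b → P z → Q (suc z) → ⊥) → (∀ z → a ℕ.≤ z → z ℕ.≤ b → P z ⊎ Q z) → P a →
              ∀ z → a ℕ.≤ z → z ℕ.≤ b → P z
          propagate P Q no-jump pq pa z az zb = subst P (ℕ.m∸n+n≡m az) (go (z ℕ.∸ a) (subst (ℕ._≤ b) (sym (ℕ.m∸n+n≡m az)) zb))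
            where
            go : ∀ i → i ℕ.+ a ℕ.≤ b → P (i ℕ.+ a)
            go zero    _ = pa
            go (suc i) u with pq (suc i ℕ.+ a) (ℕ.m≤n+m a (suc i)) u
            ... | inj₁ p = p
            ... | inj₂ qq = ⊥-elim (no-jump (i ℕ.+ a) (ℕ.m≤n+m a i) u (go i (ℕ.<⇒≤ u)) qq)

          contradiction : ⊥
          contradiction with side a ℕ.≤-refl a≤b
          ... | inj₁ lo = all-low (propagate Low High (λ z az zb → low-high z (ℕ.≤-trans y₀≤a az) (8≤ z (ℕ.≤-trans (ℕ.<⇒≤ zb) b≤2b))) side lo)
          ... | inj₂ hi = all-high (propagate High Low (λ z az zb → high-low z (ℕ.≤-trans y₀≤a az) (8≤ z (ℕ.≤-trans (ℕ.<⇒≤ zb) b≤2b)))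
              (λ z az zb → swap (side z az zb)) hi)

      -- As q cannot leap over the middle range, an interval without mid points is all low or all
      -- high. Then lg and M grow at different rates, against Mertens' bounds: 9 Δ ≤ 8 (Δ + 60)
      -- allows Δ up to 480 only.
      mid-exists : ∃ λ z → a ℕ.≤ z × z ℕ.≤ b × Mid z
      mid-exists with search≤ (λ z → (a ℕ.≤? z) ×-dec ((ι z ≼? q z) ×-dec (q z ≼? (ι 5 ⊗ ι z)))) b
      ... | inj₁ (z , zb , az , m) = z , az , zb , m
      ... | inj₂ none = ⊥-elim (None.contradiction (λ z az zb m → none z zb (az , m)))

-- The deficit near a mid point

module LocalContribution where
  open OrderedField
  open LinearArithmetic
  open FiniteSums
  open Logarithms
  open AdditiveLogarithm
  open SummatoryFunctions
  open GapDeficit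
  open MidPoints

  module Erdos₃ (Z : ℕ) (LG : Logarithm Z) (SU : Setup Z LG) where
    open Erdos₂ Z LG SU public

    G-diff : ∀ a b t → a ℕ.≤ b → (∀ n → a ℕ.< n → n ℕ.≤ b → t ≼ deficit n) → t ⊗ (ψ b ⊖ ψ a) ≼ G b ⊖ G a
    G-diff a b t h lo = lin 5 (λ ga gb pa pb t → (ga :- pa :* t :≤ gb :- pb :* t) ⇒ (t :* (pb :- pa) :≤ gb :- ga)) (G a) (G b) (ψ a) (ψ b) t
        (subst₂ _≼_ (form a) (form b) (∑-grow≤ h
            (λ n lt u → lin 3 (λ x d t → (:ι 0 :≤ x :* (d :- t)) ⇒ (:ι 0 :≤ x :* d :- x :* t)) (Λ n) (deficit n) t
            (0≼⊗ (0≼Λ n) (≼-sub (lo n lt u))))))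
      where
      form : ∀ N → ∑ N (λ n → Λ n ⊗ deficit n ⊖ Λ n ⊗ t) ≡ G N ⊖ ψ N ⊗ t
      form N = trans (∑-⊖ N (λ n → Λ n ⊗ deficit n) (λ n → Λ n ⊗ t)) (cong (G N ⊖_) (∑-⊗ʳ N t Λ))

    module Local (z : ℕ) (4y₀≤z : 4 ℕ.* y₀ ℕ.≤ z) (4y₀≤v : 4 ℕ.* y₀ ℕ.≤ X ÷ z) (mid : Mid z) where
      -- The points z and v are dual: n near v has its window near (z, next z], and n in (z, next z]
      -- has a window around v. The margins e and p are 1/40 of the window lengths v/k and z/k.
      m v e p w : ℕ
      m = 40 ℕ.* k
      v = X ÷ z
      e = v ÷ m
      p = z ÷ m
      w = v ℕ.∸ e

      private
        4y₀≥ : ∀ x → 4 ℕ.* y₀ ℕ.≤ x → ι 400 ⊗ ι k ≼ ι x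
        4y₀≥ x h = ≼-trans (≼-reflexive (sym (ι-* 400 k)))
            (ι-mono (ℕ.≤-trans (ℕ.≤-trans (ℕ.≤-reflexive (ℕ.*-assoc 4 100 k)) (ℕ.*-monoʳ-≤ 4 100k≤y₀)) h))
        y₀≤z : y₀ ℕ.≤ z
        y₀≤z = ℕ.≤-trans (ℕ.m≤n*m y₀ 4) 4y₀≤z
        y₀≤v : y₀ ℕ.≤ v
        y₀≤v = ℕ.≤-trans (ℕ.m≤n*m y₀ 4) 4y₀≤v
        1≤z : 1 ℕ.≤ z
        1≤z = ℕ.≤-trans 1≤y₀ y₀≤z
        1≤m : 1 ℕ.≤ m
        1≤m = ℕ.*-mono-≤ {1} {40} (s≤s z≤n) 1≤k
        k≥ : ι 20 ≼ ι k
        k≥ = ι-mono 20≤k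
        z≥ : ι 400 ⊗ ι k ≼ ι z
        z≥ = 4y₀≥ z 4y₀≤z
        v≥ : ι 400 ⊗ ι k ≼ ι v
        v≥ = 4y₀≥ v 4y₀≤v
        vz≤X : ι v ⊗ ι z ≼ ι X
        vz≤X = ≼-trans (≼-reflexive (trans (⊗-comm _ _) (sym (ι-* z v)))) (ι-mono (÷-upper X z 1≤z))
        X≤vz : ι X ≼ (ι v ⊕ ι 1) ⊗ ι z
        X≤vz = ≼-trans (ι-mono (ℕ.<⇒≤ (÷-lower X z 1≤z))) (≼-reflexive (trans (ι-* z (suc v)) (trans (⊗-comm _ _) (⊗-congʳ (ι-suc v)))))
        ÷m-upper : ∀ x → ι 40 ⊗ (ι k ⊗ ι (x ÷ m)) ≼ ι x
        ÷m-upper x = ≼-trans (≼-reflexive (trans (sym (⊗-assoc _ _ _)) (trans (⊗-congʳ (sym (ι-* 40 k))) (sym (ι-* m (x ÷ m))))))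
            (ι-mono (÷-upper x m 1≤m))
        ÷m-lower : ∀ x → ι x ≼ ι 40 ⊗ (ι k ⊗ (ι (x ÷ m) ⊕ ι 1))
        ÷m-lower x = ≼-trans (ι-mono (ℕ.<⇒≤ (÷-lower x m 1≤m)))
            (≼-reflexive (trans (ι-* m (suc (x ÷ m))) (trans (cong₂ _⊗_ (ι-* 40 k) (ι-suc (x ÷ m))) (⊗-assoc _ _ _))))
        me≤v : ι 40 ⊗ (ι k ⊗ ι e) ≼ ι v
        me≤v = ÷m-upper v
        v≤me : ι v ≼ ι 40 ⊗ (ι k ⊗ (ι e ⊕ ι 1))
        v≤me = ÷m-lower v
        mp≤z : ι 40 ⊗ (ι k ⊗ ι p) ≼ ι z
        mp≤z = ÷m-upper z
        z≤mp : ι z ≼ ι 40 ⊗ (ι k ⊗ (ι p ⊕ ι 1))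
        z≤mp = ÷m-lower z
        e≤v : e ℕ.≤ v
        e≤v = ÷-≤ v m
        w+e : ι w ⊕ ι e ≡ ι v
        w+e = trans (sym (ι-+ w e)) (cong ι (ℕ.m∸n+n≡m e≤v))
        e≥9 : ι 9 ≼ ι e
        e≥9 = ⊗-cancelˡ k 1≤k (lin 3 (λ k v e → (:ι 400 :* k :≤ v) ⇒ (v :≤ :ι 40 :* (k :* (e :+ :ι 1))) ⇒ (k :* :ι 9 :≤ k :* e)) (ι k) (ι v)
            (ι e) v≥ v≤me)
        p≥9 : ι 9 ≼ ι p
        p≥9 = ⊗-cancelˡ k 1≤k (lin 3 (λ k v e → (:ι 400 :* k :≤ v) ⇒ (v :≤ :ι 40 :* (k :* (e :+ :ι 1))) ⇒ (k :* :ι 9 :≤ k :* e)) (ι k) (ι z)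
            (ι p) z≥ z≤mp)
        800x≤ : ∀ x y → ι 40 ⊗ (ι k ⊗ ι x) ≼ ι y → ι 800 ⊗ ι x ≼ ι y
        800x≤ x y h = lin 3 (λ k x y → (:ι 40 :* (k :* x) :≤ y) ⇒ (:ι 0 :≤ (k :- :ι 20) :* x) ⇒ (:ι 800 :* x :≤ y)) (ι k) (ι x) (ι y) h
            (0≼⊗ (≼-sub k≥) (0≼ι x))
        800p≤z : ι 800 ⊗ ι p ≼ ι z
        800p≤z = 800x≤ p z mp≤z
        800e≤v : ι 800 ⊗ ι e ≼ ι v
        800e≤v = 800x≤ e v me≤v
        kδ : ∀ x → ι 1000 ⊗ (ι k ⊗ (δ ⊗ ι x)) ≼ ι x
        kδ x = lin 3 (λ k d z → ((:ι 1000 :* (k :* d)) :* z :≤ :ι 1 :* z) ⇒ (:ι 1000 :* (k :* (d :* z)) :≤ z)) _ _ _ (⊗-monoʳ (ι x) (0≼ι x) δ-small)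
        X≤kez : ι X ≼ ι 160 ⊗ (ι k ⊗ (ι e ⊗ ι z))
        X≤kez = lin 5 (λ x v z k e → (x :≤ (v :+ :ι 1) :* z) ⇒ (:ι 0 :≤ (v :- :ι 1) :* z) ⇒
            (:ι 0 :≤ (:ι 40 :* (k :* (e :+ :ι 1)) :- v) :* z) ⇒ (:ι 0 :≤ (e :- :ι 9) :* (k :* z)) ⇒ (:ι 0 :≤ k :* z) ⇒
            (x :≤ :ι 160 :* (k :* (e :* z)))) (ι X) (ι v) (ι z) (ι k) (ι e)
          X≤vz (0≼⊗ (≼-sub (ι-mono (ℕ.≤-trans 1≤y₀ y₀≤v))) (0≼ι z)) (0≼⊗ (≼-sub v≤me) (0≼ι z)) (0≼⊗ (≼-sub e≥9) (0≼⊗ (0≼ι k) (0≼ι z)))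
              (0≼⊗ (0≼ι k) (0≼ι z))

      private
        -- The windows of all n in (w, v + e] lie in (A, B]: a relative change 1/(40 k) of n moves
        -- their ends by about p, and the constants absorb the rounding.
        A B : ℕ
        A = z ℕ.∸ (p ℕ.+ 2)
        B = next z ℕ.+ (3 ℕ.* p ℕ.+ 6)
        p+2≤z : p ℕ.+ 2 ℕ.≤ z
        p+2≤z = ι-cancel (≼-trans (≼-reflexive (ι-+ p 2)) (lin 2 (λ p z → (:ι 800 :* p :≤ z) ⇒ (:ι 9 :≤ p) ⇒ (p :+ :ι 2 :≤ z)) _ _ 800p≤z p≥9))
        ιA : ι A ⊕ (ι p ⊕ ι 2) ≡ ι z
        ιA = trans (⊕-congˡ (sym (ι-+ p 2))) (trans (sym (ι-+ A _)) (cong ι (ℕ.m∸n+n≡m p+2≤z)))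
        ιnext : ι (next z) ≡ ι (z ÷ k) ⊕ ι z
        ιnext = ι-+ (z ÷ k) z
        ιB : ι B ≡ ι (z ÷ k) ⊕ ι z ⊕ (ι 3 ⊗ ι p ⊕ ι 6)
        ιB = trans (ι-+ (next z) _) (cong₂ _⊕_ ιnext (trans (ι-+ (3 ℕ.* p) 6) (⊕-congʳ (ι-* 3 p))))
        kz÷ : ι k ⊗ ι (z ÷ k) ≼ ι z
        kz÷ = ≼-trans (≼-reflexive (sym (ι-* k _))) (ι-mono (÷-upper z k 1≤k))
        z≤kz÷ : ι z ≼ ι k ⊗ (ι (z ÷ k) ⊕ ι 1)
        z≤kz÷ = ≼-trans (ι-mono (ℕ.<⇒≤ (÷-lower z k 1≤k))) (≼-reflexive (trans (ι-* k _) (⊗-congˡ (ι-suc (z ÷ k)))))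
        20z÷ : ι 20 ⊗ ι (z ÷ k) ≼ ι z
        20z÷ = lin 3 (λ k a z → (k :* a :≤ z) ⇒ (:ι 0 :≤ (k :- :ι 20) :* a) ⇒ (:ι 20 :* a :≤ z)) (ι k) (ι (z ÷ k)) (ι z) kz÷ (0≼⊗ (≼-sub k≥) (0≼ι _))
        ze≤pv : ι z ⊗ ι e ≼ (ι p ⊕ ι 1) ⊗ ι v
        ze≤pv = lin 5 (λ z e p k v → (:ι 0 :≤ (:ι 40 :* (k :* (p :+ :ι 1)) :- z) :* e) ⇒ (:ι 0 :≤ (v :- :ι 40 :* (k :* e)) :* (p :+ :ι 1)) ⇒
            (z :* e :≤ (p :+ :ι 1) :* v)) (ι z) (ι e) (ι p) (ι k) (ι v)
          (0≼⊗ (≼-sub z≤mp) (0≼ι e)) (0≼⊗ (≼-sub me≤v) (≼-trans (0≼ι (p ℕ.+ 1)) (≼-reflexive (ι-+ p 1))))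
        y₀≤A : y₀ ℕ.≤ A
        y₀≤A = ι-cancel (lin 4 (λ y z p a → (:ι 4 :* y :≤ z) ⇒ (:ι 800 :* p :≤ z) ⇒ (:ι 9 :≤ p) ⇒ (a :+ (p :+ :ι 2) :≡ z) ⇒ (y :≤ a)) (ι y₀)
            (ι z) (ι p) (ι A) (≼-trans (≼-reflexive (sym (ι-* 4 y₀))) (ι-mono 4y₀≤z)) 800p≤z p≥9 ιA)
        A≤z : A ℕ.≤ z
        A≤z = ℕ.m∸n≤m z (p ℕ.+ 2)
        z≤X : z ℕ.≤ X
        z≤X = ℕ.≤-trans (ℕ.≤-trans (ℕ.≤-reflexive (sym (ℕ.*-identityʳ z))) (ℕ.*-monoʳ-≤ z (ℕ.≤-trans 1≤y₀ y₀≤v))) (÷-upper X z 1≤z)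
        z≤next : z ℕ.≤ next z
        z≤next = ℕ.m≤n+m z (z ÷ k)
        ok : ∀ x → ι x ≼ ι 4 ⊗ ι X → 2 ℕ.* x ℕ.≤ Z
        ok x h = ℕ.≤-trans (ι-cancel (≼-trans (≼-reflexive (ι-* 2 x))
            (≼-trans (lin 2 (λ x X → (x :≤ :ι 4 :* X) ⇒ (:ι 2 :* x :≤ :ι 8 :* X)) _ _ h) (≼-reflexive (sym (ι-* 8 X)))))) 8ku≤Z
        z≼X : ι z ≼ ι X
        z≼X = ι-mono z≤X

        aboveA : ∀ n → 1 ℕ.≤ n → n ℕ.≤ v ℕ.+ e → A ℕ.≤ X ÷ n
        aboveA n l h = *≤⇒≤÷ {A} {X} {n} l (ι-cancel
            (≼-trans (≼-reflexive (ι-* n A)) (lin 7 (λ n a v e p z x → (:ι 0 :≤ a :* (v :+ e :- n)) ⇒ (z :* e :≤ (p :+ :ι 1) :* v) ⇒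
            (v :* z :≤ x) ⇒ (a :+ (p :+ :ι 2) :≡ z) ⇒ ((a :+ (p :+ :ι 2)) :* v :≡ z :* v) ⇒ ((a :+ (p :+ :ι 2)) :* e :≡ z :* e) ⇒
                (:ι 0 :≤ p :* e) ⇒ (:ι 0 :≤ v) ⇒ (:ι 0 :≤ e) ⇒ (n :* a :≤ x)) (ι n) (ι A) (ι v) (ι e) (ι p) (ι z) (ι X)
          (0≼⊗ (0≼ι A) (≼-sub (≼-trans (ι-mono h) (≼-reflexive (ι-+ v e))))) ze≤pv vz≤X ιA (⊗-congʳ ιA) (⊗-congʳ ιA) (0≼⊗ (0≼ι p) (0≼ι e))
              (0≼ι v) (0≼ι e))))

        belowB : ∀ n → w ℕ.< n → Y ÷ n ℕ.≤ B
        belowB n lt = ι-cancel (⊗-cancelˡ n l (≼-trans (≼-trans (≼-reflexive (sym (ι-* n _))) (ι-mono (÷-upper Y n l)))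
            (⊗-cancelˡ k 1≤k (≼-trans kY kBn))))
          where
          l : 1 ℕ.≤ n
          l = ℕ.≤-trans (s≤s z≤n) lt
          n≥ : ι v ⊕ ι 1 ≼ ι n ⊕ ι e
          n≥ = lin 5 (λ v w e n s → (s :≤ n) ⇒ (s :≡ w :+ :ι 1) ⇒ (w :+ e :≡ v) ⇒ (v :+ :ι 1 :≤ n :+ e)) (ι v) (ι w) (ι e) (ι n) (ι (suc w))
              (ι-mono lt) (ι-suc w) w+e
          kY : ι k ⊗ ι Y ≼ (ι k ⊕ ι 1) ⊗ ((ι v ⊕ ι 1) ⊗ ι z)
          kY = lin 5 (λ k y x u t → (k :* y :≡ k :* (x :+ u)) ⇒ (x :≡ k :* u) ⇒ (:ι 0 :≤ (k :+ :ι 1) :* (t :- x)) ⇒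
              (k :* y :≤ (k :+ :ι 1) :* t)) (ι k) (ι Y) (ι X) (ι u) ((ι v ⊕ ι 1) ⊗ ι z)
            (⊗-congˡ ιY) ιX (0≼⊗ (≼-trans (0≼ι (k ℕ.+ 1)) (≼-reflexive (ι-+ k 1))) (≼-sub X≤vz))
          kB : (ι k ⊕ ι 1) ⊗ ι z ⊕ ι 3 ⊗ (ι k ⊗ ι p) ⊕ ι 5 ⊗ ι k ≼ ι k ⊗ ι B
          kB = lin 5 (λ k b a z p → (k :* b :≡ k :* (a :+ z :+ (:ι 3 :* p :+ :ι 6))) ⇒ (z :≤ k :* (a :+ :ι 1)) ⇒
              ((k :+ :ι 1) :* z :+ :ι 3 :* (k :* p) :+ :ι 5 :* k :≤ k :* b)) (ι k) (ι B) (ι (z ÷ k)) (ι z) (ι p)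
            (⊗-congˡ ιB) z≤kz÷
          kBn : (ι k ⊕ ι 1) ⊗ ((ι v ⊕ ι 1) ⊗ ι z) ≼ ι k ⊗ (ι n ⊗ ι B)
          kBn = lin 7 (λ k z p v n e B → (:ι 0 :≤ n :* (k :* B :- ((k :+ :ι 1) :* z :+ :ι 3 :* (k :* p) :+ :ι 5 :* k))) ⇒
              (:ι 0 :≤ (n :+ e :- (v :+ :ι 1)) :* ((k :+ :ι 1) :* z :+ :ι 3 :* (k :* p) :+ :ι 5 :* k)) ⇒
              (:ι 0 :≤ k :* ((p :+ :ι 1) :* v :- z :* e)) ⇒ (:ι 0 :≤ (k :- :ι 20) :* ((p :+ :ι 1) :* v)) ⇒
                  (:ι 0 :≤ (p :+ :ι 1) :* v :- z :* e) ⇒ (:ι 0 :≤ (k :* p) :* (v :- :ι 800 :* e)) ⇒ (:ι 0 :≤ k :* (v :- :ι 800 :* e)) ⇒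
                  (:ι 0 :≤ k :* (p :* v)) ⇒ (:ι 0 :≤ k :* v) ⇒ (:ι 0 :≤ k :* p) ⇒ (:ι 0 :≤ k) ⇒
              ((k :+ :ι 1) :* ((v :+ :ι 1) :* z) :≤ k :* (n :* B))) (ι k) (ι z) (ι p) (ι v) (ι n) (ι e) (ι B)
            (0≼⊗ (0≼ι n) (≼-sub kB)) (0≼⊗ (≼-sub n≥) pos)
            (0≼⊗ (0≼ι k) (≼-sub ze≤pv)) (0≼⊗ (≼-sub k≥) (0≼⊗ p1 (0≼ι v))) (≼-sub ze≤pv) (0≼⊗ (0≼⊗ (0≼ι k) (0≼ι p)) (≼-sub 800e≤v))
                (0≼⊗ (0≼ι k) (≼-sub 800e≤v))
            (0≼⊗ (0≼ι k) (0≼⊗ (0≼ι p) (0≼ι v))) (0≼⊗ (0≼ι k) (0≼ι v)) (0≼⊗ (0≼ι k) (0≼ι p)) (0≼ι k)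
            where
            p1 : ι 0 ≼ ι p ⊕ ι 1
            p1 = ≼-trans (0≼ι (p ℕ.+ 1)) (≼-reflexive (ι-+ p 1))
            pos : ι 0 ≼ (ι k ⊕ ι 1) ⊗ ι z ⊕ ι 3 ⊗ (ι k ⊗ ι p) ⊕ ι 5 ⊗ ι k
            pos = lin 3 (λ k z kp → (:ι 0 :≤ k) ⇒ (:ι 0 :≤ z) ⇒ (:ι 0 :≤ kp) ⇒ (:ι 0 :≤ k :* z) ⇒
                (:ι 0 :≤ (k :+ :ι 1) :* z :+ :ι 3 :* kp :+ :ι 5 :* k)) (ι k) (ι z) _ (0≼ι k) (0≼ι z) (0≼⊗ (0≼ι k) (0≼ι p)) (0≼⊗ (0≼ι k) (0≼ι z))

        D-near : ∀ n → w ℕ.< n → n ℕ.≤ v ℕ.+ e → D n ≼ inc z ⊕ ι 8 ⊗ ι p ⊕ ι 16 ⊕ ι 3 ⊗ (δ ⊗ ι z)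
        D-near n lt h = lin 13 (λ pY pX pB pA pn pz B A n z p d a → (pY :≤ pB) ⇒ (pA :≤ pX) ⇒ (pB :- pn :≤ :ι 2 :* (B :- n) :+ d :* n) ⇒
            (pz :- pA :≤ :ι 2 :* (z :- A) :+ d :* A) ⇒
            (B :≡ a :+ z :+ (:ι 3 :* p :+ :ι 6)) ⇒ (n :≡ a :+ z) ⇒ (A :+ (p :+ :ι 2) :≡ z) ⇒ (d :* n :≤ d :* (:ι 2 :* z)) ⇒ (d :* A :≤ d :* z) ⇒
            (pY :- pX :≤ pn :- pz :+ :ι 8 :* p :+ :ι 16 :+ :ι 3 :* (d :* z))) (ψ (Y ÷ n)) (ψ (X ÷ n)) (ψ B) (ψ A) (ψ (next z)) (ψ z) (ι B)
                (ι A) (ι (next z)) (ι z) (ι p) δ (ι (z ÷ k))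
          (ψ-mono (belowB n lt)) (ψ-mono (aboveA n (ℕ.≤-trans (s≤s z≤n) lt) h))
          (ψ-short (next z) B (ℕ.≤-trans y₀≤z z≤next) (ℕ.m≤m+n (next z) _) B≤2next (ok B B≤4X))
          (ψ-short A z y₀≤A A≤z z≤2A (ok z (lin 2 (λ z x → (z :≤ x) ⇒ (:ι 0 :≤ x) ⇒ (z :≤ :ι 4 :* x)) _ _ z≼X (0≼ι X))))
          ιB ιnext ιA (⊗-monoˡ δ 0≼δ (≼-trans (ι-mono (next≤2 z)) (≼-reflexive (ι-* 2 z)))) (⊗-monoˡ δ 0≼δ (ι-mono A≤z))
          where
          B≤2next : B ℕ.≤ 2 ℕ.* next z
          B≤2next = ι-cancel (lin 6 (λ B d n a z p → (B :≡ a :+ z :+ (:ι 3 :* p :+ :ι 6)) ⇒ (n :≡ a :+ z) ⇒ (d :≡ :ι 2 :* n) ⇒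
              (:ι 800 :* p :≤ z) ⇒ (:ι 9 :≤ p) ⇒ (:ι 0 :≤ a) ⇒ (B :≤ d)) _ _ (ι (next z)) _ _ _ ιB ιnext (ι-* 2 (next z)) 800p≤z p≥9 (0≼ι (z ÷ k)))
          B≤4X : ι B ≼ ι 4 ⊗ ι X
          B≤4X = lin 5 (λ B a z p x → (B :≡ a :+ z :+ (:ι 3 :* p :+ :ι 6)) ⇒ (:ι 800 :* p :≤ z) ⇒ (:ι 9 :≤ p) ⇒ (:ι 20 :* a :≤ z) ⇒ (z :≤ x)
              ⇒ (B :≤ :ι 4 :* x)) _ _ _ _ _ ιB 800p≤z p≥9 20z÷ z≼X
          z≤2A : z ℕ.≤ 2 ℕ.* A
          z≤2A = ι-cancel (lin 4 (λ z t p a → (a :+ (p :+ :ι 2) :≡ z) ⇒ (t :≡ :ι 2 :* a) ⇒ (:ι 800 :* p :≤ z) ⇒ (:ι 9 :≤ p) ⇒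
              (z :≤ t)) _ _ _ _ ιA (ι-* 2 A) 800p≤z p≥9)

        -- The allowance is about 2 z / k. By `Mid` the increment is at most 5 z / (4 k), and 8 p
        -- adds at most z / (5 k), so z / (4 k) is left with room for the errors.
        deficit-near : ∀ n → w ℕ.< n → n ℕ.≤ v ℕ.+ e → ι z ≼ ι 4 ⊗ (ι k ⊗ deficit n)
        deficit-near n lt h = lin 11 (λ z k u r D A i p d X a → (:ι 0 :≤ k :* (i :+ :ι 8 :* p :+ :ι 16 :+ :ι 3 :* (d :* z) :- D)) ⇒
            (:ι 4 :* (k :* i) :≤ :ι 5 :* z) ⇒ (a :≤ X :* r) ⇒ (A :≤ a) ⇒ (X :* r :≡ (k :* u) :* r) ⇒ (:ι 0 :≤ k :* ((d :* X) :* r)) ⇒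
            (A :+ (p :+ :ι 2) :≡ z) ⇒ (:ι 40 :* (k :* p) :≤ z) ⇒ (:ι 800 :* p :≤ z) ⇒ (:ι 400 :* k :≤ z) ⇒ (:ι 20 :≤ k) ⇒
                (:ι 1000 :* (k :* (d :* z)) :≤ z) ⇒
            (z :≤ :ι 4 :* (k :* ((:ι 2 :* u :+ :ι 2 :* (d :* X)) :* r :- D)))) (ι z) (ι k) (ι u) (rec n) (D n) (ι A) (inc z) (ι p) δ (ι X) (ι (X ÷ n))
          (0≼⊗ (0≼ι k) (≼-sub (D-near n lt h))) (proj₂ mid) (÷-ι-upper X n l) (ι-mono (aboveA n l h)) (⊗-congʳ ιX)
              (0≼⊗ (0≼ι k) (0≼⊗ (0≼⊗ 0≼δ (0≼ι X)) (rec-nonneg n)))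
          ιA mp≤z 800p≤z z≥ k≥ (kδ z)
          where
          l : 1 ℕ.≤ n
          l = ℕ.≤-trans (s≤s z≤n) lt

      v+e≤N₁ : v ℕ.+ e ℕ.≤ N₁
      v+e≤N₁ = *≤⇒≤÷ 1≤y₀ (ℕ.≤-trans (ℕ.*-monoˡ-≤ (v ℕ.+ e) (ℕ.≤-trans y₀≤A (aboveA (v ℕ.+ e) l ℕ.≤-refl)))
          (ℕ.≤-trans (ℕ.≤-reflexive (ℕ.*-comm _ (v ℕ.+ e))) (÷-upper X (v ℕ.+ e) l)))
        where
        l : 1 ℕ.≤ v ℕ.+ e
        l = ℕ.≤-trans (ℕ.≤-trans 1≤y₀ y₀≤v) (ℕ.m≤m+n v e)

      next≤N₁ : next z ℕ.≤ N₁
      next≤N₁ = *≤⇒≤÷ 1≤y₀ (ι-cancel (≼-trans (≼-reflexive (ι-* y₀ (next z)))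
          (lin 5 (λ y n v z x → (:ι 0 :≤ y :* (:ι 2 :* z :- n)) ⇒ (:ι 0 :≤ (v :- :ι 4 :* y) :* z) ⇒ (v :* z :≤ x) ⇒ (:ι 0 :≤ y :* z) ⇒
          (y :* n :≤ x)) (ι y₀) (ι (next z)) (ι v) (ι z) (ι X)
         (0≼⊗ (0≼ι y₀) (≼-sub (≼-trans (ι-mono (next≤2 z)) (≼-reflexive (ι-* 2 z)))))
             (0≼⊗ (≼-sub (≼-trans (≼-reflexive (sym (ι-* 4 y₀))) (ι-mono 4y₀≤v))) (0≼ι z)) vz≤X (0≼⊗ (0≼ι y₀) (0≼ι z)))))

      private
        mass : R
        mass = ψ (v ℕ.+ e) ⊖ ψ w

        -- The n near v have Λ-mass at least e, and each lacks at least z / (4 k).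
        case₁ : ι e ≼ mass → ι X ≼ ι 640 ⊗ ((ι k ⊗ ι k) ⊗ (G (v ℕ.+ e) ⊖ G w))
        case₁ h = lin 7 (λ x k e z ms g t → (x :≤ :ι 160 :* (k :* (e :* z))) ⇒ (:ι 0 :≤ (k :* z) :* (ms :- e)) ⇒
            (k :* ((:ι 4 :* k) :* (t :* ms)) :≤ k :* ((:ι 4 :* k) :* g)) ⇒ ((:ι 4 :* (k :* t)) :≡ z) ⇒
            ((:ι 4 :* (k :* t)) :* (k :* ms) :≡ z :* (k :* ms)) ⇒
            (x :≤ :ι 640 :* ((k :* k) :* g))) (ι X) (ι k) (ι e) (ι z) mass (G (v ℕ.+ e) ⊖ G w) t
          X≤kez (0≼⊗ (0≼⊗ (0≼ι k) (0≼ι z)) (≼-sub h)) (⊗-monoˡ (ι k) (0≼ι k) (⊗-monoˡ _ (0≼⊗ (0≼ι 4) (0≼ι k)) gd)) 4kt (⊗-congʳ 4kt)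
          where
          t : R
          t = ι z ⊗ rec (4 ℕ.* k)
          4kt : ι 4 ⊗ (ι k ⊗ t) ≡ ι z
          4kt = trans (lin 3 (λ k z r → :ι 4 :* (k :* (z :* r)) :≡ ((:ι 4 :* k) :* r) :* z) (ι k) (ι z) (rec (4 ℕ.* k)))
            (1⊗ (trans (⊗-congʳ (sym (ι-* 4 k))) (rec-inv′ (4 ℕ.* k) (ℕ.*-mono-≤ {1} {4} (s≤s z≤n) 1≤k))))
          gd : t ⊗ mass ≼ G (v ℕ.+ e) ⊖ G w
          gd = G-diff w (v ℕ.+ e) t (ℕ.≤-trans (ℕ.m∸n≤m v e) (ℕ.m≤m+n v e)) (λ n lt u → ⊗-cancelˡ (4 ℕ.* k) (ℕ.*-mono-≤ {1} {4} (s≤s z≤n) 1≤k)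
            (subst (λ s → s ⊗ t ≼ s ⊗ deficit n) (sym (ι-* 4 k))
                (subst₂ _≼_ (sym (trans (⊗-assoc _ _ _) 4kt)) (sym (⊗-assoc _ _ _)) (deficit-near n lt u))))

        module Window (small : mass ≼ ι e) (n : ℕ) (z<n : z ℕ.< n) (n≤ : n ℕ.≤ next z) where
          a b : ℕ
          a = X ÷ n
          b = Y ÷ n
          1≤n : 1 ℕ.≤ n
          1≤n = ℕ.≤-trans (s≤s z≤n) z<n
          a≤v : a ℕ.≤ v
          a≤v = ÷-monoʳ X 1≤z (ℕ.<⇒≤ z<n)
          v≤b : v ℕ.≤ b
          v≤b = *≤⇒≤÷ 1≤n (ι-cancel (≼-trans (≼-reflexive (ι-* n v))
              (⊗-cancelˡ k 1≤k (lin 8 (λ k n v z c x u y → (:ι 0 :≤ (k :* v) :* (c :+ z :- n)) ⇒ (:ι 0 :≤ v :* (z :- k :* c)) ⇒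
              (:ι 0 :≤ (k :+ :ι 1) :* (x :- v :* z)) ⇒ (x :≡ k :* u) ⇒ (y :≡ x :+ u) ⇒ (k :* y :≡ k :* (x :+ u)) ⇒
                (k :* (n :* v) :≤ k :* y)) (ι k) (ι n) (ι v) (ι z) (ι (z ÷ k)) (ι X) (ι u) (ι Y)
             (0≼⊗ (0≼⊗ (0≼ι k) (0≼ι v)) (≼-sub (≼-trans (ι-mono n≤) (≼-reflexive ιnext)))) (0≼⊗ (0≼ι v) (≼-sub kz÷))
                 (0≼⊗ (≼-trans (0≼ι (k ℕ.+ 1)) (≼-reflexive (ι-+ k 1))) (≼-sub vz≤X)) ιX ιY (⊗-congˡ ιY)))))
          20v≤21a : ι 20 ⊗ ι v ≼ ι 21 ⊗ (ι a ⊕ ι 1)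
          20v≤21a = ⊗-cancelˡ z 1≤z (lin 6 (λ z v a n c x → (x :≤ n :* (a :+ :ι 1)) ⇒ (v :* z :≤ x) ⇒ (:ι 0 :≤ (c :+ z :- n) :* (a :+ :ι 1))
              ⇒ (:ι 0 :≤ (z :- :ι 20 :* c) :* (a :+ :ι 1)) ⇒ (z :* (:ι 20 :* v) :≤ z :* (:ι 21 :* (a :+ :ι 1)))) (ι z) (ι v) (ι a) (ι n)
              (ι (z ÷ k)) (ι X)
            (≼-trans (ι-mono (ℕ.<⇒≤ (÷-lower X n 1≤n))) (≼-reflexive (trans (ι-* n (suc a)) (⊗-congˡ (ι-suc a))))) vz≤X
            (0≼⊗ (≼-sub (≼-trans (ι-mono n≤) (≼-reflexive ιnext))) a1) (0≼⊗ (≼-sub 20z÷) a1))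
            where
            a1 : ι 0 ≼ ι a ⊕ ι 1
            a1 = ≼-trans (0≼ι (a ℕ.+ 1)) (≼-reflexive (ι-+ a 1))
          v≤2a : ι v ≼ ι 2 ⊗ ι a
          v≤2a = lin 3 (λ v a k → (:ι 20 :* v :≤ :ι 21 :* (a :+ :ι 1)) ⇒ (:ι 400 :* k :≤ v) ⇒ (:ι 20 :≤ k) ⇒ (v :≤ :ι 2 :* a)) (ι v) (ι a)
              (ι k) 20v≤21a v≥ k≥
          y₀≤a : y₀ ℕ.≤ a
          y₀≤a = ι-cancel (lin 3 (λ v a y → (v :≤ :ι 2 :* a) ⇒ (:ι 4 :* y :≤ v) ⇒ (:ι 0 :≤ y) ⇒ (y :≤ a)) (ι v) (ι a) (ι y₀) v≤2a
              (≼-trans (≼-reflexive (sym (ι-* 4 y₀))) (ι-mono 4y₀≤v)) (0≼ι y₀))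
          v≤2aℕ : v ℕ.≤ 2 ℕ.* a
          v≤2aℕ = ι-cancel (≼-trans v≤2a (≼-reflexive (sym (ι-* 2 a))))
          b≤2a : b ℕ.≤ 2 ℕ.* a
          b≤2a = window-double n 1≤n y₀≤a
          2b≤Z : 2 ℕ.* b ℕ.≤ Z
          2b≤Z = ℕ.≤-trans (ℕ.*-monoʳ-≤ 2 (÷-≤ Y n)) 2Y≤Z
          2v≤Z : 2 ℕ.* v ℕ.≤ Z
          2v≤Z = ℕ.≤-trans (ℕ.*-monoʳ-≤ 2 v≤b) 2b≤Z
          δv≤e : ι 10 ⊗ (δ ⊗ ι v) ≼ ι e
          δv≤e = ⊗-cancelˡ k 1≤k (lin 4 (λ k d v e → (:ι 1000 :* (k :* (d :* v)) :≤ v) ⇒ (v :≤ :ι 40 :* (k :* (e :+ :ι 1))) ⇒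
              (:ι 0 :≤ k :* (e :- :ι 9)) ⇒ (:ι 0 :≤ k) ⇒ (k :* (:ι 10 :* (d :* v)) :≤ k :* e)) (ι k) δ (ι v) (ι e) (kδ v) v≤me
              (0≼⊗ (0≼ι k) (≼-sub e≥9)) (0≼ι k))
          0≼δXr : ι 0 ≼ (δ ⊗ ι X) ⊗ rec n
          0≼δXr = 0≼⊗ (0≼⊗ 0≼δ (0≼ι X)) (rec-nonneg n)
          w≤v : w ℕ.≤ v
          w≤v = ℕ.m∸n≤m v e
          δw : δ ⊗ ι a ≼ δ ⊗ ι v
          δw = ⊗-monoˡ δ 0≼δ (ι-mono a≤v)

          -- The window contains (w, v], where the mass is at most e instead of the allowed 2 e; δ
          -- takes away at most half of the saving.
          wide-left : a ℕ.≤ w → ι e ≼ ι 2 ⊗ deficit n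
          wide-left a≤w = lin 14 (λ pb pv pw pa pq b v w a d e u r X →
              (pb :- pv :≤ :ι 2 :* (b :- v) :+ d :* v) ⇒ (pw :- pa :≤ :ι 2 :* (w :- a) :+ d :* a) ⇒ (pv :≤ pq) ⇒ (pq :- pw :≤ e) ⇒
                  (w :+ e :≡ v) ⇒ (b :- a :≤ u :* r :+ :ι 1) ⇒ (d :* a :≤ d :* v) ⇒ (:ι 2 :≤ d :* v) ⇒ (:ι 10 :* (d :* v) :≤ e) ⇒
                  (:ι 0 :≤ (d :* X) :* r) ⇒
              (e :≤ :ι 2 :* ((:ι 2 :* u :+ :ι 2 :* (d :* X)) :* r :- (pb :- pa)))) (ψ b) (ψ v) (ψ w) (ψ a) (ψ (v ℕ.+ e)) (ι b) (ι v) (ι w)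
                  (ι a) δ (ι e) (ι u) (rec n) (ι X)
            (ψ-short v b y₀≤v v≤b (ℕ.≤-trans b≤2a (ℕ.*-monoʳ-≤ 2 a≤v)) 2b≤Z)
            (ψ-short a w y₀≤a a≤w (ℕ.≤-trans w≤v v≤2aℕ) (ℕ.≤-trans (ℕ.*-monoʳ-≤ 2 w≤v) 2v≤Z)) (ψ-mono (ℕ.m≤m+n v e)) small w+e
                (÷-diff n 1≤n) δw (δ-big v y₀≤v) δv≤e 0≼δXr

          wide-right : v ℕ.+ e ℕ.≤ b → ι e ≼ ι 2 ⊗ deficit n
          wide-right ve≤b = lin 14 (λ pb pv pw pa pq b v q a d e u r X →
              (pb :- pq :≤ :ι 2 :* (b :- q) :+ d :* q) ⇒ (pv :- pa :≤ :ι 2 :* (v :- a) :+ d :* a) ⇒ (pw :≤ pv) ⇒ (pq :- pw :≤ e) ⇒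
                  (q :≡ v :+ e) ⇒ (d :* q :≤ d :* (:ι 2 :* v)) ⇒ (b :- a :≤ u :* r :+ :ι 1) ⇒ (d :* a :≤ d :* v) ⇒ (:ι 2 :≤ d :* v) ⇒
                  (:ι 10 :* (d :* v) :≤ e) ⇒ (:ι 0 :≤ (d :* X) :* r) ⇒
              (e :≤ :ι 2 :* ((:ι 2 :* u :+ :ι 2 :* (d :* X)) :* r :- (pb :- pa)))) (ψ b) (ψ v) (ψ w) (ψ a) (ψ (v ℕ.+ e)) (ι b) (ι v)
                  (ι (v ℕ.+ e)) (ι a) δ (ι e) (ι u) (rec n) (ι X)
            (ψ-short (v ℕ.+ e) b (ℕ.≤-trans y₀≤v (ℕ.m≤m+n v e)) ve≤b (ℕ.≤-trans b≤2a (ℕ.*-monoʳ-≤ 2 (ℕ.≤-trans a≤v (ℕ.m≤m+n v e)))) 2b≤Z)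
            (ψ-short a v y₀≤a a≤v v≤2aℕ 2v≤Z) (ψ-mono w≤v) small (ι-+ v e) (⊗-monoˡ δ 0≼δ v+e≼) (÷-diff n 1≤n) δw (δ-big v y₀≤v) δv≤e 0≼δXr
            where
            v+e≼ : ι (v ℕ.+ e) ≼ ι 2 ⊗ ι v
            v+e≼ = ≼-trans (≼-reflexive (ι-+ v e)) (lin 2 (λ v e → (e :≤ v) ⇒ (v :+ e :≤ :ι 2 :* v)) _ _ (ι-mono e≤v))

          -- The whole window lies in (w, v + e] and has mass at most e, whereas its allowance is at
          -- least v / k, hence at least 40 e.
          narrow : w ℕ.≤ a → b ℕ.≤ v ℕ.+ e → ι e ≼ ι 2 ⊗ deficit n
          narrow w≤a b≤ = ⊗-cancelˡ k 1≤k (lin 12 (λ k pb pa pq pw e u r X d a v → (:ι 0 :≤ k :* (e :- (pq :- pw))) ⇒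
              (:ι 0 :≤ k :* (pq :- pb)) ⇒ (:ι 0 :≤ k :* (pa :- pw)) ⇒ (a :≤ X :* r) ⇒ (X :* r :≡ (k :* u) :* r) ⇒ (v :≤ :ι 2 :* a) ⇒
              (:ι 40 :* (k :* e) :≤ v) ⇒ (:ι 0 :≤ k :* ((d :* X) :* r)) ⇒ (:ι 0 :≤ k :* e) ⇒
              (k :* e :≤ k :* (:ι 2 :* ((:ι 2 :* u :+ :ι 2 :* (d :* X)) :* r :- (pb :- pa))))) (ι k) (ψ b) (ψ a) (ψ (v ℕ.+ e)) (ψ w) (ι e)
                  (ι u) (rec n) (ι X) δ (ι a) (ι v)
            (0≼⊗ (0≼ι k) (≼-sub small)) (0≼⊗ (0≼ι k) (≼-sub (ψ-mono b≤))) (0≼⊗ (0≼ι k) (≼-sub (ψ-mono w≤a))) (÷-ι-upper X n 1≤n)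
                (⊗-congʳ ιX) v≤2a me≤v (0≼⊗ (0≼ι k) 0≼δXr) (0≼⊗ (0≼ι k) (0≼ι e)))

          deficit-window : ι e ≼ ι 2 ⊗ deficit n
          deficit-window with ℕ.≤-total a w
          ... | inj₁ a≤w = wide-left a≤w
          ... | inj₂ w≤a with ℕ.≤-total b (v ℕ.+ e)
          ...   | inj₁ b≤ = narrow w≤a b≤
          ...   | inj₂ ≥b = wide-right ≥b

        -- Each n in (z, next z] lacks at least e / 2, and these n have Λ-mass at least z / (4 k),
        -- by the lower half of `Mid`.
        case₂ : mass ≼ ι e → ι X ≼ ι 1280 ⊗ ((ι k ⊗ ι k) ⊗ (G (next z) ⊖ G z))
        case₂ small = lin 7 (λ x k e z i g t → (x :≤ :ι 160 :* (k :* (e :* z))) ⇒ (:ι 0 :≤ (k :* e) :* (:ι 4 :* (k :* i) :- z)) ⇒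
            ((k :* k) :* (t :* i) :≤ (k :* k) :* g) ⇒ (:ι 2 :* t :≡ e) ⇒ ((:ι 2 :* t) :* (k :* (k :* i)) :≡ e :* (k :* (k :* i))) ⇒
            (x :≤ :ι 1280 :* ((k :* k) :* g))) (ι X) (ι k) (ι e) (ι z) (inc z) (G (next z) ⊖ G z) t
          X≤kez (0≼⊗ (0≼⊗ (0≼ι k) (0≼ι e)) (≼-sub (proj₁ mid))) (⊗-monoˡ _ (0≼⊗ (0≼ι k) (0≼ι k)) gd) 2t (⊗-congʳ 2t)
          where
          t : R
          t = ι e ⊗ rec 2
          2t : ι 2 ⊗ t ≡ ι e
          2t = trans (lin 2 (λ e r → :ι 2 :* (e :* r) :≡ (:ι 2 :* r) :* e) (ι e) (rec 2)) (1⊗ (rec-inv 1))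
          gd : t ⊗ inc z ≼ G (next z) ⊖ G z
          gd = G-diff z (next z) t z≤next (λ n lt u → ⊗-cancelˡ 2 (s≤s z≤n) (≼-trans (≼-reflexive 2t) (Window.deficit-window small n lt u)))

      -- Either the mass near v reaches e and the n near v lose, or it does not and the n near z
      -- lose. Both losses are of order e z / k, and X is at most 160 k e z.
      contribution : ι X ≼ ι 1280 ⊗ ((ι k ⊗ ι k) ⊗ ((G (v ℕ.+ e) ⊖ G w) ⊕ (G (next z) ⊖ G z)))
      contribution with ≼-total (ι e) mass
      ... | inj₁ h = lin 4 (λ x kk g g′ → (x :≤ :ι 640 :* (kk :* g)) ⇒ (:ι 0 :≤ kk :* g′) ⇒ (:ι 0 :≤ kk :* g) ⇒
          (x :≤ :ι 1280 :* (kk :* (g :+ g′)))) _ _ _ _ (case₁ h)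
              (0≼⊗ (0≼⊗ (0≼ι k) (0≼ι k)) (≼-sub (G-mono z≤next next≤N₁)))
                  (0≼⊗ (0≼⊗ (0≼ι k) (0≼ι k)) (≼-sub (G-mono (ℕ.≤-trans (ℕ.m∸n≤m v e) (ℕ.m≤m+n v e)) v+e≤N₁)))
      ... | inj₂ h = lin 4 (λ x kk g g′ → (x :≤ :ι 1280 :* (kk :* g′)) ⇒ (:ι 0 :≤ kk :* g) ⇒ (x :≤ :ι 1280 :* (kk :* (g :+ g′)))) _ _ _ _ (case₂ h)
              (0≼⊗ (0≼⊗ (0≼ι k) (0≼ι k)) (≼-sub (G-mono (ℕ.≤-trans (ℕ.m∸n≤m v e) (ℕ.m≤m+n v e)) v+e≤N₁)))

-- Summation over scales

module Stretches where
  open OrderedField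
  open LinearArithmetic
  open FiniteSums
  open Logarithms
  open AdditiveLogarithm
  open SummatoryFunctions
  open GapDeficit
  open LocalContribution
  open import Data.Nat using (_^_)

  lg-^′ : ∀ {Z} (LG : Logarithm Z) → let open Logarithm LG in ∀ b n → 1 ℕ.≤ b → lg (b ^ n) ≡ ι n ⊗ lg b
  lg-^′ {Z} LG b zero    l = trans (Estimates.lg1 Z LG) (sym (⊗-zeroˡ _))
  lg-^′ LG b (suc n) l = trans (lg-* b (b ^ n) l (ℕ.>-nonZero⁻¹ (b ^ n) {{ℕ.m^n≢0 b n {{ℕ.>-nonZero l}}}}))
    (trans (⊕-congˡ (lg-^′ LG b n l)) (trans (lin 2 (λ l n → l :+ n :* l :≡ (n :+ :ι 1) :* l) (lg b) (ι n)) (⊗-congʳ (sym (ι-suc n)))))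
    where open Logarithm LG

  module Erdos₄ (Z : ℕ) (LG : Logarithm Z) (SU : Setup Z LG)
    (B₁ : ℕ) (2≤B₁ : 2 ℕ.≤ B₁) (long : Logarithm.lg LG 2 ⊕ ι 481 ≼ Logarithm.lg LG B₁) where
    open Erdos₃ Z LG SU public

    lg-^ : ∀ b n → 1 ℕ.≤ b → lg (b ^ n) ≡ ι n ⊗ lg b
    lg-^ = lg-^′ LG

    -- The mid point is sought between 2 B ^ i and B₁ B ^ i. The two factors 2 leave room for `next`
    -- below B ^ suc i and for the neighbourhood of X / z between `τ (suc i)` and `τ i`.
    B : ℕ
    B = 2 ℕ.* B₁

    private
      1≤B₁ = ℕ.≤-trans (s≤s z≤n) 2≤B₁
      1≤B : 1 ℕ.≤ B
      1≤B = ℕ.*-mono-≤ {1} {2} (s≤s z≤n) 1≤B₁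
      1≤B^ : ∀ i → 1 ℕ.≤ B ^ i
      1≤B^ i = ℕ.>-nonZero⁻¹ (B ^ i) {{ℕ.m^n≢0 B i {{ℕ.>-nonZero 1≤B}}}}

    τ : ℕ → ℕ
    τ i = X ÷ (B ^ i)

    -- Both local ranges of deficit lie within one stretch, the one near z between powers of B and
    -- the one near X / z between values of τ; monotonicity of G then enlarges them to the full
    -- stretch.
    stretch : ∀ i → 4 ℕ.* y₀ ℕ.≤ B ^ i → 4 ℕ.* y₀ ℕ.≤ τ (suc i) →
      ι X ≼ ι 1280 ⊗ ((ι k ⊗ ι k) ⊗ ((G (τ i) ⊖ G (τ (suc i))) ⊕ (G (B ^ suc i) ⊖ G (B ^ i))))
    stretch i 4y₀≤Bi 4y₀≤τ = go (mid-exists (2 ℕ.* b) (B₁ ℕ.* b) y₀≤2b (ℕ.*-monoˡ-≤ b 2≤B₁) 16b≤Z longᵢ)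
      where
      b = B ^ i
      1≤b = 1≤B^ i
      y₀≤τ : y₀ ℕ.≤ τ (suc i)
      y₀≤τ = ℕ.≤-trans (ℕ.m≤n*m y₀ 4) 4y₀≤τ
      y₀≤b : y₀ ℕ.≤ b
      y₀≤b = ℕ.≤-trans (ℕ.m≤n*m y₀ 4) 4y₀≤Bi
      b≤2b : b ℕ.≤ 2 ℕ.* b
      b≤2b = ℕ.m≤n*m b 2
      y₀≤2b = ℕ.≤-trans y₀≤b b≤2b
      Bτ≤X : B ^ suc i ℕ.* τ (suc i) ℕ.≤ X
      Bτ≤X = ÷-upper X (B ^ suc i) (1≤B^ (suc i))
      2B₁b : 2 ℕ.* (B₁ ℕ.* b) ≡ B ^ suc i
      2B₁b = sym (ℕ.*-assoc 2 B₁ b)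
      Bsuc≤X : B ^ suc i ℕ.≤ X
      Bsuc≤X = ℕ.≤-trans (ℕ.≤-trans (ℕ.≤-reflexive (sym (ℕ.*-identityʳ _))) (ℕ.*-monoʳ-≤ (B ^ suc i) (ℕ.≤-trans 1≤y₀ y₀≤τ))) Bτ≤X
      16b≤Z : 16 ℕ.* (B₁ ℕ.* b) ℕ.≤ Z
      16b≤Z = ℕ.≤-trans (ℕ.≤-reflexive (trans (ℕ.*-assoc 8 2 (B₁ ℕ.* b)) (cong (8 ℕ.*_) 2B₁b))) (ℕ.≤-trans (ℕ.*-monoʳ-≤ 8 Bsuc≤X) 8ku≤Z)
      longᵢ : lg (2 ℕ.* b) ⊕ ι 481 ≼ lg (B₁ ℕ.* b)
      longᵢ = lin 5 (λ x y p q c → (x :≡ p :+ c) ⇒ (y :≡ q :+ c) ⇒ (p :+ :ι 481 :≤ q) ⇒ (x :+ :ι 481 :≤ y)) _ _ _ _ _ (lg-* 2 b (s≤s z≤n)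
          1≤b) (lg-* B₁ b 1≤B₁ 1≤b) long
      go : (∃ λ z → 2 ℕ.* b ℕ.≤ z × z ℕ.≤ B₁ ℕ.* b × Mid z) → ι X ≼ ι 1280 ⊗ ((ι k ⊗ ι k) ⊗ ((G (τ i) ⊖ G (τ (suc i))) ⊕ (G (B ^ suc i) ⊖ G b)))
      go (z , lo , hi , mid) = lin 10 (λ x kk a a′ t t′ n n′ c c′ → (x :≤ :ι 1280 :* (kk :* ((a :- a′) :+ (n :- n′)))) ⇒
          (:ι 0 :≤ kk :* (t :- a)) ⇒ (:ι 0 :≤ kk :* (a′ :- t′)) ⇒ (:ι 0 :≤ kk :* (c :- n)) ⇒ (:ι 0 :≤ kk :* (n′ :- c′)) ⇒
            (x :≤ :ι 1280 :* (kk :* ((t :- t′) :+ (c :- c′))))) (ι X) (ι k ⊗ ι k) (G (L.v ℕ.+ L.e)) (G L.w) (G (τ i)) (G (τ (suc i)))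
                (G (next z)) (G z) (G (B ^ suc i)) (G b)
          L.contribution (up (G-mono v+e≤τ τ≤N₁)) (up (G-mono τ≤w w≤N₁)) (up (G-mono next≤B B≤N₁)) (up (G-mono b≤z z≤N₁))
        where
        up : ∀ {x y} → x ≼ y → ι 0 ≼ (ι k ⊗ ι k) ⊗ (y ⊖ x)
        up h = 0≼⊗ (0≼⊗ (0≼ι k) (0≼ι k)) (≼-sub h)
        b≤z = ℕ.≤-trans b≤2b lo
        2z≤B : 2 ℕ.* z ℕ.≤ B ^ suc i
        2z≤B = ℕ.≤-trans (ℕ.*-monoʳ-≤ 2 hi) (ℕ.≤-reflexive 2B₁b)
        1≤z = ℕ.≤-trans 1≤b b≤z
        2τ≤v : 2 ℕ.* τ (suc i) ℕ.≤ X ÷ z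
        2τ≤v = *≤⇒≤÷ {2 ℕ.* τ (suc i)} 1≤z (ℕ.≤-trans (ℕ.≤-reflexive (trans (sym (ℕ.*-assoc z 2 _)) (cong (ℕ._* τ (suc i)) (ℕ.*-comm z 2))))
            (ℕ.≤-trans (ℕ.*-monoˡ-≤ (τ (suc i)) 2z≤B) Bτ≤X))
        4y₀≤v = ℕ.≤-trans 4y₀≤τ (ℕ.≤-trans (ℕ.m≤n*m _ 2) 2τ≤v)
        module L = Local z (ℕ.≤-trans 4y₀≤Bi b≤z) 4y₀≤v mid
        2v≤τ : 2 ℕ.* L.v ℕ.≤ τ i
        2v≤τ = *≤⇒≤÷ {2 ℕ.* L.v} 1≤b (ℕ.≤-trans (ℕ.≤-reflexive (trans (sym (ℕ.*-assoc b 2 L.v)) (cong (ℕ._* L.v) (ℕ.*-comm b 2))))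
            (ℕ.≤-trans (ℕ.*-monoˡ-≤ L.v lo) (÷-upper X z 1≤z)))
        2e≤v : 2 ℕ.* L.e ℕ.≤ L.v
        2e≤v = ℕ.≤-trans (ℕ.*-monoˡ-≤ L.e (ℕ.≤-trans (ℕ.m≤m*n 2 k {{ℕ.>-nonZero 1≤k}}) (ℕ.*-monoˡ-≤ k {2} {40} (s≤s (s≤s z≤n)))))
            (÷-upper L.v L.m (ℕ.*-mono-≤ {1} {40} (s≤s z≤n) 1≤k))
        v+e≤τ : L.v ℕ.+ L.e ℕ.≤ τ i
        v+e≤τ = ℕ.≤-trans (ℕ.+-monoʳ-≤ L.v (ℕ.≤-trans (÷-≤ L.v L.m) (ℕ.≤-reflexive (sym (ℕ.+-identityʳ L.v))))) 2v≤τ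
        τ≤N₁ : τ i ℕ.≤ N₁
        τ≤N₁ = ÷-monoʳ X 1≤y₀ y₀≤b
        w≤N₁ : L.w ℕ.≤ N₁
        w≤N₁ = ℕ.≤-trans (ℕ.≤-trans (ℕ.m∸n≤m L.v L.e) (ℕ.m≤m+n L.v L.e)) L.v+e≤N₁
        τ≤w : τ (suc i) ℕ.≤ L.w
        τ≤w = ι-cancel (lin 4 (λ t v e w → (:ι 2 :* t :≤ v) ⇒ (:ι 2 :* e :≤ v) ⇒ (w :+ e :≡ v) ⇒ (t :≤ w)) (ι (τ (suc i))) (ι L.v) (ι L.e) (ι L.w)
          (≼-trans (≼-reflexive (sym (ι-* 2 _))) (ι-mono 2τ≤v)) (≼-trans (≼-reflexive (sym (ι-* 2 _))) (ι-mono 2e≤v))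
              (trans (sym (ι-+ L.w L.e)) (cong ι (ℕ.m∸n+n≡m (÷-≤ L.v L.m)))))
        next≤B : next z ℕ.≤ B ^ suc i
        next≤B = ℕ.≤-trans (next≤2 z) 2z≤B
        B≤N₁ : B ^ suc i ℕ.≤ N₁
        B≤N₁ = *≤⇒≤÷ 1≤y₀ (ℕ.≤-trans (ℕ.≤-trans (ℕ.≤-reflexive (ℕ.*-comm y₀ _)) (ℕ.*-monoʳ-≤ (B ^ suc i) y₀≤τ)) Bτ≤X)
        z≤N₁ : z ℕ.≤ N₁
        z≤N₁ = ℕ.≤-trans (ℕ.≤-trans (ℕ.m≤n+m z (z ÷ k)) next≤B) B≤N₁

    τ-anti : ∀ i j → τ (i ℕ.+ j) ℕ.≤ τ j
    τ-anti i j = ÷-monoʳ X (1≤B^ j) (ℕ.^-monoʳ-≤ B {{ℕ.>-nonZero 1≤B}} (ℕ.m≤n+m j i))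

    -- Consecutive stretches adjoin on either side, so the differences of G telescope.
    stretches : ∀ j i → 4 ℕ.* y₀ ℕ.≤ B ^ j → 4 ℕ.* y₀ ℕ.≤ τ (i ℕ.+ j) →
      ι i ⊗ ι X ≼ ι 1280 ⊗ ((ι k ⊗ ι k) ⊗ ((G (τ j) ⊖ G (τ (i ℕ.+ j))) ⊕ (G (B ^ (i ℕ.+ j)) ⊖ G (B ^ j))))
    stretches j zero    _ _ = lin 4 (λ x kk a b → :ι 0 :* x :≤ :ι 1280 :* (kk :* ((a :- a) :+ (b :- b)))) _ _ _ _
    stretches j (suc i) h t = lin 10 (λ x kk a b c p q r n n′ → (n :* x :≤ :ι 1280 :* (kk :* ((a :- b) :+ (q :- p)))) ⇒
        (x :≤ :ι 1280 :* (kk :* ((b :- c) :+ (r :- q)))) ⇒ (n′ :* x :≡ (n :+ :ι 1) :* x) ⇒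
          (n′ :* x :≤ :ι 1280 :* (kk :* ((a :- c) :+ (r :- p))))) (ι X) (ι k ⊗ ι k) (G (τ j)) (G (τ (i ℕ.+ j))) (G (τ (suc i ℕ.+ j)))
              (G (B ^ j)) (G (B ^ (i ℕ.+ j))) (G (B ^ (suc i ℕ.+ j))) (ι i) (ι (suc i))
        (stretches j i h (ℕ.≤-trans t (τ-anti 1 (i ℕ.+ j))))
            (stretch (i ℕ.+ j) (ℕ.≤-trans h (ℕ.^-monoʳ-≤ B {{ℕ.>-nonZero 1≤B}} (ℕ.m≤n+m j i))) t) (⊗-congʳ (ι-suc i))

    -- The j scales at each end keep z and X / z above 4 y₀. In between, i X ≤ 1280 k² · 2 G(N₁) ≤
    -- 1280 k² · 8 δ X lg X with lg X ≤ (i + 2 j + 1) lg B ≤ 2 i lg B. As 61440 = 6 · 8 · 1280, this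
    -- gives 6 i ≤ 2 i.
    contradiction : ∀ j i → 4 ℕ.* y₀ ℕ.≤ B ^ j → 3 ℕ.* j ℕ.+ 1 ℕ.≤ i → B ^ (i ℕ.+ (j ℕ.+ j)) ℕ.≤ X → X ℕ.< B ^ suc (i ℕ.+ (j ℕ.+ j)) →
      ψ Y ⊖ ψ X ≼ δ ⊗ ι X → ι 48 ⊗ lg y₀ ⊕ ι 5000 ≼ δ ⊗ lg X → ι 61440 ⊗ (((ι k ⊗ ι k) ⊗ δ) ⊗ lg B) ≼ ι 1 →
      B ℕ.* X ℕ.≤ Z → ⊥
    contradiction j i hB 3j≤i lo hi gap large tiny BX≤Z = 1⋠0 (⊗-cancelˡ {ι 1} {ι 0} X 1≤X (lin 13 (λ x kk a b p r g d lX lB i j I →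
           (i :* x :≤ :ι 1280 :* (kk :* ((a :- b) :+ (r :- p)))) ⇒ (:ι 0 :≤ kk :* b) ⇒ (:ι 0 :≤ kk :* p) ⇒ (:ι 0 :≤ kk :* (g :- a)) ⇒
               (:ι 0 :≤ kk :* (g :- r)) ⇒ (kk :* g :≤ kk :* (:ι 4 :* (d :* (x :* lX)))) ⇒
           (((kk :* d) :* x) :* lX :≤ ((kk :* d) :* x) :* (I :* lB)) ⇒ ((:ι 61440 :* ((kk :* d) :* lB)) :* (I :* x) :≤ :ι 1 :* (I :* x)) ⇒
               (I :* x :≡ (i :+ :ι 2 :* j :+ :ι 1) :* x) ⇒ ((:ι 3 :* j :+ :ι 1) :* x :≤ i :* x) ⇒ (:ι 1 :≤ x) ⇒ (:ι 0 :≤ j :* x) ⇒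
               (x :* :ι 1 :≤ x :* :ι 0))
         (ι X) (ι k ⊗ ι k) (G (τ j)) (G (τ (i ℕ.+ j))) (G (B ^ j)) (G (B ^ (i ℕ.+ j))) (G N₁) δ (lg X) (lg B) (ι i) (ι j) (ι (suc (i ℕ.+ (j ℕ.+ j))))
         (stretches j i hB 4y₀≤τ) (0≼⊗ kk (0≼G (τ (i ℕ.+ j)) τ≤N₁))
             (0≼⊗ kk (0≼G (B ^ j) (ℕ.≤-trans (ℕ.^-monoʳ-≤ B {{ℕ.>-nonZero 1≤B}} (ℕ.m≤n+m j i)) B≤N₁)))
         (0≼⊗ kk (≼-sub (G-mono (÷-monoʳ X 1≤y₀ (ℕ.≤-trans (ℕ.m≤n*m y₀ 4) hB)) ℕ.≤-refl))) (0≼⊗ kk (≼-sub (G-mono B≤N₁ ℕ.≤-refl)))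
         (⊗-monoˡ _ kk (G-total gap large)) (⊗-monoˡ _ (0≼⊗ (0≼⊗ kk 0≼δ) (0≼ι X)) lgX) (⊗-monoʳ _ (0≼⊗ (0≼ι _) (0≼ι X)) tiny)
         (⊗-congʳ I≡) (⊗-monoʳ (ι X) (0≼ι X) (≼-trans (≼-reflexive (sym (trans (ι-+ (3 ℕ.* j) 1) (⊕-congʳ (ι-* 3 j))))) (ι-mono 3j≤i)))
             (ι-mono 1≤X) (0≼⊗ (0≼ι j) (0≼ι X))))
      where
      kk : ι 0 ≼ ι k ⊗ ι k
      kk = 0≼⊗ (0≼ι k) (0≼ι k)
      0≼G : ∀ t → t ℕ.≤ N₁ → ι 0 ≼ G t
      0≼G t h = G-mono {0} z≤n h
      split : B ^ (i ℕ.+ j) ℕ.* B ^ j ≡ B ^ (i ℕ.+ (j ℕ.+ j))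
      split = trans (sym (ℕ.^-distribˡ-+-* B (i ℕ.+ j) j)) (cong (B ^_) (ℕ.+-assoc i j j))
      4y₀≤τ : 4 ℕ.* y₀ ℕ.≤ τ (i ℕ.+ j)
      4y₀≤τ = ℕ.≤-trans hB (*≤⇒≤÷ (1≤B^ (i ℕ.+ j)) (ℕ.≤-trans (ℕ.≤-reflexive split) lo))
      y₀≤Bj = ℕ.≤-trans (ℕ.m≤n*m y₀ 4) hB
      B≤N₁ : B ^ (i ℕ.+ j) ℕ.≤ N₁
      B≤N₁ = *≤⇒≤÷ 1≤y₀ (ℕ.≤-trans (ℕ.≤-trans (ℕ.≤-reflexive (ℕ.*-comm y₀ _)) (ℕ.*-monoʳ-≤ (B ^ (i ℕ.+ j)) y₀≤Bj))
          (ℕ.≤-trans (ℕ.≤-reflexive split) lo))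
      τ≤N₁ : τ (i ℕ.+ j) ℕ.≤ N₁
      τ≤N₁ = ℕ.≤-trans (τ-anti i j) (÷-monoʳ X 1≤y₀ y₀≤Bj)
      I≡ : ι (suc (i ℕ.+ (j ℕ.+ j))) ≡ ι i ⊕ ι 2 ⊗ ι j ⊕ ι 1
      I≡ = trans (ι-suc _) (⊕-congʳ (trans (ι-+ i (j ℕ.+ j)) (⊕-congˡ (trans (ι-+ j j) (lin 1 (λ j → j :+ j :≡ :ι 2 :* j) (ι j))))))
      lgX : lg X ≼ ι (suc (i ℕ.+ (j ℕ.+ j))) ⊗ lg B
      lgX = ≼-trans (lg-mono 1≤X (ℕ.<⇒≤ hi) Bn≤Z) (≼-reflexive (lg-^ B (suc (i ℕ.+ (j ℕ.+ j))) 1≤B))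
        where
        Bn≤Z : B ^ suc (i ℕ.+ (j ℕ.+ j)) ℕ.≤ suc Z
        Bn≤Z = ℕ.m≤n⇒m≤1+n (ℕ.≤-trans (ℕ.*-monoʳ-≤ B lo) BX≤Z)

-- Primes in intervals of fixed relative length

module PrimeGaps where
  open OrderedField
  open LinearArithmetic
  open FiniteSums
  open Logarithms
  open AdditiveLogarithm
  open SummatoryFunctions
  open GapDeficit
  open MidPoints
  open Stretches
  open import Data.Nat using (_^_)
  open import Data.Nat.Primality using (Prime; prime?)
  open import Relation.Nullary.Decidable using (_×-dec_)

  floorLog : ∀ B → 2 ℕ.≤ B → ∀ n → 1 ℕ.≤ n → ∃ λ i → B ^ i ℕ.≤ n × n ℕ.< B ^ suc i
  floorLog B 2≤B (suc zero) _ = 0 , ℕ.≤-refl , subst (2 ℕ.≤_) (sym (ℕ.*-identityʳ B)) 2≤B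
  floorLog B 2≤B (suc (suc n)) _ with floorLog B 2≤B (suc n) (s≤s z≤n)
  ... | i , lo , hi with B ^ suc i ℕ.≤? suc (suc n)
  ...   | no ≰   = i , ℕ.m≤n⇒m≤1+n lo , ℕ.≰⇒> ≰
  ...   | yes le = suc i , le , ℕ.<-≤-trans (s≤s hi) (ℕ.≤-trans (ℕ.+-monoˡ-≤ (B ^ suc i) (ℕ.≤-trans (s≤s z≤n) hi))
                     (ℕ.≤-trans (ℕ.≤-reflexive (cong (B ^ suc i ℕ.+_) (sym (ℕ.+-identityʳ (B ^ suc i))))) (ℕ.*-monoˡ-≤ (B ^ suc i) 2≤B)))

  floorSqrt : ∀ n → ∃ λ s → s ℕ.* s ℕ.≤ n × n ℕ.< suc s ℕ.* suc s
  floorSqrt zero = 0 , z≤n , s≤s z≤n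
  floorSqrt (suc n) with floorSqrt n
  ... | s , lo , hi with suc s ℕ.* suc s ℕ.≤? suc n
  ...   | no ≰   = s , ℕ.m≤n⇒m≤1+n lo , ℕ.≰⇒> ≰
  ...   | yes le = suc s , le , ℕ.≤-<-trans hi (ℕ.*-mono-< (ℕ.n<1+n (suc s)) (ℕ.n<1+n (suc s)))

  n<2^n : ∀ n → n ℕ.< 2 ^ n
  n<2^n zero    = s≤s z≤n
  n<2^n (suc n) = ℕ.≤-trans (ℕ.+-mono-≤ (ℕ.≤-trans (s≤s z≤n) (n<2^n n)) (n<2^n n)) (ℕ.≤-reflexive (cong (2 ^ n ℕ.+_) (sym (ℕ.+-identityʳ _))))

  -- The constants are variables known only through equations in R, so numbers such as 2 ^ j₀ are
  -- never evaluated.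
  module Contradiction
    (k dd j₀ b₁ jj n₀ : ℕ) (20≤k : 20 ℕ.≤ k)
    (dd-def : ι dd ≡ ι 240000000 ⊗ (ι k ⊗ ι k)) (j₀-def : ι j₀ ≡ ι 4832 ⊗ ι dd) (b₁-def : ι b₁ ≡ ι 1925)
    (jj-def : ι jj ≡ ι 4 ⊗ ι (2 ^ j₀)) (n₀-def : ι n₀ ≡ ι 5 ⊗ ι jj ⊕ ι 1 ⊕ ι 4 ⊗ (ι dd ⊗ (ι 96 ⊗ ι j₀ ⊕ ι 5000)))
    (u : ℕ) (Bn₀≤u : (2 ℕ.* 2 ^ b₁) ^ n₀ ℕ.≤ u) (dd⁴≤u : (18 ℕ.* dd ℕ.* (18 ℕ.* dd)) ℕ.* (18 ℕ.* dd ℕ.* (18 ℕ.* dd)) ℕ.≤ u)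
    (no-prime : ∀ p → Prime p → k ℕ.* u ℕ.< p → ¬ (p ℕ.≤ k ℕ.* u ℕ.+ u)) where
    private
      X Y B Z y₀ : ℕ
      X = k ℕ.* u
      Y = X ℕ.+ u
      B = 2 ℕ.* 2 ^ b₁
      -- The logarithm must reach the first power of B beyond X, which is at most B X, and the
      -- fourth power (t + 1)⁴ in `gap`, which is at most 32 X.
      Z = (B ℕ.+ 32) ℕ.* X
      y₀ = 2 ^ j₀

      LG : Logarithm Z
      LG = logarithm Z
      open Logarithm LG
      open Estimates Z LG

      1≤k : 1 ℕ.≤ k
      1≤k = ℕ.≤-trans (s≤s z≤n) 20≤k
      20≼k : ι 20 ≼ ι k
      20≼k = ι-mono 20≤k
      k²≥20k : ι 0 ≼ (ι k ⊖ ι 20) ⊗ ι k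
      k²≥20k = 0≼⊗ (≼-sub 20≼k) (0≼ι k)
      1≤2^ : ∀ n → 1 ℕ.≤ 2 ^ n
      1≤2^ n = ℕ.≤-trans (s≤s z≤n) (n<2^n n)
      dd≥ : ι 1000 ⊗ ι k ≼ ι dd
      dd≥ = lin 2 (λ k d → (d :≡ :ι 240000000 :* (k :* k)) ⇒ (:ι 0 :≤ (k :- :ι 20) :* k) ⇒ (:ι 0 :≤ k) ⇒ (:ι 1000 :* k :≤ d)) _ _ dd-def
          k²≥20k (0≼ι k)
      1≤dd : 1 ℕ.≤ dd
      1≤dd = ι-cancel (lin 2 (λ k d → (:ι 1000 :* k :≤ d) ⇒ (:ι 20 :≤ k) ⇒ (:ι 1 :≤ d)) _ _ dd≥ 20≼k)
      dd≤j₀ : ι dd ⊗ ι 4832 ≼ ι j₀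
      dd≤j₀ = ≼-reflexive (trans (⊗-comm _ _) (sym j₀-def))
      j₀≼y₀ : ι j₀ ≼ ι y₀
      j₀≼y₀ = ι-mono (ℕ.<⇒≤ (n<2^n j₀))
      2≤B : 2 ℕ.≤ B
      2≤B = ℕ.*-monoʳ-≤ 2 (1≤2^ b₁)
      1≤B = ℕ.≤-trans (s≤s z≤n) 2≤B
      1≤Bn : ∀ n → 1 ℕ.≤ B ^ n
      1≤Bn n = ℕ.>-nonZero⁻¹ (B ^ n) {{ℕ.m^n≢0 B n {{ℕ.>-nonZero 1≤B}}}}
      n<B^n : ∀ n → n ℕ.< B ^ n
      n<B^n n = ℕ.<-≤-trans (n<2^n n) (ℕ.^-monoˡ-≤ n 2≤B)
      1≤u : 1 ℕ.≤ u
      1≤u = ℕ.≤-trans (1≤Bn n₀) Bn₀≤u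
      u≤X : u ℕ.≤ X
      u≤X = ℕ.≤-trans (ℕ.≤-reflexive (sym (ℕ.*-identityˡ u))) (ℕ.*-monoˡ-≤ u 1≤k)
      1≤X = ℕ.≤-trans 1≤u u≤X
      32X≤Z : 32 ℕ.* X ℕ.≤ Z
      32X≤Z = ℕ.*-monoˡ-≤ X (ℕ.m≤n+m 32 B)
      BX≤Z : B ℕ.* X ℕ.≤ Z
      BX≤Z = ℕ.*-monoˡ-≤ X (ℕ.m≤m+n B 32)
      8X≤Z : 8 ℕ.* X ℕ.≤ Z
      8X≤Z = ℕ.≤-trans (ℕ.*-monoˡ-≤ X (ℕ.m≤m+n 8 24)) 32X≤Z
      X≤Z = ℕ.≤-trans (ℕ.m≤n*m X 8) 8X≤Z
      1≤Z : 1 ℕ.≤ Z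
      1≤Z = ℕ.≤-trans 1≤X X≤Z
      jj≡ : jj ≡ 4 ℕ.* y₀
      jj≡ = ℕ.≤-antisym (ι-cancel (≼-reflexive (trans jj-def (sym (ι-* 4 y₀))))) (ι-cancel (≼-reflexive (trans (ι-* 4 y₀) (sym jj-def))))
      4y₀≤Bjj : 4 ℕ.* y₀ ℕ.≤ B ^ jj
      4y₀≤Bjj = subst (ℕ._≤ B ^ jj) jj≡ (ℕ.<⇒≤ (n<B^n jj))
      5jj≤n₀ : 5 ℕ.* jj ℕ.+ 1 ℕ.≤ n₀
      5jj≤n₀ = ι-cancel (lin 4 (λ s j n e → (s :≡ :ι 5 :* j :+ :ι 1) ⇒ (n :≡ :ι 5 :* j :+ :ι 1 :+ :ι 4 :* e) ⇒ (:ι 0 :≤ e) ⇒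
          (s :≤ n)) _ (ι jj) _ _ (trans (ι-+ (5 ℕ.* jj) 1) (⊕-congʳ (ι-* 5 jj))) n₀-def
        (0≼⊗ (0≼ι dd) (lin 1 (λ j → (:ι 0 :≤ j) ⇒ (:ι 0 :≤ :ι 96 :* j :+ :ι 5000)) _ (0≼ι j₀))))
      y₀≤X : y₀ ℕ.≤ X
      y₀≤X = ℕ.≤-trans (ℕ.≤-trans (ℕ.m≤n*m y₀ 4) 4y₀≤Bjj)
          (ℕ.≤-trans (ℕ.^-monoʳ-≤ B {{ℕ.>-nonZero 1≤B}} (ℕ.≤-trans (ℕ.≤-trans (ℕ.m≤n*m jj 5) (ℕ.m≤m+n _ 1)) 5jj≤n₀)) (ℕ.≤-trans Bn₀≤u u≤X))

      δ : R
      δ = rec dd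
      0≼δ : ι 0 ≼ δ
      0≼δ = rec-nonneg dd
      ddδ : ι dd ⊗ δ ≡ ι 1
      ddδ = rec-inv′ dd 1≤dd
      lgy₀ : lg y₀ ≡ ι j₀ ⊗ lg 2
      lgy₀ = lg-^′ LG 2 j₀ (s≤s z≤n)

      SU : Setup Z LG
      SU = record
        { k = k ; u = u ; y₀ = y₀ ; δ = δ ; 20≤k = 20≤k ; 1≤u = 1≤u ; 8ku≤Z = 8X≤Z
        ; 100k≤y₀ = ι-cancel (lin 5 (λ h k d j y → (h :≡ :ι 100 :* k) ⇒ (:ι 1000 :* k :≤ d) ⇒ (d :* :ι 4832 :≤ j) ⇒ (j :≤ y) ⇒ (:ι 20 :≤ k)
            ⇒ (h :≤ y)) _ _ _ _ _ (ι-* 100 k) dd≥ dd≤j₀ j₀≼y₀ 20≼k)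
        ; 0≼δ = 0≼δ
        ; δ-small = lin 3 (λ k d e → (:ι 0 :≤ (d :- :ι 1000 :* k) :* e) ⇒ (d :* e :≡ :ι 1) ⇒ (:ι 1000 :* (k :* e) :≤ :ι 1)) (ι k) (ι dd) δ
            (0≼⊗ (≼-sub dd≥) 0≼δ) ddδ
        ; δ-log = lin 5 (λ d e j l y → (y :≡ j :* l) ⇒ (j :≡ :ι 4832 :* d) ⇒ (e :* y :≡ e :* (j :* l)) ⇒
            (j :* (e :* l) :≡ (:ι 4832 :* d) :* (e :* l)) ⇒ ((d :* e) :* l :≡ :ι 1 :* l) ⇒ (:ι 1 :≤ :ι 4 :* l) ⇒ (:ι 1208 :≤ e :* y))
            (ι dd) δ (ι j₀) (lg 2) (lg y₀) lgy₀ j₀-def (⊗-congˡ lgy₀) (⊗-congʳ j₀-def) (⊗-congʳ ddδ) (4lg2≽1 1≤Z)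
        ; δ-y₀ = lin 4 (λ d e j y → (:ι 0 :≤ e :* (j :- d :* :ι 4832)) ⇒ (:ι 0 :≤ e :* (y :- j)) ⇒ (d :* e :≡ :ι 1) ⇒ (:ι 2 :≤ e :* y))
            (ι dd) δ (ι j₀) (ι y₀) (0≼⊗ 0≼δ (≼-sub dd≤j₀)) (0≼⊗ 0≼δ (≼-sub j₀≼y₀)) ddδ
        ; y₀≤ku = y₀≤X
        }

      lgB₁ : lg (2 ^ b₁) ≡ ι 1925 ⊗ lg 2
      lgB₁ = trans (lg-^′ LG 2 b₁ (s≤s z≤n)) (⊗-congʳ b₁-def)
      long : lg 2 ⊕ ι 481 ≼ lg (2 ^ b₁)
      long = lin 2 (λ l b → (b :≡ :ι 1925 :* l) ⇒ (:ι 1 :≤ :ι 4 :* l) ⇒ (l :+ :ι 481 :≤ b)) _ _ lgB₁ (4lg2≽1 1≤Z)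
      2≤B₁ : 2 ℕ.≤ 2 ^ b₁
      2≤B₁ = ℕ.≤-trans (ι-cancel (lin 1 (λ b → (b :≡ :ι 1925) ⇒ (:ι 2 :≤ b)) _ b₁-def)) (ℕ.<⇒≤ (n<2^n b₁))
      lgB : lg B ≼ ι 3852
      lgB = lin 3 (λ b l c → (b :≡ l :+ c) ⇒ (c :≡ :ι 1925 :* l) ⇒ (l :≤ :ι 2) ⇒ (b :≤ :ι 3852)) _ _ _ (lg-* 2 (2 ^ b₁) (s≤s z≤n) (1≤2^ b₁))
          lgB₁ (lg2≼2 1≤Z)

      module E = Erdos₄ Z LG SU (2 ^ b₁) 2≤B₁ long

      -- With s about √Y and t about √s, lg Y ≤ 8 t turns `ψ-gap` into 9 s t. From 18 dd ≤ t, t² ≤ s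
      -- and s² ≤ 2 X follows 9 dd s t ≤ X.
      gap : ψ Y ⊖ ψ X ≼ δ ⊗ ι X
      gap = fromRoots (floorSqrt Y)
        where
        Y<2X : Y ℕ.< 2 ℕ.* X
        Y<2X = ℕ.+-monoʳ-< X (ℕ.<-≤-trans (subst (ℕ._< k ℕ.* u) (ℕ.*-identityˡ u)
            (ℕ.*-monoˡ-< u {{ℕ.>-nonZero 1≤u}} (ℕ.≤-trans (s≤s (s≤s z≤n)) 20≤k))) (ℕ.m≤m+n X 0))
        Y≤Z : Y ℕ.≤ Z
        Y≤Z = ℕ.≤-trans (ℕ.<⇒≤ Y<2X) (ℕ.≤-trans (ℕ.*-monoˡ-≤ X {2} {8} (s≤s (s≤s z≤n))) 8X≤Z)
        1≤Y = ℕ.≤-trans 1≤X (ℕ.m≤m+n X u)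
        fromRoots : (∃ λ s → s ℕ.* s ℕ.≤ Y × Y ℕ.< suc s ℕ.* suc s) → ψ Y ⊖ ψ X ≼ δ ⊗ ι X
        fromRoots (s , s²≤Y , Y<s²) with floorSqrt s
        ... | t , t²≤s , s<t² = ⊗-cancelˡ dd 1≤dd
            (lin 7 (λ g s l t d e x → (g :≤ s :* (l :+ :ι 1)) ⇒ (:ι 0 :≤ (d :* s) :* (:ι 8 :* t :- l)) ⇒ (d :* g :≤ d :* (s :* (l :+ :ι 1)))
            ⇒ (:ι 0 :≤ (d :* s) :* (t :- :ι 1)) ⇒ (:ι 0 :≤ (s :* t) :* (t :- :ι 18 :* d)) ⇒
              (:ι 0 :≤ s :* (s :- t :* t)) ⇒ (s :* s :≤ :ι 2 :* x) ⇒ ((d :* e) :* x :≡ :ι 1 :* x) ⇒ (d :* g :≤ d :* (e :* x))) (ψ Y ⊖ ψ X)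
                  (ι s) (lg Y) (ι t) (ι dd) δ (ι X)
            pg (0≼⊗ ds (≼-sub lgY)) (⊗-monoˡ (ι dd) (0≼ι dd) pg) (0≼⊗ ds (≼-sub (ι-mono 1≤t)))
                (0≼⊗ (0≼⊗ (0≼ι s) (0≼ι t)) (≼-sub (≼-trans (≼-reflexive (sym (ι-* 18 dd))) (ι-mono 18dd≤t))))
            (0≼⊗ (0≼ι s) (≼-sub (≼-trans (≼-reflexive (sym (ι-* t t))) (ι-mono t²≤s))))
            (≼-trans (≼-reflexive (sym (ι-* s s))) (≼-trans (ι-mono (ℕ.≤-trans s²≤Y (ℕ.<⇒≤ Y<2X))) (≼-reflexive (ι-* 2 X)))) (⊗-congʳ ddδ))
          where
          ds : ι 0 ≼ ι dd ⊗ ι s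
          ds = 0≼⊗ (0≼ι dd) (0≼ι s)
          pg : ψ Y ⊖ ψ X ≼ ι s ⊗ (lg Y ⊕ ι 1)
          pg = ψ-gap X Y s Y≤Z Y<2X (ℕ.m≤m+n X u) no-prime Y<s²
          Y≤t⁴ : Y ℕ.< (suc t ℕ.* suc t) ℕ.* (suc t ℕ.* suc t)
          Y≤t⁴ = ℕ.<-≤-trans Y<s² (ℕ.*-mono-≤ s<t² s<t²)
          18dd≤t : 18 ℕ.* dd ℕ.≤ t
          18dd≤t = ℕ.≮⇒≥ (λ lt → ℕ.<⇒≱ Y≤t⁴ (ℕ.≤-trans (ℕ.*-mono-≤ (ℕ.*-mono-≤ lt lt) (ℕ.*-mono-≤ lt lt)) (ℕ.≤-trans dd⁴≤u (ℕ.m≤n+m u X))))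
          1≤t : 1 ℕ.≤ t
          1≤t = ℕ.≤-trans (ℕ.*-mono-≤ {1} {18} (s≤s z≤n) 1≤dd) 18dd≤t
          t≤2 : suc t ℕ.≤ 2 ℕ.* t
          t≤2 = ℕ.+-mono-≤ 1≤t (ℕ.m≤m+n t 0)
          t≤Z : t ℕ.≤ Z
          t≤Z = ℕ.≤-trans (ℕ.m≤m*n t t {{ℕ.>-nonZero 1≤t}})
              (ℕ.≤-trans t²≤s (ℕ.≤-trans (ℕ.m≤m*n s s {{ℕ.>-nonZero (ℕ.≤-trans (ℕ.*-mono-≤ 1≤t 1≤t) t²≤s)}}) (ℕ.≤-trans s²≤Y Y≤Z)))
          t⁴≤Z : (suc t ℕ.* suc t) ℕ.* (suc t ℕ.* suc t) ℕ.≤ Z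
          t⁴≤Z = ι-cancel (≼-trans (≼-reflexive (trans (ι-* (suc t ℕ.* suc t) _) (cong₂ _⊗_ (ι-* (suc t) (suc t)) (ι-* (suc t) (suc t)))))
             (lin 5 (λ a t s x z → (:ι 0 :≤ (a :* (a :* a)) :* (:ι 2 :* t :- a)) ⇒ (:ι 0 :≤ (t :* (a :* a)) :* (:ι 2 :* t :- a)) ⇒
                 (:ι 0 :≤ (t :* (t :* a)) :* (:ι 2 :* t :- a)) ⇒ (:ι 0 :≤ (t :* (t :* t)) :* (:ι 2 :* t :- a)) ⇒
                 (:ι 0 :≤ (t :* t) :* (s :- t :* t)) ⇒ (:ι 0 :≤ s :* (s :- t :* t)) ⇒ (s :* s :≤ :ι 2 :* x) ⇒ (:ι 32 :* x :≤ z) ⇒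
                     ((a :* a) :* (a :* a) :≤ z)) (ι (suc t)) (ι t) (ι s) (ι X) (ι Z)
               (0≼⊗ (p a a a) d) (0≼⊗ (p t a a) d) (0≼⊗ (p t t a) d) (0≼⊗ (p t t t) d) (0≼⊗ (0≼⊗ (0≼ι t) (0≼ι t)) ts) (0≼⊗ (0≼ι s) ts)
               (≼-trans (≼-reflexive (sym (ι-* s s))) (≼-trans (ι-mono (ℕ.≤-trans s²≤Y (ℕ.<⇒≤ Y<2X))) (≼-reflexive (ι-* 2 X))))
                   (≼-trans (≼-reflexive (sym (ι-* 32 X))) (ι-mono 32X≤Z))))
            where
            a = suc t
            p : ∀ x y z → ι 0 ≼ ι x ⊗ (ι y ⊗ ι z)
            p x y z = 0≼⊗ (0≼ι x) (0≼⊗ (0≼ι y) (0≼ι z))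
            d : ι 0 ≼ ι 2 ⊗ ι t ⊖ ι (suc t)
            d = ≼-sub (≼-trans (ι-mono t≤2) (≼-reflexive (ι-* 2 t)))
            ts : ι 0 ≼ ι s ⊖ ι t ⊗ ι t
            ts = ≼-sub (≼-trans (≼-reflexive (sym (ι-* t t))) (ι-mono t²≤s))
          lgY : lg Y ≼ ι 8 ⊗ ι t
          lgY = lin 5 (λ y q r l t → (y :≤ q) ⇒ (q :≡ r :+ r) ⇒ (r :≡ l :+ l) ⇒ (l :≤ :ι 2 :* t) ⇒ (y :≤ :ι 8 :* t)) _ _ _ _ (ι t)
            (lg-mono 1≤Y (ℕ.<⇒≤ Y≤t⁴) (ℕ.m≤n⇒m≤1+n t⁴≤Z)) (lg-* (suc t ℕ.* suc t) (suc t ℕ.* suc t) (s≤s z≤n) (s≤s z≤n))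
                (lg-* (suc t) (suc t) (s≤s z≤n) (s≤s z≤n))
            (≼-trans (lg-suc≼2H t t≤Z) (⊗-monoˡ (ι 2) (0≼ι 2) (H≼ι t)))

      n₀≤ : ∀ I → X ℕ.< B ^ suc I → n₀ ℕ.≤ I
      n₀≤ I hi = ℕ.≮⇒≥ (λ lt → ℕ.<⇒≱ hi (ℕ.≤-trans (ℕ.^-monoʳ-≤ B {{ℕ.>-nonZero 1≤B}} lt) (ℕ.≤-trans Bn₀≤u u≤X)))

      large : ∀ I → B ^ I ℕ.≤ X → n₀ ℕ.≤ I → ι 48 ⊗ lg y₀ ⊕ ι 5000 ≼ δ ⊗ lg X
      large I lo n₀≤I = lin 10 (λ y j l d e x I n jj lB → (y :≡ j :* l) ⇒ (l :≤ :ι 2) ⇒ (:ι 0 :≤ j :* (:ι 2 :- l)) ⇒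
          (n :≡ :ι 5 :* jj :+ :ι 1 :+ :ι 4 :* (d :* (:ι 96 :* j :+ :ι 5000))) ⇒ (:ι 0 :≤ jj :* e) ⇒ (:ι 0 :≤ e) ⇒
          (n :* e :≡ (:ι 5 :* jj :+ :ι 1 :+ :ι 4 :* (d :* (:ι 96 :* j :+ :ι 5000))) :* e) ⇒
              ((d :* e) :* (:ι 96 :* j :+ :ι 5000) :≡ :ι 1 :* (:ι 96 :* j :+ :ι 5000)) ⇒ (:ι 0 :≤ (I :- n) :* e) ⇒
              (:ι 0 :≤ (:ι 4 :* lB :- :ι 1) :* (I :* e)) ⇒ (:ι 0 :≤ e :* (x :- I :* lB)) ⇒
          (:ι 48 :* y :+ :ι 5000 :≤ e :* x)) (lg y₀) (ι j₀) (lg 2) (ι dd) δ (lg X) (ι I) (ι n₀) (ι jj) (lg B)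
        lgy₀ (lg2≼2 1≤Z) (0≼⊗ (0≼ι j₀) (≼-sub (lg2≼2 1≤Z))) n₀-def (0≼⊗ (0≼ι jj) 0≼δ) 0≼δ (⊗-congʳ n₀-def) (⊗-congʳ ddδ)
            (0≼⊗ (≼-sub (ι-mono n₀≤I)) 0≼δ)
        (0≼⊗ (≼-sub 1≤4lgB) (0≼⊗ (0≼ι I) 0≼δ))
        (0≼⊗ 0≼δ (≼-sub (≼-trans (≼-reflexive (sym (lg-^′ LG B I 1≤B))) (lg-mono (1≤Bn I) lo (ℕ.m≤n⇒m≤1+n X≤Z)))))
        where
        1≤4lgB : ι 1 ≼ ι 4 ⊗ lg B
        1≤4lgB = lin 3 (λ b l c → (b :≡ l :+ c) ⇒ (c :≡ :ι 1925 :* l) ⇒ (:ι 1 :≤ :ι 4 :* l) ⇒ (:ι 1 :≤ :ι 4 :* b)) _ _ _ (lg-* 2 (2 ^ b₁)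
            (s≤s z≤n) (1≤2^ b₁)) lgB₁ (4lg2≽1 1≤Z)

      tiny : ι 61440 ⊗ (((ι k ⊗ ι k) ⊗ δ) ⊗ lg B) ≼ ι 1
      tiny = lin 4 (λ q d e b → (:ι 0 :≤ (q :* e) :* (:ι 3852 :- b)) ⇒ (d :≡ :ι 240000000 :* q) ⇒ (d :* e :≡ (:ι 240000000 :* q) :* e) ⇒
          (d :* e :≡ :ι 1) ⇒ (:ι 0 :≤ q :* e) ⇒ (:ι 61440 :* ((q :* e) :* b) :≤ :ι 1)) (ι k ⊗ ι k) (ι dd) δ (lg B)
        (0≼⊗ qe (≼-sub lgB)) dd-def (⊗-congʳ dd-def) ddδ qe
        where
        qe : ι 0 ≼ (ι k ⊗ ι k) ⊗ δ
        qe = 0≼⊗ (0≼⊗ (0≼ι k) (0≼ι k)) 0≼δ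

    contradiction : ⊥
    contradiction with floorLog B 2≤B X 1≤X
    ... | I , lo , hi = E.contradiction jj i 4y₀≤Bjj 3jj≤i (subst (λ n → B ^ n ℕ.≤ X) (sym I≡) lo)
        (subst (λ n → X ℕ.< B ^ suc n) (sym I≡) hi) gap (large I lo (n₀≤ I hi)) tiny BX≤Z
      where
      i = I ℕ.∸ (jj ℕ.+ jj)
      5jj≤I : 5 ℕ.* jj ℕ.+ 1 ℕ.≤ I
      5jj≤I = ℕ.≤-trans 5jj≤n₀ (n₀≤ I hi)
      five : 5 ℕ.* jj ℕ.+ 1 ≡ (3 ℕ.* jj ℕ.+ 1) ℕ.+ (jj ℕ.+ jj)
      five = ℕ.≤-antisym (ι-cancel (≼-reflexive e)) (ι-cancel (≼-reflexive (sym e)))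
        where
        e : ι (5 ℕ.* jj ℕ.+ 1) ≡ ι ((3 ℕ.* jj ℕ.+ 1) ℕ.+ (jj ℕ.+ jj))
        e = trans (trans (ι-+ (5 ℕ.* jj) 1) (⊕-congʳ (ι-* 5 jj))) (trans (lin 1 (λ j → :ι 5 :* j :+ :ι 1 :≡ (:ι 3 :* j :+ :ι 1) :+ (j :+ j)) (ι jj))
              (sym (trans (ι-+ (3 ℕ.* jj ℕ.+ 1) _) (cong₂ _⊕_ (trans (ι-+ (3 ℕ.* jj) 1) (⊕-congʳ (ι-* 3 jj))) (ι-+ jj jj)))))
      2jj≤I : jj ℕ.+ jj ℕ.≤ I
      2jj≤I = ℕ.≤-trans (ℕ.m≤n+m (jj ℕ.+ jj) (3 ℕ.* jj ℕ.+ 1)) (subst (ℕ._≤ I) five 5jj≤I)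
      I≡ : i ℕ.+ (jj ℕ.+ jj) ≡ I
      I≡ = ℕ.m∸n+n≡m 2jj≤I
      3jj≤i : 3 ℕ.* jj ℕ.+ 1 ℕ.≤ i
      3jj≤i = ℕ.m+n≤o⇒m≤o∸n (3 ℕ.* jj ℕ.+ 1) (subst (ℕ._≤ I) five 5jj≤I)

  abstract
    private
      constants : ∀ k → ∃ λ dd → ∃ λ j₀ → ∃ λ b₁ → ∃ λ jj → ∃ λ n₀ → ι dd ≡ ι 240000000 ⊗ (ι k ⊗ ι k) × ι j₀ ≡ ι 4832 ⊗ ι dd × ι b₁ ≡ ι 1925
        × ι jj ≡ ι 4 ⊗ ι (2 ^ j₀) × ι n₀ ≡ ι 5 ⊗ ι jj ⊕ ι 1 ⊕ ι 4 ⊗ (ι dd ⊗ (ι 96 ⊗ ι j₀ ⊕ ι 5000))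
      -- Since lg 2 is at least 1/4, 1924 lg 2 is at least 481: the length of stretch that
      -- `mid-exists` asks for.
      constants k = dd , j₀ , 1925 , jj , n₀ , trans (ι-* 240000000 (k ℕ.* k)) (⊗-congˡ (ι-* k k)) , ι-* 4832 dd , refl , ι-* 4 (2 ^ j₀) ,
          trans (ι-+ (5 ℕ.* jj ℕ.+ 1) _) (cong₂ _⊕_ (trans (ι-+ (5 ℕ.* jj) 1) (⊕-congʳ (ι-* 5 jj)))
              (trans (ι-* 4 _) (⊗-congˡ (trans (ι-* dd _) (⊗-congˡ (trans (ι-+ (96 ℕ.* j₀) 5000) (⊕-congʳ (ι-* 96 j₀))))))))
        where
        dd j₀ jj n₀ : ℕ
        -- The reciprocal of δ. As lg B = 1926 lg 2 ≤ 3852, `tiny` needs 61440 · 3852 k², which is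
        -- below this.
        dd = 240000000 ℕ.* (k ℕ.* k)
        -- 4832 = 4 · 1208, so that δ lg (2 ^ j₀) ≥ 1208 follows from lg 2 ≥ 1/4.
        j₀ = 4832 ℕ.* dd
        jj = 4 ℕ.* 2 ^ j₀
        -- The first summand leaves 3 jj + 1 stretches after 2 jj are set aside at the ends; the
        -- second makes δ lg X exceed 48 lg y₀ + 5000, using lg B ≥ 1/4.
        n₀ = (5 ℕ.* jj ℕ.+ 1) ℕ.+ 4 ℕ.* (dd ℕ.* (96 ℕ.* j₀ ℕ.+ 5000))

  -- The search through the interval is finite and decidable, so refuting its failure produces an
  -- actual prime.
  prime-in-interval : ∀ k → 20 ℕ.≤ k → ∃ λ N → ∀ u → N ℕ.≤ u → ∃ λ p → Prime p × k ℕ.* u ℕ.< p × p ℕ.≤ k ℕ.* u ℕ.+ u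
  prime-in-interval k 20≤k with constants k
  ... | dd , j₀ , b₁ , jj , n₀ , e₁ , e₂ , e₃ , e₄ , e₅ = N , find
    where
    N₁ N₂ N : ℕ
    N₁ = (2 ℕ.* 2 ^ b₁) ^ n₀
    N₂ = (18 ℕ.* dd ℕ.* (18 ℕ.* dd)) ℕ.* (18 ℕ.* dd ℕ.* (18 ℕ.* dd))
    N = N₁ ℕ.+ N₂
    find : ∀ u → N ℕ.≤ u → ∃ λ p → Prime p × k ℕ.* u ℕ.< p × p ℕ.≤ k ℕ.* u ℕ.+ u
    find u N≤u with search≤ (λ p → prime? p ×-dec (k ℕ.* u ℕ.<? p)) (k ℕ.* u ℕ.+ u)
    ... | inj₁ (p , le , pp , lt) = p , pp , lt , le
    ... | inj₂ none = ⊥-elim (Contradiction.contradiction k dd j₀ b₁ jj n₀ 20≤k e₁ e₂ e₃ e₄ e₅ u (ℕ.≤-trans (ℕ.m≤m+n N₁ N₂) N≤u)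
        (ℕ.≤-trans (ℕ.m≤n+m N₂ N₁) N≤u)
                                     (λ p pp lt le → none p le (pp , lt)))

-- Arithmetic modulo a prime

module PrimeField where
  open LegendreSieve using (prime≥2; prime≥1)
  open import Data.Nat.Primality using (Prime; euclidsLemma)
  import Data.Nat.Divisibility as ℕ
  open import Data.Integer as ℤ using (ℤ; +_; _+_; _*_; _-_; _^_; -_)
  import Data.Integer.Properties as ℤ
  open import Data.Integer.Divisibility.Signed as ℤ using (_∣_; divides; ∣ᵤ⇒∣; ∣⇒∣ᵤ)
  open import Data.Integer.Tactic.RingSolver using (solve-∀)
  open import Data.Vec using (Vec; []; _∷_; replicate)
  open import Relation.Nullary.Decidable using (map′)

  module Mod (p : ℕ) (pp : Prime p) where
    infix 4 _≈_ _≈?_ _by_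
    -- With an explicit quotient the congruence rules become ring identities for `solve-∀`.
    record _≈_ (a b : ℤ) : Set where
      constructor _by_
      field
        quot : ℤ
        eqn  : a ≡ b + quot * + p

    ≈-refl : ∀ {a} → a ≈ a
    ≈-refl {a} = + 0 by lemma a (+ p)
      where lemma : ∀ a P → a ≡ a + + 0 * P
            lemma = solve-∀

    ≡⇒≈ : ∀ {a b} → a ≡ b → a ≈ b
    ≡⇒≈ refl = ≈-refl

    ≈-sym : ∀ {a b} → a ≈ b → b ≈ a
    ≈-sym {b = b} (c by refl) = - c by lemma b c (+ p)
      where lemma : ∀ b c P → b ≡ b + c * P + (- c) * P
            lemma = solve-∀

    ≈-trans : ∀ {a b c} → a ≈ b → b ≈ c → a ≈ c
    ≈-trans {c = c} (x by refl) (y by refl) = y + x by lemma c x y (+ p)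
      where lemma : ∀ c x y P → c + y * P + x * P ≡ c + (y + x) * P
            lemma = solve-∀

    *-cong : ∀ {a b c d} → a ≈ b → c ≈ d → a * c ≈ b * d
    *-cong {b = b} {d = d} (x by refl) (y by refl) = b * y + x * d + x * y * + p by lemma b d x y (+ p)
      where lemma : ∀ b d x y P → (b + x * P) * (d + y * P) ≡ b * d + (b * y + x * d + x * y * P) * P
            lemma = solve-∀

    *-congˡ : ∀ a {b c} → b ≈ c → a * b ≈ a * c
    *-congˡ a h = *-cong (≈-refl {a}) h

    +-cong : ∀ {a b c d} → a ≈ b → c ≈ d → a + c ≈ b + d
    +-cong {b = b} {d = d} (x by refl) (y by refl) = x + y by lemma b d x y (+ p)
      where lemma : ∀ b d x y P → b + x * P + (d + y * P) ≡ b + d + (x + y) * P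
            lemma = solve-∀

    ^-cong : ∀ {a b} n → a ≈ b → a ^ n ≈ b ^ n
    ^-cong zero    h = ≈-refl
    ^-cong (suc n) h = *-cong h (^-cong n h)

    1^ : ∀ n → (+ 1) ^ n ≡ + 1
    1^ = ℤ.^-zeroˡ

    private
      ≈0⇒∣ : ∀ {a} → a ≈ + 0 → p ℕ.∣ ℤ.∣ a ∣
      ≈0⇒∣ (c by e) = ∣⇒∣ᵤ (divides c (trans e (ℤ.+-identityˡ _)))

      ∣⇒≈0 : ∀ {a} → p ℕ.∣ ℤ.∣ a ∣ → a ≈ + 0
      ∣⇒≈0 d with ∣ᵤ⇒∣ d
      ... | divides c e = c by trans e (sym (ℤ.+-identityˡ _))

    to-diff : ∀ {a b} → a ≈ b → a - b ≈ + 0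
    to-diff {b = b} (c by refl) = c by lemma b c (+ p)
      where lemma : ∀ b c P → b + c * P - b ≡ + 0 + c * P
            lemma = solve-∀

    from-diff : ∀ {a b} → a - b ≈ + 0 → a ≈ b
    from-diff {a} {b} (c by e) = c by trans (lemma a b) (trans (cong (_+_ b) e) (lemma′ b c (+ p)))
      where lemma : ∀ a b → a ≡ b + (a - b)
            lemma = solve-∀
            lemma′ : ∀ b c P → b + (+ 0 + c * P) ≡ b + c * P
            lemma′ = solve-∀

    _≈?_ : ∀ a b → Dec (a ≈ b)
    a ≈? b = map′ (λ d → from-diff (∣⇒≈0 d)) (λ h → ≈0⇒∣ (to-diff h)) (p ℕ.∣? ℤ.∣ a - b ∣)

    zero-product : ∀ a b → a * b ≈ + 0 → a ≈ + 0 ⊎ b ≈ + 0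
    zero-product a b h with euclidsLemma ℤ.∣ a ∣ ℤ.∣ b ∣ pp (subst (p ℕ.∣_) (ℤ.abs-* a b) (≈0⇒∣ h))
    ... | inj₁ d = inj₁ (∣⇒≈0 d)
    ... | inj₂ d = inj₂ (∣⇒≈0 d)

    small-≉0 : ∀ n → 1 ℕ.≤ n → n ℕ.< p → ¬ (+ n ≈ + 0)
    small-≉0 (suc n) _ lt h = ℕ.<⇒≱ lt (ℕ.∣⇒≤ (≈0⇒∣ h))

    1≉0 : ¬ (+ 1 ≈ + 0)
    1≉0 = small-≉0 1 ℕ.≤-refl (prime≥2 pp)

    cancelˡ : ∀ a b c → ¬ (a ≈ + 0) → a * b ≈ a * c → b ≈ c
    cancelˡ a b c a≉0 h with zero-product a (b - c) (subst (_≈ + 0) (lemma a b c) (to-diff h))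
      where lemma : ∀ a b c → a * b - a * c ≡ a * (b - c)
            lemma = solve-∀
    ... | inj₁ e = ⊥-elim (a≉0 e)
    ... | inj₂ e = from-diff e

    ^-≉0 : ∀ a n → ¬ (a ≈ + 0) → ¬ (a ^ n ≈ + 0)
    ^-≉0 a zero    h e = 1≉0 e
    ^-≉0 a (suc n) h e with zero-product a (a ^ n) e
    ... | inj₁ z = h z
    ... | inj₂ z = ^-≉0 a n h z

    -- Monic polynomials of degree n, constant coefficient first
    eval : ∀ {n} → Vec ℤ n → ℤ → ℤ
    eval []      x = + 1
    eval (a ∷ f) x = a + x * eval f x

    private
      comb : ∀ {n} → ℤ → Vec ℤ (suc n) → Vec ℤ n → Vec ℤ (suc n)
      comb r (b ∷ [])        []      = (b + r) ∷ []
      comb r (b ∷ f@(_ ∷ _)) (c ∷ q) = (b + r * c) ∷ comb r f q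

      eval-comb : ∀ {n} r (f : Vec ℤ (suc n)) q x → eval (comb r f q) x ≡ eval f x + r * eval q x
      eval-comb r (b ∷ []) [] x = lemma b r x
        where lemma : ∀ b r x → (b + r) + x * + 1 ≡ b + x * + 1 + r * + 1
              lemma = solve-∀
      eval-comb r (b ∷ f@(_ ∷ _)) (c ∷ q) x = trans (cong (λ e → b + r * c + x * e) (eval-comb r f q x)) (lemma b r c x (eval f x) (eval q x))
        where lemma : ∀ b r c x F Q → b + r * c + x * (F + r * Q) ≡ b + x * F + r * (c + x * Q)
              lemma = solve-∀

      -- Synthetic division of f - f(r) by x - r; the quotient of a monic polynomial is monic, which
      -- is why the leading coefficient is left implicit.
      quotient : ∀ {n} → ℤ → Vec ℤ (suc n) → Vec ℤ n
      quotient r (a ∷ [])        = []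
      quotient r (a ∷ f@(_ ∷ _)) = comb r f (quotient r f)

      eval-quotient : ∀ {n} r (f : Vec ℤ (suc n)) x → eval f x - eval f r ≡ (x - r) * eval (quotient r f) x
      eval-quotient r (a ∷ []) x = lemma a x r
        where lemma : ∀ a x r → a + x * + 1 - (a + r * + 1) ≡ (x - r) * + 1
              lemma = solve-∀
      eval-quotient r (a ∷ f@(_ ∷ _)) x = begin
        a + x * eval f x - (a + r * eval f r)                  ≡⟨ lemma a x r (eval f x) (eval f r) ⟩
        (x - r) * eval f x + r * (eval f x - eval f r)         ≡⟨ cong (λ e → (x - r) * eval f x + r * e) (eval-quotient r f x) ⟩
        (x - r) * eval f x + r * ((x - r) * eval Q x)          ≡⟨ lemma′ (x - r) (eval f x) r (eval Q x) ⟩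
        (x - r) * (eval f x + r * eval Q x)                    ≡⟨ cong ((x - r) *_) (sym (eval-comb r f Q x)) ⟩
        (x - r) * eval (comb r f Q) x                          ∎
        where
        open ≡-Reasoning
        Q = quotient r f
        lemma : ∀ a x r F G → a + x * F - (a + r * G) ≡ (x - r) * F + r * (F - G)
        lemma = solve-∀
        lemma′ : ∀ d F r Q → d * F + r * (d * Q) ≡ d * (F + r * Q)
        lemma′ = solve-∀

    -- Lagrange's bound: dividing out the last root leaves a monic polynomial of lower degree, and p
    -- being prime, the other roots are roots of it.
    few-roots : ∀ n (f : Vec ℤ n) (r : ℕ → ℤ) → (∀ i → i ℕ.≤ n → eval f (r i) ≈ + 0) → (∀ i j → i ℕ.< j → j ℕ.≤ n → ¬ (r i ≈ r j)) → ⊥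
    few-roots zero    [] r root distinct = 1≉0 (root 0 z≤n)
    few-roots (suc n) f  r root distinct = few-roots n (quotient (r (suc n)) f) r root′ (λ i j lt le → distinct i j lt (ℕ.m≤n⇒m≤1+n le))
      where
      root′ : ∀ i → i ℕ.≤ n → eval (quotient (r (suc n)) f) (r i) ≈ + 0
      root′ i le with zero-product (r i - r (suc n)) (eval (quotient (r (suc n)) f) (r i))
                        (subst (_≈ + 0) (eval-quotient (r (suc n)) f (r i))
                            (to-diff (≈-trans (root i (ℕ.m≤n⇒m≤1+n le)) (≈-sym (root (suc n) ℕ.≤-refl)))))
      ... | inj₁ e = ⊥-elim (distinct i (suc n) (s≤s le) ℕ.≤-refl (from-diff e))
      ... | inj₂ e = e

    private
      eval-x^n : ∀ n x → eval (replicate n (+ 0)) x ≡ x ^ n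
      eval-x^n zero    x = refl
      eval-x^n (suc n) x = trans (ℤ.+-identityˡ _) (cong (x *_) (eval-x^n n x))

    small-distinct : ∀ i j → 1 ℕ.≤ i → i ℕ.< j → j ℕ.< p → ¬ (+ i ≈ + j)
    small-distinct i j l lt lt′ h = small-≉0 (j ℕ.∸ i) (ℕ.m<n⇒0<n∸m lt) (ℕ.≤-<-trans (ℕ.m∸n≤m j i) lt′)
      (subst (_≈ + 0) (trans (ℤ.m-n≡m⊖n j i) (ℤ.⊖-≥ (ℕ.<⇒≤ lt))) (to-diff (≈-sym h)))

    -- Otherwise 1, ..., d + 1 would be d + 1 distinct roots of x ^ d - 1.
    non-root : ∀ d → 1 ℕ.≤ d → suc d ℕ.< p → ∃ λ x → ¬ (+ x ≈ + 0) × ¬ ((+ x) ^ d ≈ + 1)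
    non-root (suc d) _ lt = search (suc (suc d)) lt (λ none → few-roots (suc d) ((- (+ 1)) ∷ replicate d (+ 0)) (λ i → + suc i)
        (λ i le → subst (_≈ + 0) (trans (lemma ((+ suc i) ^ suc d)) (cong (λ e → - + 1 + (+ suc i) * e) (sym (eval-x^n d (+ suc i)))))
            (to-diff (none i (s≤s le))))
        (λ i j lt′ le → small-distinct (suc i) (suc j) (s≤s z≤n) (s≤s lt′) (ℕ.≤-<-trans (s≤s le) lt)))
      where
      lemma : ∀ a → a - + 1 ≡ - + 1 + a
      lemma = solve-∀
      search : ∀ n → n ℕ.< p → ((∀ i → i ℕ.< n → (+ suc i) ^ suc d ≈ + 1) → ⊥) → ∃ λ x → ¬ (+ x ≈ + 0) × ¬ ((+ x) ^ suc d ≈ + 1)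
      search zero    _  h = ⊥-elim (h (λ i ()))
      search (suc n) lt h with (+ suc n) ^ suc d ≈? + 1
      ... | no ≉  = suc n , small-≉0 (suc n) (s≤s z≤n) lt , ≉
      ... | yes e = search n (ℕ.<-trans (ℕ.n<1+n n) lt) (λ all → h (λ i i≤n → extend all i i≤n))
        where
        extend : (∀ i → i ℕ.< n → (+ suc i) ^ suc d ≈ + 1) → ∀ i → i ℕ.< suc n → (+ suc i) ^ suc d ≈ + 1
        extend all i i≤n with i ℕ.≟ n
        ... | yes refl = e
        ... | no i≢n   = all i (ℕ.≤∧≢⇒< (ℕ.≤-pred i≤n) i≢n)

    private
      choose : ℕ → ℕ → ℕ
      choose n       zero    = 1
      choose zero    (suc k) = 0
      choose (suc n) (suc k) = choose n k ℕ.+ choose n (suc k)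

      choose-> : ∀ n k → n ℕ.< k → choose n k ≡ 0
      choose-> zero    (suc k) _        = refl
      choose-> (suc n) (suc k) (s≤s lt) = cong₂ ℕ._+_ (choose-> n k lt) (choose-> n (suc k) (ℕ.m<n⇒m<1+n lt))

      choose-n : ∀ n → choose n n ≡ 1
      choose-n zero    = refl
      choose-n (suc n) = cong₂ ℕ._+_ (choose-n n) (choose-> n (suc n) ℕ.≤-refl)

      -- Shows that p divides k times the binomial coefficient of p over k, hence the coefficient
      -- itself for 0 < k < p.
      absorb : ∀ n k → suc k ℕ.* choose (suc n) (suc k) ≡ suc n ℕ.* choose n k
      absorb zero    zero    = refl
      absorb zero    (suc k) = ℕ.*-zeroʳ (suc (suc k))
      absorb (suc n) zero    = begin
        (1 ℕ.+ choose (suc n) 1) ℕ.+ 0    ≡⟨ ℕ.+-identityʳ _ ⟩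
        1 ℕ.+ choose (suc n) 1            ≡⟨ cong suc (trans (sym (ℕ.+-identityʳ _)) (absorb n 0)) ⟩
        suc (suc n ℕ.* 1)                 ≡⟨⟩
        suc (suc n) ℕ.* 1                 ∎
        where open ≡-Reasoning
      absorb (suc n) (suc k) = begin
        suc (suc k) ℕ.* (a ℕ.+ b)                                 ≡⟨ ℕ.*-distribˡ-+ (suc (suc k)) a b ⟩
        (a ℕ.+ suc k ℕ.* a) ℕ.+ suc (suc k) ℕ.* b                 ≡⟨ cong₂ (λ u v → (a ℕ.+ u) ℕ.+ v) (absorb n k) (absorb n (suc k)) ⟩
        (a ℕ.+ suc n ℕ.* choose n k) ℕ.+ suc n ℕ.* choose n (suc k)   ≡⟨ ℕ.+-assoc a _ _ ⟩
        a ℕ.+ (suc n ℕ.* choose n k ℕ.+ suc n ℕ.* choose n (suc k))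
            ≡⟨ cong (a ℕ.+_) (sym (ℕ.*-distribˡ-+ (suc n) (choose n k) (choose n (suc k)))) ⟩
        suc (suc n) ℕ.* a                                         ∎
        where
        open ≡-Reasoning
        a = choose (suc n) (suc k)
        b = choose (suc n) (suc (suc k))

      sum₀ : (ℕ → ℤ) → ℕ → ℤ
      sum₀ f zero    = f 0
      sum₀ f (suc m) = sum₀ f m + f (suc m)

      term : ℕ → ℤ → ℕ → ℤ
      term n x k = + choose n k * x ^ k

      pascal : ∀ n x m → sum₀ (term (suc n) x) (suc m) ≡ sum₀ (term n x) (suc m) + x * sum₀ (term n x) m
      pascal n x zero = trans (cong (λ z → + 1 * + 1 + z * (x * + 1)) (ℤ.pos-+ 1 (choose n 1))) (lemma x (+ choose n 1))
        where lemma : ∀ x c → + 1 * + 1 + (+ 1 + c) * (x * + 1) ≡ + 1 * + 1 + c * (x * + 1) + x * (+ 1 * + 1)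
              lemma = solve-∀
      pascal n x (suc m) = trans (cong₂ _+_ (pascal n x m) (cong (_* (x * (x * x ^ m))) (ℤ.pos-+ (choose n (suc m)) (choose n (suc (suc m))))))
          (lemma (sum₀ (term n x) (suc m)) x (sum₀ (term n x) m) (+ choose n (suc m)) (+ choose n (suc (suc m))) (x ^ m))
        where lemma : ∀ S x S′ a b y → S + x * S′ + (a + b) * (x * (x * y)) ≡ S + b * (x * (x * y)) + x * (S′ + a * (x * y))
              lemma = solve-∀

      binomial : ∀ n x → sum₀ (term n x) n ≡ (+ 1 + x) ^ n
      binomial zero    x = refl
      binomial (suc n) x = begin
        sum₀ (term (suc n) x) (suc n)                                    ≡⟨ pascal n x n ⟩
        sum₀ (term n x) n + + choose n (suc n) * x ^ suc n + x * sum₀ (term n x)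
            n   ≡⟨ cong₂ (λ c s → s + + c * x ^ suc n + x * s) (choose-> n (suc n) ℕ.≤-refl) (binomial n x) ⟩
        (+ 1 + x) ^ n + + 0 * x ^ suc n + x * (+ 1 + x) ^ n              ≡⟨ lemma ((+ 1 + x) ^ n) (x ^ suc n) x ⟩
        (+ 1 + x) * (+ 1 + x) ^ n                                        ∎
        where
        open ≡-Reasoning
        lemma : ∀ S y x → S + + 0 * y + x * S ≡ (+ 1 + x) * S
        lemma = solve-∀

      choose-p : ∀ k → 1 ℕ.≤ k → k ℕ.< p → + choose p k ≈ + 0
      choose-p (suc k) _ lt with zero-product (+ suc k) (+ choose p (suc k)) (subst (_≈ + 0) (ℤ.pos-* (suc k) (choose p (suc k))) (∣⇒≈0 p∣))
        where
        p≡ : suc (ℕ.pred p) ≡ p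
        p≡ = ℕ.suc-pred p {{ℕ.>-nonZero (prime≥1 pp)}}
        p∣ : p ℕ.∣ suc k ℕ.* choose p (suc k)
        p∣ = subst (λ q → q ℕ.∣ suc k ℕ.* choose q (suc k)) p≡
            (subst (suc (ℕ.pred p) ℕ.∣_) (sym (absorb (ℕ.pred p) k)) (ℕ.m∣m*n (choose (ℕ.pred p) k)))
      ... | inj₁ e = ⊥-elim (small-≉0 (suc k) (s≤s z≤n) lt e)
      ... | inj₂ e = e

      partial : ∀ x m → m ℕ.< p → sum₀ (term p x) m ≈ + 1
      partial x zero    lt = ≈-refl
      partial x (suc m) lt = ≈-trans (+-cong (partial x m (ℕ.<-trans (ℕ.n<1+n m) lt))
          (*-cong (choose-p (suc m) (s≤s z≤n) lt) (≈-refl {x ^ suc m}))) (≡⇒≈ (lemma (x ^ suc m)))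
        where lemma : ∀ y → + 1 + + 0 * y ≡ + 1
              lemma = solve-∀

      frobenius : ∀ x → (+ 1 + x) ^ p ≈ + 1 + x ^ p
      frobenius x = subst (λ q → (+ 1 + x) ^ q ≈ + 1 + x ^ q) p≡
          (≈-trans (≡⇒≈ (sym (binomial (suc q) x)))
          (+-cong (subst (λ r → sum₀ (term r x) q ≈ + 1) (sym p≡) (partial x q (subst (q ℕ.<_) p≡ ℕ.≤-refl)))
          (≡⇒≈ (trans (cong (λ c → + c * x ^ suc q) (choose-n (suc q))) (ℤ.*-identityˡ _)))))
        where
        q = ℕ.pred p
        p≡ : suc q ≡ p
        p≡ = ℕ.suc-pred p {{ℕ.>-nonZero (prime≥1 pp)}}

    fermat-p : ∀ x → (+ x) ^ p ≈ + x
    fermat-p zero    = subst (λ q → (+ 0) ^ q ≈ + 0) (ℕ.suc-pred p {{ℕ.>-nonZero (prime≥1 pp)}}) ≈-refl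
    fermat-p (suc x) = ≈-trans (frobenius (+ x)) (+-cong (≈-refl {+ 1}) (fermat-p x))

    q : ℕ
    q = ℕ.pred p

    suc-q : suc q ≡ p
    suc-q = ℕ.suc-pred p {{ℕ.>-nonZero (prime≥1 pp)}}

    fermat : ∀ x → ¬ (+ x ≈ + 0) → (+ x) ^ q ≈ + 1
    fermat x x≉0 = cancelˡ (+ x) _ _ x≉0 (≈-trans (subst (λ r → (+ x) ^ r ≈ + x) (sym suc-q) (fermat-p x)) (≡⇒≈ (sym (ℤ.*-identityʳ (+ x)))))

-- Primitive roots and Ruzsa's Sidon set

module RuzsaSet where
  open LegendreSieve using (prime≥2; prime≥1; primeFactor; prime∣prime)
  open PrimeField
  open import Data.Nat.Induction using (<-rec)
  open import Data.Nat.GCD using (gcd; gcd-GCD; module Bézout; gcd[m,n]∣m; gcd[m,n]∣n)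
  open import Data.Nat.Coprimality using (Coprime; coprime-divisor)
  open import Data.Nat.Primality using (Prime; prime?; euclidsLemma; prime⇒irreducible; ¬prime[1])
  open import Data.Nat.Divisibility using (_∣_; _∣?_; divides; ∣⇒≤; m∣m*n; n∣m*n; ∣1⇒≡1)
  open import Data.Integer as ℤ using (ℤ; +_; _+_; _*_; _-_; _^_; -_)
  import Data.Integer.Properties as ℤ
  open import Data.Integer.DivMod using (_%ℕ_; _/ℕ_; a≡a%ℕn+[a/ℕn]*n)
  open import Data.Integer.Tactic.RingSolver using (solve-∀)

  valuation : ∀ r → Prime r → ∀ n → 1 ℕ.≤ n → ∃ λ a → ∃ λ b → n ≡ r ℕ.^ a ℕ.* b × ¬ (r ∣ b)
  valuation r pr = <-rec (λ n → 1 ℕ.≤ n → ∃ λ a → ∃ λ b → n ≡ r ℕ.^ a ℕ.* b × ¬ (r ∣ b)) step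
    where
    step : ∀ n → (∀ {m} → m ℕ.< n → 1 ℕ.≤ m → ∃ λ a → ∃ λ b → m ≡ r ℕ.^ a ℕ.* b × ¬ (r ∣ b)) → 1 ℕ.≤ n → ∃ λ a → ∃ λ b → n ≡ r ℕ.^ a ℕ.* b × ¬ (r ∣ b)
    step n rec l with r ∣? n
    ... | no ∤ = 0 , n , sym (ℕ.*-identityˡ n) , ∤
    ... | yes (divides zero refl) = ⊥-elim (ℕ.<⇒≱ l z≤n)
    ... | yes (divides m@(suc _) refl) with rec (ℕ.m<m*n m r (prime≥2 pr)) (s≤s z≤n)
    ...   | a , b , e , ∤ = suc a , b , trans (ℕ.*-comm m r) (trans (cong (r ℕ.*_) e) (sym (ℕ.*-assoc r (r ℕ.^ a) b))) , ∤

  prime∣^ : ∀ {r s} a → Prime r → Prime s → r ∣ s ℕ.^ a → r ≡ s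
  prime∣^ zero    pr ps d = ⊥-elim (¬prime[1] (subst Prime (∣1⇒≡1 d) pr))
  prime∣^ {s = s} (suc a) pr ps d with euclidsLemma s (s ℕ.^ a) pr d
  ... | inj₁ e = prime∣prime pr ps e
  ... | inj₂ e = prime∣^ a pr ps e

  ^-distribʳ : ∀ n a b → (a * b) ^ n ≡ a ^ n * b ^ n
  ^-distribʳ zero    a b = refl
  ^-distribʳ (suc n) a b = trans (cong (a * b *_) (^-distribʳ n a b)) (lemma a b (a ^ n) (b ^ n))
    where lemma : ∀ a b x y → a * b * (x * y) ≡ a * x * (b * y)
          lemma = solve-∀

  -- The multiples s M and t M on the two sides express a congruence modulo M without subtraction.
  record SidonSet (q M : ℕ) : Set where
    field
      a     : ℕ → ℕ
      sidon : ∀ i j k l → 1 ℕ.≤ i → i ℕ.≤ q → 1 ℕ.≤ j → j ℕ.≤ q → 1 ℕ.≤ k → k ℕ.≤ q → 1 ℕ.≤ l → l ℕ.≤ q →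
              ∀ s t → a i ℕ.+ a j ℕ.+ s ℕ.* M ≡ a k ℕ.+ a l ℕ.+ t ℕ.* M → (i ≡ k × j ≡ l) ⊎ (i ≡ l × j ≡ k)

  module Primitive (p : ℕ) (pp : Prime p) where
    open Mod p pp

    1≤q : 1 ℕ.≤ q
    1≤q = ℕ.≤-pred (subst (2 ℕ.≤_) (sym suc-q) (prime≥2 pp))

    pow-∣ : ∀ {x m n} → x ^ m ≈ + 1 → m ∣ n → x ^ n ≈ + 1
    pow-∣ {x} {m} h (divides k refl) = ≈-trans (≡⇒≈ (trans (cong (x ^_) (ℕ.*-comm k m)) (sym (ℤ.^-*-assoc x m k))))
        (≈-trans (^-cong k h) (≡⇒≈ (1^ k)))

    pow-gcd : ∀ x m n → x ^ m ≈ + 1 → x ^ n ≈ + 1 → x ^ gcd m n ≈ + 1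
    pow-gcd x m n hm hn with Bézout.identity (gcd-GCD m n)
    ... | Bézout.+- a b e = ≈-trans (≡⇒≈ (sym (ℤ.*-identityʳ _))) (≈-trans (*-congˡ (x ^ gcd m n) (≈-sym (pow-∣ {x} {n} {b ℕ.* n} hn (n∣m*n b))))
          (≈-trans (≡⇒≈ (trans (sym (ℤ.^-distribˡ-+-* x (gcd m n) (b ℕ.* n))) (cong (x ^_) e))) (pow-∣ {x} {m} hm (n∣m*n a))))
    ... | Bézout.-+ a b e = ≈-trans (≡⇒≈ (sym (ℤ.*-identityʳ _))) (≈-trans (*-congˡ (x ^ gcd m n) (≈-sym (pow-∣ {x} {m} {a ℕ.* m} hm (n∣m*n a))))
          (≈-trans (≡⇒≈ (trans (sym (ℤ.^-distribˡ-+-* x (gcd m n) (a ℕ.* m))) (cong (x ^_) e))) (pow-∣ {x} {n} hn (n∣m*n b))))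

    -- g ^ (q / r) ≠ 1 for the primes r ≤ m dividing q: raising m to q makes g primitive.
    Good : ℤ → ℕ → Set
    Good g m = ∀ r e → Prime r → r ℕ.≤ m → q ≡ e ℕ.* r → ¬ (g ^ e ≈ + 1)

    private
      extend : ∀ {g m} → Good g m → (∀ e → Prime (suc m) → q ≡ e ℕ.* suc m → ¬ (g ^ e ≈ + 1)) → Good g (suc m)
      extend {g} {m} good new r e pr le eq with r ℕ.≟ suc m
      ... | yes refl = new e pr eq
      ... | no r≢    = good r e pr (ℕ.≤-pred (ℕ.≤∧≢⇒< le r≢)) eq

      -- Write q = r ^ a b with r not dividing b, and let x ^ (q / r) differ from 1. The factor y =
      -- x ^ b has order dividing r ^ a. For another prime r′ the exponent q / r′ is a multiple of r
      -- ^ a, so y does not disturb the earlier conditions. If (g y) ^ (q / r) were 1, then ζ = x ^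
      -- (q / r) would satisfy ζ ^ b = ζ ^ r = 1 and so ζ = 1.
      enlarge : ∀ g m → g ^ q ≈ + 1 → Good g m → Prime (suc m) → ∀ e → q ≡ e ℕ.* suc m → g ^ e ≈ + 1 → ∃ λ g′ → g′ ^ q ≈ + 1 × Good g′ (suc m)
      enlarge g m gq good pr e eq ge with valuation (suc m) pr q 1≤q | non-root e 1≤e se<p
        where
        1≤e : 1 ℕ.≤ e
        1≤e = ℕ.n≢0⇒n>0 (λ { refl → ℕ.<⇒≢ 1≤q (sym eq) })
        se<p : suc e ℕ.< p
        se<p = subst (suc e ℕ.<_) suc-q (s≤s (subst (suc e ℕ.≤_) (sym eq) (ℕ.m<m*n e (suc m) {{ℕ.>-nonZero 1≤e}} (prime≥2 pr))))
      ... | a , b , q≡ , r∤b | x , x≉0 , xe = g * y , power-q , extend old new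
        where
        r = suc m
        y = (+ x) ^ b
        xq = fermat x x≉0
        *-pow : ∀ n → (g * y) ^ n ≡ g ^ n * y ^ n
        *-pow n = ^-distribʳ n g y
        power-q : (g * y) ^ q ≈ + 1
        power-q = ≈-trans (≡⇒≈ (*-pow q)) (*-cong gq (≈-trans (≡⇒≈ (ℤ.^-*-assoc (+ x) b q)) (pow-∣ {+ x} {q} xq (n∣m*n b))))
        yr : y ^ (r ℕ.^ a) ≈ + 1
        yr = ≈-trans (≡⇒≈ (trans (ℤ.^-*-assoc (+ x) b (r ℕ.^ a)) (cong ((+ x) ^_) (trans (ℕ.*-comm b _) (sym q≡))))) xq
        old : Good (g * y) m
        old r′ e′ pr′ le eq′ h = good r′ e′ pr′ le eq′
            (≈-trans (≡⇒≈ (sym (ℤ.*-identityʳ _))) (≈-trans (*-congˡ (g ^ e′) (≈-sym (pow-∣ {y} {r ℕ.^ a} yr r^a∣e′)))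
            (≈-trans (≡⇒≈ (sym (*-pow e′))) h)))
          where
          coprime : Coprime (r ℕ.^ a) r′
          coprime (d₁ , d₂) with prime⇒irreducible pr′ d₂
          ... | inj₁ z = z
          ... | inj₂ refl = ⊥-elim (ℕ.<⇒≢ (s≤s le) (prime∣^ a pr′ pr d₁))
          r^a∣e′ : r ℕ.^ a ∣ e′
          r^a∣e′ = coprime-divisor coprime (subst (r ℕ.^ a ∣_) (trans (sym q≡) (trans eq′ (ℕ.*-comm e′ r′))) (m∣m*n b))
        new : ∀ e₁ → Prime r → q ≡ e₁ ℕ.* r → ¬ ((g * y) ^ e₁ ≈ + 1)
        new e₁ _ eq₁ h with ℕ.*-cancelʳ-≡ e e₁ r (trans (sym eq) eq₁)
        ... | refl = xe (≈-trans (≡⇒≈ (sym (ℤ.*-identityʳ ((+ x) ^ e)))) (subst (λ d → ζ ^ d ≈ + 1) gcd≡1 (pow-gcd ζ b r ζb ζr)))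
          where
          ζ = (+ x) ^ e
          ζr : ζ ^ r ≈ + 1
          ζr = ≈-trans (≡⇒≈ (trans (ℤ.^-*-assoc (+ x) e r) (cong ((+ x) ^_) (sym eq)))) xq
          ζb : ζ ^ b ≈ + 1
          ζb = ≈-trans (≡⇒≈ (trans (ℤ.^-*-assoc (+ x) e b) (trans (cong ((+ x) ^_) (ℕ.*-comm e b)) (sym (ℤ.^-*-assoc (+ x) b e)))))
                 (≈-trans (≡⇒≈ (sym (ℤ.*-identityˡ (y ^ e)))) (≈-trans (*-cong (≈-sym ge) (≈-refl {y ^ e})) (≈-trans (≡⇒≈ (sym (*-pow e))) h)))
          gcd≡1 : gcd b r ≡ 1
          gcd≡1 with prime⇒irreducible pr (gcd[m,n]∣n b r)
          ... | inj₁ z = z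
          ... | inj₂ z = ⊥-elim (r∤b (subst (_∣ b) z (gcd[m,n]∣m b r)))

      build : ∀ m → ∃ λ g → g ^ q ≈ + 1 × Good g m
      build zero = + 1 , ≡⇒≈ (1^ q) , λ r e pr le _ _ → ℕ.<⇒≱ (prime≥1 pr) le
      build (suc m) with build m | prime? (suc m) | suc m ∣? q
      ... | g , gq , good | no ¬pr | _    = g , gq , extend good (λ e pr → ⊥-elim (¬pr pr))
      ... | g , gq , good | yes pr | no ∤ = g , gq , extend good (λ e _ eq → ⊥-elim (∤ (divides e eq)))
      ... | g , gq , good | yes pr | yes (divides e eq) with g ^ e ≈? + 1
      ...   | no ge  = g , gq , extend good (λ e₁ _ eq₁ h → ge (subst (λ f → g ^ f ≈ + 1) (ℕ.*-cancelʳ-≡ e₁ e (suc m) (trans (sym eq₁) eq)) h))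
      ...   | yes ge = enlarge g m gq good pr e eq ge

    g : ℤ
    g = proj₁ (build q)

    g^q : g ^ q ≈ + 1
    g^q = proj₁ (proj₂ (build q))

    -- If gcd i q were a proper divisor of q, it would divide q / r for some prime r, and g ^ (q /
    -- r) would be 1.
    order : ∀ i → g ^ i ≈ + 1 → q ∣ i
    order i h with gcd[m,n]∣n i q
    ... | divides zero eq = ⊥-elim (ℕ.<⇒≢ 1≤q (sym eq))
    ... | divides (suc zero) eq = subst (_∣ i) (trans (sym (ℕ.*-identityˡ _)) (sym eq)) (gcd[m,n]∣m i q)
    ... | divides f@(suc (suc _)) eq with primeFactor f (s≤s (s≤s z≤n))
    ...   | r , pr , divides f′ ef = ⊥-elim (proj₂ (proj₂ (build q)) r (f′ ℕ.* gcd i q) pr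
              (∣⇒≤ {{ℕ.>-nonZero 1≤q}} (divides (f′ ℕ.* gcd i q) eq′)) eq′ (pow-∣ {g} {gcd i q} (pow-gcd g i q h g^q) (n∣m*n f′)))
      where
      eq′ : q ≡ f′ ℕ.* gcd i q ℕ.* r
      eq′ = trans eq (trans (cong (ℕ._* gcd i q) ef) (trans (ℕ.*-assoc f′ r _) (trans (cong (f′ ℕ.*_) (ℕ.*-comm r _)) (sym (ℕ.*-assoc f′ _ r)))))

    g≉0 : ¬ (g ≈ + 0)
    g≉0 h = 1≉0 (≈-trans (≈-sym g^q) (subst (λ n → g ^ n ≈ + 0) (ℕ.suc-pred q {{ℕ.>-nonZero 1≤q}}) (*-cong h (≈-refl {g ^ ℕ.pred q}))))

    private
      g-injective≤ : ∀ i j → 1 ℕ.≤ i → i ℕ.≤ j → j ℕ.≤ q → g ^ i ≈ g ^ j → i ≡ j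
      g-injective≤ i j l le u h with order (j ℕ.∸ i) (cancelˡ (g ^ i) _ _ (^-≉0 g i g≉0)
           (≈-trans (≡⇒≈ (trans (sym (ℤ.^-distribˡ-+-* g i (j ℕ.∸ i))) (cong (g ^_) (ℕ.m+[n∸m]≡n le))))
               (≈-trans (≈-sym h) (≡⇒≈ (sym (ℤ.*-identityʳ _))))))
      ... | d with j ℕ.∸ i in e
      ...   | zero  = ℕ.≤-antisym le (ℕ.m∸n≡0⇒m≤n e)
      ...   | suc n = ⊥-elim (ℕ.<⇒≱ (subst (ℕ._< j) e (ℕ.∸-monoʳ-< {j} {i} {0} l le)) (ℕ.≤-trans u (∣⇒≤ d)))

    g-injective : ∀ i j → 1 ℕ.≤ i → i ℕ.≤ q → 1 ℕ.≤ j → j ℕ.≤ q → g ^ i ≈ g ^ j → i ≡ j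
    g-injective i j li ui lj uj h with ℕ.≤-total i j
    ... | inj₁ le = g-injective≤ i j li le uj h
    ... | inj₂ ge = sym (g-injective≤ j i lj ge ui (≈-sym h))

    private
      instance _ = ℕ.>-nonZero (prime≥1 pp)

    residue : ℕ → ℕ
    residue i = (g ^ i) %ℕ p

    residue-≈ : ∀ i → g ^ i ≈ + residue i
    residue-≈ i = ((g ^ i) /ℕ p) by a≡a%ℕn+[a/ℕn]*n (g ^ i) p

    -- aᵢ ≡ i (mod p − 1) and aᵢ ≡ − gⁱ (mod p)
    element : ℕ → ℕ
    element i = p ℕ.* i ℕ.+ q ℕ.* residue i

    private
      -- Modulo p one has q ≡ -1, so an element is the negative of its residue and the s, t terms
      -- vanish.
      sum-mod-p : ∀ i j k l s t → element i ℕ.+ element j ℕ.+ s ℕ.* (p ℕ.* q) ≡ element k ℕ.+ element l ℕ.+ t ℕ.* (p ℕ.* q) →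
          g ^ i + g ^ j ≈ g ^ k + g ^ l
      sum-mod-p i j k l s t e = ≈-trans (+-cong (residue-≈ i) (residue-≈ j))
          (≈-trans ((I + H + S - I′ - H′ - T) by final) (≈-sym (+-cong (residue-≈ k) (residue-≈ l))))
        where
        H = + residue i + + residue j
        H′ = + residue k + + residue l
        I = + i + + j
        I′ = + k + + l
        S = + s * + q
        T = + t * + q
        expand : ∀ i j s → + (element i ℕ.+ element j ℕ.+ s ℕ.* (p ℕ.* q)) ≡ + p * + i + + q * + residue i + (+ p * + j + + q * + residue j)
            + + s * (+ p * + q)
        expand i j s = trans (ℤ.pos-+ (element i ℕ.+ element j) _)
            (cong₂ _+_ (trans (ℤ.pos-+ (element i) _) (cong₂ _+_ (el i) (el j))) (trans (ℤ.pos-* s _) (cong (+ s *_) (ℤ.pos-* p q))))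
          where
          el : ∀ i → + element i ≡ + p * + i + + q * + residue i
          el i = trans (ℤ.pos-+ (p ℕ.* i) _) (cong₂ _+_ (ℤ.pos-* p i) (ℤ.pos-* q (residue i)))
        P≡ : + p ≡ + 1 + + q
        P≡ = trans (cong +_ (sym suc-q)) (ℤ.pos-+ 1 q)
        eqn : + p * + i + + q * + residue i + (+ p * + j + + q * + residue j) + + s * (+ p * + q) ≡ + p * + k + + q * + residue k +
            (+ p * + l + + q * + residue l) + + t * (+ p * + q)
        eqn = trans (sym (expand i j s)) (trans (cong +_ e) (expand k l t))
        lemma : ∀ Q i j x y s → (+ 1 + Q) * i + Q * x + ((+ 1 + Q) * j + Q * y) + s * ((+ 1 + Q) * Q) ≡ (i + j + (x + y) + s * Q) *
            (+ 1 + Q) - (x + y)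
        lemma = solve-∀
        eqn′ : (I + H + S) * + p - H ≡ (I′ + H′ + T) * + p - H′
        eqn′ = subst (λ P → (I + H + S) * P - H ≡ (I′ + H′ + T) * P - H′) (sym P≡)
          (trans (sym (lemma (+ q) (+ i) (+ j) (+ residue i) (+ residue j) (+ s)))
              (trans (subst (λ P → P * + i + + q * + residue i + (P * + j + + q * + residue j) + + s * (P * + q)
              ≡ P * + k + + q * + residue k + (P * + l + + q * + residue l) + + t * (P * + q)) P≡ eqn)
            (lemma (+ q) (+ k) (+ l) (+ residue k) (+ residue l) (+ t))))
        final : H ≡ H′ + (I + H + S - I′ - H′ - T) * + p
        final = trans (l₁ H ((I + H + S) * + p)) (trans (cong (λ z → (I + H + S) * + p - z) eqn′) (l₂ H′ (+ p) I H S I′ T))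
          where
          l₁ : ∀ H A → H ≡ A - (A - H)
          l₁ = solve-∀
          l₂ : ∀ H′ P I H S I′ T → (I + H + S) * P - ((I′ + H′ + T) * P - H′) ≡ H′ + (I + H + S - I′ - H′ - T) * P
          l₂ = solve-∀

      -- An element is congruent to its index modulo q and g ^ q ≈ 1, so g raised to both sides of
      -- the equation gives the two products.
      product-mod-p : ∀ i j k l s t → element i ℕ.+ element j ℕ.+ s ℕ.* (p ℕ.* q) ≡ element k ℕ.+ element l ℕ.+ t ℕ.* (p ℕ.* q) →
          g ^ i * g ^ j ≈ g ^ k * g ^ l
      product-mod-p i j k l s t e = ≈-trans (shift i j s) (≈-trans (≡⇒≈ (cong (g ^_) e)) (≈-sym (shift k l t)))
        where
        A : ℕ → ℕ → ℕ → ℕ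
        A i j s = i ℕ.+ residue i ℕ.+ (j ℕ.+ residue j) ℕ.+ s ℕ.* p
        expand : ∀ i j s → element i ℕ.+ element j ℕ.+ s ℕ.* (p ℕ.* q) ≡ (i ℕ.+ j) ℕ.+ q ℕ.* A i j s
        expand i j s = begin
          p ℕ.* i ℕ.+ q ℕ.* x ℕ.+ (p ℕ.* j ℕ.+ q ℕ.* y) ℕ.+ s ℕ.* (p ℕ.* q)
            ≡⟨ cong₂ (λ u v → u ℕ.+ q ℕ.* x ℕ.+ (v ℕ.+ q ℕ.* y) ℕ.+ s ℕ.* (p ℕ.* q)) (cong (ℕ._* i) (sym suc-q)) (cong (ℕ._* j) (sym suc-q)) ⟩
          (i ℕ.+ q ℕ.* i) ℕ.+ q ℕ.* x ℕ.+ ((j ℕ.+ q ℕ.* j) ℕ.+ q ℕ.* y) ℕ.+ s ℕ.* (p ℕ.* q)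
            ≡⟨ lemma i j x y s q p ⟩
          (i ℕ.+ j) ℕ.+ q ℕ.* A i j s ∎
          where
          open ≡-Reasoning
          x = residue i
          y = residue j
          open import Data.Nat.Tactic.RingSolver using () renaming (solve-∀ to solveℕ)
          lemma : ∀ i j x y s q p → (i ℕ.+ q ℕ.* i) ℕ.+ q ℕ.* x ℕ.+ ((j ℕ.+ q ℕ.* j) ℕ.+ q ℕ.* y) ℕ.+ s ℕ.* (p ℕ.* q) ≡ (i ℕ.+ j) ℕ.+ q ℕ.*
              (i ℕ.+ x ℕ.+ (j ℕ.+ y) ℕ.+ s ℕ.* p)
          lemma = solveℕ
        shift : ∀ i j s → g ^ i * g ^ j ≈ g ^ (element i ℕ.+ element j ℕ.+ s ℕ.* (p ℕ.* q))
        shift i j s = ≈-sym (≈-trans (≡⇒≈ (trans (cong (g ^_) (expand i j s)) (ℤ.^-distribˡ-+-* g (i ℕ.+ j) _)))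
          (≈-trans (*-congˡ (g ^ (i ℕ.+ j)) (pow-∣ {g} {q} g^q (m∣m*n (A i j s)))) (≡⇒≈ (trans (ℤ.*-identityʳ _) (ℤ.^-distribˡ-+-* g i j)))))

    ruzsa : SidonSet q (p ℕ.* q)
    ruzsa = record { a = element ; sidon = proof }
      where
      proof : ∀ i j k l → 1 ℕ.≤ i → i ℕ.≤ q → 1 ℕ.≤ j → j ℕ.≤ q → 1 ℕ.≤ k → k ℕ.≤ q → 1 ℕ.≤ l → l ℕ.≤ q →
              ∀ s t → element i ℕ.+ element j ℕ.+ s ℕ.* (p ℕ.* q) ≡ element k ℕ.+ element l ℕ.+ t ℕ.* (p ℕ.* q) → (i ≡ k × j ≡ l) ⊎ (i ≡ l × j ≡ k)
      proof i j k l li ui lj uj lk uk ll ul s t e = roots (zero-product (g ^ k - g ^ i) (g ^ k - g ^ j) factored)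
        where
        Σ≈ = sum-mod-p i j k l s t e
        Π≈ = product-mod-p i j k l s t e
        -- gᵏ is a root of (x − gⁱ)(x − gʲ) = (x − gᵏ)(x − gˡ)
        factored : (g ^ k - g ^ i) * (g ^ k - g ^ j) ≈ + 0
        factored = ≈-trans (≡⇒≈ (l₁ (g ^ i) (g ^ j) (g ^ k)))
            (≈-trans (+-cong (≈-refl {g ^ k * g ^ k}) (+-cong (*-congˡ (- (g ^ k)) Σ≈) Π≈)) (≡⇒≈ (l₂ (g ^ k) (g ^ l))))
          where
          l₁ : ∀ a b c → (c - a) * (c - b) ≡ c * c + ((- c) * (a + b) + a * b)
          l₁ = solve-∀
          l₂ : ∀ c d → c * c + ((- c) * (c + d) + c * d) ≡ + 0
          l₂ = solve-∀
        rest : ∀ i j k l → g ^ i + g ^ j ≈ g ^ k + g ^ l → i ≡ k → g ^ j ≈ g ^ l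
        rest i j .i l h refl = ≈-trans (≡⇒≈ (l₁ (g ^ i) (g ^ j))) (≈-trans (+-cong h (≈-refl { - (g ^ i)})) (≡⇒≈ (l₂ (g ^ i) (g ^ l))))
          where
          l₁ : ∀ a b → b ≡ a + b + (- a)
          l₁ = solve-∀
          l₂ : ∀ a b → a + b + (- a) ≡ b
          l₂ = solve-∀
        roots : (g ^ k - g ^ i ≈ + 0) ⊎ (g ^ k - g ^ j ≈ + 0) → (i ≡ k × j ≡ l) ⊎ (i ≡ l × j ≡ k)
        roots (inj₁ z) = inj₁ (i≡k , g-injective j l lj uj ll ul (rest i j k l Σ≈ i≡k))
          where i≡k = g-injective i k li ui lk uk (≈-sym (from-diff z))
        roots (inj₂ z) = inj₂ (g-injective i l li ui ll ul (rest j i k l (≈-trans (≡⇒≈ (ℤ.+-comm (g ^ j) (g ^ i))) Σ≈) j≡k) , j≡k)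
          where j≡k = g-injective j k lj uj lk uk (≈-sym (from-diff z))

-- Second moment of a Sidon set in short windows

module Equidistribution where
  open OrderedField
  open LinearArithmetic
  open FiniteSums
  open Logarithms using (≼-sub)
  open SummatoryFunctions using (∑-one)
  open RuzsaSet using (SidonSet)
  open import Data.Nat using (NonZero)
  import Data.Nat.DivMod as ℕ
  open import Data.Nat.Tactic.RingSolver using (solve-∀)
  open import Relation.Nullary.Decidable using (_×-dec_; ¬?)

  ∑-shift : ∀ n (g : ℕ → R) → ∑ n (λ t → g (suc t)) ⊕ g 1 ≡ ∑ n g ⊕ g (suc n)
  ∑-shift zero    g = refl
  ∑-shift (suc n) g = lin 4 (λ s a s′ b → (s :+ a :≡ s′) ⇒ (s :+ b :+ a :≡ s′ :+ b)) (∑ n (λ t → g (suc t))) (g 1) (∑ n g ⊕ g (suc n))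
      (g (suc (suc n))) (∑-shift n g)

  ∑-rotate : ∀ M (f : ℕ → R) → (∀ x → f (x ℕ.+ M) ≡ f x) → ∀ c → ∑ M (λ t → f (c ℕ.+ t)) ≡ ∑ M f
  ∑-rotate M f per zero    = refl
  ∑-rotate M f per (suc c) = trans (lin 4 (λ s a s′ b → (s :+ a :≡ s′ :+ b) ⇒ (b :≡ a) ⇒ (s :≡ s′)) _ (f (c ℕ.+ 1))
      (∑ M (λ t → f (c ℕ.+ t))) (f (c ℕ.+ suc M))
      (trans (⊕-congʳ (∑-cong′ M (λ t → cong f (sym (ℕ.+-suc c t))))) (∑-shift M (λ t → f (c ℕ.+ t))))
      (trans (cong f (trans (ℕ.+-suc c M) (cong (ℕ._+ M) (ℕ.+-comm 1 c)))) (per (c ℕ.+ 1)))) (∑-rotate M f per c)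

  ∃≤? : ∀ {P : ℕ → Set} → (∀ i → Dec (P i)) → ∀ n → Dec (∃ λ i → 1 ℕ.≤ i × i ℕ.≤ n × P i)
  ∃≤? P? zero = no (λ { (i , l , u , _) → ℕ.<⇒≱ l u })
  ∃≤? P? (suc n) with P? (suc n) | ∃≤? P? n
  ... | yes p | _ = yes (suc n , s≤s z≤n , ℕ.≤-refl , p)
  ... | no _  | yes (i , l , u , p) = yes (i , l , ℕ.m≤n⇒m≤1+n u , p)
  ∃≤? {P} P? (suc n) | no ¬p | no ¬∃ = no none
    where
    none : ¬ (∃ λ i → 1 ℕ.≤ i × i ℕ.≤ suc n × P i)
    none (i , l , u , p) with i ℕ.≟ suc n
    ... | yes refl = ¬p p
    ... | no i≢    = ¬∃ (i , l , ℕ.≤-pred (ℕ.≤∧≢⇒< u i≢) , p)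

  ∑χ≼χ∃ : ∀ {P : ℕ → Set} (P? : ∀ i → Dec (P i)) n → (∀ i j → 1 ℕ.≤ i → i ℕ.≤ n → 1 ℕ.≤ j → j ℕ.≤ n → P i → P j → i ≡ j) →
    ∑ n (λ i → χ (P? i)) ≼ χ (∃≤? P? n)
  ∑χ≼χ∃ {P} P? n uniq with ∃≤? P? n
  ... | yes (i , l , u , p) = ≼-trans (≼-reflexive
      (∑-single n i (λ i → χ (P? i)) l u (λ j lj uj j≢i → χ-no (P? j) (λ pj → j≢i (uniq j i lj uj l u pj p))))) (χ≼1 (P? i))
  ... | no ¬∃ = ≼-reflexive (trans (∑-cong n (λ i l u → χ-no (P? i) (λ p → ¬∃ (i , l , u , p)))) (∑-zero n))

  ∑-≼-∃ : ∀ {P : ℕ → Set} (P? : ∀ i → Dec (P i)) n → χ (∃≤? P? n) ≼ ∑ n (λ i → χ (P? i))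
  ∑-≼-∃ P? n with ∃≤? P? n
  ... | yes (i , l , u , p) = ≼-trans (≼-reflexive (sym (χ-yes (P? i) p))) (∑-term n (λ i _ _ → 0≼χ (P? i)) i l u)
  ... | no _ = ∑-nonneg n (λ i _ _ → 0≼χ (P? i))

  average : ∀ n (f : ℕ → R) → 1 ℕ.≤ n → ∃ λ t → 1 ℕ.≤ t × t ℕ.≤ n × ι n ⊗ f t ≼ ∑ n f
  average n f 1≤n with ∃≤? (λ t → (ι n ⊗ f t) ≼? ∑ n f) n
  ... | yes r = r
  ... | no ¬∃ = ⊥-elim (¬∃ (1 , ℕ.≤-refl , 1≤n , lin 2 (λ s y → (y :- s :≤ :ι 0) ⇒ (y :≤ s)) (∑ n f) (ι n ⊗ f 1)
        (≼-trans (∑-term n {λ t → ι n ⊗ f t ⊖ ∑ n f} (λ t l u → big t l u) 1 ℕ.≤-refl 1≤n)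
          (≼-reflexive (trans (∑-⊖ n (λ t → ι n ⊗ f t) (λ _ → ∑ n f))
              (trans (cong₂ _⊖_ (∑-⊗ˡ n (ι n) f) (∑-const n (∑ n f))) (lin 1 (λ a → a :- a :≡ :ι 0) _)))))))
    where
    big : ∀ t → 1 ℕ.≤ t → t ℕ.≤ n → ι 0 ≼ ι n ⊗ f t ⊖ ∑ n f
    big t l u with ≼-total (ι n ⊗ f t) (∑ n f)
    ... | inj₁ le = ⊥-elim (¬∃ (t , l , u , le))
    ... | inj₂ ge = ≼-sub ge

  module SecondMoment (q M p : ℕ) {{_ : NonZero M}} (p≡ : p ≡ suc q) (M≡ : M ≡ p ℕ.* q) (A : SidonSet q M) (L : ℕ) (1≤L : 1 ℕ.≤ L)
      (L≤M : L ℕ.≤ M) where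
    open SidonSet A

    rem : ℕ → ℕ
    rem x = x ℕ.% M

    rem-+M : ∀ x → rem (x ℕ.+ M) ≡ rem x
    rem-+M x = ℕ.[m+n]%n≡m%n x M

    rem-cong : ∀ {x y} z → rem x ≡ rem y → rem (x ℕ.+ z) ≡ rem (y ℕ.+ z)
    rem-cong {x} {y} z h = trans (ℕ.%-distribˡ-+ x z M) (trans (cong (λ w → (w ℕ.+ z ℕ.% M) ℕ.% M) h) (sym (ℕ.%-distribˡ-+ y z M)))

    rem⇒ : ∀ x y → rem x ≡ rem y → x ℕ.+ (y ℕ./ M) ℕ.* M ≡ y ℕ.+ (x ℕ./ M) ℕ.* M
    rem⇒ x y h = begin
      x ℕ.+ Y                         ≡⟨ cong (ℕ._+ Y) (ℕ.m≡m%n+[m/n]*n x M) ⟩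
      (rem x ℕ.+ X) ℕ.+ Y             ≡⟨ cong (λ r → (r ℕ.+ X) ℕ.+ Y) h ⟩
      (rem y ℕ.+ X) ℕ.+ Y             ≡⟨ lemma (rem y) X Y ⟩
      (rem y ℕ.+ Y) ℕ.+ X             ≡⟨ cong (ℕ._+ X) (sym (ℕ.m≡m%n+[m/n]*n y M)) ⟩
      y ℕ.+ X                         ∎
      where
      open ≡-Reasoning
      X Y : ℕ
      X = (x ℕ./ M) ℕ.* M
      Y = (y ℕ./ M) ℕ.* M
      lemma : ∀ a b c → a ℕ.+ b ℕ.+ c ≡ a ℕ.+ c ℕ.+ b
      lemma = solve-∀

    win : ℕ → R
    win x = χ (rem x ℕ.<? L)

    win-per : ∀ x → win (x ℕ.+ M) ≡ win x
    win-per x = cong (λ r → χ (r ℕ.<? L)) (rem-+M x)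

    private
      M₁ : ℕ
      M₁ = ℕ.pred M
      M₁+1 : suc M₁ ≡ M
      M₁+1 = ℕ.suc-pred M

    ∑-rem : ∀ (f : ℕ → R) → ∑ M (λ t → f (rem t)) ≡ f 0 ⊕ ∑ M₁ f
    ∑-rem f = trans (cong (λ m → ∑ m (λ t → f (rem t))) (sym M₁+1))
        (trans (cong₂ _⊕_ (∑-cong M₁ (λ t _ u → cong f (ℕ.m<n⇒m%n≡m (subst (t ℕ.<_) M₁+1 (s≤s u)))))
        (cong f (trans (cong rem M₁+1) (ℕ.n%n≡0 M)))) (⊕-comm _ _))

    ∑-win : ∀ c → ∑ M (λ t → win (c ℕ.+ t)) ≡ ι L
    ∑-win c = trans (∑-rotate M win win-per c)
        (trans (∑-rem (λ r → χ (r ℕ.<? L))) (trans (cong₂ _⊕_ (χ-yes (0 ℕ.<? L) 1≤L) below)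
        (trans (⊕-comm _ _) (trans (sym (ι-suc (ℕ.pred L))) (cong ι L₁+1)))))
      where
      L₁+1 : suc (ℕ.pred L) ≡ L
      L₁+1 = ℕ.suc-pred L {{ℕ.>-nonZero 1≤L}}
      below : ∑ M₁ (λ r → χ (r ℕ.<? L)) ≡ ι (ℕ.pred L)
      below = trans (∑-extend (ℕ.pred-mono-≤ L≤M) (λ i lt → χ-no (i ℕ.<? L) (λ i<L → ℕ.<⇒≱ lt (ℕ.≤-pred (subst (i ℕ.<_) (sym L₁+1) i<L)))))
        (trans (∑-cong (ℕ.pred L) (λ i _ u → χ-yes (i ℕ.<? L) (subst (i ℕ.<_) L₁+1 (s≤s u)))) (∑-one (ℕ.pred L)))

    N : ℕ → R
    N t = ∑ q (λ i → win (a i ℕ.+ t))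

    N-per : ∀ x → N (x ℕ.+ M) ≡ N x
    N-per x = ∑-cong′ q (λ i → trans (cong win (sym (ℕ.+-assoc (a i) x M))) (win-per (a i ℕ.+ x)))

    ∑N : ∑ M N ≡ ι q ⊗ ι L
    ∑N = trans (∑-swap M q (λ t i → win (a i ℕ.+ t))) (trans (∑-cong′ q (λ i → ∑-win (a i))) (∑-const q (ι L)))

    private
      -- Autocorrelation of the window at distance d.
      f : ℕ → R
      f d = ∑ M (λ t → win t ⊗ win (d ℕ.+ t))

      0≼win : ∀ x → ι 0 ≼ win x
      0≼win x = 0≼χ (rem x ℕ.<? L)

      0≼f : ∀ d → ι 0 ≼ f d
      0≼f d = ∑-nonneg M (λ t _ _ → 0≼⊗ (0≼win t) (0≼win _))

      ∑f : ∑ M f ≡ ι L ⊗ ι L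
      ∑f = trans (∑-swap M M (λ d t → win t ⊗ win (d ℕ.+ t)))
          (trans (∑-cong′ M (λ t → trans (∑-⊗ˡ M (win t) (λ d → win (d ℕ.+ t)))
          (⊗-congˡ (trans (∑-cong′ M (λ d → cong win (ℕ.+-comm d t))) (∑-win t)))))
         (trans (∑-⊗ʳ M (ι L) win) (⊗-congʳ (∑-win 0))))

      δ? : ∀ d i j → Dec (rem (a i ℕ.+ d) ≡ rem (a j))
      δ? d i j = rem (a i ℕ.+ d) ℕ.≟ rem (a j)

      ∑δ : ∀ i j → ∑ M (λ d → χ (δ? d i j)) ≡ ι 1
      ∑δ i j = trans (∑-rotate M (λ x → χ (rem x ℕ.≟ v)) (λ x → cong (λ r → χ (r ℕ.≟ v)) (rem-+M x)) (a i))
          (trans (∑-rem (λ r → χ (r ℕ.≟ v))) (value v (ℕ.≤-pred (subst (v ℕ.<_) (sym M₁+1) (ℕ.m%n<n (a j) M)))))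
        where
        v = rem (a j)
        value : ∀ v → v ℕ.≤ M₁ → χ (0 ℕ.≟ v) ⊕ ∑ M₁ (λ r → χ (r ℕ.≟ v)) ≡ ι 1
        value zero    _ = trans (⊕-congˡ (trans (∑-cong M₁ (λ r l _ → χ-no (r ℕ.≟ 0) (λ { refl → ℕ.<⇒≱ l z≤n }))) (∑-zero M₁))) (⊕-identityʳ _)
        value (suc v) u = trans (0⊕ refl) (trans
            (∑-single M₁ (suc v) (λ r → χ (r ℕ.≟ suc v)) (s≤s z≤n) u (λ i _ _ i≢ → χ-no (i ℕ.≟ suc v) i≢)) (χ-yes (suc v ℕ.≟ suc v) refl))

      -- The correlation depends only on the difference of the two elements modulo M; the indicator
      -- picks the one d that represents it.
      pair : ∀ i j → ∑ M (λ t → win (a i ℕ.+ t) ⊗ win (a j ℕ.+ t)) ≡ ∑ M (λ d → χ (δ? d i j) ⊗ f d)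
      pair i j = trans (sym (⊗-identityˡ _)) (trans (⊗-congʳ (sym (∑δ i j))) (trans (sym (∑-⊗ʳ M _ (λ d → χ (δ? d i j)))) (∑-cong′ M each)))
        where
        each : ∀ d → χ (δ? d i j) ⊗ ∑ M (λ t → win (a i ℕ.+ t) ⊗ win (a j ℕ.+ t)) ≡ χ (δ? d i j) ⊗ f d
        each d with δ? d i j
        ... | no _  = trans (⊗-zeroˡ _) (sym (⊗-zeroˡ _))
        ... | yes e = ⊗-congˡ (trans (∑-cong′ M (λ t → ⊗-congˡ (cong (λ r → χ (r ℕ.<? L)) (sym (trans (cong rem (lemma d (a i) t)) (rem-cong t e))))))
                (∑-rotate M (λ x → win x ⊗ win (d ℕ.+ x))
                    (λ x → cong₂ _⊗_ (win-per x) (trans (cong win (sym (ℕ.+-assoc d x M))) (win-per (d ℕ.+ x)))) (a i)))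
          where
          lemma : ∀ d a t → d ℕ.+ (a ℕ.+ t) ≡ a ℕ.+ d ℕ.+ t
          lemma = solve-∀

      off? : ∀ d i j → Dec (¬ (i ≡ j) × rem (a i ℕ.+ d) ≡ rem (a j))
      off? d i j = ¬? (i ℕ.≟ j) ×-dec δ? d i j

      In : ℕ → Set
      In i = 1 ℕ.≤ i × i ℕ.≤ q

      -- Two pairs with the same difference d give a i + a j′ ≡ a j + a i′ modulo M; the Sidon
      -- property matches i with i′, since i differs from j.
      unique : ∀ d i j i′ j′ → In i → In j → In i′ → In j′ → ¬ (i ≡ j) → rem (a i ℕ.+ d) ≡ rem (a j) → rem (a i′ ℕ.+ d) ≡ rem (a j′) → i ≡ i′ × j ≡ j′
      unique d i j i′ j′ (li , ui) (lj , uj) (li′ , ui′) (lj′ , uj′) i≢j e e′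
        with sidon i j′ j i′ li ui lj′ uj′ lj uj li′ ui′ (s₁ ℕ.+ t₂) (t₁ ℕ.+ s₂)
            (ℕ.+-cancelˡ-≡ d _ _ (trans (l₁ d (a i) (a j′) s₁ t₂ M)
            (trans (cong₂ ℕ._+_ (rem⇒ _ _ e) (sym (rem⇒ _ _ e′))) (l₂ d (a j) (a i′) t₁ s₂ M))))
        where
        s₁ = a j ℕ./ M
        t₁ = (a i ℕ.+ d) ℕ./ M
        s₂ = a j′ ℕ./ M
        t₂ = (a i′ ℕ.+ d) ℕ./ M
        l₁ : ∀ d x y s t M → d ℕ.+ (x ℕ.+ y ℕ.+ (s ℕ.+ t) ℕ.* M) ≡ (x ℕ.+ d ℕ.+ s ℕ.* M) ℕ.+ (y ℕ.+ t ℕ.* M)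
        l₁ = solve-∀
        l₂ : ∀ d x y t s M → (x ℕ.+ t ℕ.* M) ℕ.+ (y ℕ.+ d ℕ.+ s ℕ.* M) ≡ d ℕ.+ (x ℕ.+ y ℕ.+ (t ℕ.+ s) ℕ.* M)
        l₂ = solve-∀
      ... | inj₁ (i≡j , _)  = ⊥-elim (i≢j i≡j)
      ... | inj₂ (i≡i′ , j′≡j) = i≡i′ , sym j′≡j

      off-count : ∀ d → ∑ q (λ i → ∑ q (λ j → χ (off? d i j))) ≼ ι 1
      off-count d = ≼-trans (∑-mono q (λ i li ui → ∑χ≼χ∃ (off? d i) q
          (λ j j′ lj uj lj′ uj′ (n , e) (_ , e′) → proj₂ (unique d i j i j′ (li , ui) (lj , uj) (li , ui) (lj′ , uj′) n e e′))))
        (≼-trans (∑χ≼χ∃ (λ i → ∃≤? (off? d i) q) q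
            (λ i i′ li ui li′ ui′ (j , lj , uj , n , e) (j′ , lj′ , uj′ , _ , e′) → proj₁
            (unique d i j i′ j′ (li , ui) (lj , uj) (li′ , ui′) (lj′ , uj′) n e e′))) (χ≼1 (∃≤? (λ i → ∃≤? (off? d i) q) q)))

    -- The diagonal pairs contribute at most q L. Off the diagonal each d occurs at most once, so
    -- these pairs contribute at most the sum of the autocorrelation, L².
    ∑N² : ∑ M (λ t → N t ⊗ N t) ≼ ι q ⊗ ι L ⊕ ι L ⊗ ι L
    ∑N² = ≼-trans (≼-reflexive expand) (≼-trans (∑-mono q (λ i li ui → ∑-mono q (λ j lj uj → split i j)))
        (≼-trans (≼-reflexive collect) (⊕-mono ≼-refl off-bound)))
      where
      open ≡-Reasoning
      P : ℕ → ℕ → R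
      P i j = ∑ M (λ t → win (a i ℕ.+ t) ⊗ win (a j ℕ.+ t))
      expand : ∑ M (λ t → N t ⊗ N t) ≡ ∑ q (λ i → ∑ q (λ j → P i j))
      expand = trans (∑-cong′ M (λ t → ∑-product q q (λ i → win (a i ℕ.+ t)) (λ j → win (a j ℕ.+ t))))
          (trans (∑-swap M q (λ t i → ∑ q (λ j → win (a i ℕ.+ t) ⊗ win (a j ℕ.+ t))))
         (∑-cong′ q (λ i → ∑-swap M q (λ t j → win (a i ℕ.+ t) ⊗ win (a j ℕ.+ t)))))
      split : ∀ i j → P i j ≼ χ (i ℕ.≟ j) ⊗ ι L ⊕ ∑ M (λ d → χ (off? d i j) ⊗ f d)
      split i j with i ℕ.≟ j
      ... | yes refl = ≼-trans (≼-trans (∑-mono M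
          (λ t _ _ → ≼-trans (⊗-monoˡ (win (a i ℕ.+ t)) (0≼win _) (χ≼1 (rem (a i ℕ.+ t) ℕ.<? L)))
          (≼-reflexive (trans (⊗-comm _ _) (⊗-identityˡ _))))) (≼-reflexive (∑-win (a i))))
            (lin 2 (λ l s → (:ι 0 :≤ s) ⇒ (l :≤ :ι 1 :* l :+ s))
                (ι L) _ (∑-nonneg M (λ d _ _ → 0≼⊗ (0≼χ (¬? (yes (refl {x = i})) ×-dec δ? d i i)) (0≼f d))))
      ... | no i≢j = ≼-reflexive (trans (pair i j)
          (trans (∑-cong′ M (λ d → ⊗-congʳ (χ-⇔ (δ? d i j) (¬? (no i≢j) ×-dec δ? d i j) (i≢j ,_) proj₂))) (sym (0⊕ (⊗-zeroˡ _)))))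
      collect : ∑ q (λ i → ∑ q (λ j → χ (i ℕ.≟ j) ⊗ ι L ⊕ ∑ M (λ d → χ (off? d i j) ⊗ f d))) ≡ ι q ⊗ ι L ⊕ ∑ M
          (λ d → ∑ q (λ i → ∑ q (λ j → χ (off? d i j))) ⊗ f d)
      collect = trans (∑-cong′ q (λ i → ∑-⊕ q (λ j → χ (i ℕ.≟ j) ⊗ ι L) (λ j → ∑ M (λ d → χ (off? d i j) ⊗ f d))))
        (trans (∑-⊕ q (λ i → ∑ q (λ j → χ (i ℕ.≟ j) ⊗ ι L)) (λ i → ∑ q (λ j → ∑ M (λ d → χ (off? d i j) ⊗ f d))))
          (cong₂ _⊕_ (trans (∑-cong q (λ i li ui → trans
              (∑-single q i (λ j → χ (i ℕ.≟ j) ⊗ ι L) li ui (λ j _ _ j≢i → 0⊗ (χ-no (i ℕ.≟ j) (λ e → j≢i (sym e)))))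
              (1⊗ (χ-yes (i ℕ.≟ i) refl)))) (∑-const q (ι L)))
            (trans (∑-cong′ q (λ i → ∑-swap q M (λ j d → χ (off? d i j) ⊗ f d))) (trans (∑-swap q M (λ i d → ∑ q (λ j → χ (off? d i j) ⊗ f d)))
              (∑-cong′ M (λ d → trans (∑-cong′ q (λ i → ∑-⊗ʳ q (f d) (λ j → χ (off? d i j)))) (∑-⊗ʳ q (f d) (λ i → ∑ q (λ j → χ (off? d i j))))))))))
      off-bound : ∑ M (λ d → ∑ q (λ i → ∑ q (λ j → χ (off? d i j))) ⊗ f d) ≼ ι L ⊗ ι L
      off-bound = ≼-trans (∑-mono M (λ d _ _ → ≼-trans (⊗-monoʳ (f d) (0≼f d) (off-count d)) (≼-reflexive (⊗-identityˡ _)))) (≼-reflexive ∑f)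

    -- The squared deviation of N t from its mean q L / M = L / p, multiplied by p² to clear the
    -- denominator.
    V : ℕ → R
    V t = (ι p ⊗ N t ⊖ ι L) ⊗ (ι p ⊗ N t ⊖ ι L)

    V-bound : R
    V-bound = (ι p ⊗ ι p) ⊗ (ι q ⊗ ι L) ⊕ ι p ⊗ (ι L ⊗ ι L)

    -- Expanding the square leaves p² L² - p q L², which collapses to p L² because p = q + 1.
    ∑V : ∑ M V ≼ V-bound
    ∑V = ≼-trans (≼-reflexive form) (lin 6 (λ s₁ s₂ p q l m → (s₁ :≡ q :* l) ⇒ (:ι 0 :≤ (p :* p) :* (q :* l :+ l :* l :- s₂)) ⇒
        (p :≡ q :+ :ι 1) ⇒ (m :≡ p :* q) ⇒ ((p :* l) :* s₁ :≡ (p :* l) :* (q :* l)) ⇒ (m :* (l :* l) :≡ (p :* q) :* (l :* l)) ⇒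
        (p :* (p :* (l :* l)) :≡ (q :+ :ι 1) :* (p :* (l :* l))) ⇒
           ((p :* p) :* s₂ :- :ι 2 :* ((p :* l) :* s₁) :+ m :* (l :* l) :≤ (p :* p) :* (q :* l) :+ p :* (l :* l))) (∑ M N)
               (∑ M (λ t → N t ⊗ N t)) (ι p) (ι q) (ι L) (ι M)
         ∑N (0≼⊗ (0≼⊗ (0≼ι p) (0≼ι p)) (≼-sub ∑N²)) ιp ιM (⊗-congˡ ∑N) (⊗-congʳ ιM) (⊗-congʳ ιp))
      where
      ιp : ι p ≡ ι q ⊕ ι 1
      ιp = trans (cong ι p≡) (ι-suc q)
      ιM : ι M ≡ ι p ⊗ ι q
      ιM = trans (cong ι M≡) (ι-* p q)
      form : ∑ M V ≡ (ι p ⊗ ι p) ⊗ ∑ M (λ t → N t ⊗ N t) ⊖ ι 2 ⊗ ((ι p ⊗ ι L) ⊗ ∑ M N) ⊕ ι M ⊗ (ι L ⊗ ι L)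
      form = trans (∑-cong′ M (λ t → lin 3 (λ p n l → (p :* n :- l) :* (p :* n :- l) :≡ (p :* p) :* (n :* n) :- :ι 2 :* ((p :* l) :* n)
          :+ l :* l) (ι p) (N t) (ι L)))
        (trans (∑-⊕ M (λ t → (ι p ⊗ ι p) ⊗ (N t ⊗ N t) ⊖ ι 2 ⊗ ((ι p ⊗ ι L) ⊗ N t)) (λ _ → ι L ⊗ ι L))
            (cong₂ _⊕_ (trans (∑-⊖ M (λ t → (ι p ⊗ ι p) ⊗ (N t ⊗ N t)) (λ t → ι 2 ⊗ ((ι p ⊗ ι L) ⊗ N t)))
          (cong₂ _⊖_ (∑-⊗ˡ M (ι p ⊗ ι p) (λ t → N t ⊗ N t))
              (trans (∑-⊗ˡ M (ι 2) (λ t → (ι p ⊗ ι L) ⊗ N t)) (⊗-congˡ (∑-⊗ˡ M (ι p ⊗ ι L) N))))) (∑-const M (ι L ⊗ ι L))))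

    V-per : ∀ x → V (x ℕ.+ M) ≡ V x
    V-per x = cong (λ n → (ι p ⊗ n ⊖ ι L) ⊗ (ι p ⊗ n ⊖ ι L)) (N-per x)

    -- Averaging over t the sum of V over K windows gives one translate for all windows at once; as
    -- V is nonnegative, each window obeys the bound for the sum.
    even-translate : ∀ K (c : ℕ → ℕ) → ∃ λ t → ∀ j → 1 ℕ.≤ j → j ℕ.≤ K → ι M ⊗ V (c j ℕ.+ t) ≼ ι K ⊗ V-bound
    even-translate K c with average M (λ t → ∑ K (λ j → V (c j ℕ.+ t))) (ℕ.>-nonZero⁻¹ M)
    ... | t , _ , _ , h = t , λ j l u → ≼-trans (⊗-monoˡ (ι M) (0≼ι M) (∑-term K {λ j → V (c j ℕ.+ t)} (λ j _ _ → square _) j l u))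
        (≼-trans h (≼-trans (≼-reflexive total) (⊗-monoˡ (ι K) (0≼ι K) ∑V)))
      where
      square : ∀ x → ι 0 ≼ x ⊗ x
      square x with ≼-total (ι 0) x
      ... | inj₁ p = 0≼⊗ p p
      ... | inj₂ n = lin 1 (λ x → (:ι 0 :≤ (:ι 0 :- x) :* (:ι 0 :- x)) ⇒ (:ι 0 :≤ x :* x)) x (0≼⊗ (≼-sub n) (≼-sub n))
      total : ∑ M (λ t → ∑ K (λ j → V (c j ℕ.+ t))) ≡ ι K ⊗ ∑ M V
      total = trans (∑-swap M K (λ t j → V (c j ℕ.+ t))) (trans (∑-cong′ K (λ j → ∑-rotate M V V-per (c j))) (∑-const K (∑ M V)))

-- Counting triples with a prescribed sum

module TripleCount where
  open OrderedField
  open LinearArithmetic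
  open FiniteSums
  open Logarithms using (≼-sub)
  open SummatoryFunctions using (∑-one)
  open Equidistribution
  open import Data.Nat.Tactic.RingSolver using (solve-∀)
  open import Relation.Nullary.Decidable using (_×-dec_; _⊎-dec_)

  ∑-gauss : ∀ n → ι 2 ⊗ ∑ n (λ x → ι x ⊕ ι 1) ≡ ι n ⊗ (ι n ⊕ ι 3)
  ∑-gauss zero    = lin 0 (:ι 2 :* :ι 0 :≡ :ι 0 :* (:ι 0 :+ :ι 3))
  ∑-gauss (suc n) = lin 3 (λ s n n′ → (:ι 2 :* s :≡ n :* (n :+ :ι 3)) ⇒ (n′ :≡ n :+ :ι 1) ⇒
      (n′ :* (n′ :+ :ι 3) :≡ (n :+ :ι 1) :* (n′ :+ :ι 3)) ⇒ (n :* n′ :≡ n :* (n :+ :ι 1)) ⇒ (:ι 2 :* (s :+ (n′ :+ :ι 1)) :≡ n′ :* (n′ :+ :ι 3)))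
      (∑ n (λ x → ι x ⊕ ι 1)) (ι n) (ι (suc n)) (∑-gauss n) (ι-suc n) (⊗-congʳ (ι-suc n)) (⊗-congˡ (ι-suc n))

  χ-⊎ : ∀ {P Q : Set} (d : Dec P) (e : Dec Q) → χ (d ⊎-dec e) ≼ χ d ⊕ χ e
  χ-⊎ (yes p) e       = lin 1 (λ x → (:ι 0 :≤ x) ⇒ (:ι 1 :≤ :ι 1 :+ x)) _ (0≼χ e)
  χ-⊎ (no _)  (yes q) = ≼-reflexive (sym (0⊕ refl))
  χ-⊎ (no _)  (no _)  = ≼-reflexive (sym (0⊕ refl))

  ordered? : ∀ x y z → Dec (x ℕ.< y × y ℕ.< z)
  ordered? x y z = (x ℕ.<? y) ×-dec (y ℕ.<? z)

  -- Each chain is bounded by a product of three pairwise indicators, and the six products are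
  -- different terms in the expansion of (A + A′)(B + B′)(C + C′), which is at most 1.
  six-orders : ∀ x y z → χ (ordered? x y z) ⊕ χ (ordered? x z y) ⊕ χ (ordered? y x z) ⊕ χ (ordered? y z x) ⊕ χ (ordered? z x y) ⊕ χ
      (ordered? z y x) ≼ ι 1
  six-orders x y z = lin 12 (λ o₁ o₂ o₃ o₄ o₅ o₆ A A′ B B′ C C′ →
        (o₁ :≤ A :* (B :* C)) ⇒ (o₂ :≤ C :* (B′ :* A)) ⇒ (o₃ :≤ A′ :* (C :* B)) ⇒ (o₄ :≤ B :* (C′ :* A′)) ⇒ (o₅ :≤ C′ :* (A :* B′)) ⇒
            (o₆ :≤ B′ :* (A′ :* C′)) ⇒
        (A :+ A′ :≤ :ι 1) ⇒ (:ι 0 :≤ (A :+ A′) :* (:ι 1 :- (B :+ B′))) ⇒ (:ι 0 :≤ ((A :+ A′) :* (B :+ B′)) :* (:ι 1 :- (C :+ C′))) ⇒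
            (:ι 0 :≤ A :* (B :* C′)) ⇒ (:ι 0 :≤ A′ :* (B′ :* C)) ⇒
        (o₁ :+ o₂ :+ o₃ :+ o₄ :+ o₅ :+ o₆ :≤ :ι 1)) _ _ _ _ _ _ A A′ B B′ C C′
      (three (x ℕ.<? y) (y ℕ.<? z) (x ℕ.<? z) (λ (a , b) → ℕ.<-trans a b)) (three′ (x ℕ.<? z) (z ℕ.<? y) (x ℕ.<? y) (λ (a , b) → ℕ.<-trans a b))
      (three′ (y ℕ.<? x) (x ℕ.<? z) (y ℕ.<? z) (λ (a , b) → ℕ.<-trans a b)) (three (y ℕ.<? z) (z ℕ.<? x) (y ℕ.<? x) (λ (a , b) → ℕ.<-trans a b))
      (three (z ℕ.<? x) (x ℕ.<? y) (z ℕ.<? y) (λ (a , b) → ℕ.<-trans a b)) (three (z ℕ.<? y) (y ℕ.<? x) (z ℕ.<? x) (λ (a , b) → ℕ.<-trans a b))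
      (excl x y) (0≼⊗ (0≼+ (x ℕ.<? y) (y ℕ.<? x)) (≼-sub (excl y z)))
          (0≼⊗ (0≼⊗ (0≼+ (x ℕ.<? y) (y ℕ.<? x)) (0≼+ (y ℕ.<? z) (z ℕ.<? y))) (≼-sub (excl x z)))
      (0≼⊗ (0≼χ (x ℕ.<? y)) (0≼⊗ (0≼χ (y ℕ.<? z)) (0≼χ (z ℕ.<? x)))) (0≼⊗ (0≼χ (y ℕ.<? x)) (0≼⊗ (0≼χ (z ℕ.<? y)) (0≼χ (x ℕ.<? z))))
    where
    A A′ B B′ C C′ : R
    A  = χ (x ℕ.<? y)
    A′ = χ (y ℕ.<? x)
    B  = χ (y ℕ.<? z)
    B′ = χ (z ℕ.<? y)
    C  = χ (x ℕ.<? z)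
    C′ = χ (z ℕ.<? x)
    excl : ∀ x y → χ (x ℕ.<? y) ⊕ χ (y ℕ.<? x) ≼ ι 1
    excl x y with x ℕ.<? y
    ... | yes lt = ≼-reflexive (⊕0 (χ-no (y ℕ.<? x) (ℕ.<-asym lt)))
    ... | no _   = ≼-trans (≼-reflexive (0⊕ refl)) (χ≼1 (y ℕ.<? x))
    0≼+ : ∀ {P Q : Set} (d : Dec P) (e : Dec Q) → ι 0 ≼ χ d ⊕ χ e
    0≼+ d e = ≼-trans (≼-reflexive (sym (⊕-identityʳ _))) (⊕-mono (0≼χ d) (0≼χ e))
    three : ∀ {P Q S : Set} (d : Dec P) (e : Dec Q) (s : Dec S) → (P × Q → S) → χ (d ×-dec e) ≼ χ d ⊗ (χ e ⊗ χ s)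
    three d e s h = ≼-trans (χ-mono (d ×-dec e) (d ×-dec (e ×-dec s)) (λ pq → proj₁ pq , proj₂ pq , h pq))
        (≼-reflexive (trans (χ-× d (e ×-dec s)) (⊗-congˡ (χ-× e s))))
    three′ : ∀ {P Q S : Set} (d : Dec P) (e : Dec Q) (s : Dec S) → (P × Q → S) → χ (d ×-dec e) ≼ χ d ⊗ (χ e ⊗ χ s)
    three′ = three

  module Triples (q M : ℕ) (b : ℕ → ℕ) (b<M : ∀ i → b i ℕ.< M) (L K w : ℕ) (1≤L : 1 ℕ.≤ L) (M≤KL : M ℕ.≤ K ℕ.* L)
      (KL≤M+K : K ℕ.* L ℕ.≤ M ℕ.+ K) (2K≤L : 2 ℕ.* K ℕ.≤ L)
    (c : R) (0≼c : ι 0 ≼ c) (cap : ∀ x → ∑ q (λ i → χ (suc (b i ÷ L) ℕ.≟ x)) ≼ c) (1≤w : 1 ℕ.≤ w) where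

    block : ℕ → ℕ
    block i = suc (b i ÷ L)

    block≤K : ∀ i → block i ℕ.≤ K
    block≤K i = ℕ.*-cancelʳ-< L (b i ÷ L) K (ℕ.≤-<-trans (ℕ.≤-trans (ℕ.≤-reflexive (ℕ.*-comm (b i ÷ L) L)) (÷-upper (b i) L 1≤L))
        (ℕ.<-≤-trans (b<M i) M≤KL))

    by-blocks : ∀ (g : ℕ → R) → (∀ x → ι 0 ≼ g x) → ∑ q (λ i → g (block i)) ≼ c ⊗ ∑ K g
    by-blocks g g≥0 = ≼-trans (≼-reflexive form) (≼-trans (∑-mono K (λ x _ _ → ⊗-monoʳ (g x) (g≥0 x) (cap x))) (≼-reflexive (∑-⊗ˡ K c g)))
      where
      form : ∑ q (λ i → g (block i)) ≡ ∑ K (λ x → ∑ q (λ i → χ (block i ℕ.≟ x)) ⊗ g x)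
      form = trans (∑-cong′ q (λ i → sym (trans
          (∑-single K (block i) (λ x → χ (block i ℕ.≟ x) ⊗ g x) (s≤s z≤n) (block≤K i)
          (λ x _ _ x≢ → 0⊗ (χ-no (block i ℕ.≟ x) (λ e → x≢ (sym e))))) (1⊗ (χ-yes (block i ℕ.≟ block i) refl)))))
        (trans (∑-swap q K (λ i x → χ (block i ℕ.≟ x) ⊗ g x)) (∑-cong′ K (λ x → ∑-⊗ʳ q (g x) (λ i → χ (block i ℕ.≟ x)))))

    -- The possible block sums of a triple with sum 2 M + r and 1 ≤ r ≤ w L; passing from elements
    -- to blocks costs up to 3.
    range? : ∀ x y z → Dec (2 ℕ.* K ℕ.≤ x ℕ.+ y ℕ.+ z × x ℕ.+ y ℕ.+ z ℕ.≤ 2 ℕ.* K ℕ.+ w ℕ.+ 3)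
    range? x y z = (2 ℕ.* K ℕ.≤? x ℕ.+ y ℕ.+ z) ×-dec (x ℕ.+ y ℕ.+ z ℕ.≤? 2 ℕ.* K ℕ.+ w ℕ.+ 3)

    cells : R
    cells = ∑ K (λ x → ∑ K (λ y → ∑ K (λ z → χ (range? x y z))))

    private
      row : ∀ x → ∑ K (λ y → χ (K ℕ.≤? x ℕ.+ y)) ≼ ι x ⊕ ι 1
      row x with go K
        where
        go : ∀ n → (∑ n (λ y → χ (K ℕ.≤? x ℕ.+ y)) ≡ ι 0) ⊎ (∑ n (λ y → χ (K ℕ.≤? x ℕ.+ y)) ⊕ ι K ≼ ι (x ℕ.+ n) ⊕ ι 1)
        go zero = inj₁ refl
        go (suc n) with go n | K ℕ.≤? x ℕ.+ suc n
        ... | inj₁ z | no _   = inj₁ (trans (⊕0 refl) z)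
        ... | inj₁ z | yes le = inj₂ (lin 3 (λ s k m → (s :≡ :ι 0) ⇒ (k :≤ m) ⇒ (s :+ :ι 1 :+ k :≤ m :+ :ι 1)) _ _ _ z (ι-mono le))
        ... | inj₂ h | no _   = inj₂ (lin 4 (λ s k m m′ → (s :+ k :≤ m :+ :ι 1) ⇒ (m :≤ m′) ⇒ (s :+ :ι 0 :+ k :≤ m′ :+ :ι 1)) _ _ _ _ h
            (ι-mono (ℕ.+-monoʳ-≤ x (ℕ.n≤1+n n))))
        ... | inj₂ h | yes _  = inj₂ (lin 4 (λ s k m m′ → (s :+ k :≤ m :+ :ι 1) ⇒ (m′ :≡ m :+ :ι 1) ⇒
            (s :+ :ι 1 :+ k :≤ m′ :+ :ι 1)) _ _ _ _ h (trans (cong ι (ℕ.+-suc x n)) (ι-suc (x ℕ.+ n))))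
      ... | inj₁ z = ≼-trans (≼-reflexive z) (≼-trans (0≼ι (suc x)) (≼-reflexive (ι-suc x)))
      ... | inj₂ h = lin 4 (λ s k x m → (s :+ k :≤ m :+ :ι 1) ⇒ (m :≡ x :+ k) ⇒ (s :≤ x :+ :ι 1)) _ _ _ _ h (ι-+ x K)

      plane? : ∀ v x y z → Dec (x ℕ.+ y ℕ.+ z ℕ.+ 1 ≡ 2 ℕ.* K ℕ.+ v)
      plane? v x y z = x ℕ.+ y ℕ.+ z ℕ.+ 1 ℕ.≟ 2 ℕ.* K ℕ.+ v

      -- In a plane x and y determine z, and z ≤ K forces x + y ≥ K because v ≥ 1.
      line : ∀ v x y → 1 ℕ.≤ v → ∑ K (λ z → χ (plane? v x y z)) ≼ χ (K ℕ.≤? x ℕ.+ y)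
      line v x y 1≤v = ≼-trans (∑χ≼χ∃ (plane? v x y) K (λ z z′ _ _ _ _ e e′ → ℕ.+-cancelˡ-≡ (x ℕ.+ y) z z′ (ℕ.+-cancelʳ-≡ 1 _ _ (trans e (sym e′)))))
        (χ-mono (∃≤? (plane? v x y) K) (K ℕ.≤? x ℕ.+ y)
            (λ { (z , _ , z≤K , e) → ℕ.+-cancelʳ-≤ (K ℕ.+ 1) K (x ℕ.+ y)
            (ℕ.≤-trans (ℕ.≤-reflexive (l₁ K)) (ℕ.≤-trans (ℕ.+-monoʳ-≤ (2 ℕ.* K) 1≤v) (ℕ.≤-trans (ℕ.≤-reflexive (sym e))
           (ℕ.≤-trans (ℕ.≤-reflexive (ℕ.+-assoc (x ℕ.+ y) z 1)) (ℕ.+-monoʳ-≤ (x ℕ.+ y) (ℕ.+-monoˡ-≤ 1 z≤K)))))) }))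
        where
        l₁ : ∀ K → K ℕ.+ (K ℕ.+ 1) ≡ 2 ℕ.* K ℕ.+ 1
        l₁ = solve-∀

      planes : ∀ x y z → χ (range? x y z) ≼ ∑ (w ℕ.+ 4) (λ v → χ (plane? v x y z))
      planes x y z = ≼-trans (χ-mono (range? x y z) (∃≤? (λ v → plane? v x y z) (w ℕ.+ 4)) (λ { (lo , hi) →
          let v = suc (x ℕ.+ y ℕ.+ z ℕ.∸ 2 ℕ.* K)
              e : x ℕ.+ y ℕ.+ z ℕ.+ 1 ≡ 2 ℕ.* K ℕ.+ v
              e = trans (ℕ.+-comm (x ℕ.+ y ℕ.+ z) 1) (trans (cong suc (sym (ℕ.m+[n∸m]≡n lo))) (sym (ℕ.+-suc (2 ℕ.* K) _)))
          in v , s≤s z≤n , ℕ.+-cancelˡ-≤ (2 ℕ.* K) v (w ℕ.+ 4)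
              (ℕ.≤-trans (ℕ.≤-reflexive (sym e)) (ℕ.≤-trans (ℕ.+-monoˡ-≤ 1 hi) (ℕ.≤-reflexive (l (2 ℕ.* K) w)))) , e }))
        (∑-≼-∃ (λ v → plane? v x y z) (w ℕ.+ 4))
        where
        l : ∀ a w → a ℕ.+ w ℕ.+ 3 ℕ.+ 1 ≡ a ℕ.+ (w ℕ.+ 4)
        l = solve-∀

    -- The range is covered by w + 4 planes, and each meets the cube in at most ∑ (x + 1) = K (K +
    -- 3)/2 cells. This half is one of the two factors of 1/12.
    cells-bound : ι 2 ⊗ cells ≼ (ι w ⊕ ι 4) ⊗ (ι K ⊗ (ι K ⊕ ι 3))
    cells-bound = ≼-trans (⊗-monoˡ (ι 2) (0≼ι 2)
        (≼-trans (∑-mono K (λ x _ _ → ∑-mono K (λ y _ _ → ∑-mono K (λ z _ _ → planes x y z)))) (≼-trans (≼-reflexive reorder)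
        (∑-mono (w ℕ.+ 4) (λ v l _ → ∑-mono K (λ x _ _ → ≼-trans (∑-mono K (λ y _ _ → line v x y l)) (row x)))))))
      (≼-reflexive (trans (⊗-congˡ (∑-const (w ℕ.+ 4) (∑ K (λ x → ι x ⊕ ι 1))))
          (trans (lin 2 (λ a s → :ι 2 :* (a :* s) :≡ a :* (:ι 2 :* s)) _ _) (cong₂ _⊗_ (ι-+ w 4) (∑-gauss K)))))
      where
      reorder : ∑ K (λ x → ∑ K (λ y → ∑ K (λ z → ∑ (w ℕ.+ 4) (λ v → χ (plane? v x y z))))) ≡ ∑ (w ℕ.+ 4)
          (λ v → ∑ K (λ x → ∑ K (λ y → ∑ K (λ z → χ (plane? v x y z)))))
      reorder = trans (∑-cong′ K (λ x → trans (∑-cong′ K (λ y → ∑-swap K (w ℕ.+ 4) (λ z v → χ (plane? v x y z))))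
          (∑-swap K (w ℕ.+ 4) (λ y v → ∑ K (λ z → χ (plane? v x y z))))))
        (∑-swap K (w ℕ.+ 4) (λ x v → ∑ K (λ y → ∑ K (λ z → χ (plane? v x y z)))))

    target : ℕ → ℕ
    target r = 2 ℕ.* M ℕ.+ r

    sum? : ∀ r i j k → Dec (b i ℕ.+ b j ℕ.+ b k ≡ target r)
    sum? r i j k = b i ℕ.+ b j ℕ.+ b k ℕ.≟ target r

    rMax : ℕ
    rMax = w ℕ.* L

    private
      in-range : ∀ r i j k → 1 ℕ.≤ r → r ℕ.≤ rMax → b i ℕ.+ b j ℕ.+ b k ≡ target r →
        2 ℕ.* K ℕ.≤ block i ℕ.+ block j ℕ.+ block k × block i ℕ.+ block j ℕ.+ block k ℕ.≤ 2 ℕ.* K ℕ.+ w ℕ.+ 3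
      in-range r i j k l u e = ℕ.≤-pred (ℕ.*-cancelˡ-< L (2 ℕ.* K) (suc S) lo) , ℕ.*-cancelˡ-≤ L {{ℕ.>-nonZero 1≤L}} hi
        where
        S = block i ℕ.+ block j ℕ.+ block k
        ιS : ι S ≡ ι (block i) ⊕ ι (block j) ⊕ ι (block k)
        ιS = trans (ι-+ (block i ℕ.+ block j) _) (⊕-congʳ (ι-+ (block i) (block j)))
        ιe : ι (b i) ⊕ ι (b j) ⊕ ι (b k) ≡ ι 2 ⊗ ι M ⊕ ι r
        ιe = trans (sym (trans (ι-+ (b i ℕ.+ b j) (b k)) (⊕-congʳ (ι-+ (b i) (b j)))))
            (trans (cong ι e) (trans (ι-+ (2 ℕ.* M) r) (⊕-congʳ (ι-* 2 M))))
        up : ∀ i → ι (b i) ⊕ ι 1 ≼ ι L ⊗ ι (block i)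
        up i = ≼-trans (≼-reflexive (sym (ι-suc (b i)))) (≼-trans (ι-mono (÷-lower (b i) L 1≤L)) (≼-reflexive (ι-* L (block i))))
        down : ∀ i → ι L ⊗ ι (block i) ≼ ι (b i) ⊕ ι L
        down i = ≼-trans (≼-reflexive (trans (⊗-congˡ (ι-suc (b i ÷ L))) (lin 2 (λ l x → l :* (x :+ :ι 1) :≡ l :* x :+ l) _ _)))
            (⊕-mono (≼-trans (≼-reflexive (sym (ι-* L _))) (ι-mono (÷-upper (b i) L 1≤L))) ≼-refl)
        KL : ι K ⊗ ι L ≼ ι M ⊕ ι K
        KL = ≼-trans (≼-reflexive (sym (ι-* K L))) (≼-trans (ι-mono KL≤M+K) (≼-reflexive (ι-+ M K)))
        lo : L ℕ.* (2 ℕ.* K) ℕ.< L ℕ.* suc S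
        lo = ι-cancel (lin 13 (λ s₁ s₂ l k m r x y z X Y W S → (s₁ :≡ l :* (:ι 2 :* k) :+ :ι 1) ⇒ (s₂ :≡ l :* (S :+ :ι 1)) ⇒
            (l :* S :≡ l :* (X :+ Y :+ W)) ⇒ (x :+ :ι 1 :≤ l :* X) ⇒ (y :+ :ι 1 :≤ l :* Y) ⇒ (z :+ :ι 1 :≤ l :* W) ⇒
            (x :+ y :+ z :≡ :ι 2 :* m :+ r) ⇒ (k :* l :≤ m :+ k) ⇒ (:ι 2 :* k :≤ l) ⇒ (:ι 0 :≤ r) ⇒ (s₁ :≤ s₂))
          _ _ (ι L) (ι K) (ι M) (ι r) (ι (b i)) (ι (b j)) (ι (b k)) (ι (block i)) (ι (block j)) (ι (block k)) (ι S)
          (trans (ι-suc _) (⊕-congʳ (trans (ι-* L _) (⊗-congˡ (ι-* 2 K))))) (trans (ι-* L (suc S)) (⊗-congˡ (ι-suc S))) (⊗-congˡ ιS) (up i)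
              (up j) (up k) ιe KL (≼-trans (≼-reflexive (sym (ι-* 2 K))) (ι-mono 2K≤L)) (0≼ι r))
        hi : L ℕ.* S ℕ.≤ L ℕ.* (2 ℕ.* K ℕ.+ w ℕ.+ 3)
        hi = ι-cancel (lin 13 (λ s₁ s₂ l k m r x y z X Y W w → (s₁ :≡ l :* (X :+ Y :+ W)) ⇒ (s₂ :≡ l :* (:ι 2 :* k :+ w :+ :ι 3)) ⇒
            (l :* X :≤ x :+ l) ⇒ (l :* Y :≤ y :+ l) ⇒ (l :* W :≤ z :+ l) ⇒ (x :+ y :+ z :≡ :ι 2 :* m :+ r) ⇒ (m :≤ k :* l) ⇒ (r :≤ w :* l) ⇒
            (s₁ :≤ s₂))
          _ _ (ι L) (ι K) (ι M) (ι r) (ι (b i)) (ι (b j)) (ι (b k)) (ι (block i)) (ι (block j)) (ι (block k)) (ι w)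
          (trans (ι-* L S) (⊗-congˡ ιS)) (trans (ι-* L _)
              (⊗-congˡ (trans (ι-+ (2 ℕ.* K ℕ.+ w) 3) (⊕-congʳ (trans (ι-+ (2 ℕ.* K) w) (⊕-congʳ (ι-* 2 K))))))) (down i) (down j) (down k) ιe
          (≼-trans (ι-mono M≤KL) (≼-reflexive (ι-* K L))) (≼-trans (ι-mono u) (≼-reflexive (ι-* w L))))

      target-injective : ∀ {r r′ s} → s ≡ target r → s ≡ target r′ → r ≡ r′
      target-injective e e′ = ℕ.+-cancelˡ-≡ (2 ℕ.* M) _ _ (trans (sym e) e′)

    E : ℕ → R
    E r = ∑ q (λ i → ∑ q (λ j → ∑ q (λ k → χ (sum? r i j k))))

    -- A triple has its sum at no more than one r, so summing over r counts each triple once; then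
    -- each of its three indices is replaced by its block at the cost of a factor c.
    ∑E : ∑ rMax E ≼ c ⊗ (c ⊗ (c ⊗ cells))
    ∑E = ≼-trans (≼-reflexive reorder) (≼-trans
        (∑-mono q (λ i _ _ → ∑-mono q (λ j _ _ → ∑-mono q
        (λ k _ _ → ≼-trans (∑χ≼χ∃ (λ r → sum? r i j k) rMax (λ r r′ _ _ _ _ e e′ → target-injective e e′))
          (χ-mono (∃≤? (λ r → sum? r i j k) rMax) (range? (block i) (block j) (block k)) (λ { (r , l , u , e) → in-range r i j k l u e }))))))
        (≼-trans (by-blocks (λ x → ∑ q (λ j → ∑ q (λ k → χ (range? x (block j) (block k)))))
            (λ x → ∑-nonneg q (λ j _ _ → ∑-nonneg q (λ k _ _ → 0≼χ (range? x (block j) (block k))))))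
          (⊗-monoˡ c 0≼c (≼-trans (∑-mono K (λ x _ _ → ≼-trans
              (by-blocks (λ y → ∑ q (λ k → χ (range? x y (block k)))) (λ y → ∑-nonneg q (λ k _ _ → 0≼χ (range? x y (block k)))))
              (⊗-monoˡ c 0≼c (≼-trans (∑-mono K (λ y _ _ → by-blocks (λ z → χ (range? x y z)) (λ z → 0≼χ (range? x y z))))
                  (≼-reflexive (∑-⊗ˡ K c (λ y → ∑ K (λ z → χ (range? x y z)))))))))
            (≼-reflexive (trans (∑-⊗ˡ K c (λ x → c ⊗ ∑ K (λ y → ∑ K (λ z → χ (range? x y z)))))
                (⊗-congˡ (∑-⊗ˡ K c (λ x → ∑ K (λ y → ∑ K (λ z → χ (range? x y z))))))))))))
      where
      reorder : ∑ rMax E ≡ ∑ q (λ i → ∑ q (λ j → ∑ q (λ k → ∑ rMax (λ r → χ (sum? r i j k)))))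
      reorder = trans (∑-swap rMax q (λ r i → ∑ q (λ j → ∑ q (λ k → χ (sum? r i j k)))))
          (∑-cong′ q (λ i → trans (∑-swap rMax q (λ r j → ∑ q (λ k → χ (sum? r i j k))))
          (∑-cong′ q (λ j → ∑-swap rMax q (λ r k → χ (sum? r i j k))))))

    top? : ∀ r k i j → Dec ((b i ℕ.< b j × b j ℕ.< b k) × b i ℕ.+ b j ℕ.+ b k ≡ target r)
    top? r k i j = ordered? (b i) (b j) (b k) ×-dec sum? r i j k

    isTop? : ∀ r k → Dec (∃ λ i → 1 ℕ.≤ i × i ℕ.≤ q × ∃ λ j → 1 ℕ.≤ j × j ℕ.≤ q × ((b i ℕ.< b j × b j ℕ.< b k) × b i ℕ.+ b j ℕ.+ b k ≡ target r))
    isTop? r k = ∃≤? (λ i → ∃≤? (top? r k i) q) q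

    -- Each top is the largest element of some increasing triple, and `E` counts such a triple in
    -- all its six orders.
    tops : ∀ r → ι 6 ⊗ ∑ q (λ k → χ (isTop? r k)) ≼ E r
    tops r = ≼-trans (⊗-monoˡ (ι 6) (0≼ι 6) (≼-trans
        (∑-mono q (λ k _ _ → ≼-trans (∑-≼-∃ (λ i → ∃≤? (top? r k i) q) q) (∑-mono q (λ i _ _ → ∑-≼-∃ (top? r k i) q)))) (≼-reflexive to-T)))
        (≼-trans (≼-reflexive six) (∑-mono q (λ i _ _ → ∑-mono q (λ j _ _ → ∑-mono q (λ k _ _ → pointwise i j k)))))
      where
      g : ℕ → ℕ → ℕ → R
      g i j k = χ (top? r k i j)
      ∑³ : (ℕ → ℕ → ℕ → R) → R
      ∑³ h = ∑ q (λ i → ∑ q (λ j → ∑ q (λ k → h i j k)))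
      T : R
      T = ∑³ g
      inner : ∀ h → ∑³ h ≡ ∑³ (λ i j k → h i k j)
      inner h = ∑-cong′ q (λ i → ∑-swap q q (λ j k → h i j k))
      outer : ∀ h → ∑³ h ≡ ∑³ (λ i j k → h j i k)
      outer h = ∑-swap q q (λ i j → ∑ q (λ k → h i j k))
      to-T : ∑ q (λ k → ∑ q (λ i → ∑ q (λ j → χ (top? r k i j)))) ≡ T
      to-T = trans (outer (λ k i j → g i j k)) (inner (λ i k j → g i j k))
      ∑³-⊕ : ∀ h h′ → ∑³ (λ i j k → h i j k ⊕ h′ i j k) ≡ ∑³ h ⊕ ∑³ h′
      ∑³-⊕ h h′ = trans (∑-cong′ q (λ i → trans (∑-cong′ q (λ j → ∑-⊕ q (h i j) (h′ i j)))
          (∑-⊕ q (λ j → ∑ q (h i j)) (λ j → ∑ q (h′ i j))))) (∑-⊕ q (λ i → ∑ q (λ j → ∑ q (h i j))) (λ i → ∑ q (λ j → ∑ q (h′ i j))))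
      G : ℕ → ℕ → ℕ → R
      G i j k = g i j k ⊕ g i k j ⊕ g j i k ⊕ g j k i ⊕ g k i j ⊕ g k j i
      six : ι 6 ⊗ T ≡ ∑³ G
      six = sym (trans (∑³-⊕ (λ i j k → g i j k ⊕ g i k j ⊕ g j i k ⊕ g j k i ⊕ g k i j) (λ i j k → g k j i))
        (trans (⊕-congʳ (trans (∑³-⊕ (λ i j k → g i j k ⊕ g i k j ⊕ g j i k ⊕ g j k i) (λ i j k → g k i j))
          (⊕-congʳ (trans (∑³-⊕ (λ i j k → g i j k ⊕ g i k j ⊕ g j i k) (λ i j k → g j k i))
              (⊕-congʳ (trans (∑³-⊕ (λ i j k → g i j k ⊕ g i k j) (λ i j k → g j i k)) (⊕-congʳ (∑³-⊕ g (λ i j k → g i k j)))))))))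
        (lin 6 (λ t a b c d e → (a :≡ t) ⇒ (b :≡ t) ⇒ (c :≡ t) ⇒ (d :≡ t) ⇒ (e :≡ t) ⇒ (t :+ a :+ b :+ c :+ d :+ e :≡ :ι 6 :* t)) T _ _ _ _ _
          (sym (inner g)) (sym (outer g)) (trans (outer (λ i j k → g j k i)) (inner (λ i j k → g i k j)))
              (trans (inner (λ i j k → g k i j)) (outer (λ i j k → g j i k)))
          (trans (inner (λ i j k → g k j i)) (trans (outer (λ i j k → g j k i)) (inner (λ i j k → g i k j)))))))
      F : ℕ → ℕ → ℕ → R
      F i j k = χ (sum? r i j k)
      Fsym : ∀ i j k i′ j′ k′ → b i ℕ.+ b j ℕ.+ b k ≡ b i′ ℕ.+ b j′ ℕ.+ b k′ → F i′ j′ k′ ≡ F i j k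
      Fsym i j k i′ j′ k′ e = cong (λ s → χ (s ℕ.≟ target r)) (sym e)
      pointwise : ∀ i j k → G i j k ≼ F i j k
      pointwise i j k = ≼-trans (≼-reflexive (cong₂ _⊕_
          (cong₂ _⊕_ (cong₂ _⊕_ (cong₂ _⊕_ (cong₂ _⊕_ (p i j k refl) (p i k j (l₁ (b i) (b j) (b k)))) (p j i k (l₂ (b i) (b j) (b k))))
          (p j k i (l₃ (b i) (b j) (b k)))) (p k i j (l₄ (b i) (b j) (b k)))) (p k j i (l₅ (b i) (b j) (b k)))))
        (lin 7 (λ o₁ o₂ o₃ o₄ o₅ o₆ f → (:ι 0 :≤ f :* (:ι 1 :- (o₁ :+ o₂ :+ o₃ :+ o₄ :+ o₅ :+ o₆))) ⇒
            (o₁ :* f :+ o₂ :* f :+ o₃ :* f :+ o₄ :* f :+ o₅ :* f :+ o₆ :* f :≤ f)) _ _ _ _ _ _ (F i j k)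
          (0≼⊗ (0≼χ (sum? r i j k)) (≼-sub (six-orders (b i) (b j) (b k)))))
        where
        p : ∀ i′ j′ k′ → b i ℕ.+ b j ℕ.+ b k ≡ b i′ ℕ.+ b j′ ℕ.+ b k′ → g i′ j′ k′ ≡ χ (ordered? (b i′) (b j′) (b k′)) ⊗ F i j k
        p i′ j′ k′ e = trans (χ-× (ordered? (b i′) (b j′) (b k′)) (sum? r i′ j′ k′)) (⊗-congˡ (Fsym i j k i′ j′ k′ e))
        l₁ : ∀ x y z → x ℕ.+ y ℕ.+ z ≡ x ℕ.+ z ℕ.+ y
        l₁ = solve-∀
        l₂ : ∀ x y z → x ℕ.+ y ℕ.+ z ≡ y ℕ.+ x ℕ.+ z
        l₂ = solve-∀
        l₃ : ∀ x y z → x ℕ.+ y ℕ.+ z ≡ y ℕ.+ z ℕ.+ x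
        l₃ = solve-∀
        l₄ : ∀ x y z → x ℕ.+ y ℕ.+ z ≡ z ℕ.+ x ℕ.+ y
        l₄ = solve-∀
        l₅ : ∀ x y z → x ℕ.+ y ℕ.+ z ≡ z ℕ.+ y ℕ.+ x
        l₅ = solve-∀

    double? : ∀ r k j → Dec (b k ℕ.+ b k ℕ.+ b j ≡ target r)
    double? r k j = sum? r k k j

    isDouble? : ∀ r k → Dec (∃ λ j → 1 ℕ.≤ j × j ℕ.≤ q × b k ℕ.+ b k ℕ.+ b j ≡ target r)
    isDouble? r k = ∃≤? (double? r k) q

    -- A pair (k, j) fits at most one r. Spread over w L values of r, the q² pairs become
    -- negligible.
    ∑doubles : ∑ rMax (λ r → ∑ q (λ k → χ (isDouble? r k))) ≼ ι q ⊗ ι q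
    ∑doubles = ≼-trans (∑-mono rMax (λ r _ _ → ∑-mono q (λ k _ _ → ∑-≼-∃ (double? r k) q)))
        (≼-trans (≼-reflexive (trans (∑-swap rMax q (λ r k → ∑ q (λ j → χ (double? r k j))))
        (∑-cong′ q (λ k → ∑-swap rMax q (λ r j → χ (double? r k j))))))
      (≼-trans (∑-mono q (λ k _ _ → ∑-mono q (λ j _ _ → ≼-trans
          (∑χ≼χ∃ (λ r → double? r k j) rMax (λ r r′ _ _ _ _ e e′ → target-injective e e′)) (χ≼1 (∃≤? (λ r → double? r k j) rMax)))))
        (≼-reflexive (trans (∑-cong′ q (λ k → ∑-one q)) (∑-const q (ι q))))))

    Bad : ℕ → ℕ → Set
    Bad r k = (∃ λ i → 1 ℕ.≤ i × i ℕ.≤ q × ∃ λ j → 1 ℕ.≤ j × j ℕ.≤ q × ((b i ℕ.< b j × b j ℕ.< b k) × b i ℕ.+ b j ℕ.+ b k ≡ target r)) ⊎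
              (∃ λ j → 1 ℕ.≤ j × j ℕ.≤ q × b k ℕ.+ b k ℕ.+ b j ≡ target r)

    bad? : ∀ r k → Dec (Bad r k)
    bad? r k = isTop? r k ⊎-dec isDouble? r k

    bads : ℕ → R
    bads r = ∑ q (λ k → χ (bad? r k))

    -- Averaging over r. The factor 12 combines the 6 of `tops` with the 2 of `cells-bound`.
    few-bad : ∃ λ r → 1 ℕ.≤ r × r ℕ.≤ rMax × ι rMax ⊗ (ι 12 ⊗ bads r) ≼ (c ⊗ (c ⊗ c)) ⊗ ((ι w ⊕ ι 4) ⊗ (ι K ⊗ (ι K ⊕ ι 3))) ⊕ ι 12 ⊗ (ι q ⊗ ι q)
    few-bad with average rMax (λ r → ι 12 ⊗ bads r) (ℕ.*-mono-≤ 1≤w 1≤L)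
    ... | r , l , u , h = r , l , u , ≼-trans h
        (≼-trans (∑-mono rMax (λ r _ _ → each r))
        (≼-trans (≼-reflexive (trans (∑-⊕ rMax (λ r → ι 2 ⊗ E r) (λ r → ι 12 ⊗ D r)) (cong₂ _⊕_ (∑-⊗ˡ rMax (ι 2) E) (∑-⊗ˡ rMax (ι 12) D))))
          (lin 6 (λ e c n d y q → (e :≤ c :* (c :* (c :* n))) ⇒ (d :≤ q) ⇒ ((c :* (c :* c)) :* (:ι 2 :* n) :≤ (c :* (c :* c)) :* y) ⇒
              (:ι 2 :* e :+ :ι 12 :* d :≤ (c :* (c :* c)) :* y :+ :ι 12 :* q)) _ c cells _ _ _
            ∑E ∑doubles (⊗-monoˡ _ (0≼⊗ 0≼c (0≼⊗ 0≼c 0≼c)) cells-bound))))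
      where
      D : ℕ → R
      D r = ∑ q (λ k → χ (isDouble? r k))
      each : ∀ r → ι 12 ⊗ bads r ≼ ι 2 ⊗ E r ⊕ ι 12 ⊗ D r
      each r = lin 4 (λ b t d e → (b :≤ t :+ d) ⇒ (:ι 6 :* t :≤ e) ⇒ (:ι 12 :* b :≤ :ι 2 :* e :+ :ι 12 :* d)) _ _ _ _
        (≼-trans (∑-mono q (λ k _ _ → χ-⊎ (isTop? r k) (isDouble? r k)))
            (≼-reflexive (∑-⊕ q (λ k → χ (isTop? r k)) (λ k → χ (isDouble? r k))))) (tops r)

-- The labelling from a translated Sidon set

module MagicLabelling where
  open import Defs
  open OrderedField
  open LinearArithmetic
  open FiniteSums
  open Logarithms using (≼-sub)
  open SummatoryFunctions using (∑-one)
  open Equidistribution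
  open TripleCount
  open PrimeField using (module Mod)
  open RuzsaSet
  open import Data.Nat using (NonZero)
  import Data.Nat.DivMod as ℕ
  open import Data.Nat.Primality using (Prime)
  open import Data.Nat.Tactic.RingSolver using (solve-∀)
  open import Data.Fin as F using (Fin)
  import Data.Fin.Properties as F
  open import Relation.Nullary.Decidable using (¬?)
  open import Relation.Binary.Definitions using (tri<; tri≈; tri>)

  record Selection (n q : ℕ) (P : ℕ → Set) : Set where
    field
      index : Fin n → ℕ
      lower : ∀ v → 1 ℕ.≤ index v
      upper : ∀ v → index v ℕ.≤ q
      holds : ∀ v → P (index v)
      injective : ∀ v v′ → index v ≡ index v′ → v ≡ v′

  select : ∀ {P : ℕ → Set} (P? : ∀ i → Dec (P i)) n q → ι n ≼ ∑ q (λ i → χ (P? i)) → Selection n q P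
  select P? zero q _ = record { index = λ () ; lower = λ () ; upper = λ () ; holds = λ () ; injective = λ () }
  select P? (suc n) zero h = ⊥-elim (ℕ.<⇒≱ (s≤s z≤n) (ι-cancel h))
  select {P} P? (suc n) (suc q) h with P? (suc q)
  ... | no _ = record { index = index ; lower = lower ; upper = λ v → ℕ.m≤n⇒m≤1+n (upper v) ; holds = holds ; injective = injective }
    where open Selection (select P? (suc n) q (≼-trans h (≼-reflexive (⊕-identityʳ _))))
  ... | yes p = record { index = index′ ; lower = lower′ ; upper = upper′ ; holds = holds′ ; injective = injective′ }
    where
    open Selection (select P? n q (lin 3 (λ n′ n s → (n′ :≡ n :+ :ι 1) ⇒ (n′ :≤ s :+ :ι 1) ⇒ (n :≤ s)) _ _ _ (ι-suc n) h))
    index′ : Fin (suc n) → ℕ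
    index′ F.zero    = suc q
    index′ (F.suc v) = index v
    lower′ : ∀ v → 1 ℕ.≤ index′ v
    lower′ F.zero    = s≤s z≤n
    lower′ (F.suc v) = lower v
    upper′ : ∀ v → index′ v ℕ.≤ suc q
    upper′ F.zero    = ℕ.≤-refl
    upper′ (F.suc v) = ℕ.m≤n⇒m≤1+n (upper v)
    holds′ : ∀ v → P (index′ v)
    holds′ F.zero    = p
    holds′ (F.suc v) = holds v
    injective′ : ∀ v v′ → index′ v ≡ index′ v′ → v ≡ v′
    injective′ F.zero    F.zero     _ = refl
    injective′ F.zero    (F.suc v′) e = ⊥-elim (ℕ.<⇒≢ (s≤s (upper v′)) (sym e))
    injective′ (F.suc v) F.zero     e = ⊥-elim (ℕ.<⇒≢ (s≤s (upper v)) e)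
    injective′ (F.suc v) (F.suc v′) e = cong F.suc (injective v v′ e)

  module Labelling (n M r : ℕ) (B : Fin n → ℕ) (B<M : ∀ v → B v ℕ.< M)
    (B-inj : ∀ v v′ → B v ≡ B v′ → v ≡ v′)
    (B-sidon : ∀ i j k l → B i ℕ.+ B j ≡ B k ℕ.+ B l → (i ≡ k × j ≡ l) ⊎ (i ≡ l × j ≡ k))
    (B-free : ∀ i j k → ¬ (i ≡ j) → ¬ (B i ℕ.+ B j ℕ.+ B k ≡ 2 ℕ.* M ℕ.+ r)) where

    private
      s : ℕ
      s = 2 ℕ.* M ℕ.+ r

      -- All labels are shifted by 1 to be positive, so an edge and its ends add up to s + 3. Edge
      -- labels are positive because a pair sum stays below 2 M.
      label : Elem n → ℕ
      label (vert v)     = suc (B v)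
      label (edge i j _) = suc s ℕ.∸ (B i ℕ.+ B j)

      pair≤ : ∀ i j → B i ℕ.+ B j ℕ.≤ s
      pair≤ i j = ℕ.≤-trans (ℕ.+-mono-≤ (ℕ.<⇒≤ (B<M i)) (ℕ.<⇒≤ (B<M j)))
          (ℕ.≤-trans (ℕ.≤-reflexive (cong (M ℕ.+_) (sym (ℕ.+-identityʳ M)))) (ℕ.m≤m+n (2 ℕ.* M) r))

      edge-eq : ∀ i j → (suc s ℕ.∸ (B i ℕ.+ B j)) ℕ.+ (B i ℕ.+ B j) ≡ suc s
      edge-eq i j = ℕ.m∸n+n≡m (ℕ.m≤n⇒m≤1+n (pair≤ i j))

      -- Equality would make B i + B j + B v equal to s. The vertex v may be an end of the edge, and
      -- so `B-free` separates only i from j.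
      vert≢edge : ∀ v i j (p : i F.< j) → ¬ (label (vert v) ≡ label (edge i j p))
      vert≢edge v i j p e = B-free i j v (λ { refl → ℕ.<⇒≢ p refl })
          (ℕ.suc-injective (trans (l (B i) (B j) (B v)) (trans (cong (ℕ._+ (B i ℕ.+ B j)) e) (edge-eq i j))))
        where
        l : ∀ x y z → suc (x ℕ.+ y ℕ.+ z) ≡ suc z ℕ.+ (x ℕ.+ y)
        l = solve-∀

      label-injective : ∀ {x y} → label x ≡ label y → x ≡ y
      label-injective {vert v} {vert v′} e = cong vert (B-inj v v′ (ℕ.suc-injective e))
      label-injective {vert v} {edge i j p} e = ⊥-elim (vert≢edge v i j p e)
      label-injective {edge i j p} {vert v} e = ⊥-elim (vert≢edge v i j p (sym e))
      label-injective {edge i j p} {edge k l p′} e with B-sidon i j k l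
          (ℕ.+-cancelˡ-≡ (label (edge i j p)) _ _ (trans (edge-eq i j) (trans (sym (edge-eq k l)) (cong (ℕ._+ (B k ℕ.+ B l)) (sym e)))))
      ... | inj₁ (refl , refl) = cong (edge i j) (ℕ.<-irrelevant p p′)
      ... | inj₂ (refl , refl) = ⊥-elim (ℕ.<-asym p p′)

    magic : IsMagicSum n (s ℕ.+ 3)
    magic = label , label-injective , positive , λ i j p → trans (l (B i) (B j) (label (edge i j p))) (trans (cong (2 ℕ.+_) (edge-eq i j)) (l′ s))
      where
      positive : ∀ x → 0 ℕ.< label x
      positive (vert v)     = s≤s z≤n
      positive (edge i j p) = ℕ.m<n⇒0<n∸m (s≤s (pair≤ i j))
      l : ∀ x y z → suc x ℕ.+ suc y ℕ.+ z ≡ 2 ℕ.+ (z ℕ.+ (x ℕ.+ y))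
      l = solve-∀
      l′ : ∀ s → 2 ℕ.+ suc s ≡ s ℕ.+ 3
      l′ = solve-∀

  module Construction (p : ℕ) (pp : Prime p) (w : ℕ) (60≤w : 60 ℕ.≤ w) where
    -- With K = w² blocks of length L, the range w L of r is about M / w: it spans w blocks, yet
    -- adds only a 1/w share of M to the magic sum.
    q M K L : ℕ
    q = ℕ.pred p
    M = p ℕ.* q
    K = w ℕ.* w
    L = suc (M ÷ K)

    module Labels (q-large : w ℕ.* w ℕ.* (K ℕ.* K ℕ.+ 2 ℕ.* K) ℕ.< q) (2KK≤q : 2 ℕ.* K ℕ.* K ℕ.≤ q)
        (12ww≤q : 12 ℕ.* (w ℕ.* w) ℕ.+ 12 ℕ.* w ℕ.≤ q) where
      private
        suc-q : suc q ≡ p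
        suc-q = Mod.suc-q p pp
        1≤w : 1 ℕ.≤ w
        1≤w = ℕ.≤-trans (s≤s z≤n) 60≤w
        1≤K : 1 ℕ.≤ K
        1≤K = ℕ.*-mono-≤ 1≤w 1≤w
        1≤q : 1 ℕ.≤ q
        1≤q = ℕ.≤-trans (s≤s z≤n) q-large
        q≤p : q ℕ.≤ p
        q≤p = subst (q ℕ.≤_) suc-q (ℕ.n≤1+n q)
        1≤p = ℕ.≤-trans 1≤q q≤p
        q≤M : q ℕ.≤ M
        q≤M = ℕ.≤-trans (ℕ.≤-reflexive (sym (ℕ.*-identityˡ q))) (ℕ.*-monoˡ-≤ q 1≤p)
        instance
          M≢0 : NonZero M
          M≢0 = ℕ.>-nonZero (ℕ.≤-trans 1≤q q≤M)
        w≤K : w ℕ.≤ K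
        w≤K = ℕ.m≤m*n w w {{ℕ.>-nonZero 1≤w}}
        M≤KL : M ℕ.≤ K ℕ.* L
        M≤KL = ℕ.<⇒≤ (÷-lower M K 1≤K)
        KL≤M+K : K ℕ.* L ℕ.≤ M ℕ.+ K
        KL≤M+K = ℕ.≤-trans (ℕ.≤-reflexive (ℕ.*-suc K (M ÷ K))) (ℕ.≤-trans (ℕ.+-monoʳ-≤ K (÷-upper M K 1≤K)) (ℕ.≤-reflexive (ℕ.+-comm K M)))
        2K≤L : 2 ℕ.* K ℕ.≤ L
        2K≤L = ℕ.m≤n⇒m≤1+n (*≤⇒≤÷ {2 ℕ.* K} 1≤K (ℕ.≤-trans (ℕ.≤-reflexive (ℕ.*-comm K (2 ℕ.* K))) (ℕ.≤-trans 2KK≤q q≤M)))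
        1≤L : 1 ℕ.≤ L
        1≤L = s≤s z≤n
        K≤q : K ℕ.≤ q
        K≤q = ℕ.≤-trans (ℕ.≤-trans (ℕ.m≤n*m K 12) (ℕ.m≤m+n _ (12 ℕ.* w))) 12ww≤q
        L≤M : L ℕ.≤ M
        L≤M = ι-cancel (lin 4 (λ l m k q → (k :* l :≤ m :+ k) ⇒ (:ι 2 :* l :≤ k :* l) ⇒ (k :≤ q) ⇒ (q :≤ m) ⇒ (l :≤ m)) (ι L) (ι M) (ι K) (ι q)
          (≼-trans (≼-reflexive (sym (ι-* K L))) (≼-trans (ι-mono KL≤M+K) (≼-reflexive (ι-+ M K))))
              (⊗-monoʳ (ι L) (0≼ι L) (ι-mono (ℕ.≤-trans (ℕ.≤-trans (s≤s (s≤s z≤n)) 60≤w) w≤K))) (ι-mono K≤q) (ι-mono q≤M))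

        -- The primitive root behind A must not be computed during type checking; the same holds
        -- below for the translate and for r.
        abstract
          A : SidonSet q M
          A = Primitive.ruzsa p pp
        open SidonSet A
        open module SM = SecondMoment q M p (sym suc-q) refl A L 1≤L L≤M using (rem; rem-cong; rem⇒; V; V-bound; even-translate; win)
            renaming (N to winCount)

        -- Adding M - (x - 1) L carries block x onto the window [0, L) modulo M.
        c : ℕ → ℕ
        c x = M ℕ.∸ ℕ.pred x ℕ.* L

        abstract
          even : ∃ λ t → ∀ j → 1 ℕ.≤ j → j ℕ.≤ K → ι M ⊗ V (c j ℕ.+ t) ≼ ι K ⊗ V-bound
          even = even-translate K c
        t : ℕ
        t = proj₁ even

        b : ℕ → ℕ
        b i = rem (a i ℕ.+ t)

        b<M : ∀ i → b i ℕ.< M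
        b<M i = ℕ.m%n<n (a i ℕ.+ t) M

        in-window : ∀ i x → suc (b i ÷ L) ≡ x → rem (a i ℕ.+ (c x ℕ.+ t)) ℕ.< L
        in-window i .(suc (b i ÷ L)) refl = subst (ℕ._< L) (sym rem≡)
            (ℕ.+-cancelʳ-< y (b i ℕ.∸ y) L (subst₂ ℕ._<_ (sym (ℕ.m∸n+n≡m y≤b)) (cong (L ℕ.+_) (ℕ.*-comm L (b i ÷ L)))
            (subst (b i ℕ.<_) (ℕ.*-suc L (b i ÷ L)) (÷-lower (b i) L 1≤L))))
          where
          y : ℕ
          y = b i ÷ L ℕ.* L
          y≤b : y ℕ.≤ b i
          y≤b = ℕ.≤-trans (ℕ.≤-reflexive (ℕ.*-comm (b i ÷ L) L)) (÷-upper (b i) L 1≤L)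
          z : ℕ
          z = b i ℕ.∸ y
          sums : b i ℕ.+ (M ℕ.∸ y) ≡ z ℕ.+ M
          sums = ℕ.+-cancelʳ-≡ y _ _ (trans (ℕ.+-assoc (b i) (M ℕ.∸ y) y)
              (trans (cong (b i ℕ.+_) (ℕ.m∸n+n≡m (ℕ.≤-trans y≤b (ℕ.<⇒≤ (b<M i))))) (trans (cong (ℕ._+ M) (sym (ℕ.m∸n+n≡m y≤b))) (l z y M))))
            where
            l : ∀ z y M → z ℕ.+ y ℕ.+ M ≡ z ℕ.+ M ℕ.+ y
            l = solve-∀
          rem≡ : rem (a i ℕ.+ (c (suc (b i ÷ L)) ℕ.+ t)) ≡ z
          rem≡ = trans (cong rem (l (a i) (M ℕ.∸ y) t))
              (trans (rem-cong (M ℕ.∸ y) (sym (ℕ.m%n%n≡m%n (a i ℕ.+ t) M)))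
              (trans (cong rem sums) (trans (ℕ.[m+n]%n≡m%n z M) (ℕ.m<n⇒m%n≡m (ℕ.≤-<-trans (ℕ.m∸n≤m (b i) y) (b<M i))))))
            where
            l : ∀ a m t → a ℕ.+ (m ℕ.+ t) ≡ a ℕ.+ t ℕ.+ m
            l = solve-∀

        C cap : R
        C = ι 1 ⊕ rec w
        cap = (ι L ⊗ rec p) ⊗ C

        0≼C : ι 0 ≼ C
        0≼C = lin 1 (λ r → (:ι 0 :≤ r) ⇒ (:ι 0 :≤ :ι 1 :+ r)) _ (rec-nonneg w)
        0≼cap : ι 0 ≼ cap
        0≼cap = 0≼⊗ (0≼⊗ (0≼ι L) (rec-nonneg p)) 0≼C
        pρ : ι p ⊗ rec p ≡ ι 1
        pρ = rec-inv′ p 1≤p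
        wρ : ι w ⊗ rec w ≡ ι 1
        wρ = rec-inv′ w 1≤w
        ιM : ι M ≡ ι p ⊗ ι q
        ιM = ι-* p q
        ιp : ι p ≡ ι q ⊕ ι 1
        ιp = trans (cong ι (sym suc-q)) (ι-suc q)
        ιK : ι K ≡ ι w ⊗ ι w
        ιK = ι-* w w
        KL≼ : ι K ⊗ ι L ≼ ι M ⊕ ι K
        KL≼ = ≼-trans (≼-reflexive (sym (ι-* K L))) (≼-trans (ι-mono KL≤M+K) (≼-reflexive (ι-+ M K)))
        M≼ : ι M ≼ ι K ⊗ ι L
        M≼ = ≼-trans (ι-mono M≤KL) (≼-reflexive (ι-* K L))

        -- A larger count deviates by at least L / w. Then the bound on V reads M L² ≤ w² K
        -- `V-bound`, and this reduces to q ≤ w² (K² + 2 K), against `q-large`.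
        window-cap : ∀ x → ι M ⊗ V x ≼ ι K ⊗ V-bound → ι p ⊗ winCount x ≼ ι L ⊗ C
        window-cap x h with ≼-total (ι p ⊗ winCount x) (ι L ⊗ C)
        ... | inj₁ le = le
        ... | inj₂ ge = ⊥-elim (1⋠0 (⊗-cancelˡ {ι 1} {ι 0} (p ℕ.* p ℕ.* q) (ℕ.*-mono-≤ (ℕ.*-mono-≤ 1≤p 1≤p) 1≤q)
              (lin 4 (λ s t q W → (s :≡ t) ⇒ (t :* q :≤ t :* W) ⇒ (t :* (W :+ :ι 1) :≤ t :* q) ⇒
                  (s :* :ι 1 :≤ s :* :ι 0)) _ (ι p ⊗ ι p ⊗ ι q) (ι q) _ (trans (ι-* (p ℕ.* p) q) (⊗-congʳ (ι-* p p))) few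
                (⊗-monoˡ _ (0≼⊗ (0≼⊗ (0≼ι p) (0≼ι p)) (0≼ι q))
                    (≼-trans (≼-reflexive (sym (trans (ι-suc (w ℕ.* w ℕ.* (K ℕ.* K ℕ.+ 2 ℕ.* K)))
                    (⊕-congʳ (trans (ι-* (w ℕ.* w) _) (cong₂ _⊗_ (ι-* w w) (trans (ι-+ (K ℕ.* K) _) (cong₂ _⊕_ (ι-* K K) (ι-* 2 K)))))))))
                    (ι-mono q-large))))))
          where
          D : R
          D = ι p ⊗ winCount x ⊖ ι L
          D≥ : ι L ⊗ rec w ≼ D
          D≥ = lin 3 (λ y l r → (l :* (:ι 1 :+ r) :≤ y) ⇒ (l :* r :≤ y :- l)) _ _ _ ge
          Lr : ι 0 ≼ ι L ⊗ rec w
          Lr = 0≼⊗ (0≼ι L) (rec-nonneg w)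
          DD : (ι L ⊗ rec w) ⊗ (ι L ⊗ rec w) ≼ D ⊗ D
          DD = ⊗-mono Lr (≼-trans Lr D≥) D≥ D≥
          step₁ : ι M ⊗ (ι L ⊗ ι L) ≼ (ι w ⊗ ι w) ⊗ (ι K ⊗ V-bound)
          step₁ = lin 7 (λ m l r w d v k → (:ι 0 :≤ (w :* w) :* (k :* v :- m :* d)) ⇒
              (:ι 0 :≤ ((w :* w) :* m) :* (d :- (l :* r) :* (l :* r))) ⇒ (w :* r :≡ :ι 1) ⇒
               ((w :* r) :* ((w :* r) :* (m :* (l :* l))) :≡ :ι 1 :* ((w :* r) :* (m :* (l :* l)))) ⇒
                   ((w :* r) :* (m :* (l :* l)) :≡ :ι 1 :* (m :* (l :* l))) ⇒ (m :* (l :* l) :≤ (w :* w) :* (k :* v))) (ι M) (ι L) (rec w)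
                   (ι w) (D ⊗ D) V-bound (ι K)
            (0≼⊗ (0≼⊗ (0≼ι w) (0≼ι w)) (≼-sub h)) (0≼⊗ (0≼⊗ (0≼⊗ (0≼ι w) (0≼ι w)) (0≼ι M)) (≼-sub DD)) wρ (⊗-congʳ wρ) (⊗-congʳ wρ)
          step₂ : ι M ⊗ ι L ≼ (ι w ⊗ ι w) ⊗ (ι K ⊗ ((ι p ⊗ ι p) ⊗ ι q ⊕ ι p ⊗ ι L))
          step₂ = ⊗-cancelˡ L 1≤L (lin 6 (λ m l w k p q → (m :* (l :* l) :≤ (w :* w) :* (k :* ((p :* p) :* (q :* l) :+ p :* (l :* l)))) ⇒
              (l :* (m :* l) :≤ l :* ((w :* w) :* (k :* ((p :* p) :* q :+ p :* l))))) (ι M) (ι L) (ι w) (ι K) (ι p) (ι q) step₁)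
          KL2 : ι K ⊗ ι L ≼ ι 2 ⊗ (ι p ⊗ ι q)
          KL2 = lin 5 (λ kl m k q pq → (kl :≤ m :+ k) ⇒ (k :≤ q) ⇒ (q :≤ m) ⇒ (m :≡ pq) ⇒ (kl :≤ :ι 2 :* pq)) _ _ _ _ _ KL≼ (ι-mono K≤q)
              (ι-mono q≤M) ιM
          few : (ι p ⊗ ι p ⊗ ι q) ⊗ ι q ≼ (ι p ⊗ ι p ⊗ ι q) ⊗ ((ι w ⊗ ι w) ⊗ (ι K ⊗ ι K ⊕ ι 2 ⊗ ι K))
          few = lin 6 (λ m l w k p q → (k :* (m :* l) :≤ k :* ((w :* w) :* (k :* ((p :* p) :* q :+ p :* l)))) ⇒
              (:ι 0 :≤ ((w :* w) :* (k :* p)) :* (:ι 2 :* (p :* q) :- k :* l)) ⇒ (:ι 0 :≤ m :* (k :* l :- m)) ⇒ (m :* m :≡ (p :* q) :* (p :* q)) ⇒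
              ((p :* p :* q) :* q :≤ (p :* p :* q) :* ((w :* w) :* (k :* k :+ :ι 2 :* k)))) (ι M) (ι L) (ι w) (ι K) (ι p) (ι q)
            (⊗-monoˡ (ι K) (0≼ι K) step₂) (0≼⊗ (0≼⊗ (0≼⊗ (0≼ι w) (0≼ι w)) (0≼⊗ (0≼ι K) (0≼ι p))) (≼-sub KL2)) (0≼⊗ (0≼ι M) (≼-sub M≼))
                (cong₂ _⊗_ ιM ιM)

        block-cap : ∀ x → ∑ q (λ i → χ (suc (b i ÷ L) ℕ.≟ x)) ≼ cap
        block-cap x with 1 ℕ.≤? x | x ℕ.≤? K
        ... | yes 1≤x | yes x≤K = ≼-trans (∑-mono q (λ i _ _ → χ-mono (suc (b i ÷ L) ℕ.≟ x) (rem (a i ℕ.+ (c x ℕ.+ t)) ℕ.<? L) (in-window i x)))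
              (⊗-cancelˡ p 1≤p (lin 5 (λ p n l r C → (p :* n :≤ l :* C) ⇒ ((p :* r) :* (l :* C) :≡ :ι 1 :* (l :* C)) ⇒
                  (p :* n :≤ p :* ((l :* r) :* C))) (ι p) (winCount (c x ℕ.+ t)) (ι L) (rec p) C
                  (window-cap (c x ℕ.+ t) (proj₂ even x 1≤x x≤K)) (⊗-congʳ pρ)))
        ... | no 1≰x | _ = ≼-trans (≼-reflexive (trans (∑-cong′ q (λ i → χ-no (suc (b i ÷ L) ℕ.≟ x) (λ { refl → 1≰x (s≤s z≤n) }))) (∑-zero q))) 0≼cap
        ... | yes _ | no x≰K = ≼-trans (≼-reflexive
            (trans (∑-cong′ q (λ i → χ-no (suc (b i ÷ L) ℕ.≟ x)
            (λ { refl → x≰K (ℕ.*-cancelʳ-< L (b i ÷ L) K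
            (ℕ.≤-<-trans (ℕ.≤-trans (ℕ.≤-reflexive (ℕ.*-comm (b i ÷ L) L)) (÷-upper (b i) L 1≤L)) (ℕ.<-≤-trans (b<M i) M≤KL))) }))) (∑-zero q))) 0≼cap

        open module TR = Triples q M b b<M L K w 1≤L M≤KL KL≤M+K 2K≤L cap 0≼cap block-cap 1≤w using (few-bad; Bad; bad?; bads; rMax)

        abstract
          chosen : ∃ λ r → 1 ℕ.≤ r × r ℕ.≤ rMax × ι rMax ⊗ (ι 12 ⊗ bads r) ≼ (cap ⊗ (cap ⊗ cap)) ⊗ ((ι w ⊕ ι 4) ⊗ (ι K ⊗ (ι K ⊕ ι 3)))
              ⊕ ι 12 ⊗ (ι q ⊗ ι q)
          chosen = few-bad

      r : ℕ
      r = proj₁ chosen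
      r≤ : r ℕ.≤ w ℕ.* L
      r≤ = proj₁ (proj₂ (proj₂ chosen))

      private
        W P : R
        W = ι w
        P = ι p
        60≼w : ι 60 ≼ W
        60≼w = ι-mono 60≤w
        pwcap : ι p ⊗ (W ⊗ cap) ≡ ι L ⊗ (W ⊕ ι 1)
        pwcap = lin 5 (λ p w l r s → (p :* r :≡ :ι 1) ⇒ (w :* s :≡ :ι 1) ⇒
            ((p :* r) :* (l :* (w :+ w :* s)) :≡ :ι 1 :* (l :* (w :+ w :* s))) ⇒ (l :* (w :* s) :≡ l :* :ι 1) ⇒
            (p :* (w :* ((l :* r) :* (:ι 1 :+ s))) :≡ l :* (w :+ :ι 1)))
          (ι p) W (ι L) (rec p) (rec w) pρ wρ (⊗-congʳ pρ) (⊗-congˡ wρ)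
        KL≼p² : ι K ⊗ ι L ≼ ι p ⊗ ι p
        KL≼p² = lin 5 (λ kl m k p q → (kl :≤ m :+ k) ⇒ (m :≡ p :* q) ⇒ (k :≤ q) ⇒ (p :≡ q :+ :ι 1) ⇒ (p :* p :≡ p :* (q :+ :ι 1)) ⇒
            (kl :≤ p :* p)) _ (ι M) (ι K) (ι p) (ι q) KL≼ ιM (ι-mono K≤q) ιp (⊗-congˡ ιp)
        -- The product (w + 1)³ (w + 4) begins w⁴ + 7 w³, so the factor w + 8 leaves one w⁵ to spare
        -- for all lower terms when w ≥ 60.
        poly : (W ⊕ ι 1) ⊗ ((W ⊕ ι 1) ⊗ (W ⊕ ι 1)) ⊗ ((W ⊕ ι 4) ⊗ (W ⊗ W ⊕ ι 3)) ≼ (W ⊗ W ⊗ W) ⊗ ((W ⊗ W) ⊗ (W ⊕ ι 8))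
        poly = lin 1 (λ w → (:ι 0 :≤ (w :* (w :* (w :* w))) :* (w :- :ι 60)) ⇒ (:ι 0 :≤ (w :* (w :* w)) :* (w :- :ι 60)) ⇒
            (:ι 0 :≤ (w :* w) :* (w :- :ι 60)) ⇒ (:ι 0 :≤ w :* (w :- :ι 60)) ⇒ (:ι 60 :≤ w) ⇒
            ((w :+ :ι 1) :* ((w :+ :ι 1) :* (w :+ :ι 1)) :* ((w :+ :ι 4) :* (w :* w :+ :ι 3)) :≤ (w :* w :* w) :* ((w :* w) :* (w :+ :ι 8)))) W
          (0≼⊗ w⁴ d) (0≼⊗ w³ d) (0≼⊗ w² d) (0≼⊗ (0≼ι w) d) 60≼w
          where
          d = ≼-sub 60≼w
          w² = 0≼⊗ (0≼ι w) (0≼ι w)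
          w³ = 0≼⊗ (0≼ι w) w²
          w⁴ = 0≼⊗ (0≼ι w) w³
        Q : R
        Q = (W ⊕ ι 4) ⊗ (ι K ⊗ (ι K ⊕ ι 3))

        -- Uses (p w cap)³ = (L (w + 1))³, (K L)² ≤ p⁴ and K = w².
        main-term : (cap ⊗ (cap ⊗ cap)) ⊗ Q ≼ ι L ⊗ (P ⊗ (W ⊕ ι 8))
        main-term = ⊗-cancelˡ (p ℕ.* p ℕ.* p ℕ.* (w ℕ.* w ℕ.* w) ℕ.* K)
            (ℕ.*-mono-≤ (ℕ.*-mono-≤ (ℕ.*-mono-≤ (ℕ.*-mono-≤ 1≤p 1≤p) 1≤p) (ℕ.*-mono-≤ (ℕ.*-mono-≤ 1≤w 1≤w) 1≤w)) 1≤K)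
            (subst (λ s → s ⊗ ((cap ⊗ (cap ⊗ cap)) ⊗ Q) ≼ s ⊗ (ι L ⊗ (P ⊗ (W ⊕ ι 8)))) (sym scale)
              (≼-trans (≼-reflexive lhs) (≼-trans (⊗-monoˡ (ι L) (0≼ι L) (≼-trans (⊗-monoʳ _ nonneg square) (⊗-monoˡ _ p⁴ poly′)))
                  (≼-reflexive rhs))))
          where
          S : R
          S = (P ⊗ P ⊗ P) ⊗ (W ⊗ W ⊗ W) ⊗ ι K
          scale : ι (p ℕ.* p ℕ.* p ℕ.* (w ℕ.* w ℕ.* w) ℕ.* K) ≡ S
          scale = trans (ι-* (p ℕ.* p ℕ.* p ℕ.* (w ℕ.* w ℕ.* w)) K)
              (⊗-congʳ (trans (ι-* (p ℕ.* p ℕ.* p) _) (cong₂ _⊗_ (trans (ι-* (p ℕ.* p) p) (⊗-congʳ (ι-* p p)))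
              (trans (ι-* (w ℕ.* w) w) (⊗-congʳ (ι-* w w))))))
          Y : R
          Y = P ⊗ (W ⊗ cap)
          B : R
          B = (W ⊕ ι 1) ⊗ ((W ⊕ ι 1) ⊗ (W ⊕ ι 1)) ⊗ ((W ⊕ ι 4) ⊗ (ι K ⊕ ι 3))
          lhs : S ⊗ ((cap ⊗ (cap ⊗ cap)) ⊗ Q) ≡ ι L ⊗ (((ι K ⊗ ι L) ⊗ (ι K ⊗ ι L)) ⊗ B)
          lhs = trans (lin 5 (λ p w k c v → ((p :* p :* p) :* (w :* w :* w) :* k) :* ((c :* (c :* c)) :* (v :* (k :* (k :+ :ι 3)))) :≡
              ((p :* (w :* c)) :* ((p :* (w :* c)) :* (p :* (w :* c)))) :* (k :* (v :* (k :* (k :+ :ι 3))))) P W (ι K) cap (W ⊕ ι 4))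
            (trans (cong (λ y → (y ⊗ (y ⊗ y)) ⊗ (ι K ⊗ ((W ⊕ ι 4) ⊗ (ι K ⊗ (ι K ⊕ ι 3))))) pwcap)
              (lin 4 (λ l u v k → ((l :* u) :* ((l :* u) :* (l :* u))) :* (k :* (v :* (k :* (k :+ :ι 3)))) :≡ l :*
                  (((k :* l) :* (k :* l)) :* (u :* (u :* u) :* (v :* (k :+ :ι 3))))) (ι L) (W ⊕ ι 1) (W ⊕ ι 4) (ι K)))
          p⁴ : ι 0 ≼ (P ⊗ P) ⊗ (P ⊗ P)
          p⁴ = 0≼⊗ (0≼⊗ (0≼ι p) (0≼ι p)) (0≼⊗ (0≼ι p) (0≼ι p))
          nn : ∀ m → ι 0 ≼ W ⊕ ι m
          nn m = ≼-trans (0≼ι (w ℕ.+ m)) (≼-reflexive (ι-+ w m))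
          nonneg : ι 0 ≼ B
          nonneg = 0≼⊗ (0≼⊗ (nn 1) (0≼⊗ (nn 1) (nn 1))) (0≼⊗ (nn 4) (≼-trans (0≼ι (K ℕ.+ 3)) (≼-reflexive (ι-+ K 3))))
          square : (ι K ⊗ ι L) ⊗ (ι K ⊗ ι L) ≼ (P ⊗ P) ⊗ (P ⊗ P)
          square = ⊗-mono (0≼⊗ (0≼ι K) (0≼ι L)) (0≼⊗ (0≼ι p) (0≼ι p)) KL≼p² KL≼p²
          poly′ : B ≼ (W ⊗ W ⊗ W) ⊗ (ι K ⊗ (W ⊕ ι 8))
          poly′ = subst (λ k → (W ⊕ ι 1) ⊗ ((W ⊕ ι 1) ⊗ (W ⊕ ι 1)) ⊗ ((W ⊕ ι 4) ⊗ (k ⊕ ι 3)) ≼ (W ⊗ W ⊗ W) ⊗ (k ⊗ (W ⊕ ι 8))) (sym ιK) poly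
          rhs : ι L ⊗ (((P ⊗ P) ⊗ (P ⊗ P)) ⊗ ((W ⊗ W ⊗ W) ⊗ (ι K ⊗ (W ⊕ ι 8)))) ≡ S ⊗ (ι L ⊗ (P ⊗ (W ⊕ ι 8)))
          rhs = lin 5 (λ l p w k v → l :* (((p :* p) :* (p :* p)) :* ((w :* w :* w) :* (k :* v))) :≡ ((p :* p :* p) :* (w :* w :* w) :* k)
              :* (l :* (p :* v))) (ι L) P W (ι K) (W ⊕ ι 8)

        -- `few-bad` divided by L: at most p/12 (1 + 8/w) + K/w elements are bad, the last term
        -- coming from q² / (w L) and q² ≤ M ≤ K L.
        12wbads : ι 12 ⊗ (W ⊗ bads r) ≼ P ⊗ (W ⊕ ι 8) ⊕ ι 12 ⊗ ι K
        12wbads = ⊗-cancelˡ L 1≤L (lin 10 (λ w l β x y q k m p s → (s :≡ w :* l) ⇒ (s :* (:ι 12 :* β) :≤ x :+ :ι 12 :* (q :* q)) ⇒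
            (s :* (:ι 12 :* β) :≡ (w :* l) :* (:ι 12 :* β)) ⇒ (x :≤ l :* y) ⇒ (:ι 0 :≤ q :* (p :- q)) ⇒ (m :≤ k :* l) ⇒ (m :≡ p :* q) ⇒
              (l :* (:ι 12 :* (w :* β)) :≤ l :* (y :+ :ι 12 :* k))) W (ι L) (bads r) _ (P ⊗ (W ⊕ ι 8)) (ι q) (ι K) (ι M) P (ι rMax)
            (ι-* w L) (proj₂ (proj₂ (proj₂ chosen))) (⊗-congʳ (ι-* w L)) main-term (0≼⊗ (0≼ι q) (≼-sub (ι-mono q≤p))) M≼ ιM)

      good? : ∀ i → Dec (¬ Bad r i)
      good? i = ¬? (bad? r i)

      private
        good-count : ∑ q (λ i → χ (good? i)) ≡ ι q ⊖ bads r
        good-count = trans (∑-cong′ q (λ i → complement (bad? r i))) (trans (∑-⊖ q (λ _ → ι 1) (λ i → χ (bad? r i))) (cong (_⊖ bads r) (∑-one q)))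
          where
          complement : ∀ {P : Set} (d : Dec P) → χ (¬? d) ≡ ι 1 ⊖ χ d
          complement (yes _) = lin 0 (:ι 0 :≡ :ι 1 :- :ι 1)
          complement (no _)  = lin 0 (:ι 1 :≡ :ι 1 :- :ι 0)

      -- Here d / (12 w) = 11/12 - 3/w. The margin 3/w absorbs the excess 8/(12 w) of `12wbads`, the
      -- difference of p and q, and the terms in K.
      many-good : ∀ n d → d ℕ.+ 36 ≡ 11 ℕ.* w → 12 ℕ.* w ℕ.* n ℕ.≤ d ℕ.* p → ι n ≼ ∑ q (λ i → χ (good? i))
      many-good n d d≡ h = ≼-trans (⊗-cancelˡ (12 ℕ.* w) (ℕ.*-mono-≤ {1} {12} (s≤s z≤n) 1≤w)
          (lin 8 (λ s w n q β d p k → (s :≡ :ι 12 :* w) ⇒ (s :* n :≤ d :* p) ⇒ (d :+ :ι 36 :≡ :ι 11 :* w) ⇒ ((d :+ :ι 36) :* p :≡ (:ι 11 :* w) :* p) ⇒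
            (:ι 12 :* (w :* β) :≤ p :* (w :+ :ι 8) :+ :ι 12 :* k) ⇒ (k :≡ w :* w) ⇒ (:ι 12 :* (w :* w) :+ :ι 12 :* w :≤ q) ⇒
                (p :≡ q :+ :ι 1) ⇒ (w :* p :≡ w :* (q :+ :ι 1)) ⇒ (s :* (q :- β) :≡ (:ι 12 :* w) :* (q :- β)) ⇒ (:ι 0 :≤ q) ⇒
            (s :* n :≤ s :* (q :- β))) (ι (12 ℕ.* w)) W (ι n) (ι q) (bads r) (ι d) P (ι K)
          (ι-* 12 w) (≼-trans (≼-reflexive (sym (ι-* (12 ℕ.* w) n))) (≼-trans (ι-mono h) (≼-reflexive (ι-* d p)))) d≡ᴿ (⊗-congʳ d≡ᴿ) 12wbads ιK
          (≼-trans (≼-reflexive (sym (trans (ι-+ (12 ℕ.* (w ℕ.* w)) _) (cong₂ _⊕_ (trans (ι-* 12 _) (⊗-congˡ (ι-* w w))) (ι-* 12 w)))))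
              (ι-mono 12ww≤q)) ιp (⊗-congˡ ιp) (⊗-congʳ (ι-* 12 w)) (0≼ι q))) (≼-reflexive (sym good-count))
        where
        d≡ᴿ : ι d ⊕ ι 36 ≡ ι 11 ⊗ W
        d≡ᴿ = trans (sym (ι-+ d 36)) (trans (cong ι d≡) (ι-* 11 w))

      private
        b-sidon : ∀ i j k l → 1 ℕ.≤ i → i ℕ.≤ q → 1 ℕ.≤ j → j ℕ.≤ q → 1 ℕ.≤ k → k ℕ.≤ q → 1 ℕ.≤ l → l ℕ.≤ q → b i ℕ.+ b j ≡ b k ℕ.+ b l →
            (i ≡ k × j ≡ l) ⊎ (i ≡ l × j ≡ k)
        b-sidon i j k l li ui lj uj lk uk ll ul e = sidon i j k l li ui lj uj lk uk ll ul (f k ℕ.+ f l) (f i ℕ.+ f j)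
            (ℕ.+-cancelʳ-≡ (t ℕ.+ t) _ _ (trans (l₁ (a i) (a j) t (f k) (f l) M) (trans (cong₂ (λ x y → x ℕ.+ y ℕ.+ (f k ℕ.+ f l) ℕ.* M) (ρ i) (ρ j))
              (trans (l₂ (b i) (f i) (b j) (f j) M (f k) (f l))
                  (trans (cong (λ x → x ℕ.+ (f i ℕ.+ f j ℕ.+ (f k ℕ.+ f l)) ℕ.* M) e) (trans (sym (l₃ (b k) (f k) (b l) (f l) M (f i) (f j)))
                (trans (cong₂ (λ x y → x ℕ.+ y ℕ.+ (f i ℕ.+ f j) ℕ.* M) (sym (ρ k)) (sym (ρ l))) (sym (l₁ (a k) (a l) t (f i) (f j) M)))))))))
          where
          f : ℕ → ℕ
          f i = (a i ℕ.+ t) ℕ./ M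
          ρ : ∀ i → a i ℕ.+ t ≡ b i ℕ.+ f i ℕ.* M
          ρ i = ℕ.m≡m%n+[m/n]*n (a i ℕ.+ t) M
          l₁ : ∀ x y t u v M → x ℕ.+ y ℕ.+ (u ℕ.+ v) ℕ.* M ℕ.+ (t ℕ.+ t) ≡ (x ℕ.+ t) ℕ.+ (y ℕ.+ t) ℕ.+ (u ℕ.+ v) ℕ.* M
          l₁ = solve-∀
          l₂ : ∀ x f y g M u v → (x ℕ.+ f ℕ.* M) ℕ.+ (y ℕ.+ g ℕ.* M) ℕ.+ (u ℕ.+ v) ℕ.* M ≡ x ℕ.+ y ℕ.+ (f ℕ.+ g ℕ.+ (u ℕ.+ v)) ℕ.* M
          l₂ = solve-∀
          l₃ : ∀ x f y g M u v → (x ℕ.+ f ℕ.* M) ℕ.+ (y ℕ.+ g ℕ.* M) ℕ.+ (u ℕ.+ v) ℕ.* M ≡ x ℕ.+ y ℕ.+ (u ℕ.+ v ℕ.+ (f ℕ.+ g)) ℕ.* M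
          l₃ = solve-∀

      private
        from-selection : ∀ n → Selection n q (λ i → ¬ Bad r i) → IsMagicSum n (2 ℕ.* M ℕ.+ r ℕ.+ 3)
        from-selection n sel = Labelling.magic n M r (λ v → b (index v)) (λ v → b<M (index v)) B-inj
            (λ i j k l e → transport i j k l (b-sidon (index i) (index j) (index k) (index l) (lower i) (upper i) (lower j) (upper j)
                (lower k) (upper k) (lower l) (upper l) e)) free
          where
          open Selection sel
          transport : ∀ i j k l → (index i ≡ index k × index j ≡ index l) ⊎ (index i ≡ index l × index j ≡ index k) → (i ≡ k × j ≡ l) ⊎
              (i ≡ l × j ≡ k)
          transport i j k l (inj₁ (e , e′)) = inj₁ (injective i k e , injective j l e′)
          transport i j k l (inj₂ (e , e′)) = inj₂ (injective i l e , injective j k e′)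
          B-inj : ∀ v v′ → b (index v) ≡ b (index v′) → v ≡ v′
          B-inj v v′ e with transport v v v′ v′ (b-sidon (index v) (index v) (index v′) (index v′) (lower v) (upper v) (lower v) (upper v)
              (lower v′) (upper v′) (lower v′) (upper v′) (cong₂ ℕ._+_ e e))
          ... | inj₁ (e′ , _) = e′
          ... | inj₂ (e′ , _) = e′
          target : ℕ
          target = 2 ℕ.* M ℕ.+ r
          no-top : ∀ i j k → b (index i) ℕ.< b (index j) → b (index j) ℕ.< b (index k) → ¬ (b (index i) ℕ.+ b (index j) ℕ.+ b (index k) ≡ target)
          no-top i j k lt lt′ e = holds k (inj₁ (index i , lower i , upper i , index j , lower j , upper j , (lt , lt′) , e))
          no-double : ∀ k j → ¬ (b (index k) ℕ.+ b (index k) ℕ.+ b (index j) ≡ target)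
          no-double k j e = holds k (inj₂ (index j , lower j , upper j , e))
          l₁ : ∀ x y z → x ℕ.+ z ℕ.+ y ≡ x ℕ.+ y ℕ.+ z
          l₁ = solve-∀
          l₂ : ∀ x y z → z ℕ.+ x ℕ.+ y ≡ x ℕ.+ y ℕ.+ z
          l₂ = solve-∀
          l₃ : ∀ x y z → y ℕ.+ x ℕ.+ z ≡ x ℕ.+ y ℕ.+ z
          l₃ = solve-∀
          l₄ : ∀ x y z → y ℕ.+ z ℕ.+ x ≡ x ℕ.+ y ℕ.+ z
          l₄ = solve-∀
          l₅ : ∀ x y z → z ℕ.+ y ℕ.+ x ≡ x ℕ.+ y ℕ.+ z
          l₅ = solve-∀
          -- If k has the value of i or j, the sum is a double; otherwise the largest of three
          -- distinct values is a top. Selected elements are neither.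
          free< : ∀ i j k → b (index i) ℕ.< b (index j) → ¬ (b (index i) ℕ.+ b (index j) ℕ.+ b (index k) ≡ target)
          free< i j k i<j e with ℕ.<-cmp (b (index k)) (b (index i)) | ℕ.<-cmp (b (index k)) (b (index j))
          ... | tri< k<i _ _ | _ = no-top k i j k<i i<j (trans (l₂ (b (index i)) (b (index j)) (b (index k))) e)
          ... | tri≈ _ k≡i _ | _ = no-double i j (trans (l₁ (b (index i)) (b (index j)) (b (index i)))
              (trans (cong (b (index i) ℕ.+ b (index j) ℕ.+_) (sym k≡i)) e))
          ... | tri> _ _ i<k | tri< k<j _ _ = no-top i k j i<k k<j (trans (l₁ (b (index i)) (b (index j)) (b (index k))) e)
          ... | tri> _ _ _   | tri≈ _ k≡j _ = no-double j i
              (trans (l₄ (b (index i)) (b (index j)) (b (index j))) (trans (cong (b (index i) ℕ.+ b (index j) ℕ.+_) (sym k≡j)) e))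
          ... | tri> _ _ _   | tri> _ _ j<k = no-top i j k i<j j<k e
          free : ∀ i j k → ¬ (i ≡ j) → ¬ (b (index i) ℕ.+ b (index j) ℕ.+ b (index k) ≡ target)
          free i j k i≢j e with ℕ.<-cmp (b (index i)) (b (index j))
          ... | tri< lt _ _ = free< i j k lt e
          ... | tri≈ _ eq _ = i≢j (B-inj i j eq)
          ... | tri> _ _ gt = free< j i k gt (trans (l₃ (b (index i)) (b (index j)) (b (index k))) e)

      magic : ∀ n → ι n ≼ ∑ q (λ i → χ (good? i)) → IsMagicSum n (2 ℕ.* M ℕ.+ r ℕ.+ 3)
      magic n h = from-selection n (select good? n q h)

      -- M is p² - p and r is at most w L, about p² / w; the saving 2 p in 2 M pays for the rounding
      -- of L and the final 3.
      sum-bound : W ⊗ ι (2 ℕ.* M ℕ.+ r ℕ.+ 3) ≼ (ι 2 ⊗ W ⊕ ι 1) ⊗ (P ⊗ P)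
      sum-bound = lin 8 (λ s m r w l k p q → (s :≡ :ι 2 :* m :+ r :+ :ι 3) ⇒ (w :* s :≡ w :* (:ι 2 :* m :+ r :+ :ι 3)) ⇒
          (w :* r :≤ w :* (w :* l)) ⇒ (k :* l :≡ (w :* w) :* l) ⇒ (k :* l :≤ m :+ k) ⇒ (k :≡ w :* w) ⇒ (m :≡ p :* q) ⇒
          (w :* m :≡ w :* (p :* q)) ⇒ (p :≡ q :+ :ι 1) ⇒ (p :* p :≡ p :* (q :+ :ι 1)) ⇒ (w :* (p :* p) :≡ w :* (p :* (q :+ :ι 1))) ⇒
            (:ι 12 :* (w :* w) :+ :ι 12 :* w :≤ q) ⇒ (:ι 0 :≤ w :* p) ⇒ (:ι 0 :≤ w) ⇒ (:ι 0 :≤ w :* w) ⇒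
                (w :* s :≤ (:ι 2 :* w :+ :ι 1) :* (p :* p))) (ι (2 ℕ.* M ℕ.+ r ℕ.+ 3)) (ι M) (ι r) W (ι L) (ι K) P (ι q)
        ιs (⊗-congˡ ιs) (⊗-monoˡ W (0≼ι w) (≼-trans (ι-mono r≤) (≼-reflexive (ι-* w L)))) (⊗-congʳ ιK) KL≼ ιK ιM (⊗-congˡ ιM) ιp
            (⊗-congˡ ιp) (⊗-congˡ (⊗-congˡ ιp))
        (≼-trans (≼-reflexive (sym (trans (ι-+ (12 ℕ.* (w ℕ.* w)) _) (cong₂ _⊕_ (trans (ι-* 12 _) (⊗-congˡ (ι-* w w))) (ι-* 12 w)))))
            (ι-mono 12ww≤q)) (0≼⊗ (0≼ι w) (0≼ι p)) (0≼ι w) (0≼⊗ (0≼ι w) (0≼ι w))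
        where
        ιs : ι (2 ℕ.* M ℕ.+ r ℕ.+ 3) ≡ ι 2 ⊗ ι M ⊕ ι r ⊕ ι 3
        ιs = trans (ι-+ (2 ℕ.* M ℕ.+ r) 3) (⊕-congʳ (trans (ι-+ (2 ℕ.* M) r) (⊕-congʳ (ι-* 2 M))))

-- Choice of the parameters

open import Defs
open OrderedField
open LinearArithmetic
open FiniteSums
open Logarithms using (≼-sub)
open PrimeGaps using (prime-in-interval)
open PrimeField using (module Mod)
open MagicLabelling
open import Data.Nat.Primality using (Prime)
open import Data.Nat using (_+_; _*_; _≤_)
open import Data.Product using (Σ)

private
  -- Both sides begin with 288 · 121 κ w⁵. The factors 2 w + 1, v⁴ and d² cost about 11/w = 11/(60
  -- κ) in relative terms, and the summand 121 on the right gains 121/(288 κ), which is more; this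
  -- is the reason for w = 60 κ.
  final-polynomial : ∀ κ → ι 1 ≼ κ → let w = ι 60 ⊗ κ ; d = ι 11 ⊗ w ⊖ ι 36 ; v = w ⊕ ι 1 in
    ι 121 ⊗ κ ⊗ ((ι 2 ⊗ w ⊕ ι 1) ⊗ (ι 144 ⊗ ((v ⊗ v) ⊗ (v ⊗ v)))) ≼ (ι 288 ⊗ κ ⊕ ι 121) ⊗ (w ⊗ ((w ⊗ d) ⊗ (w ⊗ d)))
  final-polynomial κ h = lin 1 (λ κ → (:ι 0 :≤ κ :* (κ :* (κ :* (κ :* (κ :- :ι 1))))) ⇒ (:ι 0 :≤ κ :* (κ :* (κ :* (κ :- :ι 1)))) ⇒
      (:ι 0 :≤ κ :* (κ :* (κ :- :ι 1))) ⇒ (:ι 0 :≤ κ :* (κ :- :ι 1)) ⇒ (:ι 1 :≤ κ) ⇒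
      (:ι 121 :* κ :* ((:ι 2 :* (:ι 60 :* κ) :+ :ι 1) :*
          (:ι 144 :* (((:ι 60 :* κ :+ :ι 1) :* (:ι 60 :* κ :+ :ι 1)) :* ((:ι 60 :* κ :+ :ι 1) :* (:ι 60 :* κ :+ :ι 1)))))
        :≤ (:ι 288 :* κ :+ :ι 121) :* ((:ι 60 :* κ) :*
            (((:ι 60 :* κ) :* (:ι 11 :* (:ι 60 :* κ) :- :ι 36)) :* ((:ι 60 :* κ) :* (:ι 11 :* (:ι 60 :* κ) :- :ι 36)))))) κ
    (0≼⊗ k (0≼⊗ k (0≼⊗ k (0≼⊗ k d)))) (0≼⊗ k (0≼⊗ k (0≼⊗ k d))) (0≼⊗ k (0≼⊗ k d)) (0≼⊗ k d) h
    where
    k : ι 0 ≼ κ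
    k = ≼-trans (0≼ι 1) h
    d : ι 0 ≼ κ ⊖ ι 1
    d = ≼-sub h

  -- w = 60 κ, and u is least with d u > 12 n, where d = 11 w − 36
  module Choice (κ w d T u n p : ℕ) (1≤κ : 1 ≤ κ) (w-def : w ≡ 60 * κ) (d-def : d + 36 ≡ 11 * w)
    (u-lower : 12 * n ≤ d * u) (u-upper : d * u ≤ 12 * n + d) (n-large : w * T ≤ n) (n-large′ : d * w ≤ n)
    (pp : Prime p) (p-lower : w * u ℕ.< p) (p-upper : p ≤ w * u + u) where

    60≤w : 60 ≤ w
    60≤w = subst (60 ≤_) (sym w-def) (ℕ.*-monoʳ-≤ 60 1≤κ)
    1≤w : 1 ≤ w
    1≤w = ℕ.≤-trans (s≤s z≤n) 60≤w
    ιw : ι w ≡ ι 60 ⊗ ι κ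
    ιw = trans (cong ι w-def) (ι-* 60 κ)
    ιd : ι d ⊕ ι 36 ≡ ι 11 ⊗ ι w
    ιd = trans (sym (ι-+ d 36)) (trans (cong ι d-def) (ι-* 11 w))
    d≡ : ι d ≡ ι 11 ⊗ (ι 60 ⊗ ι κ) ⊖ ι 36
    d≡ = lin 3 (λ d w k → (d :+ :ι 36 :≡ :ι 11 :* w) ⇒ (w :≡ :ι 60 :* k) ⇒ (d :≡ :ι 11 :* (:ι 60 :* k) :- :ι 36)) _ _ _ ιd ιw
    κ≥1 : ι 1 ≼ ι κ
    κ≥1 = ι-mono 1≤κ
    1≤d : 1 ≤ d
    1≤d = ι-cancel (lin 2 (λ d k → (d :≡ :ι 11 :* (:ι 60 :* k) :- :ι 36) ⇒ (:ι 1 :≤ k) ⇒ (:ι 1 :≤ d)) _ _ d≡ κ≥1)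

    T≤u : T ≤ u
    T≤u = ι-cancel (⊗-cancelˡ w 1≤w (lin 5 (λ w t n d u → (w :* t :≤ n) ⇒ (:ι 12 :* n :≤ d :* u) ⇒ (d :+ :ι 36 :≡ :ι 11 :* w) ⇒
        ((d :+ :ι 36) :* u :≡ (:ι 11 :* w) :* u) ⇒ (:ι 0 :≤ u) ⇒ (:ι 0 :≤ w :* u) ⇒ (w :* t :≤ w :* u)) (ι w) (ι T) (ι n) (ι d) (ι u)
      (≼-trans (≼-reflexive (sym (ι-* w T))) (ι-mono n-large))
          (≼-trans (≼-reflexive (sym (ι-* 12 n))) (≼-trans (ι-mono u-lower) (≼-reflexive (ι-* d u)))) ιd (⊗-congʳ ιd) (0≼ι u) (0≼⊗ (0≼ι w) (0≼ι u))))

    T≤q : T ≤ ℕ.pred p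
    T≤q = ℕ.≤-trans T≤u (ℕ.≤-trans (ℕ.m≤n*m u w {{ℕ.>-nonZero 1≤w}}) (ℕ.≤-pred (subst (w * u ℕ.<_) (sym (Mod.suc-q p pp)) p-lower)))

    enough : 12 * w * n ≤ d * p
    enough = ι-cancel (lin 7 (λ s t w n d u p → (s :≡ :ι 12 :* w :* n) ⇒ (t :≡ d :* p) ⇒ (:ι 0 :≤ w :* (d :* u :- :ι 12 :* n)) ⇒
        (:ι 0 :≤ d :* (p :- w :* u)) ⇒ (s :≤ t)) _ _ (ι w) (ι n) (ι d) (ι u) (ι p)
      (trans (ι-* (12 * w) n) (⊗-congʳ (ι-* 12 w))) (ι-* d p)
          (0≼⊗ (0≼ι w) (≼-sub (≼-trans (≼-reflexive (sym (ι-* 12 n))) (≼-trans (ι-mono u-lower) (≼-reflexive (ι-* d u))))))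
      (0≼⊗ (0≼ι d) (≼-sub (≼-trans (≼-reflexive (sym (ι-* w u))) (ι-mono (ℕ.<⇒≤ p-lower))))))

    -- Both roundings are included: p ≤ (w + 1) u from the search for a prime, and d u ≤ 12 n + d
    -- from the choice of u. The condition d w ≤ n absorbs the latter.
    wdp : (ι w ⊗ ι d) ⊗ ι p ≼ ι 12 ⊗ (ι n ⊗ ((ι w ⊕ ι 1) ⊗ (ι w ⊕ ι 1)))
    wdp = lin 5 (λ w d p u n → (:ι 0 :≤ (w :* d) :* ((w :+ :ι 1) :* u :- p)) ⇒ (:ι 0 :≤ (w :* (w :+ :ι 1)) :* (:ι 12 :* n :+ d :- d :* u)) ⇒
        (:ι 0 :≤ (w :+ :ι 1) :* (n :- d :* w)) ⇒ (:ι 0 :≤ n :* w) ⇒ (:ι 0 :≤ n) ⇒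
        ((w :* d) :* p :≤ :ι 12 :* (n :* ((w :+ :ι 1) :* (w :+ :ι 1))))) (ι w) (ι d) (ι p) (ι u) (ι n)
      (0≼⊗ (0≼⊗ (0≼ι w) (0≼ι d)) (≼-sub (≼-trans (ι-mono p-upper)
          (≼-reflexive (trans (ι-+ (w * u) u) (trans (⊕-congʳ (ι-* w u)) (lin 2 (λ w u → w :* u :+ u :≡ (w :+ :ι 1) :* u) _ _)))))))
      (0≼⊗ (0≼⊗ (0≼ι w) w+1) (≼-sub (≼-trans (≼-reflexive (sym (ι-* d u)))
          (≼-trans (ι-mono u-upper) (≼-reflexive (trans (ι-+ (12 * n) d) (⊕-congʳ (ι-* 12 n))))))))
      (0≼⊗ w+1 (≼-sub (≼-trans (≼-reflexive (sym (ι-* d w))) (ι-mono n-large′)))) (0≼⊗ (0≼ι n) (0≼ι w)) (0≼ι n)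
      where
      w+1 : ι 0 ≼ ι w ⊕ ι 1
      w+1 = ≼-trans (0≼ι (w + 1)) (≼-reflexive (ι-+ w 1))

    bound : ∀ s → ι w ⊗ ι s ≼ (ι 2 ⊗ ι w ⊕ ι 1) ⊗ (ι p ⊗ ι p) → 121 * κ * s ≤ (288 * κ + 121) * (n * n)
    bound s h = ι-cancel (≼-trans (≼-reflexive (trans (ι-* (121 * κ) s) (⊗-congʳ (ι-* 121 κ))))
        (≼-trans goal (≼-reflexive (sym (trans (ι-* (288 * κ + 121) (n * n))
        (cong₂ _⊗_ (trans (ι-+ (288 * κ) 121) (⊕-congʳ (ι-* 288 κ))) (ι-* n n)))))))
      where
      w⁰ v wd Kp : R
      w⁰ = ι w
      v  = w⁰ ⊕ ι 1
      wd = w⁰ ⊗ ι d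
      Kp = ι 2 ⊗ w⁰ ⊕ ι 1
      0≼Kp : ι 0 ≼ Kp
      0≼Kp = lin 1 (λ w → (:ι 0 :≤ w) ⇒ (:ι 0 :≤ :ι 2 :* w :+ :ι 1)) _ (0≼ι w)
      0≼wd = 0≼⊗ (0≼ι w) (0≼ι d)
      0≼wdp : ι 0 ≼ wd ⊗ ι p
      0≼wdp = 0≼⊗ 0≼wd (0≼ι p)
      squared : (wd ⊗ ι p) ⊗ (wd ⊗ ι p) ≼ (ι 12 ⊗ (ι n ⊗ (v ⊗ v))) ⊗ (ι 12 ⊗ (ι n ⊗ (v ⊗ v)))
      squared = ⊗-mono 0≼wdp (≼-trans 0≼wdp wdp) wdp wdp
      poly : ι 121 ⊗ ι κ ⊗ (Kp ⊗ (ι 144 ⊗ ((v ⊗ v) ⊗ (v ⊗ v)))) ≼ (ι 288 ⊗ ι κ ⊕ ι 121) ⊗ (w⁰ ⊗ (wd ⊗ wd))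
      poly = subst₂ (λ w d → ι 121 ⊗ ι κ ⊗ ((ι 2 ⊗ w ⊕ ι 1) ⊗ (ι 144 ⊗ (((w ⊕ ι 1) ⊗ (w ⊕ ι 1)) ⊗ ((w ⊕ ι 1) ⊗ (w ⊕ ι 1))))) ≼
          (ι 288 ⊗ ι κ ⊕ ι 121) ⊗ (w ⊗ ((w ⊗ d) ⊗ (w ⊗ d))))
        (sym ιw) (sym d≡) (final-polynomial (ι κ) κ≥1)
      0≼121κ : ι 0 ≼ ι 121 ⊗ ι κ
      0≼121κ = 0≼⊗ (0≼ι 121) (0≼ι κ)
      goal : ι 121 ⊗ ι κ ⊗ ι s ≼ (ι 288 ⊗ ι κ ⊕ ι 121) ⊗ (ι n ⊗ ι n)
      -- Multiplying by w (w d)² clears the denominators of s ≤ (2 + 1/w) p² and p ≤ 12 n (w + 1)² /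
      -- (w d).
      goal = ⊗-cancelˡ (w * (w * d * (w * d))) (ℕ.*-mono-≤ 1≤w (ℕ.*-mono-≤ (ℕ.*-mono-≤ 1≤w 1≤d) (ℕ.*-mono-≤ 1≤w 1≤d)))
        (subst (λ z → z ⊗ (ι 121 ⊗ ι κ ⊗ ι s) ≼ z ⊗ ((ι 288 ⊗ ι κ ⊕ ι 121) ⊗ (ι n ⊗ ι n)))
            (sym (trans (ι-* w _) (⊗-congˡ (trans (ι-* (w * d) (w * d)) (cong₂ _⊗_ (ι-* w d) (ι-* w d))))))
          (≼-trans (≼-reflexive (lin 4 (λ w x c s → w :* x :* (c :* s) :≡ (c :* x) :* (w :* s)) w⁰ (wd ⊗ wd) (ι 121 ⊗ ι κ) (ι s)))
          (≼-trans (⊗-monoˡ _ (0≼⊗ 0≼121κ (0≼⊗ 0≼wd 0≼wd)) h)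
          (≼-trans (≼-reflexive (lin 4 (λ c x k p → (c :* (x :* x)) :* (k :* (p :* p)) :≡ (c :* k) :* ((x :* p) :* (x :* p))) (ι 121 ⊗ ι κ)
              wd Kp (ι p)))
          (≼-trans (⊗-monoˡ _ (0≼⊗ 0≼121κ 0≼Kp) squared)
          (≼-trans (≼-reflexive (lin 4 (λ c k n v → (c :* k) :* ((:ι 12 :* (n :* v)) :* (:ι 12 :* (n :* v))) :≡ (n :* n) :*
              (c :* (k :* (:ι 144 :* (v :* v))))) (ι 121 ⊗ ι κ) Kp (ι n) (v ⊗ v)))
          (≼-trans (⊗-monoˡ _ (0≼⊗ (0≼ι n) (0≼ι n)) poly)
            (≼-reflexive (lin 3 (λ n a b → n :* (a :* b) :≡ b :* (a :* n)) (ι n ⊗ ι n) (ι 288 ⊗ ι κ ⊕ ι 121) (w⁰ ⊗ (wd ⊗ wd)))))))))))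

  module Conclude (κ w d T : ℕ) (1≤κ : 1 ≤ κ) (w-def : w ≡ 60 * κ) (d-def : d + 36 ≡ 11 * w)
    (T₁ : w * w * ((w * w) * (w * w) + 2 * (w * w)) ℕ.< T) (T₂ : 2 * (w * w) * (w * w) ≤ T) (T₃ : 12 * (w * w) + 12 * w ≤ T)
    (N : ℕ) (primes : ∀ u → N ≤ u → ∃ λ p → Prime p × w * u ℕ.< p × p ≤ w * u + u) where

    conclude : ∀ n → w * (T + N) + d * w ≤ n → Σ ℕ λ s → IsMagicSum n s × (121 * κ * s ≤ (288 * κ + 121) * (n * n))
    conclude n N≤n = 2 * M + r + 3 , magic n (many-good n d d-def C.enough) , C.bound _ sum-bound
      where
      1≤d : 1 ≤ d
      1≤d = ι-cancel (lin 3 (λ d w k → (d :+ :ι 36 :≡ :ι 11 :* w) ⇒ (w :≡ :ι 60 :* k) ⇒ (:ι 1 :≤ k) ⇒ (:ι 1 :≤ d)) _ (ι w) (ι κ)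
          (trans (sym (ι-+ d 36)) (trans (cong ι d-def) (ι-* 11 w))) (trans (cong ι w-def) (ι-* 60 κ)) (ι-mono 1≤κ))
      u : ℕ
      u = suc (12 * n ÷ d)
      u-lower : 12 * n ≤ d * u
      u-lower = ℕ.<⇒≤ (÷-lower (12 * n) d 1≤d)
      u-upper : d * u ≤ 12 * n + d
      u-upper = ℕ.≤-trans (ℕ.≤-reflexive (trans (ℕ.*-suc d _) (ℕ.+-comm d _))) (ℕ.+-monoˡ-≤ d (÷-upper (12 * n) d 1≤d))
      n-large : w * (T + N) ≤ n
      n-large = ℕ.≤-trans (ℕ.m≤m+n _ (d * w)) N≤n
      n-large′ : d * w ≤ n
      n-large′ = ℕ.≤-trans (ℕ.m≤n+m (d * w) _) N≤n
      60≤w : 60 ≤ w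
      60≤w = subst (60 ≤_) (sym w-def) (ℕ.*-monoʳ-≤ 60 1≤κ)
      T+N≤u : T + N ≤ u
      T+N≤u = ι-cancel (⊗-cancelˡ w (ℕ.≤-trans (s≤s z≤n) 60≤w)
          (lin 5 (λ w t n d u → (w :* t :≤ n) ⇒ (:ι 12 :* n :≤ d :* u) ⇒ ((d :+ :ι 36) :* u :≡ (:ι 11 :* w) :* u) ⇒ (:ι 0 :≤ u) ⇒
          (:ι 0 :≤ w :* u) ⇒ (w :* t :≤ w :* u)) (ι w) (ι (T + N)) (ι n) (ι d) (ι u)
        (≼-trans (≼-reflexive (sym (ι-* w (T + N)))) (ι-mono n-large))
            (≼-trans (≼-reflexive (sym (ι-* 12 n))) (≼-trans (ι-mono u-lower) (≼-reflexive (ι-* d u))))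
        (⊗-congʳ (trans (sym (ι-+ d 36)) (trans (cong ι d-def) (ι-* 11 w)))) (0≼ι u) (0≼⊗ (0≼ι w) (0≼ι u))))
      found = primes u (ℕ.≤-trans (ℕ.m≤n+m N T) T+N≤u)
      p : ℕ
      p = proj₁ found
      pp : Prime p
      pp = proj₁ (proj₂ found)
      module C = Choice κ w d (T + N) u n p 1≤κ w-def d-def u-lower u-upper n-large n-large′ pp (proj₁ (proj₂ (proj₂ found)))
          (proj₂ (proj₂ (proj₂ found)))
      T≤q : T ≤ ℕ.pred p
      T≤q = ℕ.≤-trans (ℕ.m≤m+n T N) C.T≤q
      open Construction p pp w 60≤w using (M)
      open Construction.Labels p pp w 60≤w (ℕ.<-≤-trans T₁ T≤q) (ℕ.≤-trans T₂ T≤q) (ℕ.≤-trans T₃ T≤q) using (r; magic; many-good; sum-bound)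

-- The term o(1) is rendered by 1/(k + 1) for arbitrary k, and denominators are cleared. A magic sum
-- s below the bound also bounds the smallest one.
theorem4 : (k : ℕ) → Σ ℕ λ N → (n : ℕ) → N ≤ n →
    Σ ℕ λ s → IsMagicSum n s ×
    (121 * suc k * s ≤ (288 * suc k + 121) * (n * n))
theorem4 k = w * (T + N) + d * w , Conclude.conclude (suc k) w d T (s≤s z≤n) refl d-def T₁ T₂ T₃ N primes
  where
  w d T A B C : ℕ
  w = 60 * suc k
  -- This is 11 w - 36, written without subtraction.
  d = 660 * k + 624
  A = w * w * ((w * w) * (w * w) + 2 * (w * w))
  B = 2 * (w * w) * (w * w)
  C = 12 * (w * w) + 12 * w
  T = suc A + B + C
  d-def : d + 36 ≡ 11 * w
  d-def = lemma k
    where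
    open import Data.Nat.Tactic.RingSolver using (solve-∀)
    lemma : ∀ k → 660 * k + 624 + 36 ≡ 11 * (60 * suc k)
    lemma = solve-∀
  T₁ : A ℕ.< T
  T₁ = ℕ.≤-trans (ℕ.m≤m+n (suc A) B) (ℕ.m≤m+n (suc A + B) C)
  T₂ : B ≤ T
  T₂ = ℕ.≤-trans (ℕ.m≤n+m B (suc A)) (ℕ.m≤m+n (suc A + B) C)
  T₃ : C ≤ T
  T₃ = ℕ.m≤n+m C (suc A + B)
  20≤w : 20 ≤ w
  20≤w = ℕ.≤-trans (ℕ.m≤m+n 20 40) (ℕ.m≤m*n 60 (suc k))
  N : ℕ
  N = proj₁ (prime-in-interval w 20≤w)
  primes = proj₂ (prime-in-interval w 20≤w)
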